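{- There is an algorithm which, given a minimal weighted graph $G=(V,E,w)$ together with the distances $d_G(u,v)$ between all pairs of vertices $u,v\in V$, computes a factorization of $G$ into prime weighted graphs in $O(|E|^2)$ time. If the distances are not given in advance, a factorization of $G$ into prime weighted graphs can be computed in $O(|V|^2\log\log|V|+|E|^2)$ time.
   Context: Graphs are finite, connected, undirected weighted graphs $G=(V,E,w)$ with $w:E\to\mathbb{R}_{>0}$; $d_G$ denotes the shortest-path metric (minimum total edge weight of a path). $G$ is minimal if $w(uv)=d_G(u,v)$ for every edge $uv\in E$. An isomorphism of weighted graphs is a bijection of vertices preserving adjacency, non-adjacency and edge weights. Cartesian product: for $G_i=(V_i,E_i,w_i)$, $1\le i\le m$, the graph $\prod_{i=1}^m G_i$ has vertex set $V_1\times\cdots\times V_m$; $(u_1,\dots,u_m)(v_1,\dots,v_m)$ is an edge iff there is exactly one index $\ell$ with $u_\ell v_\ell\in E_\ell$ and $u_i=v_i$ for all $i\ne\ell$, and its weight is then $w_\ell(u_\ell v_\ell)$. A finite family $\{G_1,\dots,G_m\}$ (repetitions allowed) is a factorization of $G$, with factors $G_i$, if $G$ is isomorphic to $\prod_{i=1}^m G_i$. By convention a factorization does not include the one-vertex graph $K_1$ unless $G=K_1$. $G$ is prime if every factorization of $G$ includes (a graph isomorphic to) $G$ as a factor. Running time counts elementary operations, with each arithmetic operation or comparison on edge weights and distances, and each look-up of a given distance, taking constant time. -}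

module Defs where

open import Level using (0ℓ; suc)
open import Algebra.Bundles using (CommutativeRing)
open import Data.Bool.Base using (Bool; T; if_then_else_)
open import Data.Empty using (⊥)
open import Data.Fin.Base using (Fin; toℕ)
open import Data.List.Base as List using (List; []; _∷_; _++_; length; map; concatMap; allFin; head; drop)
open import Data.List.Membership.Propositional.Properties using (∈-lookup)
open import Data.List.Relation.Unary.All as All using (All)
open import Data.List.Relation.Unary.AllPairs using (AllPairs)
open import Data.List.Relation.Unary.Any using (Any)
open import Data.List.Relation.Unary.Unique.Propositional using (Unique)
open import Data.Maybe.Base using (Maybe; just; nothing; fromMaybe)
open import Data.Nat.Base as ℕ using (ℕ; NonZero)
import Data.Nat.Properties as ℕ
open import Data.Product using (Σ; Σ-syntax; ∃; ∃₂; ∃!; _×_; _,_; proj₁; proj₂)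
open import Data.Sum.Base using (_⊎_)
open import Data.Unit.Base using (⊤)
open import Function.Base using (_∘_)
open import Function.Bundles using (_↔_; _⇔_; Inverse)
open import Relation.Binary.Core using (Rel)
open import Relation.Binary.Construct.Closure.ReflexiveTransitive using (Star; ε; _◅_)
open import Relation.Binary.PropositionalEquality using (_≡_; _≢_)
open import Relation.Binary.Structures using (IsDecTotalOrder)
open import Relation.Nullary.Decidable.Core using (does; yes; no)
open import Relation.Nullary.Negation.Core using (¬_)

-- ℝ, characterised up to isomorphism as the Dedekind-complete ordered field.
-- The order is decidable because comparing two reals is an elementary
-- operation of the machine below.
record Reals : Set (suc 0ℓ) where
  field
    commutativeRing : CommutativeRing 0ℓ 0ℓ

  open CommutativeRing commutativeRing public
    using (Carrier; _≈_; _+_; _*_; -_; _-_; 0#; 1#)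

  infix 4 _≤_
  field
    _≤_             : Rel Carrier 0ℓ
    isDecTotalOrder : IsDecTotalOrder _≈_ _≤_
    +-monoˡ-≤       : ∀ z {x y} → x ≤ y → x + z ≤ y + z
    *-nonNegative   : ∀ {x y} → 0# ≤ x → 0# ≤ y → 0# ≤ x * y
    0≉1             : ¬ (0# ≈ 1#)
    inverse         : ∀ x → ¬ (x ≈ 0#) → ∃ λ y → x * y ≈ 1#

  open IsDecTotalOrder isDecTotalOrder public using (_≟_; _≤?_)

  UpperBound : (Carrier → Set) → Carrier → Set
  UpperBound P b = ∀ x → P x → x ≤ b

  field
    supremum : (P : Carrier → Set) → ∃ P → ∃ (UpperBound P) →
               ∃ λ s → UpperBound P s × (∀ b → UpperBound P b → s ≤ b)

  infix 4 _<_
  _<_ : Rel Carrier 0ℓ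
  x < y = ¬ (y ≤ x)

  -- Division is made total by x ÷ 0 = 0.
  _÷_ : Carrier → Carrier → Carrier
  x ÷ y with y ≟ 0#
  ... | yes _  = 0#
  ... | no y≉0 = x * proj₁ (inverse y y≉0)

-- Programs for a random access machine with finitely many registers and an
-- unbounded memory for natural numbers (vertices, indices, addresses), and
-- likewise for real numbers (weights, distances).  Natural numbers can be
-- added and subtracted but not multiplied in a single operation, so that
-- charging one unit of time per operation is the usual uniform cost measure.
-- Reals can enter natural-number computations only through comparisons.
data Instruction : Set where
  set              : (r k : ℕ) → Instruction
  add sub          : (r s t : ℕ) → Instruction
  load store       : (r s : ℕ) → Instruction
  jump             : (target : ℕ) → Instruction
  jump≤            : (r s target : ℕ) → Instruction
  zeroℝ oneℝ       : (x : ℕ) → Instruction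
  addℝ subℝ        : (x y z : ℕ) → Instruction
  mulℝ divℝ        : (x y z : ℕ) → Instruction
  loadℝ            : (x r : ℕ) → Instruction
  storeℝ           : (r x : ℕ) → Instruction
  jump≤ℝ           : (x y target : ℕ) → Instruction

Program : Set
Program = List Instruction

infix 9 _!?_
_!?_ : {A : Set} → List A → ℕ → Maybe A
xs !? k = head (drop k xs)

infixl 8 _[_≔_]
_[_≔_] : {A : Set} → (ℕ → A) → ℕ → A → (ℕ → A)
(f [ k ≔ a ]) j = if does (j ℕ.≟ k) then a else f j

-- The list occupies the cells a, a + 1, … of the memory m.
StoredAt : {A : Set} → Rel A 0ℓ → (ℕ → A) → ℕ → List A → Set
StoredAt _∼_ m a []       = ⊤
StoredAt _∼_ m a (x ∷ xs) = (m a ∼ x) × StoredAt _∼_ m (ℕ.suc a) xs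

module OverReals (ℛ : Reals) where

  open Reals ℛ

  -- A structure that has adjacency and edge weights, but need not satisfy
  -- the axioms of a graph.  It lets products and isomorphisms be stated
  -- uniformly.
  record Network : Set (suc 0ℓ) where
    field
      Vertex : Set
      Adj    : Rel Vertex 0ℓ
      weight : ∀ {u v} → Adj u v → Carrier

  module _ (N : Network) where
    open Network N

    vertices : ∀ {u v} → Star Adj u v → List Vertex
    vertices {u} ε       = u ∷ []
    vertices {u} (_ ◅ p) = u ∷ vertices p

    Path : Vertex → Vertex → Set
    Path u v = Σ[ p ∈ Star Adj u v ] Unique (vertices p)

    walkWeight : ∀ {u v} → Star Adj u v → Carrier
    walkWeight ε       = 0#
    walkWeight (e ◅ p) = weight e + walkWeight p

    pathWeight : ∀ {u v} → Path u v → Carrier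
    pathWeight (p , _) = walkWeight p

    IsDistance : Vertex → Vertex → Carrier → Set
    IsDistance u v d = (∃ λ (p : Path u v) → pathWeight p ≈ d)
                     × (∀ (p : Path u v) → d ≤ pathWeight p)

    -- w(uv) = d(u,v) for every edge uv
    Minimal : Set
    Minimal = ∀ {u v} (e : Adj u v) → IsDistance u v (weight e)

  record _≅_ (M N : Network) : Set where
    private
      module M = Network M
      module N = Network N
    field
      bijection : M.Vertex ↔ N.Vertex
    open Inverse bijection using (to)
    field
      adjacency : ∀ u v → M.Adj u v ⇔ N.Adj (to u) (to v)
      weights   : ∀ {u v} (e : M.Adj u v) (f : N.Adj (to u) (to v)) →
                  M.weight e ≈ N.weight f

  -- Finite connected simple weighted graphs, with the vertices numbered from
  -- 0 to order - 1.
  record WeightedGraph : Set where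
    field
      order     : ℕ
      adjacent  : Fin order → Fin order → Bool

    Adj : Rel (Fin order) 0ℓ
    Adj u v = T (adjacent u v)

    field
      weight    : ∀ {u v} → Adj u v → Carrier

    network : Network
    network = record { Vertex = Fin order ; Adj = Adj ; weight = weight }

    field
      nonEmpty  : NonZero order
      irrefl    : ∀ {u} → ¬ Adj u u
      symmetric : ∀ {u v} → Adj u v → Adj v u
      weight-sym : ∀ {u v} (e : Adj u v) (f : Adj v u) → weight e ≈ weight f
      positive  : ∀ {u v} (e : Adj u v) → 0# < weight e
      connected : ∀ u v → Path network u v

  open WeightedGraph public using (order; network)

  K₁ : Network
  K₁ = record { Vertex = ⊤ ; Adj = λ _ _ → ⊥ ; weight = λ () }

  ∏ : List WeightedGraph → Network
  ∏ Gs = record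
    { Vertex = Tuple
    ; Adj    = λ u v → ∃! _≡_ (DifferOnlyAt u v)
    ; weight = λ { (ℓ , (e , _) , _) → WeightedGraph.weight (List.lookup Gs ℓ) e }
    }
    where
    Tuple : Set
    Tuple = All (λ G → Fin (order G)) Gs

    component : Tuple → (i : Fin (length Gs)) → Fin (order (List.lookup Gs i))
    component u i = All.lookup u (∈-lookup i)

    DifferOnlyAt : Tuple → Tuple → Fin (length Gs) → Set
    DifferOnlyAt u v ℓ =
        WeightedGraph.Adj (List.lookup Gs ℓ) (component u ℓ) (component v ℓ)
      × (∀ i → i ≢ ℓ → component u i ≡ component v i)

  record IsFactorization (G : WeightedGraph) (Gs : List WeightedGraph) : Set where
    field
      nonEmpty    : Gs ≢ []
      isomorphism : network G ≅ ∏ Gs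
      noK₁        : All (λ H → network H ≅ K₁ → network G ≅ K₁) Gs

  Prime : WeightedGraph → Set
  Prime G = ∀ Gs → IsFactorization G Gs → Any (λ H → network H ≅ network G) Gs

  Edge : WeightedGraph → Set
  Edge G = ∃₂ (WeightedGraph.Adj G)

  SameEdge : ∀ {G} → Rel (Edge G) 0ℓ
  SameEdge (u , v , _) (x , y , _) = (u ≡ x × v ≡ y) ⊎ (u ≡ y × v ≡ x)

  -- An enumeration of the undirected edges, each listed once, in any order and
  -- with its ends in either order.
  record EdgeList (G : WeightedGraph) : Set where
    field
      edges    : List (Edge G)
      distinct : AllPairs (λ e f → ¬ SameEdge {G} e f) edges
      complete : ∀ e → Any (SameEdge {G} e) edges

    ∣E∣ : ℕ
    ∣E∣ = length edges

  open EdgeList public using (∣E∣)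

  -- |V|, |E|, and then the two ends of each edge
  encodeℕ : ∀ {G} → EdgeList G → List ℕ
  encodeℕ {G} L = order G ∷ ∣E∣ L
                ∷ concatMap (λ { (u , v , _) → toℕ u ∷ toℕ v ∷ [] }) (EdgeList.edges L)

  encodeℝ : ∀ {G} → EdgeList G → List Carrier
  encodeℝ {G} L = map (λ { (_ , _ , e) → WeightedGraph.weight G e }) (EdgeList.edges L)

  table : ∀ {n} → (Fin n → Fin n → Carrier) → List Carrier
  table {n} d = concatMap (λ u → map (d u) (allFin n)) (allFin n)

  record State : Set where
    field
      pc   : ℕ
      reg  : ℕ → ℕ
      mem  : ℕ → ℕ
      regℝ : ℕ → Carrier
      memℝ : ℕ → Carrier

  execute : Instruction → State → State
  execute i σ = go i
    where
    open State σ

    next : State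
    next = record σ { pc = ℕ.suc pc }

    jumpTo : ℕ → State
    jumpTo k = record σ { pc = k }

    go : Instruction → State
    go (set r k)      = record next { reg = reg [ r ≔ k ] }
    go (add r s t)    = record next { reg = reg [ r ≔ reg s ℕ.+ reg t ] }
    go (sub r s t)    = record next { reg = reg [ r ≔ reg s ℕ.∸ reg t ] }
    go (load r s)     = record next { reg = reg [ r ≔ mem (reg s) ] }
    go (store r s)    = record next { mem = mem [ reg r ≔ reg s ] }
    go (jump k)       = jumpTo k
    go (jump≤ r s k)  = if does (reg r ℕ.≤? reg s) then jumpTo k else next
    go (zeroℝ x)      = record next { regℝ = regℝ [ x ≔ 0# ] }
    go (oneℝ x)       = record next { regℝ = regℝ [ x ≔ 1# ] }
    go (addℝ x y z)   = record next { regℝ = regℝ [ x ≔ regℝ y + regℝ z ] }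
    go (subℝ x y z)   = record next { regℝ = regℝ [ x ≔ regℝ y - regℝ z ] }
    go (mulℝ x y z)   = record next { regℝ = regℝ [ x ≔ regℝ y * regℝ z ] }
    go (divℝ x y z)   = record next { regℝ = regℝ [ x ≔ regℝ y ÷ regℝ z ] }
    go (loadℝ x r)    = record next { regℝ = regℝ [ x ≔ memℝ (reg r) ] }
    go (storeℝ r x)   = record next { memℝ = memℝ [ reg r ≔ regℝ x ] }
    go (jump≤ℝ x y k) = if does (regℝ x ≤? regℝ y) then jumpTo k else next

  -- p ⊢ σ ⇓[ t ] τ : started in σ, p halts in τ after t instructions.  The
  -- machine halts when the program counter leaves the program.
  data _⊢_⇓[_]_ (p : Program) : State → ℕ → State → Set where
    halt : ∀ {σ} → p !? State.pc σ ≡ nothing → p ⊢ σ ⇓[ 0 ] σ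
    step : ∀ {i σ t τ} → p !? State.pc σ ≡ just i →
           p ⊢ execute i σ ⇓[ t ] τ → p ⊢ σ ⇓[ ℕ.suc t ] τ

  start : List ℕ → List Carrier → State
  start ks xs = record
    { pc   = 0
    ; reg  = λ _ → 0
    ; mem  = λ a → fromMaybe 0 (ks !? a)
    ; regℝ = λ _ → 0#
    ; memℝ = λ a → fromMaybe 0# (xs !? a)
    }

  inputGraph : ∀ {G} → EdgeList G → State
  inputGraph L = start (encodeℕ L) (encodeℝ L)

  -- The matrix of distances follows the edge weights in the real memory.
  inputGraphAndDistances : ∀ {G} → EdgeList G →
                           (Fin (order G) → Fin (order G) → Carrier) → State
  inputGraphAndDistances L d = start (encodeℕ L) (encodeℝ L ++ table d)

  -- The final state contains the number of factors and then the factors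
  -- one after another, each in the format of the input.  Registers 0 and 1
  -- hold the addresses where the output begins in the two memories.
  OutputsPrimeFactorization : WeightedGraph → State → Set
  OutputsPrimeFactorization G σ = Σ[ Hs ∈ List (∃ EdgeList) ]
      IsFactorization G (map proj₁ Hs)
    × All Prime (map proj₁ Hs)
    × StoredAt _≡_ mem  (reg 0) (length Hs ∷ concatMap (encodeℕ ∘ proj₂) Hs)
    × StoredAt _≈_ memℝ (reg 1) (concatMap (encodeℝ ∘ proj₂) Hs)
    where open State σ

  -- Started in σ, p computes a prime factorization of G in at most t steps.
  ComputesPrimeFactorization : Program → State → WeightedGraph → ℕ → Set
  ComputesPrimeFactorization p σ G t = ∃₂ λ s τ →
    p ⊢ σ ⇓[ s ] τ × s ℕ.≤ t × OutputsPrimeFactorization G τ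

{-# OPTIONS --safe #-}
module Submission where

-- A factorization of G is a colouring of its edges in which the edges of
-- colour i are those of the i-th factor.  Distances in the weighted product
-- are not needed to find it: let d count the edges of a shortest walk.  In
-- every factorization,
--   (Θ) edges uv and xy with d u x + d v y ≢ d u y + d v x lie in the same
--       factor, because d is the sum of the distances of the coordinates;
--   (□) edges uv and uw lie in the same factor unless they are two sides of a
--       square whose opposite sides have equal weights.
-- Conversely, let the colours be the classes generated by (Θ) and (□).  Write
-- u ∼ᵢ v if no edge of colour i is in relation Θ with the pair uv.  By (□) an
-- edge of colour i can be transported along walks that avoid colour i, so each
-- class of ∼ᵢ meets the layer Lᵢ, the set of all v with r ∼ⱼ v for every
-- j ≠ i, and by (Θ) it does so in exactly one vertex.  This makes G the
-- product of the subgraphs induced on the layers.  A factorization of a layer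
-- would give one of G in which some colour splits, contrary to (Θ) and (□),
-- so the factors are prime.
--
-- Breadth-first searches from all vertices take O(|V||E|) steps, and the two
-- rules are closed off by three passes over all arcs for each arc, which
-- takes O(|E|²) steps.  As |V| ≤ |E| + 1, the whole program runs in
-- O(|E|² + 1) steps.

-- Forgetting the weights turns a weighted product into the Cartesian product of the underlying
-- graphs, where the edge-counting distance is additive over the coordinates. Weights therefore
-- enter only through the squares of (□), and the program only ever tests them for equality.
--
-- Closing off the rules must not become a search over pairs of pairs. Each arc absorbs, in a single
-- sweep, every class that meets an arc related to it; since classes are only merged, what one sweep
-- achieves is never undone, and one sweep per arc suffices. For (□) a preceding sweep marks all
-- neighbours that complete a square with the arc.
--
-- That the colours are not too coarse is expressed through Boolean labellings: a labelling that is
-- constant on related pairs is constant on every colour. A factorization of a layer yields such a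
-- labelling of the edges of `G`, and this gives primality.
--
-- The program is written in a small language with a clock. Loops bounded by the size of the input
-- are timed by a syntactic rule. Breadth-first search, with loops nested three deep, would exceed
-- the bound in this way and is amortised against the sum of the degrees.

open import Defs
open import Data.Nat.Base using (ℕ; _+_; _*_; _^_)
open import Data.Nat.Logarithm using (⌊log₂_⌋)
open import Data.Fin.Base using (Fin)
open import Data.Product using (∃₂; _×_)
open import Data.Bool.Base using (Bool; true; false; T; not; _∧_; if_then_else_)
open import Data.Bool.Properties using (T-irrelevant)
open import Data.Empty using (⊥)
open import Data.Fin.Base using (zero; suc; toℕ; fromℕ<)
open import Data.Fin.Properties as Fin using (toℕ<n; toℕ-injective; toℕ-fromℕ<; injective⇒≤)
open import Data.List.Base as List using (List; []; _∷_; _++_; length; map; concatMap; head; drop)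
import Data.List.Membership.DecPropositional as DecMembership
open import Data.List.Membership.Propositional using (_∈_; lose)
open import Data.List.Membership.Propositional.Properties using (∈-lookup; ∈-++⁻; ∈-++⁺ˡ; ∈-++⁺ʳ)
open import Data.List.Properties using (length-++; ++-assoc; ++-identityʳ; drop-drop; concatMap-++; map-concatMap; length-map; concatMap-map; concatMap-cong)
open import Data.List.Relation.Unary.All as All using (All; []; _∷_)
open import Data.List.Relation.Unary.All.Properties as All using (¬Any⇒All¬)
open import Data.List.Relation.Unary.AllPairs as AllPairs using (AllPairs; []; _∷_)
open import Data.List.Relation.Unary.AllPairs.Properties as AllPairs using ()
open import Data.List.Relation.Unary.Any as Any using (Any; here; there)
open import Data.List.Relation.Unary.Any.Properties as Any using (concatMap⁺; lookup-index)
open import Data.List.Relation.Unary.Unique.Propositional using (Unique)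
open import Data.List.Relation.Unary.Unique.Propositional.Properties as Unique using ()
open import Data.Maybe.Base using (just; nothing; fromMaybe)
open import Data.Nat.Base using (zero; suc; _∸_; _⊔_; _≤_; _<_; _≡ᵇ_; _<ᵇ_; z≤n; s≤s; z<s; NonZero; >-nonZero; >-nonZero⁻¹)
import Data.Nat.Properties as ℕ
open import Data.Nat.Tactic.RingSolver using (solve-∀)
open import Data.Product using (Σ-syntax; ∃; _,_; proj₁; proj₂)
open import Data.Sum.Base using (_⊎_; inj₁; inj₂)
open import Data.Unit.Base using (⊤; tt)
open import Function.Base using (_∘_; id; case_of_)
open import Function.Bundles using (Inverse; Equivalence; mk⇔; mk↔ₛ′)
open import Relation.Binary.Construct.Closure.ReflexiveTransitive using (Star; ε; _◅_; _◅◅_; reverse)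
open import Relation.Binary.Definitions using (tri<; tri≈; tri>)
open import Relation.Binary.PropositionalEquality using (_≡_; _≢_; refl; sym; trans; cong; cong₂; subst; subst₂; module ≡-Reasoning)
open import Relation.Binary.Structures using (IsDecTotalOrder)
open import Relation.Nullary.Decidable using (dec-true; dec-false; _×-dec_; ¬?)
open import Relation.Nullary.Decidable.Core using (Dec; does; yes; no)
open import Relation.Nullary.Negation.Core using (¬_; contradiction)

-- Structured machine code

module _ {A : Set} (f : ℕ → A) where

  update-≡ : ∀ k {a} → (f [ k ≔ a ]) k ≡ a
  update-≡ k rewrite dec-true (k ℕ.≟ k) refl = refl

  update-≢ : ∀ {j k a} → j ≢ k → (f [ k ≔ a ]) j ≡ f j
  update-≢ {j} {k} j≢k rewrite dec-false (j ℕ.≟ k) j≢k = refl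

module StructuredCode (ℛ : Reals) where
  open OverReals ℛ
  open Reals ℛ using (_≤?_)

  -- Jumps are excluded because they are the only instructions that mention addresses of the
  -- program; `assemble` alone emits them.
  Straight : Instruction → Set
  Straight (jump _)       = ⊥
  Straight (jump≤ _ _ _)  = ⊥
  Straight (jump≤ℝ _ _ _) = ⊥
  Straight _              = ⊤

  infixr 5 _⨟_
  data Code : Set where
    nop    : Code
    op     : (i : Instruction) → {Straight i} → Code
    _⨟_    : Code → Code → Code
    if≤    : (r s : ℕ) → Code → Code → Code
    if≤ℝ   : (x y : ℕ) → Code → Code → Code
    while< : (r s : ℕ) → Code → Code

  size : Code → ℕ
  size nop            = 0
  size (op _)         = 1
  size (c ⨟ d)        = size c + size d
  size (if≤ _ _ c d)  = suc (size d + suc (size c))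
  size (if≤ℝ _ _ c d) = suc (size d + suc (size c))
  size (while< _ _ c) = suc (size c + 1)

  -- The code for a failed test comes first, so that failure falls through to it; a jump then skips
  -- the other branch. This jump is the additional step in the rules `no≤` and `no≤ℝ`.
  branch : (ℕ → Instruction) → ℕ → (ℕ → List Instruction) → ℕ → (ℕ → List Instruction) → ℕ →
           List Instruction
  branch test o c m d n =
    test (suc (o + suc n)) ∷ d (suc o) ++ jump (suc (o + (n + suc m))) ∷ c (suc (o + suc n))

  -- The second argument is the address of the first instruction.
  assemble : Code → ℕ → List Instruction
  assemble nop            o = []
  assemble (op i)         o = i ∷ []
  assemble (c ⨟ d)        o = assemble c o ++ assemble d (o + size c)
  assemble (if≤ r s c d)  o = branch (jump≤ r s) o (assemble c) (size c) (assemble d) (size d)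
  assemble (if≤ℝ x y c d) o = branch (jump≤ℝ x y) o (assemble c) (size c) (assemble d) (size d)
  assemble (while< r s c) o =
    jump≤ s r (suc (o + suc (size c))) ∷ assemble c (suc o) ++ jump o ∷ []

  at : ℕ → State → State
  at k σ = record σ { pc = k }

  -- Program counters are ignored.
  infix 4 ⟪_⟫_⇒[_]_
  data ⟪_⟫_⇒[_]_ : Code → State → ℕ → State → Set where
    nop   : ∀ {σ} → ⟪ nop ⟫ σ ⇒[ 0 ] σ
    op    : ∀ {i p σ} → ⟪ op i {p} ⟫ σ ⇒[ 1 ] execute i σ
    _⨟_   : ∀ {c d σ τ υ s t} → ⟪ c ⟫ σ ⇒[ s ] τ → ⟪ d ⟫ τ ⇒[ t ] υ → ⟪ c ⨟ d ⟫ σ ⇒[ s + t ] υ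
    yes≤  : ∀ {r s c d σ τ t} → State.reg σ r ≤ State.reg σ s →
            ⟪ c ⟫ σ ⇒[ t ] τ → ⟪ if≤ r s c d ⟫ σ ⇒[ suc t ] τ
    no≤   : ∀ {r s c d σ τ t} → ¬ State.reg σ r ≤ State.reg σ s →
            ⟪ d ⟫ σ ⇒[ t ] τ → ⟪ if≤ r s c d ⟫ σ ⇒[ suc (t + 1) ] τ
    yes≤ℝ : ∀ {x y c d σ τ t} → Reals._≤_ ℛ (State.regℝ σ x) (State.regℝ σ y) →
            ⟪ c ⟫ σ ⇒[ t ] τ → ⟪ if≤ℝ x y c d ⟫ σ ⇒[ suc t ] τ
    no≤ℝ  : ∀ {x y c d σ τ t} → ¬ Reals._≤_ ℛ (State.regℝ σ x) (State.regℝ σ y) →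
            ⟪ d ⟫ σ ⇒[ t ] τ → ⟪ if≤ℝ x y c d ⟫ σ ⇒[ suc (t + 1) ] τ
    exit  : ∀ {r s c σ} → State.reg σ s ≤ State.reg σ r → ⟪ while< r s c ⟫ σ ⇒[ 1 ] σ
    again : ∀ {r s c σ τ υ t u} → ¬ State.reg σ s ≤ State.reg σ r → ⟪ c ⟫ σ ⇒[ t ] τ →
            ⟪ while< r s c ⟫ τ ⇒[ u ] υ → ⟪ while< r s c ⟫ σ ⇒[ suc (t + suc u) ] υ

  length-assemble : ∀ c o → length (assemble c o) ≡ size c
  length-branch : ∀ c d {test} o →
    length (branch test o (assemble c) (size c) (assemble d) (size d)) ≡
    suc (size d + suc (size c))

  length-assemble nop            o = refl
  length-assemble (op _)         o = refl
  length-assemble (c ⨟ d)        o = trans (length-++ (assemble c o))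
    (cong₂ _+_ (length-assemble c o) (length-assemble d (o + size c)))
  length-assemble (if≤ r s c d)  o = length-branch c d {jump≤ r s} o
  length-assemble (if≤ℝ x y c d) o = length-branch c d {jump≤ℝ x y} o
  length-assemble (while< r s c) o = cong suc (trans (length-++ (assemble c (suc o)))
    (cong (_+ 1) (length-assemble c (suc o))))

  length-branch c d o = cong suc (trans (length-++ (assemble d (suc o)))
    (cong₂ (λ m n → m + suc n) (length-assemble d _) (length-assemble c _)))

  module _ (p : Program) where

    -- Occurrence at an address is phrased by `drop`, as is the look-up `_!?_`, so that `fetch` is a
    -- congruence.
    record Contains (o : ℕ) (is : List Instruction) : Set where
      constructor containing
      field
        rest   : List Instruction
        suffix : drop o p ≡ is ++ rest

    contains-++ˡ : ∀ {o} is {js} → Contains o (is ++ js) → Contains o is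
    contains-++ˡ is {js} (containing ks eq) = containing (js ++ ks) (trans eq (++-assoc is js ks))

    contains-++ʳ : ∀ {o n} is {js} → length is ≡ n → Contains o (is ++ js) → Contains (o + n) js
    contains-++ʳ {o} is {js} refl (containing ks eq) = containing ks (begin
      drop (o + length is) p              ≡⟨ drop-drop o (length is) p ⟨
      drop (length is) (drop o p)         ≡⟨ cong (drop (length is)) eq ⟩
      drop (length is) ((is ++ js) ++ ks) ≡⟨ cong (drop (length is)) (++-assoc is js ks) ⟩
      drop (length is) (is ++ (js ++ ks)) ≡⟨ drop-++ is ⟩
      js ++ ks                            ∎)
      where
      open ≡-Reasoning
      drop-++ : ∀ (xs : List Instruction) {ys} → drop (length xs) (xs ++ ys) ≡ ys
      drop-++ []       = refl
      drop-++ (_ ∷ xs) = drop-++ xs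

    contains-tail : ∀ {o i is} → Contains o (i ∷ is) → Contains (suc o) is
    contains-tail {o} {i} {is} k =
      subst (λ n → Contains n is) (ℕ.+-comm o 1) (contains-++ʳ (i ∷ []) refl k)

    fetch : ∀ {o i is} → Contains o (i ∷ is) → p !? o ≡ just i
    fetch (containing _ eq) = cong head eq

    execute-at : ∀ i → Straight i → ∀ k σ → execute i (at k σ) ≡ at (suc k) (execute i σ)
    execute-at (set r k)      _ _ _ = refl
    execute-at (add r s t)    _ _ _ = refl
    execute-at (sub r s t)    _ _ _ = refl
    execute-at (load r s)     _ _ _ = refl
    execute-at (store r s)    _ _ _ = refl
    execute-at (zeroℝ x)      _ _ _ = refl
    execute-at (oneℝ x)       _ _ _ = refl
    execute-at (addℝ x y z)   _ _ _ = refl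
    execute-at (subℝ x y z)   _ _ _ = refl
    execute-at (mulℝ x y z)   _ _ _ = refl
    execute-at (divℝ x y z)   _ _ _ = refl
    execute-at (loadℝ x r)    _ _ _ = refl
    execute-at (storeℝ r x)   _ _ _ = refl

    jump-yes : ∀ r s k o σ → State.reg σ r ≤ State.reg σ s → execute (jump≤ r s k) (at o σ) ≡ at k σ
    jump-yes r s k o σ le rewrite dec-true (State.reg σ r ℕ.≤? State.reg σ s) le = refl

    jump-no : ∀ r s k o σ → ¬ State.reg σ r ≤ State.reg σ s →
              execute (jump≤ r s k) (at o σ) ≡ at (suc o) σ
    jump-no r s k o σ ¬le rewrite dec-false (State.reg σ r ℕ.≤? State.reg σ s) ¬le = refl

    jump-yesℝ : ∀ r s k o σ → Reals._≤_ ℛ (State.regℝ σ r) (State.regℝ σ s) →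
                execute (jump≤ℝ r s k) (at o σ) ≡ at k σ
    jump-yesℝ r s k o σ le rewrite dec-true (State.regℝ σ r ≤? State.regℝ σ s) le = refl

    jump-noℝ : ∀ r s k o σ → ¬ Reals._≤_ ℛ (State.regℝ σ r) (State.regℝ σ s) →
              execute (jump≤ℝ r s k) (at o σ) ≡ at (suc o) σ
    jump-noℝ r s k o σ ¬le rewrite dec-false (State.regℝ σ r ≤? State.regℝ σ s) ¬le = refl

    step′ : ∀ {i is o σ′ n τ} σ → Contains o (i ∷ is) → execute i (at o σ) ≡ σ′ →
            p ⊢ σ′ ⇓[ n ] τ → p ⊢ at o σ ⇓[ suc n ] τ
    step′ σ k refl h = step (fetch k) h

    recast : ∀ {m n k l τ} σ → m ≡ n → k ≡ l → p ⊢ at k σ ⇓[ m ] τ → p ⊢ at l σ ⇓[ n ] τ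
    recast σ refl refl h = h

    then-part : ∀ test {o} c d → Contains o (branch test o (assemble c) (size c) (assemble d) (size d)) →
                Contains (suc (o + suc (size d))) (assemble c (suc (o + suc (size d))))
    then-part test {o} c d k = subst (λ o′ → Contains o′ (assemble c (suc (o + suc (size d))))) eq
      (contains-tail (contains-++ʳ (assemble d (suc o)) (length-assemble d _) (contains-tail k)))
      where
      eq : suc (suc o + size d) ≡ suc (o + suc (size d))
      eq = cong suc (sym (ℕ.+-suc o (size d)))

    -- In continuation form: the run that starts behind the code is an argument, and the steps of
    -- the code are put in front of it. As `_⊢_⇓[_]_` describes only runs up to the halt, partial
    -- runs cannot be composed directly.
    correct : ∀ {c σ t τ} o {n υ} → ⟪ c ⟫ σ ⇒[ t ] τ → Contains o (assemble c o) →
              p ⊢ at (o + size c) τ ⇓[ n ] υ → p ⊢ at o σ ⇓[ t + n ] υ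

    correct-else : ∀ test {σ t τ} o {n υ} c d → ⟪ d ⟫ σ ⇒[ t ] τ →
      Contains o (branch test o (assemble c) (size c) (assemble d) (size d)) →
      p ⊢ at (o + suc (size d + suc (size c))) τ ⇓[ n ] υ →
      p ⊢ at (suc o) σ ⇓[ t + 1 + n ] υ

    after-then : ∀ o c d → o + suc (size d + suc (size c)) ≡ suc (o + suc (size d)) + size c
    after-then o c d = shift o (size c) (size d)
      where
      shift : ∀ o c d → o + suc (d + suc c) ≡ suc (o + suc d) + c
      shift = solve-∀

    correct o (nop {σ}) k h = recast σ refl (ℕ.+-identityʳ o) h
    correct o (op {i} {q} {σ}) k h = step′ σ k
      (trans (execute-at i q o σ) (cong (λ k → at k (execute i σ)) (ℕ.+-comm 1 o))) h
    correct o {n} (_⨟_ {c} {d} {σ} {τ} {υ} {s} {t} x y) k h =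
      recast σ (sym (ℕ.+-assoc s t n)) refl
        (correct o x (contains-++ˡ (assemble c o) k)
          (correct (o + size c) y (contains-++ʳ (assemble c o) (length-assemble c o) k)
            (recast υ refl (sym (ℕ.+-assoc o (size c) (size d))) h)))
    correct o (yes≤ {r} {s} {c} {d} {σ} {τ} le x) k h =
      step′ σ k (jump-yes r s _ o σ le)
        (correct _ x (then-part (jump≤ r s) c d k) (recast τ refl (after-then o c d) h))
    correct o (no≤ {r} {s} {c} {d} {σ} ¬le x) k h =
      step′ σ k (jump-no r s _ o σ ¬le) (correct-else (jump≤ r s) o c d x k h)
    correct o (yes≤ℝ {r} {s} {c} {d} {σ} {τ} le x) k h =
      step′ σ k (jump-yesℝ r s _ o σ le)
        (correct _ x (then-part (jump≤ℝ r s) c d k) (recast τ refl (after-then o c d) h))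
    correct o (no≤ℝ {r} {s} {c} {d} {σ} ¬le x) k h =
      step′ σ k (jump-noℝ r s _ o σ ¬le) (correct-else (jump≤ℝ r s) o c d x k h)
    correct o (exit {r} {s} {c} {σ} le) k h =
      step′ σ k (jump-yes s r _ o σ le) (recast σ refl (shift o (size c)) h)
      where
      shift : ∀ o c → o + suc (c + 1) ≡ suc (o + suc c)
      shift = solve-∀
    correct o {n} (again {r} {s} {c} {σ} {τ} {υ} {t} {u} ¬le x y) k h =
      step′ σ k (jump-no s r _ o σ ¬le)
        (recast σ (sym (ℕ.+-assoc t (suc u) n)) refl
          (correct _ x (contains-++ˡ (assemble c (suc o)) (contains-tail k))
            (step′ τ (contains-++ʳ (assemble c (suc o)) (length-assemble c _) (contains-tail k)) refl
              (correct o y k h))))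

    correct-else test {σ} {t} {τ} o {n} c d x k h =
      recast σ (sym (ℕ.+-assoc t 1 n)) refl
        (correct _ x (contains-++ˡ (assemble d (suc o)) (contains-tail k))
          (step′ τ (contains-++ʳ (assemble d (suc o)) (length-assemble d _) (contains-tail k)) refl
            (recast τ refl (ℕ.+-suc o _) h)))

    correct-program : ∀ {c σ t τ} → p ≡ assemble c 0 → ⟪ c ⟫ σ ⇒[ t ] τ →
                      p ⊢ at 0 σ ⇓[ t ] at (size c) τ
    correct-program {c} {σ} {t} refl x = recast σ (ℕ.+-identityʳ t) refl
      (correct 0 x (containing [] (sym (++-identityʳ _))) (halt end))
      where
      drop-all : ∀ (is : List Instruction) → drop (length is) is ≡ []
      drop-all []       = refl
      drop-all (_ ∷ is) = drop-all is

      end : assemble c 0 !? size c ≡ nothing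
      end = trans (cong (assemble c 0 !?_) (sym (length-assemble c 0)))
                  (cong head (drop-all (assemble c 0)))

-- A language of bounded loops, and its compiler

data Exp : Set where
  lit     : ℕ → Exp
  ‵_      : ℕ → Exp
  _⊕_ _⊖_ : Exp → Exp → Exp
  _⟨_⟩    : ℕ → Exp → Exp

infixl 7 _⊕_ _⊖_
infix  9 ‵_
infix  8 _⟨_⟩

infixr 5 _⨾_
infix  6 _≔_ _⟨_⟩≔_
data Cmd : Set where
  skip     : Cmd
  _≔_      : ℕ → Exp → Cmd
  _⟨_⟩≔_   : ℕ → Exp → Exp → Cmd
  input    : ℕ → Exp → Cmd
  copyℝ    : Exp → Exp → Cmd
  _⨾_      : Cmd → Cmd → Cmd
  ifz      : Exp → Cmd → Cmd → Cmd
  wheneqℝ  : Exp → Exp → Cmd → Cmd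
  for      : ℕ → Exp → Cmd → Cmd

-- The exact length of the compiled expression. Reaching array `a` takes `a` doublings of an
-- address, since natural numbers cannot be multiplied in one operation; for a fixed program this is
-- a constant.
costE : Exp → ℕ
costE (lit _)   = 1
costE (‵ _)     = 2
costE (e ⊕ f)   = costE e + (costE f + 1)
costE (e ⊖ f)   = costE e + (costE f + 1)
costE (a ⟨ e ⟩) = costE e + (4 + a + 1)

ifZero_then_else_ : ∀ {ℓ} {A : Set ℓ} → ℕ → A → A → A
ifZero zero  then x else y = x
ifZero suc _ then x else y = y

loop : ∀ {A : Set} → (ℕ → A → A) → ℕ → A → A
loop f zero    s = s
loop f (suc n) s = f n (loop f n s)

module Language (ℛ : Reals) where
  open OverReals ℛ
  open Reals ℛ using (Carrier; _≤?_; isDecTotalOrder; _≈_) renaming (_≤_ to _≤ℝ_)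
  open StructuredCode ℛ

  -- The clock is a component of the store, so that loop invariants can speak of values and running
  -- time together.
  record Store : Set where
    constructor store
    field
      var  : ℕ → ℕ
      arr  : ℕ → ℕ → ℕ
      real : ℕ → Carrier
      time : ℕ

  open Store public

  initial : (ℕ → Carrier) → Store
  initial x = store (λ _ → 0) (λ _ _ → 0) x 0

  eval : Exp → Store → ℕ
  eval (lit k)   s = k
  eval (‵ x)     s = var s x
  eval (e ⊕ f)   s = eval e s + eval f s
  eval (e ⊖ f)   s = eval e s ∸ eval f s
  eval (a ⟨ e ⟩) s = arr s a (eval e s)

  assign : ℕ → ℕ → ℕ → Store → Store
  assign x k t s = record s { var = var s [ x ≔ k ] ; time = time s + t }

  wait : ℕ → Store → Store
  wait t s = record s { time = time s + t }

  sameℝ : Carrier → Carrier → Bool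
  sameℝ x y = does (x ≤? y) ∧ does (y ≤? x)

  sameℝ-sound : ∀ {x y} → sameℝ x y ≡ true → x ≈ y
  sameℝ-sound {x} {y} eq with x ≤? y | y ≤? x
  ... | yes p | yes q = IsDecTotalOrder.antisym isDecTotalOrder p q

  sameℝ-complete : ∀ {x y} → x ≈ y → sameℝ x y ≡ true
  sameℝ-complete {x} {y} eq
    rewrite dec-true (x ≤? y) (IsDecTotalOrder.reflexive isDecTotalOrder eq)
          | dec-true (y ≤? x) (IsDecTotalOrder.reflexive isDecTotalOrder
                                 (IsDecTotalOrder.Eq.sym isDecTotalOrder eq)) = refl

  module Semantics (inp : ℕ → ℕ) where

    run : Cmd → Store → Store
    run skip            s = s
    run (x ≔ e)         s = assign x (eval e s) (costE e + 2) s
    run (a ⟨ e ⟩≔ f)    s = record s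
      { arr  = arr s [ a ≔ arr s a [ eval e s ≔ eval f s ] ]
      ; time = time s + (costE e + (4 + a) + (costE f + 1)) }
    run (input x e)     s = assign x (inp (eval e s)) (costE e + 3) s
    run (copyℝ e f)     s = record s
      { real = real s [ eval e s ≔ real s (eval f s) ]
      ; time = time s + (costE e + (costE f + 2)) }
    run (c ⨾ d)         s = run d (run c s)
    run (ifz e c d)     s = ifZero eval e s then run c (wait (costE e + 4) s)
                                            else run d (wait (costE e + 4) s)
    run (wheneqℝ e f c) s = if sameℝ (real s (eval e s)) (real s (eval f s))
                            then run c (wait (costE e + (costE f + 6)) s)
                            else wait (costE e + (costE f + 6)) s
    -- On entry, 2 for clearing the counter and for the final exit test. In each round, 2 for
    -- copying the counter to `x`, 2 for its increment, and 2 for the test and the jump back.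
    run (for x e c)     s = loop (λ k s → run c (assign x k 6 s)) (eval e s) (wait (costE e + 2) s)

  double-injective : ∀ {m n} → m + m ≡ n + n → m ≡ n
  double-injective {zero}  {zero}  eq = refl
  double-injective {suc m} {suc n} eq rewrite ℕ.+-suc m m | ℕ.+-suc n n =
    cong suc (double-injective (ℕ.suc-injective (ℕ.suc-injective eq)))

  even≢odd : ∀ m n → m + m ≢ suc (n + n)
  even≢odd (suc m) zero    eq rewrite ℕ.+-suc m m = case eq of λ ()
  even≢odd (suc m) (suc n) eq rewrite ℕ.+-suc m m | ℕ.+-suc n n =
    even≢odd m n (ℕ.suc-injective (ℕ.suc-injective eq))

  abstract
    -- Even registers hold variables, odd registers hold temporaries; the
    -- first temporary holds the address at which the arrays begin.
    vr tp : ℕ → ℕ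
    vr x = x + x
    tp d = suc (d + d)

    vr-0 : vr 0 ≡ 0
    vr-0 = refl

    tp-0 : tp 0 ≡ 1
    tp-0 = refl

    vr≢tp : ∀ x d → vr x ≢ tp d
    vr≢tp = even≢odd

    vr-injective : ∀ {x y} → vr x ≡ vr y → x ≡ y
    vr-injective = double-injective

    tp≢ : ∀ {d e} → d < e → tp d ≢ tp e
    tp≢ d<e eq = ℕ.<⇒≢ d<e (double-injective (ℕ.suc-injective eq))

  -- Cell k of array a is kept at offset 2ᵃ(2k + 1).
  offset : ℕ → ℕ → ℕ
  offset zero    k = suc (k + k)
  offset (suc a) k = offset a k + offset a k

  offset-injective : ∀ a b {j k} → offset a j ≡ offset b k → a ≡ b × j ≡ k
  offset-injective zero    zero    eq = refl , double-injective (ℕ.suc-injective eq)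
  offset-injective zero (suc b) {j} {k} eq = contradiction (sym eq) (even≢odd (offset b k) j)
  offset-injective (suc a) zero {j} {k} eq = contradiction eq (even≢odd (offset a j) k)
  offset-injective (suc a) (suc b) {j} {k} eq with offset-injective a b {j} {k} (double-injective eq)
  ... | refl , j≡k = refl , j≡k

  -- Needed when the output is copied down to address 0: cell `k` lies above address `k`, so writing
  -- never destroys a cell that is still to be read.
  <offset : ∀ a k → k < offset a k
  <offset zero    k = s≤s (ℕ.m≤m+n k k)
  <offset (suc a) k = ℕ.≤-trans (<offset a k) (ℕ.m≤m+n _ _)

  doublings : ℕ → ℕ → Code
  doublings zero    d = nop
  doublings (suc a) d = doublings a d ⨟ op (add (tp d) (tp d) (tp d))

  address : ℕ → ℕ → Code
  address a d = op (add (tp d) (tp d) (tp d)) ⨟ op (set (tp (suc d)) 1) ⨟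
    op (add (tp d) (tp d) (tp (suc d))) ⨟ doublings a d ⨟ op (add (tp d) (tp d) (tp 0))

  -- The temporaries serve as a stack: the value ends up in `tp d`, and no lower temporary is
  -- touched.
  compileE : ℕ → Exp → Code
  compileE d (lit k)   = op (set (tp d) k)
  compileE d (‵ x)     = op (set (tp d) 0) ⨟ op (add (tp d) (tp d) (vr x))
  compileE d (e ⊕ f)   = compileE d e ⨟ compileE (suc d) f ⨟ op (add (tp d) (tp d) (tp (suc d)))
  compileE d (e ⊖ f)   = compileE d e ⨟ compileE (suc d) f ⨟ op (sub (tp d) (tp d) (tp (suc d)))
  compileE d (a ⟨ e ⟩) = compileE d e ⨟ address a d ⨟ op (load (tp d) (tp d))

  -- Bound and counter of a loop live in the temporaries `d` and `d + 1`, and the body is compiled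
  -- above them. Hence the number of rounds is fixed on entry, whatever the body assigns.
  compile : ℕ → Cmd → Code
  compile d skip            = nop
  compile d (x ≔ e)         = compileE d e ⨟ op (set (vr x) 0) ⨟ op (add (vr x) (vr x) (tp d))
  compile d (a ⟨ e ⟩≔ f)    = (compileE d e ⨟ address a d) ⨟
    compileE (suc d) f ⨟ op (store (tp d) (tp (suc d)))
  compile d (input x e)     = compileE d e ⨟
    -- Behind the input the memory holds the arrays, so the value 0 of `inp` there has to be
    -- supplied explicitly.
    if≤ (tp 0) (tp d) (op (set (vr x) 0)) (op (load (vr x) (tp d)))
  compile d (copyℝ e f)     = compileE d e ⨟ compileE (suc d) f ⨟
    op (loadℝ 0 (tp (suc d))) ⨟ op (storeℝ (tp d) 0)
  compile d (b ⨾ c)         = compile d b ⨟ compile d c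
  compile d (ifz e b c)     = compileE d e ⨟ op (set (tp (suc d)) 0) ⨟
    if≤ (tp d) (tp (suc d)) (compile d b) (compile d c)
  compile d (wheneqℝ e f c) = compileE d e ⨟ compileE (suc d) f ⨟
    op (loadℝ 0 (tp d)) ⨟ op (loadℝ 1 (tp (suc d))) ⨟
    if≤ℝ 0 1 (if≤ℝ 1 0 (compile d c) nop) nop
  compile d (for x e c)     = compileE d e ⨟ op (set (tp (suc d)) 0) ⨟
    while< (tp (suc d)) (tp d)
      ((op (set (vr x) 0) ⨟ op (add (vr x) (vr x) (tp (suc d)))) ⨟
       compile (2 + d) c ⨟
       op (set (tp (2 + d)) 1) ⨟ op (add (tp (suc d)) (tp (suc d)) (tp (2 + d))))

  module Simulation (inp : ℕ → ℕ) (B : ℕ) (inp-end : ∀ {k} → B ≤ k → inp k ≡ 0) where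
    open Semantics inp
    open State

    record Represents (s : Store) (σ : State) : Set where
      field
        vars   : ∀ x → reg σ (vr x) ≡ var s x
        base   : reg σ (tp 0) ≡ B
        arrays : ∀ a k → mem σ (offset a k + B) ≡ arr s a k
        inputs : ∀ {k} → k < B → mem σ k ≡ inp k
        reals  : ∀ k → memℝ σ k ≡ real s k

    open Represents

    record KeepsTemps (d : ℕ) (f g : ℕ → ℕ) : Set where
      constructor keeping
      field
        keep : ∀ {j} → j ≤ d → g (tp j) ≡ f (tp j)

    open KeepsTemps

    Keeps : ℕ → State → State → Set
    Keeps d σ τ = KeepsTemps d (reg σ) (reg τ)

    keeps-refl : ∀ {d f} → KeepsTemps d f f
    keeps-refl = keeping λ _ → refl

    infixr 5 _◂_ _◂⁺_
    _◂_ : ∀ {d f g h} → KeepsTemps d f g → KeepsTemps d g h → KeepsTemps d f h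
    k ◂ l = keeping λ j≤d → trans (keep l j≤d) (keep k j≤d)

    _◂⁺_ : ∀ {d f g h} → KeepsTemps d f g → KeepsTemps (suc d) g h → KeepsTemps d f h
    k ◂⁺ l = keeping λ j≤d → trans (keep l (ℕ.m≤n⇒m≤1+n j≤d)) (keep k j≤d)

    ⇒-time : ∀ {c σ s t τ} → s ≡ t → ⟪ c ⟫ σ ⇒[ s ] τ → ⟪ c ⟫ σ ⇒[ t ] τ
    ⇒-time refl x = x

    module _ {σ : State} (d : ℕ) where

      set-temp : ∀ n → State
      set-temp n = record σ { reg = reg σ [ tp (suc d) ≔ n ] }

      temp-represents : ∀ {s} n p → Represents s σ → Represents s (record (set-temp n) { pc = p })
      temp-represents n p R = record
        { vars   = λ x → trans (update-≢ (reg σ) (vr≢tp x _)) (vars R x)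
        ; base   = trans (update-≢ (reg σ) (tp≢ z<s)) (base R)
        ; arrays = arrays R
        ; inputs = inputs R
        ; reals  = reals R }

      temp-keeps : ∀ {n} → KeepsTemps d (reg σ) (reg σ [ tp (suc d) ≔ n ])
      temp-keeps = keeping λ j≤d → update-≢ (reg σ) (tp≢ (s≤s j≤d))

    record Computes (d : ℕ) (c : Code) (n : ℕ) (t : ℕ) (s : Store) (σ : State) : Set where
      constructor computes
      field
        {final} : State
        runs    : ⟪ c ⟫ σ ⇒[ t ] final
        result  : reg final (tp (suc d)) ≡ n
        repr    : Represents s final
        keeps   : Keeps d σ final

    doublings-correct : ∀ d a {s σ k} → Represents s σ → reg σ (tp (suc d)) ≡ offset 0 k →
                        Computes d (doublings a (suc d)) (offset a k) a s σ
    doublings-correct d zero    R eq = computes nop eq R keeps-refl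
    doublings-correct d (suc a) R eq with doublings-correct d a R eq
    ... | computes {τ} x eq′ R′ k = computes (⇒-time (ℕ.+-comm a 1) (x ⨟ op))
      (trans (update-≡ (reg τ) _) (cong₂ _+_ eq′ eq′)) (temp-represents d _ _ R′)
      (k ◂ temp-keeps {τ} d)

    address-correct : ∀ d a {s σ k} → Represents s σ → reg σ (tp (suc d)) ≡ k →
                      Computes d (address a (suc d)) (offset a k + B) (4 + a) s σ
    address-correct d a {s} {σ} {k} R refl = computes
        (⇒-time (cong (3 +_) (ℕ.+-comm a 1)) (op ⨟ op ⨟ op ⨟ runs ⨟ op))
        (trans (update-≡ (reg final) _) (cong₂ _+_ result (base repr)))
        (temp-represents d _ _ repr)
        (keeps₃ ◂ keeps ◂ temp-keeps {final} d)
      where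
      i₁ = add (tp (suc d)) (tp (suc d)) (tp (suc d))
      i₂ = set (tp (2 + d)) 1
      i₃ = add (tp (suc d)) (tp (suc d)) (tp (2 + d))
      σ₁ = execute i₁ σ
      σ₂ = execute i₂ σ₁
      σ₃ = execute i₃ σ₂
      R₃ : Represents s σ₃
      R₃ = temp-represents {σ₂} d _ _ (temp-represents {σ₁} (suc d) _ (pc σ₂) (temp-represents {σ} d _ (pc σ₁) R))
      keeps₃ : Keeps d σ σ₃
      keeps₃ = (temp-keeps {σ} d ◂⁺ temp-keeps {σ₁} (suc d)) ◂ temp-keeps {σ₂} d
      odd : reg σ₃ (tp (suc d)) ≡ offset 0 k
      odd = begin
        reg σ₃ (tp (suc d))                          ≡⟨ update-≡ (reg σ₂) (tp (suc d)) {reg σ₂ (tp (suc d)) + reg σ₂ (tp (2 + d))} ⟩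
        reg σ₂ (tp (suc d)) + reg σ₂ (tp (2 + d))    ≡⟨ cong₂ _+_ (trans (keep (temp-keeps {σ₁} (suc d)) ℕ.≤-refl) (update-≡ (reg σ) (tp (suc d)) {k + k})) (update-≡ (reg σ₁) (tp (2 + d)) {1}) ⟩
        k + k + 1                                    ≡⟨ ℕ.+-comm _ 1 ⟩
        suc (k + k)                                  ∎
        where open ≡-Reasoning
      open Computes (doublings-correct d a {k = k} R₃ odd)

    compileE-correct : ∀ d e {s σ} → Represents s σ →
                       Computes d (compileE (suc d) e) (eval e s) (costE e) s σ

    binary-correct : ∀ d e f {s σ} (_∙_ : ℕ → ℕ → ℕ) i {p : Straight i} →
      (∀ τ → execute i τ ≡ record (set-temp {τ} d (reg τ (tp (suc d)) ∙ reg τ (tp (2 + d)))) { pc = suc (pc τ) }) →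
      Represents s σ →
      Computes d (compileE (suc d) e ⨟ compileE (2 + d) f ⨟ op i {p})
        (eval e s ∙ eval f s) (costE e + (costE f + 1)) s σ
    binary-correct d e f _∙_ i {p} eq R with compileE-correct d e R
    ... | computes x m R₁ k with compileE-correct (suc d) f R₁
    ... | computes {τ} y n R₂ l = computes (x ⨟ y ⨟ subst (⟪ op i {p} ⟫ τ ⇒[ 1 ]_) (eq τ) op)
      (trans (update-≡ (reg τ) _) (cong₂ _∙_ (trans (keep l ℕ.≤-refl) m) n))
      (temp-represents d _ _ R₂)
      ((k ◂⁺ l) ◂ temp-keeps {τ} d)

    compileE-correct d (lit n) {σ = σ} R =
      computes op (update-≡ (reg σ) _) (temp-represents d _ _ R) (temp-keeps {σ} d)
    compileE-correct d (‵ x) {s} {σ} R = computes (op ⨟ op)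
        (trans (update-≡ (reg σ₁) (tp (suc d))) (cong₂ _+_ (update-≡ (reg σ) (tp (suc d)) {0}) (vars R₁ x)))
        (temp-represents d _ _ R₁) (temp-keeps {σ} d ◂ temp-keeps {σ₁} d)
      where
      σ₁ = execute (set (tp (suc d)) 0) σ
      R₁ : Represents s σ₁
      R₁ = temp-represents d _ _ R
    compileE-correct d (e ⊕ f) R = binary-correct d e f _+_ _ (λ _ → refl) R
    compileE-correct d (e ⊖ f) R = binary-correct d e f _∸_ _ (λ _ → refl) R
    compileE-correct d (a ⟨ e ⟩) R with compileE-correct d e R
    ... | computes x m R₁ k with address-correct d a R₁ m
    ... | computes {τ} y n R₂ l = computes (x ⨟ y ⨟ op)
      (trans (update-≡ (reg τ) _) (trans (cong (mem τ) n) (arrays R₂ a _)))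
      (temp-represents d _ _ R₂)
      (k ◂ l ◂ temp-keeps {τ} d)

    -- The clock only has to dominate the number of steps, because conditionals and reads of the
    -- input are charged by a bound that covers either outcome.
    record Executes (d : ℕ) (c : Code) (t₀ : ℕ) (s : Store) (t₁ : ℕ) (σ : State) : Set where
      constructor executes
      field
        {steps} : ℕ
        {final} : State
        runs    : ⟪ c ⟫ σ ⇒[ steps ] final
        repr    : Represents s final
        keeps   : Keeps d σ final
        timely  : t₀ + steps ≤ t₁

    at-time : ∀ {s σ} t → Represents s σ → Represents (record s { time = t }) σ
    at-time t R = record { vars = vars R ; base = base R ; arrays = arrays R
                         ; inputs = inputs R ; reals = reals R }

    assign-represents : ∀ {s σ} x {n t σ′} → Represents s σ →
      (∀ {j} → j ≢ vr x → reg σ′ j ≡ reg σ j) → reg σ′ (vr x) ≡ n →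
      (∀ j → mem σ′ j ≡ mem σ j) → (∀ j → memℝ σ′ j ≡ memℝ σ j) →
      Represents (assign x n t s) σ′
    assign-represents {s} {σ} x {n} {t} {σ′} R other this m r = record
      { vars   = vars′
      ; base   = trans (other (vr≢tp x 0 ∘ sym)) (base R)
      ; arrays = λ a k → trans (m _) (arrays R a k)
      ; inputs = λ {k} k<B → trans (m _) (inputs R k<B)
      ; reals  = λ k → trans (r _) (reals R k) }
      where
      vars′ : ∀ y → reg σ′ (vr y) ≡ (var s [ x ≔ n ]) y
      vars′ y with y ℕ.≟ x
      ... | yes refl = trans this (sym (update-≡ (var s) x))
      ... | no y≢x   = trans (other (y≢x ∘ vr-injective))
                             (trans (vars R y) (sym (update-≢ (var s) y≢x)))

    move-correct : ∀ x j {d s σ n t} → Represents s σ → reg σ (tp j) ≡ n →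
      Computes d (op (set (vr x) 0) ⨟ op (add (vr x) (vr x) (tp j))) (reg σ (tp (suc d))) 2
               (assign x n t s) σ
    move-correct x j {d} {s} {σ} {n} R eq = computes (op ⨟ op) (kept (suc d))
      (assign-represents x R other
        (trans (update-≡ (reg σ₁) (vr x)) (cong₂ _+_ (update-≡ (reg σ) (vr x) {0})
          (trans (update-≢ (reg σ) {tp j} {vr x} (vr≢tp x j ∘ sym)) eq)))
        (λ _ → refl) (λ _ → refl))
      (keeping λ {j} _ → kept j)
      where
      σ₁ = execute (set (vr x) 0) σ
      other : ∀ {j} → j ≢ vr x → reg (execute (add (vr x) (vr x) (tp _)) σ₁) j ≡ reg σ j
      other ne = trans (update-≢ (reg σ₁) ne) (update-≢ (reg σ) ne)
      kept : ∀ j → reg (execute (add (vr x) (vr x) (tp _)) σ₁) (tp j) ≡ reg σ (tp j)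
      kept j = other (vr≢tp x j ∘ sym)

    write-represents : ∀ {s σ} a k n {t p q} → Represents s σ → q ≡ offset a k + B →
      Represents (record s { arr = arr s [ a ≔ arr s a [ k ≔ n ] ] ; time = t })
                 (record σ { mem = mem σ [ q ≔ n ] ; pc = p })
    write-represents {s} {σ} a k n R refl = record
      { vars = vars R ; base = base R ; reals = reals R
      ; arrays = arrays′
      ; inputs = λ j<B → trans (update-≢ (mem σ) (λ { refl → ℕ.<⇒≱ j<B (ℕ.m≤n+m B _) })) (inputs R j<B) }
      where
      arrays′ : ∀ b j → (mem σ [ offset a k + B ≔ n ]) (offset b j + B) ≡ (arr s [ a ≔ arr s a [ k ≔ n ] ]) b j
      arrays′ b j with b ℕ.≟ a
      ... | no b≢a = trans (update-≢ (mem σ) (b≢a ∘ proj₁ ∘ offset-injective b a ∘ ℕ.+-cancelʳ-≡ B _ _))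
              (trans (arrays R b j) (cong (λ f → f j) (sym (update-≢ (arr s) b≢a))))
      ... | yes refl rewrite update-≡ (arr s) b {arr s b [ k ≔ n ]} with j ℕ.≟ k
      ...   | yes refl = trans (update-≡ (mem σ) _) (sym (update-≡ (arr s b) j))
      ...   | no j≢k   = trans (update-≢ (mem σ) (j≢k ∘ proj₂ ∘ offset-injective b b ∘ ℕ.+-cancelʳ-≡ B _ _))
              (trans (arrays R b j) (sym (update-≢ (arr s b) j≢k)))

    copy-represents : ∀ {s σ} k n {m t p q} {f : ℕ → Carrier} → Represents s σ → q ≡ k → m ≡ n →
      Represents (record s { real = real s [ k ≔ n ] ; time = t })
                 (record σ { memℝ = memℝ σ [ q ≔ m ] ; regℝ = f ; pc = p })
    copy-represents {s} {σ} k n R refl refl = record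
      { vars = vars R ; base = base R ; arrays = arrays R ; inputs = inputs R ; reals = reals′ }
      where
      reals′ : ∀ j → (memℝ σ [ k ≔ n ]) j ≡ (real s [ k ≔ n ]) j
      reals′ j with j ℕ.≟ k
      ... | yes refl = trans (update-≡ (memℝ σ) j) (sym (update-≡ (real s) j))
      ... | no j≢k   = trans (update-≢ (memℝ σ) j≢k) (trans (reals R j) (sym (update-≢ (real s) j≢k)))

    compile-correct : ∀ d c {s σ} → Represents s σ →
                      Executes d (compile (suc d) c) (time s) (run c s) (time (run c s)) σ

    module ForLoop (d x : ℕ) (c : Cmd) (s₀ : Store) (n : ℕ) where

      after : ℕ → Store
      after k = loop (λ k s → run c (assign x k 6 s)) k s₀

      counter : ℕ
      counter = tp (2 + d)

      body : Code
      body = (op (set (vr x) 0) ⨟ op (add (vr x) (vr x) counter)) ⨟ compile (3 + d) c ⨟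
             op (set (tp (3 + d)) 1) ⨟ op (add counter counter (tp (3 + d)))

      body-correct : ∀ k {σ} → Represents (after k) σ → reg σ counter ≡ k →
        Σ[ τ ∈ State ] Σ[ t ∈ ℕ ] ⟪ body ⟫ σ ⇒[ t ] τ × Represents (after (suc k)) τ ×
          Keeps (suc d) σ τ × reg τ counter ≡ suc k × time (after k) + (2 + t) ≤ time (after (suc k))
      body-correct k {σ} R eq = go (move-correct x (2 + d) {suc d} R eq)
        where
        go : Computes (suc d) (op (set (vr x) 0) ⨟ op (add (vr x) (vr x) counter))
               (reg σ counter) 2 (assign x k 6 (after k)) σ → _
        go (computes y₁ m R₁ k₁) with compile-correct (2 + d) c R₁
        ... | executes {t} {τ} y R₂ k₂ le =
          _ , _ , y₁ ⨟ y ⨟ op ⨟ op ,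
          temp-represents (suc d) _ _ (temp-represents {τ} (2 + d) _ (suc (pc τ)) R₂) ,
          (keeping λ {j} j≤ → trans (update-≢ (reg τ₁) (tp≢ (s≤s j≤)))
            (keep ((k₁ ◂⁺ k₂) ◂⁺ temp-keeps {τ} (2 + d)) j≤)) ,
          trans (update-≡ (reg τ₁) counter) (trans (cong₂ _+_ (trans (keep (temp-keeps {τ} (2 + d)) ℕ.≤-refl)
            (trans (keep k₂ ℕ.≤-refl) (trans m eq))) (update-≡ (reg τ) (tp (3 + d)) {1})) (ℕ.+-comm k 1)) ,
          ℕ.≤-trans (ℕ.≤-reflexive (shift (time (after k)) t)) le
          where
          τ₁ = execute (set (tp (3 + d)) 1) τ
          shift : ∀ a t → a + (2 + (2 + (t + 2))) ≡ a + 6 + t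
          shift = solve-∀

      -- The additional 1 is the exit test, which is charged on entry to the loop and not in any
      -- round.
      while-correct : ∀ m {k σ} → m + k ≡ n → Represents (after k) σ →
        reg σ (tp (suc d)) ≡ n → reg σ counter ≡ k →
        Executes d (while< counter (tp (suc d)) body) (time (after k)) (after n) (time (after n) + 1) σ
      while-correct zero {k} {σ} refl R lim cnt = executes
        (exit (ℕ.≤-reflexive (trans lim (sym cnt)))) R keeps-refl ℕ.≤-refl
      while-correct (suc m) {k} {σ} refl R lim cnt with body-correct k R cnt
      ... | τ , t , x , R₁ , k₁ , cnt₁ , le
        with while-correct m (ℕ.+-suc m k) R₁ (trans (keep k₁ ℕ.≤-refl) lim) cnt₁
      ... | executes {u} {υ} y R₂ k₂ le₂ = executes
        (again (λ ge → ℕ.<⇒≱ (s≤s (ℕ.m≤n+m k m)) (subst₂ _≤_ lim cnt ge)) x y) R₂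
        (keeping λ j≤ → trans (keep k₂ j≤) (keep k₁ (ℕ.m≤n⇒m≤1+n j≤)))
        (ℕ.≤-trans (ℕ.≤-reflexive (shift (time (after k)) t u))
          (ℕ.≤-trans (ℕ.+-monoˡ-≤ u le) le₂))
        where
        shift : ∀ a t u → a + suc (t + suc u) ≡ a + (2 + t) + u
        shift = solve-∀

    compile-correct d skip R = executes nop R keeps-refl (ℕ.≤-reflexive (ℕ.+-identityʳ _))
    compile-correct d (x ≔ e) {σ = σ} R with compileE-correct d e R
    ... | computes y m R₁ k with move-correct x (suc d) {d} R₁ m
    ... | computes z _ R₂ l = executes (y ⨟ z) R₂ (k ◂ l) ℕ.≤-refl
    compile-correct d (a ⟨ e ⟩≔ f) {s} {σ} R with compileE-correct d e R
    ... | computes x m R₁ k with address-correct d a R₁ m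
    ... | computes y m′ R₂ l with compileE-correct (suc d) f R₂
    ... | computes {τ} z n R₃ o = executes ((x ⨟ y) ⨟ z ⨟ op)
      (subst (λ v → Represents (run (a ⟨ e ⟩≔ f) s) (record τ { mem = mem τ [ reg τ (tp (suc d)) ≔ v ] ; pc = suc (pc τ) }))
        (sym n) (write-represents a (eval e s) (eval f s) R₃ (trans (keep o ℕ.≤-refl) m′)))
      ((k ◂ l) ◂⁺ o) ℕ.≤-refl
    compile-correct d (input x e) {s} {σ} R with compileE-correct d e R
    ... | computes {τ} y m R₁ k with B ℕ.≤? eval e s
    ...   | yes le = executes (y ⨟ yes≤ (subst₂ _≤_ (sym (base R₁)) (sym m) le) op)
      (assign-represents x R₁ (update-≢ (reg τ)) (trans (update-≡ (reg τ) _) (sym (inp-end le)))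
        (λ _ → refl) (λ _ → refl))
      (k ◂ keeping λ {j} _ → update-≢ (reg τ) (vr≢tp x j ∘ sym))
      (ℕ.+-monoʳ-≤ (time s) (ℕ.+-monoʳ-≤ (costE e) (ℕ.n≤1+n 2)))
    ...   | no ¬le = executes (y ⨟ no≤ (λ le → ¬le (subst₂ _≤_ (base R₁) m le)) op)
      (assign-represents x R₁ (update-≢ (reg τ))
        (trans (update-≡ (reg τ) _) (trans (cong (mem τ) m) (inputs R₁ (ℕ.≰⇒> ¬le))))
        (λ _ → refl) (λ _ → refl))
      (k ◂ keeping λ {j} _ → update-≢ (reg τ) (vr≢tp x j ∘ sym))
      ℕ.≤-refl
    compile-correct d (copyℝ e f) {s} {σ} R with compileE-correct d e R
    ... | computes y m R₁ k with compileE-correct (suc d) f R₁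
    ... | computes {τ} z n R₂ l = executes (y ⨟ z ⨟ op ⨟ op)
      (copy-represents (eval e s) (real s (eval f s)) R₂ (trans (keep l ℕ.≤-refl) m)
        (trans (update-≡ (regℝ τ) 0) (trans (cong (memℝ τ) n) (reals R₂ _))))
      (k ◂⁺ l) ℕ.≤-refl
    compile-correct d (b ⨾ c) {s} {σ} R with compile-correct d b R
    ... | executes {t} x R₁ k le with compile-correct d c R₁
    ... | executes {u} y R₂ l le₂ = executes (x ⨟ y) R₂ (k ◂ l)
      (ℕ.≤-trans (ℕ.≤-reflexive (sym (ℕ.+-assoc (time s) t u))) (ℕ.≤-trans (ℕ.+-monoˡ-≤ u le) le₂))
    compile-correct d (ifz e b c) {s} {σ} R with compileE-correct d e R
    ... | computes {τ} y m R₁ k = go (eval e s) m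
      where
      τ₁ = execute (set (tp (2 + d)) 0) τ

      kept : Keeps d σ τ₁
      kept = k ◂⁺ temp-keeps {τ} (suc d)

      tested : ∀ {n} → reg τ (tp (suc d)) ≡ n → reg τ₁ (tp (suc d)) ≡ n
      tested = trans (keep (temp-keeps {τ} (suc d)) ℕ.≤-refl)

      R₂ : Represents (wait (costE e + 4) s) τ₁
      R₂ = at-time _ (temp-represents {τ} (suc d) 0 (suc (pc τ)) R₁)

      shift : ∀ a e t → a + (e + (1 + suc (t + 1))) ≡ a + (e + 3) + t
      shift = solve-∀

      timely : ∀ {t u} → time s + (costE e + 4) + t ≤ u → time s + (costE e + (1 + suc (t + 1))) ≤ u
      timely {t} le = ℕ.≤-trans (ℕ.≤-reflexive (shift (time s) (costE e) t)) (ℕ.≤-trans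
        (ℕ.+-monoˡ-≤ t (ℕ.+-monoʳ-≤ (time s) (ℕ.+-monoʳ-≤ (costE e) (ℕ.n≤1+n 3)))) le)

      go : ∀ n → reg τ (tp (suc d)) ≡ n →
        let s′ = ifZero n then run b (wait (costE e + 4) s) else run c (wait (costE e + 4) s)
        in Executes d (compile (suc d) (ifz e b c)) (time s) s′ (time s′) σ
      go zero m with compile-correct d b R₂
      ... | executes {t} z R₃ l le = executes
        (y ⨟ op ⨟ yes≤ (ℕ.≤-reflexive (trans (tested m) (sym (update-≡ (reg τ) _)))) z)
        R₃ (kept ◂ l)
        (ℕ.≤-trans (ℕ.+-monoʳ-≤ (time s) (ℕ.+-monoʳ-≤ (costE e) (s≤s (s≤s (ℕ.m≤m+n t 1))))) (timely le))
      go (suc n) m with compile-correct d c R₂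
      ... | executes {t} z R₃ l le = executes
        (y ⨟ op ⨟ no≤ (λ le → case subst₂ _≤_ (tested m) (update-≡ (reg τ) (tp (2 + d)) {0}) le of λ ()) z)
        R₃ (kept ◂ l) (timely le)
    compile-correct d (wheneqℝ e f c) {s} {σ} R with compileE-correct d e R
    ... | computes y m R₁ k with compileE-correct (suc d) f R₁
    ... | computes {τ} z n R₂ l =
      go (real s (eval e s)) (real s (eval f s))
         (trans (cong (memℝ τ) (trans (keep l ℕ.≤-refl) m)) (reals R₂ _))
         (trans (cong (memℝ τ) n) (reals R₂ _))
      where
      τ₂ = execute (loadℝ 1 (tp (2 + d))) (execute (loadℝ 0 (tp (suc d))) τ)

      R₃ : Represents (wait (costE e + (costE f + 6)) s) τ₂
      R₃ = record { vars = vars R₂ ; base = base R₂ ; arrays = arrays R₂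
                  ; inputs = inputs R₂ ; reals = reals R₂ }

      kept : Keeps d σ τ₂
      kept = keeping λ j≤d → keep (k ◂⁺ l) j≤d

      shift : ∀ a e f t → a + (e + (f + (1 + (1 + (1 + (1 + t)))))) ≡ a + (e + (f + 4)) + t
      shift = solve-∀

      earlier : ∀ {j k} → j ≤ k → time s + (costE e + (costE f + j)) ≤ time s + (costE e + (costE f + k))
      earlier le = ℕ.+-monoʳ-≤ (time s) (ℕ.+-monoʳ-≤ (costE e) (ℕ.+-monoʳ-≤ (costE f) le))

      go : ∀ p q → memℝ τ (reg τ (tp (suc d))) ≡ p → memℝ τ (reg τ (tp (2 + d))) ≡ q →
        let s′ = wait (costE e + (costE f + 6)) s
            s″ = if sameℝ p q then run c s′ else s′
        in Executes d (compile (suc d) (wheneqℝ e f c)) (time s) s″ (time s″) σ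
      go p q refl refl with p ≤? q
      ... | no ¬le = executes (y ⨟ z ⨟ op ⨟ op ⨟ no≤ℝ ¬le nop) R₃ kept (earlier (s≤s (s≤s (s≤s (s≤s z≤n)))))
      ... | yes le with q ≤? p
      ...   | no ¬ge = executes (y ⨟ z ⨟ op ⨟ op ⨟ yes≤ℝ le (no≤ℝ ¬ge nop)) R₃ kept
                (earlier (s≤s (s≤s (s≤s (s≤s (s≤s z≤n))))))
      ...   | yes ge with compile-correct d c R₃
      ...     | executes {t} x R₄ o t≤ = executes (y ⨟ z ⨟ op ⨟ op ⨟ yes≤ℝ le (yes≤ℝ ge x)) R₄
        (kept ◂ o)
        (ℕ.≤-trans (ℕ.≤-reflexive (shift (time s) (costE e) (costE f) t))
          (ℕ.≤-trans (ℕ.+-monoˡ-≤ t (earlier (ℕ.m≤n+m 4 2))) t≤))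
    compile-correct d (for x e c) {s} {σ} R with compileE-correct d e R
    ... | computes {τ} y m R₁ k
      with ForLoop.while-correct d x c (wait (costE e + 2) s) (eval e s) (eval e s) {0}
             (ℕ.+-identityʳ _) (at-time {σ = execute (set (tp (2 + d)) 0) τ} _ (temp-represents {τ} (suc d) 0 (suc (pc τ)) R₁))
             (trans (keep (temp-keeps {τ} (suc d)) ℕ.≤-refl) m) (update-≡ (reg τ) _)
    ... | executes {t} z R₂ l le = executes (y ⨟ op ⨟ z) R₂
      ((k ◂⁺ temp-keeps {τ} (suc d)) ◂ l)
      (ℕ.+-cancelʳ-≤ 1 _ _ (ℕ.≤-trans (ℕ.≤-reflexive (shift (time s) (costE e) t)) le))
      where
      shift : ∀ a e t → a + (e + (1 + t)) + 1 ≡ a + (e + 2) + t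
      shift = solve-∀

-- Frame rules and running times

-- A Boolean test, so that `T (keepsVar x c)` computes to `⊤` for a concrete command and frame
-- conditions are found by unification.
keepsVar : ℕ → Cmd → Bool
keepsVar x skip            = true
keepsVar x (y ≔ _)         = not (x ≡ᵇ y)
keepsVar x (_ ⟨ _ ⟩≔ _)    = true
keepsVar x (input y _)     = not (x ≡ᵇ y)
keepsVar x (copyℝ _ _)     = true
keepsVar x (c ⨾ d)         = keepsVar x c ∧ keepsVar x d
keepsVar x (ifz _ c d)     = keepsVar x c ∧ keepsVar x d
keepsVar x (wheneqℝ _ _ c) = keepsVar x c
keepsVar x (for y _ c)     = not (x ≡ᵇ y) ∧ keepsVar x c

keepsArr : ℕ → Cmd → Bool
keepsArr a skip            = true
keepsArr a (_ ≔ _)         = true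
keepsArr a (b ⟨ _ ⟩≔ _)    = not (a ≡ᵇ b)
keepsArr a (input _ _)     = true
keepsArr a (copyℝ _ _)     = true
keepsArr a (c ⨾ d)         = keepsArr a c ∧ keepsArr a d
keepsArr a (ifz _ c d)     = keepsArr a c ∧ keepsArr a d
keepsArr a (wheneqℝ _ _ c) = keepsArr a c
keepsArr a (for _ _ c)     = keepsArr a c

keepsReal : Cmd → Bool
keepsReal (copyℝ _ _)     = false
keepsReal (c ⨾ d)         = keepsReal c ∧ keepsReal d
keepsReal (ifz _ c d)     = keepsReal c ∧ keepsReal d
keepsReal (wheneqℝ _ _ c) = keepsReal c
keepsReal (for _ _ c)     = keepsReal c
keepsReal _               = true

-- Variables 0, 1, 2, 3 hold the size parameters of the input.
static : Cmd → Bool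
static (x ≔ _)         = 3 <ᵇ x
static (input x _)     = 3 <ᵇ x
static (c ⨾ d)         = static c ∧ static d
static (ifz _ c d)     = static c ∧ static d
static (wheneqℝ _ _ c) = static c
static (for x (‵ y) c) = (3 <ᵇ x) ∧ ((y <ᵇ 4) ∧ static c)
static (for _ _ _)     = false
static _               = true

depth : Cmd → ℕ
depth (c ⨾ d)         = depth c ⊔ depth d
depth (ifz _ c d)     = depth c ⊔ depth d
depth (wheneqℝ _ _ c) = depth c
depth (for _ _ c)     = suc (depth c)
depth _               = 0

weightC : Cmd → ℕ
weightC skip            = 0
weightC (x ≔ e)         = costE e + 2
weightC (a ⟨ e ⟩≔ f)    = costE e + (4 + a) + (costE f + 1)
weightC (input x e)     = costE e + 3
weightC (copyℝ e f)     = costE e + (costE f + 2)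
weightC (c ⨾ d)         = weightC c + weightC d
weightC (ifz e c d)     = costE e + 4 + (weightC c + weightC d)
weightC (wheneqℝ e f c) = costE e + (costE f + 6) + weightC c
weightC (for x e c)     = costE e + 2 + (6 + weightC c)

∧-T : ∀ {b c} → T (b ∧ c) → T b × T c
∧-T {true} p = tt , p

T-not : ∀ {b} → T (not b) → b ≡ false
T-not {false} _ = refl

small≢large : ∀ {y x} → T (y <ᵇ 4) → T (3 <ᵇ x) → y ≢ x
small≢large {y} p q refl = ℕ.<⇒≱ (ℕ.<ᵇ⇒< y 4 p) (ℕ.<ᵇ⇒< 3 y q)

loop-rule : ∀ {A : Set} {f : ℕ → A → A} {s} (I : ℕ → A → Set) n → I 0 s →
            (∀ {k s} → k < n → I k s → I (suc k) (f k s)) → I n (loop f n s)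
loop-rule I zero    base step = base
loop-rule I (suc n) base step = step ℕ.≤-refl
  (loop-rule I n base (λ k<n → step (ℕ.m≤n⇒m≤1+n k<n)))

ifZero-elim : ∀ {A : Set} (P : A → Set) n {x y} → (n ≡ 0 → P x) → (∀ {m} → n ≡ suc m → P y) →
              P (ifZero n then x else y)
ifZero-elim P zero    p q = p refl
ifZero-elim P (suc n) p q = q refl

if-elim : ∀ {A : Set} (P : A → Set) b {x y} → (b ≡ true → P x) → (b ≡ false → P y) →
          P (if b then x else y)
if-elim P true  p q = p refl
if-elim P false p q = q refl

module Rules (ℛ : Reals) (inp : ℕ → ℕ) where
  open Reals ℛ using (Carrier)
  open Language ℛ
  open Semantics inp

  run-var : ∀ c {s} x → T (keepsVar x c) → var (run c s) x ≡ var s x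
  run-var skip            x p = refl
  run-var (y ≔ e)         x p rewrite T-not p = refl
  run-var (a ⟨ e ⟩≔ f)    x p = refl
  run-var (input y e)     x p rewrite T-not p = refl
  run-var (copyℝ e f)     x p = refl
  run-var (c ⨾ d)         x p = trans (run-var d x (proj₂ (∧-T p))) (run-var c x (proj₁ (∧-T p)))
  run-var (ifz e c d) {s} x p = ifZero-elim (λ s′ → var s′ x ≡ var s x) (eval e s)
    (λ _ → run-var c x (proj₁ (∧-T p))) (λ _ → run-var d x (proj₂ (∧-T p)))
  run-var (wheneqℝ e f c) {s} x p = if-elim (λ s′ → var s′ x ≡ var s x) (sameℝ _ _)
    (λ _ → run-var c x p) (λ _ → refl)
  run-var (for y e c) {s} x p = loop-rule (λ _ s′ → var s′ x ≡ var s x) (eval e s) refl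
    (λ {k} {s′} _ eq → trans (run-var c x (proj₂ (∧-T p))) (trans (other s′ (proj₁ (∧-T p))) eq))
    where
    other : ∀ s′ {k} → T (not (x ≡ᵇ y)) → var (assign y k 6 s′) x ≡ var s′ x
    other s′ p rewrite T-not p = refl

  run-arr : ∀ c {s} a → T (keepsArr a c) → arr (run c s) a ≡ arr s a
  run-arr skip            a p = refl
  run-arr (y ≔ e)         a p = refl
  run-arr (b ⟨ e ⟩≔ f)    a p rewrite T-not p = refl
  run-arr (input y e)     a p = refl
  run-arr (copyℝ e f)     a p = refl
  run-arr (c ⨾ d)         a p = trans (run-arr d a (proj₂ (∧-T p))) (run-arr c a (proj₁ (∧-T p)))
  run-arr (ifz e c d) {s} a p = ifZero-elim (λ s′ → arr s′ a ≡ arr s a) (eval e s)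
    (λ _ → run-arr c a (proj₁ (∧-T p))) (λ _ → run-arr d a (proj₂ (∧-T p)))
  run-arr (wheneqℝ e f c) {s} a p = if-elim (λ s′ → arr s′ a ≡ arr s a) (sameℝ _ _)
    (λ _ → run-arr c a p) (λ _ → refl)
  run-arr (for y e c) {s} a p = loop-rule (λ _ s′ → arr s′ a ≡ arr s a) (eval e s) refl
    (λ _ eq → trans (run-arr c a p) eq)

  run-real : ∀ c {s} → T (keepsReal c) → real (run c s) ≡ real s
  run-real skip            p = refl
  run-real (y ≔ e)         p = refl
  run-real (b ⟨ e ⟩≔ f)    p = refl
  run-real (input y e)     p = refl
  run-real (c ⨾ d)         p = trans (run-real d (proj₂ (∧-T p))) (run-real c (proj₁ (∧-T p)))
  run-real (ifz e c d) {s} p = ifZero-elim (λ s′ → real s′ ≡ real s) (eval e s)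
    (λ _ → run-real c (proj₁ (∧-T p))) (λ _ → run-real d (proj₂ (∧-T p)))
  run-real (wheneqℝ e f c) {s} p = if-elim (λ s′ → real s′ ≡ real s) (sameℝ _ _)
    (λ _ → run-real c p) (λ _ → refl)
  run-real (for y e c) {s} p = loop-rule (λ _ s′ → real s′ ≡ real s) (eval e s) refl
    (λ _ eq → trans (run-real c p) eq)

  record Agree (c : Cmd) (s s′ : Store) : Set where
    field
      onVar  : ∀ x {p : T (keepsVar x c)} → var s′ x ≡ var s x
      onArr  : ∀ a {p : T (keepsArr a c)} → arr s′ a ≡ arr s a
      onReal : {p : T (keepsReal c)} → real s′ ≡ real s

  open Agree public

  agree : ∀ c s → Agree c s (run c s)
  agree c s = record
    { onVar  = λ x {p} → run-var c x p
    ; onArr  = λ a {p} → run-arr c a p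
    ; onReal = λ {p} → run-real c p }

  -- Each step is handed the frame facts between the initial and the current store, so that an
  -- invariant has to mention only what the loop changes.
  for-induction : ∀ x e c {s n} (I : ℕ → Store → Set) → eval e s ≡ n → I 0 (wait (costE e + 2) s) →
    (∀ {k s′} → k < n → Agree (for x e c) s s′ → I k s′ → I (suc k) (run c (assign x k 6 s′))) →
    I n (run (for x e c) s)
  for-induction x e c {s} {n} I refl base step = proj₁ (loop-rule
    (λ k s′ → I k s′ × Agree (for x e c) s s′) n
    (base , record { onVar = λ _ → refl ; onArr = λ _ → refl ; onReal = refl })
    (λ {k} {s′} k<n (i , ag) → step k<n ag i , record
      { onVar  = λ y {p} → trans (run-var c y (proj₂ (∧-T p)))
          (trans (other s′ y (proj₁ (∧-T p))) (onVar ag y {p}))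
      ; onArr  = λ a {p} → trans (run-arr c a p) (onArr ag a {p})
      ; onReal = λ {p} → trans (run-real c p) (onReal ag {p}) }))
    where
    other : ∀ s′ {k} y → T (not (y ≡ᵇ x)) → var (assign x k 6 s′) y ≡ var s′ y
    other s′ y p rewrite T-not p = refl

  run-size : ∀ c {s y} → T (static c) → T (y <ᵇ 4) → var (run c s) y ≡ var s y
  run-size skip            p q = refl
  run-size (x ≔ e) {s}     p q = update-≢ (var s) (small≢large {_} {x} q p)
  run-size (a ⟨ e ⟩≔ f)    p q = refl
  run-size (input x e) {s} p q = update-≢ (var s) (small≢large {_} {x} q p)
  run-size (copyℝ e f)     p q = refl
  run-size (c ⨾ d)         p q = trans (run-size d (proj₂ (∧-T p)) q) (run-size c (proj₁ (∧-T p)) q)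
  run-size (ifz e c d) {s} {y} p q = ifZero-elim (λ s′ → var s′ y ≡ var s y) (eval e s)
    (λ _ → run-size c (proj₁ (∧-T p)) q) (λ _ → run-size d (proj₂ (∧-T p)) q)
  run-size (wheneqℝ e f c) {s} {y} p q = if-elim (λ s′ → var s′ y ≡ var s y) (sameℝ _ _)
    (λ _ → run-size c p q) (λ _ → refl)
  run-size (for x (‵ z) c) {s} {y} p q = loop-rule (λ _ s′ → var s′ y ≡ var s y) (var s z) refl
    (λ {k} {s′} _ eq → trans (run-size c (proj₂ (∧-T {z <ᵇ 4} (proj₂ (∧-T {3 <ᵇ x} p)))) q) (trans
      (update-≢ (var s′) {y} {x} (small≢large {y} {x} q (proj₁ (∧-T {3 <ᵇ x} p)))) eq))

  module _ (N : ℕ) (1≤N : 1 ≤ N) where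

    private instance
      N≢0 : NonZero N
      N≢0 = >-nonZero 1≤N

    weaken : ∀ {m n} w {d e} → m ≤ w * N ^ d → d ≤ e → n + m ≤ (n + w) * N ^ e
    weaken {m} {n} w {d} {e} m≤ d≤e = begin
      n + m                     ≤⟨ ℕ.+-mono-≤ (ℕ.m≤m*n n (N ^ e) {{ℕ.m^n≢0 N e}}) m≤ ⟩
      n * N ^ e + w * N ^ d     ≤⟨ ℕ.+-monoʳ-≤ (n * N ^ e) (ℕ.*-monoʳ-≤ w (ℕ.^-monoʳ-≤ N d≤e)) ⟩
      n * N ^ e + w * N ^ e     ≡⟨ ℕ.*-distribʳ-+ (N ^ e) n w ⟨
      (n + w) * N ^ e           ∎
      where open ℕ.≤-Reasoning

    -- The size variables are constant during a `static` command, so each level of nesting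
    -- multiplies the time by at most `N`. The search falls outside this rule, its innermost loop
    -- being bounded by a degree.
    time-bound : ∀ c {s} → T (static c) → (∀ {y} → T (y <ᵇ 4) → var s y ≤ N) →
                 time (run c s) ≤ time s + weightC c * N ^ depth c

    plain : ∀ {t} k → t + k ≤ t + k * N ^ 0
    plain {t} k = ℕ.≤-reflexive (cong (t +_) (sym (ℕ.*-identityʳ k)))

    time-bound skip {s} p b = ℕ.m≤m+n _ _
    time-bound (x ≔ e) p b = plain (weightC (x ≔ e))
    time-bound (a ⟨ e ⟩≔ f) p b = plain (weightC (a ⟨ e ⟩≔ f))
    time-bound (input x e) p b = plain (weightC (input x e))
    time-bound (copyℝ e f) p b = plain (weightC (copyℝ e f))
    time-bound (c ⨾ d) {s} p b = begin
      time (run d (run c s))                                            ≤⟨ time-bound d (proj₂ (∧-T p)) (λ q → subst (_≤ N) (sym (run-size c (proj₁ (∧-T p)) q)) (b q)) ⟩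
      time (run c s) + weightC d * N ^ depth d                          ≤⟨ ℕ.+-monoˡ-≤ _ (time-bound c (proj₁ (∧-T p)) b) ⟩
      time s + weightC c * N ^ depth c + weightC d * N ^ depth d        ≡⟨ ℕ.+-assoc (time s) _ _ ⟩
      time s + (weightC c * N ^ depth c + weightC d * N ^ depth d)      ≤⟨ ℕ.+-monoʳ-≤ (time s) (both (weightC c) (weightC d) (depth c) (depth d)) ⟩
      time s + (weightC c + weightC d) * N ^ (depth c ⊔ depth d)        ∎
      where
      open ℕ.≤-Reasoning
      both : ∀ v w d e → v * N ^ d + w * N ^ e ≤ (v + w) * N ^ (d ⊔ e)
      both v w d e = ℕ.≤-trans
        (ℕ.+-mono-≤ (ℕ.*-monoʳ-≤ v (ℕ.^-monoʳ-≤ N (ℕ.m≤m⊔n d e))) (ℕ.*-monoʳ-≤ w (ℕ.^-monoʳ-≤ N (ℕ.m≤n⊔m d e))))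
        (ℕ.≤-reflexive (sym (ℕ.*-distribʳ-+ (N ^ (d ⊔ e)) v w)))
    time-bound (ifz e c d) {s} p b = ifZero-elim (λ s′ → time s′ ≤ time s + weightC (ifz e c d) * N ^ depth (ifz e c d)) (eval e s)
      (λ _ → extend (time-bound c (proj₁ (∧-T p)) b) (ℕ.m≤m+n (weightC c) (weightC d)) (ℕ.m≤m⊔n (depth c) (depth d)))
      (λ _ → extend (time-bound d (proj₂ (∧-T p)) b) (ℕ.m≤n+m (weightC d) (weightC c)) (ℕ.m≤n⊔m (depth c) (depth d)))
      where
      extend : ∀ {t k w v d e} → t ≤ time s + k + w * N ^ d → w ≤ v → d ≤ e → t ≤ time s + (k + v) * N ^ e
      extend {k = k} {w} {v} {d} t≤ w≤v d≤e = ℕ.≤-trans t≤ (ℕ.≤-trans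
        (ℕ.≤-reflexive (ℕ.+-assoc (time s) k _))
        (ℕ.+-monoʳ-≤ (time s) (weaken v (ℕ.*-monoˡ-≤ (N ^ d) w≤v) d≤e)))
    time-bound (wheneqℝ e f c) {s} p b = if-elim (λ s′ → time s′ ≤ time s + weightC (wheneqℝ e f c) * N ^ depth c) (sameℝ _ _)
      (λ _ → ℕ.≤-trans (time-bound c p b) (ℕ.≤-trans (ℕ.≤-reflexive (ℕ.+-assoc (time s) _ _))
        (ℕ.+-monoʳ-≤ (time s) (weaken (weightC c) {depth c} {depth c} ℕ.≤-refl ℕ.≤-refl))))
      (λ _ → ℕ.+-monoʳ-≤ (time s) (ℕ.≤-trans (ℕ.≤-reflexive (sym (ℕ.+-identityʳ _)))
        (weaken {0} (weightC c) {depth c} z≤n ℕ.≤-refl)))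
    time-bound (for x (‵ y) c) {s} p b = begin
      time (run (for x (‵ y) c) s)           ≤⟨ proj₁ (loop-rule I (var s y) base (λ {k} {s′} _ → step k s′)) ⟩
      time s + 4 + var s y * (6 + W)         ≤⟨ ℕ.+-monoʳ-≤ (time s + 4) (ℕ.*-monoˡ-≤ (6 + W) (b y<4)) ⟩
      time s + 4 + N * (6 + W)               ≤⟨ ℕ.+-monoʳ-≤ (time s + 4) (ℕ.*-monoʳ-≤ N (weaken (weightC c) {depth c} {depth c} ℕ.≤-refl ℕ.≤-refl)) ⟩
      time s + 4 + N * ((6 + weightC c) * N ^ depth c)   ≡⟨ trans (ℕ.+-assoc (time s) 4 _) (cong (λ m → time s + (4 + m)) (swap N (6 + weightC c) (N ^ depth c))) ⟩
      time s + (4 + (6 + weightC c) * (N * N ^ depth c)) ≤⟨ ℕ.+-monoʳ-≤ (time s) (weaken {n = 4} (6 + weightC c) {suc (depth c)} ℕ.≤-refl ℕ.≤-refl) ⟩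
      time s + (4 + (6 + weightC c)) * (N * N ^ depth c) ∎
      where
      open ℕ.≤-Reasoning
      W = weightC c * N ^ depth c
      p₁ = ∧-T {3 <ᵇ x} p
      y<4 = proj₁ (∧-T {y <ᵇ 4} (proj₂ p₁))
      static-c = proj₂ (∧-T {y <ᵇ 4} (proj₂ p₁))
      swap : ∀ a b c → a * (b * c) ≡ b * (a * c)
      swap = solve-∀
      I : ℕ → Store → Set
      I k s′ = time s′ ≤ time s + 4 + k * (6 + W) × (∀ {z} → T (z <ᵇ 4) → var s′ z ≤ N)
      base : I 0 (wait 4 s)
      base = ℕ.≤-reflexive (sym (ℕ.+-identityʳ _)) , b
      step : ∀ k s′ → I k s′ → I (suc k) (run c (assign x k 6 s′))
      step k s′ (t≤ , b′) = (begin
          time (run c (assign x k 6 s′))            ≤⟨ time-bound c static-c small ⟩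
          time s′ + 6 + W                           ≡⟨ ℕ.+-assoc (time s′) 6 W ⟩
          time s′ + (6 + W)                         ≤⟨ ℕ.+-monoˡ-≤ (6 + W) t≤ ⟩
          time s + 4 + k * (6 + W) + (6 + W)        ≡⟨ shift (time s + 4) (k * (6 + W)) (6 + W) ⟩
          time s + 4 + (6 + W + k * (6 + W))        ∎) ,
        λ q → subst (_≤ N) (sym (run-size c static-c q)) (small q)
        where
        shift : ∀ a b c → a + b + c ≡ a + (c + b)
        shift = solve-∀
        small : ∀ {z} → T (z <ᵇ 4) → var (assign x k 6 s′) z ≤ N
        small {z} q = subst (_≤ N) (sym (update-≢ (var s′) {z} {x}
          (small≢large {z} {x} q (proj₁ p₁)))) (b′ q)

-- Tables of arcs

module Names where
  V E M N I J K X Y ACC TAIL U NEXT OUTPOS REALPOS CNT : ℕ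
  V = 0
  E = 1
  M = 2
  N = 3
  I = 4
  J = 5
  K = 6
  X = 7
  Y = 8
  ACC = 9
  TAIL = 10
  U = 11
  NEXT = 12
  OUTPOS = 13
  REALPOS = 14
  CNT = 15

  TL HD EID DEG ROW NBR ADJ DIST QUEUE COL GOOD FLAG MX MN IDX OUT : ℕ
  TL = 0
  HD = 1
  EID = 2
  DEG = 3
  ROW = 4
  NBR = 5
  ADJ = 6
  DIST = 7
  QUEUE = 8
  COL = 9
  GOOD = 10
  FLAG = 11
  MX = 12
  MN = 13
  IDX = 14
  OUT = 15

module ArcTables where
  open Names

  readSizes : Cmd
  readSizes = input V (lit 0) ⨾ input E (lit 1) ⨾ M ≔ ‵ E ⊕ ‵ E ⨾ N ≔ ‵ V ⊕ ‵ M

  readArc : Cmd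
  readArc =
    input X (lit 2 ⊕ ‵ I ⊕ ‵ I) ⨾ input Y (lit 3 ⊕ ‵ I ⊕ ‵ I) ⨾
    TL ⟨ ‵ I ⟩≔ ‵ X ⨾ HD ⟨ ‵ I ⟩≔ ‵ Y ⨾ EID ⟨ ‵ I ⟩≔ ‵ I ⨾
    TL ⟨ ‵ E ⊕ ‵ I ⟩≔ ‵ Y ⨾ HD ⟨ ‵ E ⊕ ‵ I ⟩≔ ‵ X ⨾ EID ⟨ ‵ E ⊕ ‵ I ⟩≔ ‵ I

  readArcs : Cmd
  readArcs = for I (‵ E) readArc

  -- The multiples of `N` are accumulated by additions, since natural numbers cannot be multiplied
  -- in one operation.
  makeRow : Cmd
  makeRow = ROW ⟨ ‵ I ⟩≔ ‵ ACC ⨾ ACC ≔ ‵ ACC ⊕ ‵ N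

  makeRows : Cmd
  makeRows = for I (‵ V) makeRow

  -- `ADJ` stores the number of an arc plus one, so that 0 means non-adjacency. Each arc starts out
  -- with its own number as colour.
  recordArc : Cmd
  recordArc =
    X ≔ TL ⟨ ‵ I ⟩ ⨾
    ADJ ⟨ ROW ⟨ ‵ X ⟩ ⊕ HD ⟨ ‵ I ⟩ ⟩≔ ‵ I ⊕ lit 1 ⨾
    NBR ⟨ ROW ⟨ ‵ X ⟩ ⊕ DEG ⟨ ‵ X ⟩ ⟩≔ HD ⟨ ‵ I ⟩ ⨾
    DEG ⟨ ‵ X ⟩≔ DEG ⟨ ‵ X ⟩ ⊕ lit 1 ⨾
    COL ⟨ ‵ I ⟩≔ ‵ I

  recordArcs : Cmd
  recordArcs = for I (‵ M) recordArc

<suc : ∀ {i k} → i < suc k → i < k ⊎ i ≡ k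
<suc = ℕ.m<1+n⇒m<n∨m≡n

∑ : ℕ → (ℕ → ℕ) → ℕ
∑ zero    f = 0
∑ (suc n) f = f n + ∑ n f

∑-cong : ∀ n {f g} → (∀ {i} → i < n → f i ≡ g i) → ∑ n f ≡ ∑ n g
∑-cong zero    eq = refl
∑-cong (suc n) eq = cong₂ _+_ (eq ℕ.≤-refl) (∑-cong n (λ i<n → eq (ℕ.m≤n⇒m≤1+n i<n)))

∑-zero : ∀ n {f} → (∀ i → f i ≡ 0) → ∑ n f ≡ 0
∑-zero zero    eq = refl
∑-zero (suc n) eq = cong₂ _+_ (eq n) (∑-zero n eq)

∑-update : ∀ {n} f {u x} → u < n → ∑ n (f [ u ≔ x ]) + f u ≡ x + ∑ n f
∑-update {suc n} f {u} {x} u<n with <suc u<n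
... | inj₂ refl = begin
  (f [ u ≔ x ]) u + ∑ u (f [ u ≔ x ]) + f u ≡⟨ cong₂ (λ a b → a + b + f u) (update-≡ f u) (∑-cong u (λ i<u → update-≢ f (ℕ.<⇒≢ i<u))) ⟩
  x + ∑ u f + f u                           ≡⟨ shift x (∑ u f) (f u) ⟩
  x + (f u + ∑ u f)                         ∎
  where
  open ≡-Reasoning
  shift : ∀ a b c → a + b + c ≡ a + (c + b)
  shift = solve-∀
... | inj₁ u<n′ = begin
  (f [ u ≔ x ]) n + ∑ n (f [ u ≔ x ]) + f u   ≡⟨ cong (λ a → a + ∑ n (f [ u ≔ x ]) + f u) (update-≢ f (ℕ.<⇒≢ u<n′ ∘ sym)) ⟩
  f n + ∑ n (f [ u ≔ x ]) + f u               ≡⟨ ℕ.+-assoc (f n) _ _ ⟩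
  f n + (∑ n (f [ u ≔ x ]) + f u)             ≡⟨ cong (f n +_) (∑-update f u<n′) ⟩
  f n + (x + ∑ n f)                           ≡⟨ shift (f n) x (∑ n f) ⟩
  x + (f n + ∑ n f)                           ∎
  where
  open ≡-Reasoning
  shift : ∀ a b c → a + (b + c) ≡ b + (a + c)
  shift = solve-∀

-- Used to bound the degrees of the vertices expanded in one search by the sum of all degrees.
-- Clearing `f` at `q n` does not affect the other summands, by injectivity, and lowers the total by
-- exactly `f (q n)`.
∑-injective : ∀ {V} n {q f} → (∀ {j} → j < n → q j < V) →
  (∀ {i j} → i < n → j < n → q i ≡ q j → i ≡ j) → ∑ n (f ∘ q) ≤ ∑ V f
∑-injective zero bound inj = z≤n
∑-injective {V} (suc n) {q} {f} bound inj = begin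
  f (q n) + ∑ n (f ∘ q)                   ≡⟨ cong (f (q n) +_) (∑-cong n (λ i<n → update-≢ f (λ eq → ℕ.<⇒≢ i<n (inj (ℕ.m≤n⇒m≤1+n i<n) ℕ.≤-refl eq)))) ⟨
  f (q n) + ∑ n ((f [ q n ≔ 0 ]) ∘ q)       ≤⟨ ℕ.+-monoʳ-≤ (f (q n)) (∑-injective n (bound ∘ ℕ.m≤n⇒m≤1+n) (λ i< j< → inj (ℕ.m≤n⇒m≤1+n i<) (ℕ.m≤n⇒m≤1+n j<))) ⟩
  f (q n) + ∑ V (f [ q n ≔ 0 ])           ≡⟨ ℕ.+-comm (f (q n)) _ ⟩
  ∑ V (f [ q n ≔ 0 ]) + f (q n)           ≡⟨ ∑-update f (bound ℕ.≤-refl) ⟩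
  ∑ V f                                   ∎
  where open ℕ.≤-Reasoning

-- Uniqueness of division with remainder by `N`.
cell-injective : ∀ {N} u v {i j} → i < N → j < N → u * N + i ≡ v * N + j → u ≡ v × i ≡ j
cell-injective zero    zero    _   _   eq = refl , eq
cell-injective {N} zero (suc v) i<N _  eq =
  contradiction (ℕ.≤-trans (ℕ.m≤m+n N (v * N)) (ℕ.≤-trans (ℕ.m≤m+n _ _) (ℕ.≤-reflexive (sym eq)))) (ℕ.<⇒≱ i<N)
cell-injective {N} (suc u) zero _ j<N  eq =
  contradiction (ℕ.≤-trans (ℕ.m≤m+n N (u * N)) (ℕ.≤-trans (ℕ.m≤m+n _ _) (ℕ.≤-reflexive eq))) (ℕ.<⇒≱ j<N)
cell-injective {N} (suc u) (suc v) {i} {j} i<N j<N eq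
  with cell-injective u v i<N j<N (ℕ.+-cancelˡ-≡ N _ _ (trans (sym (ℕ.+-assoc N (u * N) i)) (trans eq (ℕ.+-assoc N (v * N) j))))
... | refl , i≡j = refl , i≡j

module Tables (V E : ℕ) (t h : ℕ → ℕ) where
  M N : ℕ
  M = E + E
  N = V + M

  V≤N : V ≤ N
  V≤N = ℕ.m≤m+n V M

  M≤N : M ≤ N
  M≤N = ℕ.m≤n+m M V

  infix 9 _◇_
  -- Rows of length `N = V + M` serve two purposes: matrices indexed by vertices, of which there are
  -- `V`, and lists of neighbours, of which no vertex has more than `M`.
  _◇_ : ℕ → ℕ → ℕ
  u ◇ i = u * N + i

  record Recorded (k : ℕ) (adj nbr deg col : ℕ → ℕ) : Set where
    field
      adj-sound    : ∀ {u v a} → v < V → adj (u ◇ v) ≡ suc a → a < k × t a ≡ u × h a ≡ v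
      -- Some arc with the same ends is recorded, not necessarily `a`: a later arc with these ends
      -- would overwrite the entry.
      adj-complete : ∀ {a} → a < k → ∃ λ b → adj (t a ◇ h a) ≡ suc b
      nbr-sound    : ∀ {u j} → j < deg u → ∃ λ a → a < k × t a ≡ u × nbr (u ◇ j) ≡ h a
      nbr-complete : ∀ {a} → a < k → ∃ λ j → j < deg (t a) × nbr (t a ◇ j) ≡ h a
      deg-bound    : ∀ u → deg u ≤ k
      deg-sum      : ∑ V deg ≡ k
      col-id       : ∀ {a} → a < k → col a ≡ a

  recorded-zero : ∀ {nbr col} → Recorded 0 (λ _ → 0) nbr (λ _ → 0) col
  recorded-zero = record
    { adj-sound = λ _ () ; adj-complete = λ () ; nbr-sound = λ () ; nbr-complete = λ ()
    ; deg-bound = λ _ → z≤n ; deg-sum = ∑-zero V (λ _ → refl) ; col-id = λ () }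

  recorded-suc : ∀ {k adj nbr deg col} → k < M → t k < V → h k < V → Recorded k adj nbr deg col →
    Recorded (suc k) (adj [ t k ◇ h k ≔ k + 1 ]) (nbr [ t k ◇ deg (t k) ≔ h k ])
             (deg [ t k ≔ deg (t k) + 1 ]) (col [ k ≔ k ])
  recorded-suc {k} {adj} {nbr} {deg} {col} k<M tk<V hk<V R = record
    { adj-sound = adj-sound′
    ; adj-complete = adj-complete′
    ; nbr-sound = nbr-sound′
    ; nbr-complete = nbr-complete′
    ; deg-bound = deg-bound′
    ; deg-sum = ℕ.+-cancelʳ-≡ (deg (t k)) _ _ (trans (∑-update deg tk<V)
        (trans (cong (deg (t k) + 1 +_) deg-sum) (shift (deg (t k)) k)))
    ; col-id = col-id′ }
    where
    open Recorded R
    shift : ∀ d k → d + 1 + k ≡ suc k + d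
    shift = solve-∀

    adj-sound′ : ∀ {u v a} → v < V → (adj [ t k ◇ h k ≔ k + 1 ]) (u ◇ v) ≡ suc a →
                 a < suc k × t a ≡ u × h a ≡ v
    adj-sound′ {u} {v} {a} v<V eq with u ◇ v ℕ.≟ t k ◇ h k
    ... | yes same with cell-injective u (t k) (ℕ.<-≤-trans v<V V≤N) (ℕ.<-≤-trans hk<V V≤N) same
    ...   | refl , refl with trans (ℕ.+-comm 1 k) (trans (sym (update-≡ adj _)) eq)
    ...     | refl = ℕ.≤-refl , refl , refl
    adj-sound′ {u} {v} {a} v<V eq | no other
      with adj-sound v<V (trans (sym (update-≢ adj other)) eq)
    ... | a<k , p = ℕ.m≤n⇒m≤1+n a<k , p

    adj-complete′ : ∀ {a} → a < suc k → ∃ λ b → (adj [ t k ◇ h k ≔ k + 1 ]) (t a ◇ h a) ≡ suc b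
    adj-complete′ {a} a<1+k with t a ◇ h a ℕ.≟ t k ◇ h k
    ... | yes same = k , trans (cong (adj [ t k ◇ h k ≔ k + 1 ]) same)
                           (trans (update-≡ adj _) (ℕ.+-comm k 1))
    ... | no other with <suc a<1+k
    ...   | inj₂ refl = contradiction refl other
    ...   | inj₁ a<k with adj-complete a<k
    ...     | b , eq = b , trans (update-≢ adj other) eq

    deg<N : ∀ {u j} → j ≤ deg u → j < N
    deg<N {u} j≤ = ℕ.≤-<-trans j≤ (ℕ.≤-<-trans (deg-bound u) (ℕ.<-≤-trans k<M M≤N))

    deg-bound′ : ∀ u → (deg [ t k ≔ deg (t k) + 1 ]) u ≤ suc k
    deg-bound′ u with u ℕ.≟ t k
    ... | yes refl = subst (_≤ suc k) (sym (trans (update-≡ deg (t k)) (ℕ.+-comm _ 1))) (s≤s (deg-bound u))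
    ... | no u≢    = subst (_≤ suc k) (sym (update-≢ deg u≢)) (ℕ.m≤n⇒m≤1+n (deg-bound u))

    nbr-old : ∀ {u j} → j < deg u → (nbr [ t k ◇ deg (t k) ≔ h k ]) (u ◇ j) ≡ nbr (u ◇ j)
    nbr-old {u} {j} j<deg = update-≢ nbr (λ eq →
      case cell-injective u (t k) (deg<N {u} (ℕ.<⇒≤ j<deg)) (deg<N {t k} ℕ.≤-refl) eq of
      λ { (refl , refl) → ℕ.<-irrefl refl j<deg })

    nbr-sound′ : ∀ {u j} → j < (deg [ t k ≔ deg (t k) + 1 ]) u →
      ∃ λ a → a < suc k × t a ≡ u × (nbr [ t k ◇ deg (t k) ≔ h k ]) (u ◇ j) ≡ h a
    nbr-sound′ {u} {j} j<deg = go (u ℕ.≟ t k)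
      where
      old : j < deg u → ∃ λ a → a < suc k × t a ≡ u × (nbr [ t k ◇ deg (t k) ≔ h k ]) (u ◇ j) ≡ h a
      old j< with nbr-sound {u} j<
      ... | a , a<k , eq , eq′ = a , ℕ.m≤n⇒m≤1+n a<k , eq , trans (nbr-old {u} j<) eq′
      go : Dec (u ≡ t k) → _
      go (no u≢)    = old (subst (j <_) (update-≢ deg u≢) j<deg)
      go (yes refl) with <suc (subst (j <_) (trans (update-≡ deg (t k)) (ℕ.+-comm _ 1)) j<deg)
      ... | inj₁ j<   = old j<
      ... | inj₂ refl = k , ℕ.≤-refl , refl , update-≡ nbr _

    deg-grows : ∀ u → deg u ≤ (deg [ t k ≔ deg (t k) + 1 ]) u
    deg-grows u with u ℕ.≟ t k
    ... | yes refl = subst (deg u ≤_) (sym (update-≡ deg u)) (ℕ.m≤m+n _ 1)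
    ... | no u≢    = ℕ.≤-reflexive (sym (update-≢ deg u≢))

    nbr-complete′ : ∀ {a} → a < suc k → ∃ λ j → j < (deg [ t k ≔ deg (t k) + 1 ]) (t a) ×
      (nbr [ t k ◇ deg (t k) ≔ h k ]) (t a ◇ j) ≡ h a
    nbr-complete′ {a} a<1+k with <suc a<1+k
    ... | inj₂ refl = deg (t k) , subst (deg (t k) <_) (sym (trans (update-≡ deg (t k)) (ℕ.+-comm _ 1))) ℕ.≤-refl ,
                      update-≡ nbr _
    ... | inj₁ a<k with nbr-complete a<k
    ...   | j , j< , eq = j , ℕ.<-≤-trans j< (deg-grows (t a)) , trans (nbr-old {t a} j<) eq

    col-id′ : ∀ {a} → a < suc k → (col [ k ≔ k ]) a ≡ a
    col-id′ {a} a<1+k with <suc a<1+k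
    ... | inj₂ refl = update-≡ col k
    ... | inj₁ a<k  = trans (update-≢ col (ℕ.<⇒≢ a<k)) (col-id a<k)

-- The bound `k < E` keeps the halves of an array apart: writing arc `k` does not disturb the
-- reversed arcs, which begin at `E`.
mirror : ∀ {E k} {p q f : ℕ → ℕ} → k < E →
  (∀ {i} → i < k → f i ≡ p i × f (E + i) ≡ q i) →
  ∀ {i} → i < suc k → (f [ k ≔ p k ] [ E + k ≔ q k ]) i ≡ p i × (f [ k ≔ p k ] [ E + k ≔ q k ]) (E + i) ≡ q i
mirror {E} {k} {p} {q} {f} k<E eq {i} i<1+k = lower , upper (<suc i<1+k)
  where
  low : ∀ {j} → j < suc k → j ≢ E + k
  low j<1+k refl = ℕ.<⇒≱ (ℕ.<-≤-trans j<1+k k<E) (ℕ.m≤m+n E k)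
  lower : (f [ k ≔ p k ] [ E + k ≔ q k ]) i ≡ p i
  lower with <suc i<1+k
  ... | inj₂ refl = trans (update-≢ (f [ k ≔ p k ]) (low i<1+k)) (update-≡ f k)
  ... | inj₁ i<k  = trans (update-≢ (f [ k ≔ p k ]) (low i<1+k)) (trans (update-≢ f (ℕ.<⇒≢ i<k)) (proj₁ (eq i<k)))
  upper : i < k ⊎ i ≡ k → (f [ k ≔ p k ] [ E + k ≔ q k ]) (E + i) ≡ q i
  upper (inj₂ refl) = update-≡ (f [ k ≔ p k ]) (E + k)
  upper (inj₁ i<k)  = trans (update-≢ (f [ k ≔ p k ]) (λ e → ℕ.<⇒≢ i<k (ℕ.+-cancelˡ-≡ E _ _ e)))
    (trans (update-≢ f (λ e → ℕ.<⇒≢ (ℕ.<-≤-trans k<E (ℕ.m≤m+n E i)) (sym e))) (proj₂ (eq i<k)))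

module ArcTablesCorrect (ℛ : Reals) (inp : ℕ → ℕ) where
  open Language ℛ
  open Semantics inp
  open Rules ℛ inp
  open Names
  open ArcTables

  readArcs-correct : ∀ s {e} → var s E ≡ e → let s′ = run readArcs s in ∀ {i} → i < e →
    (arr s′ TL i ≡ inp (2 + i + i) × arr s′ TL (e + i) ≡ inp (3 + i + i)) ×
    (arr s′ HD i ≡ inp (3 + i + i) × arr s′ HD (e + i) ≡ inp (2 + i + i)) ×
    (arr s′ EID i ≡ i × arr s′ EID (e + i) ≡ i)
  readArcs-correct s {e} refl = for-induction I (‵ E) readArc Inv refl (λ ()) step
    where
    Inv : ℕ → Store → Set
    Inv k s′ = ∀ {i} → i < k →
      (arr s′ TL i ≡ inp (2 + i + i) × arr s′ TL (e + i) ≡ inp (3 + i + i)) ×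
      (arr s′ HD i ≡ inp (3 + i + i) × arr s′ HD (e + i) ≡ inp (2 + i + i)) ×
      (arr s′ EID i ≡ i × arr s′ EID (e + i) ≡ i)
    step : ∀ {k s′} → k < e → Agree readArcs s s′ → Inv k s′ → Inv (suc k) (run readArc (assign I k 6 s′))
    step {k} {s′} k<e ag ih {i} i< rewrite onVar ag E {_} =
      mirror {p = λ i → inp (2 + i + i)} {λ i → inp (3 + i + i)} k<e (λ j<k → proj₁ (ih j<k)) i< ,
      mirror {p = λ i → inp (3 + i + i)} {λ i → inp (2 + i + i)} k<e (λ j<k → proj₁ (proj₂ (ih j<k))) i< ,
      mirror {p = λ i → i} {λ i → i} k<e (λ j<k → proj₂ (proj₂ (ih j<k))) i<

  makeRows-correct : ∀ s {v n} → var s V ≡ v → var s N ≡ n → var s ACC ≡ 0 →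
    ∀ {u} → u < v → arr (run makeRows s) ROW u ≡ u * n
  makeRows-correct s {v} {n} refl eqN eqACC = proj₂ (for-induction I (‵ V) makeRow Inv refl (eqACC , λ ()) step)
    where
    Inv : ℕ → Store → Set
    Inv k s′ = var s′ ACC ≡ k * n × (∀ {u} → u < k → arr s′ ROW u ≡ u * n)
    step : ∀ {k s′} → k < v → Agree makeRows s s′ → Inv k s′ → Inv (suc k) (run makeRow (assign I k 6 s′))
    step {k} {s′} _ ag (eq , rows) =
      trans (cong₂ _+_ eq (trans (onVar ag N) eqN)) (ℕ.+-comm (k * n) n) ,
      λ u<1+k → row (<suc u<1+k)
      where
      row : ∀ {u} → u < k ⊎ u ≡ k → (arr s′ ROW [ k ≔ var s′ ACC ]) u ≡ u * n
      row (inj₁ u<k)  = trans (update-≢ (arr s′ ROW) (ℕ.<⇒≢ u<k)) (rows u<k)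
      row (inj₂ refl) = trans (update-≡ (arr s′ ROW) k) eq

  module _ {v e : ℕ} (t h : ℕ → ℕ) (t< : ∀ {a} → a < e + e → t a < v) (h< : ∀ {a} → a < e + e → h a < v) where
    open Tables v e t h using (_◇_; Recorded; recorded-zero; recorded-suc)

    recordArcs-correct : ∀ s → var s M ≡ e + e → arr s TL ≡ t → arr s HD ≡ h →
      (∀ {u} → u < v → arr s ROW u ≡ u * (v + (e + e))) →
      arr s ADJ ≡ (λ _ → 0) → arr s DEG ≡ (λ _ → 0) → let s′ = run recordArcs s in
      Recorded (e + e) (arr s′ ADJ) (arr s′ NBR) (arr s′ DEG) (arr s′ COL)
    recordArcs-correct s eqM eqTL eqHD eqROW eqADJ eqDEG = for-induction I (‵ M) recordArc
      Inv eqM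
      (subst₂ (λ a d → Recorded 0 a (arr s NBR) d (arr s COL)) (sym eqADJ) (sym eqDEG) recorded-zero)
      step
      where
      Inv : ℕ → Store → Set
      Inv k s′ = Recorded k (arr s′ ADJ) (arr s′ NBR) (arr s′ DEG) (arr s′ COL)
      step : ∀ {k s′} → k < e + e → Agree recordArcs s s′ → Inv k s′ → Inv (suc k) (run recordArc (assign I k 6 s′))
      step {k} {s′} k<M ag ih rewrite trans (onArr ag TL {_}) eqTL | trans (onArr ag HD {_}) eqHD
        | onArr ag ROW {_} | eqROW (t< k<M) = recorded-suc k<M (t< k<M) (h< k<M) ih

-- Breadth-first search

module SearchCode where
  open Names

  -- DIST holds one more than the number of edges, and 0 before the visit.
  visit expand search : Cmd
  visit =
    Y ≔ NBR ⟨ ROW ⟨ ‵ U ⟩ ⊕ ‵ K ⟩ ⨾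
    ifz (DIST ⟨ ROW ⟨ ‵ I ⟩ ⊕ ‵ Y ⟩)
        (DIST ⟨ ROW ⟨ ‵ I ⟩ ⊕ ‵ Y ⟩≔ ‵ NEXT ⨾ QUEUE ⟨ ‵ TAIL ⟩≔ ‵ Y ⨾ TAIL ≔ ‵ TAIL ⊕ lit 1)
        skip
  expand =
    ifz (‵ J ⊕ lit 1 ⊖ ‵ TAIL)
        (U ≔ QUEUE ⟨ ‵ J ⟩ ⨾ NEXT ≔ DIST ⟨ ROW ⟨ ‵ I ⟩ ⊕ ‵ U ⟩ ⊕ lit 1 ⨾ for K (DEG ⟨ ‵ U ⟩) visit)
        skip
  search =
    DIST ⟨ ROW ⟨ ‵ I ⟩ ⊕ ‵ I ⟩≔ lit 1 ⨾ QUEUE ⟨ lit 0 ⟩≔ ‵ I ⨾ TAIL ≔ lit 1 ⨾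
    for J (‵ V) expand

  searches : Cmd
  searches = for I (‵ V) search

module Hops (V E : ℕ) (t h : ℕ → ℕ) (t< : ∀ {a} → a < E + E → t a < V) (h< : ∀ {a} → a < E + E → h a < V) where
  open Tables V E t h

  data Walk (s : ℕ) : ℕ → ℕ → Set where
    here  : Walk s 0 s
    _▹_   : ∀ {n a} → Walk s n (t a) → a < M → Walk s (suc n) (h a)

  -- The usual invariant of the queue: labels do not decrease along it (`sorted`) and exceed that of
  -- the head by at most one (`near`). Labels are attained by walks (`walk`), and no arc out of an
  -- expanded vertex raises the label by more than one (`closed`), which together give shortest
  -- distances.
  record Search (s head tail : ℕ) (δ q : ℕ → ℕ) : Set where
    field
      q-bound   : ∀ {j} → j < tail → q j < V
      q-visited : ∀ {j} → j < tail → 0 < δ (q j)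
      q-inj     : ∀ {i j} → i < tail → j < tail → q i ≡ q j → i ≡ j
      visited-q : ∀ {x} → x < V → 0 < δ x → ∃ λ j → j < tail × q j ≡ x
      sorted    : ∀ {i j} → i ≤ j → j < tail → δ (q i) ≤ δ (q j)
      near      : ∀ {j} → head < tail → j < tail → δ (q j) ≤ suc (δ (q head))
      walk      : ∀ {x n} → x < V → δ x ≡ suc n → Walk s n x
      source    : δ s ≡ 1
      closed    : ∀ {j a} → j < head → j < tail → a < M → t a ≡ q j →
                  0 < δ (h a) × δ (h a) ≤ suc (δ (t a))

  search-start : ∀ {s q} → s < V → Search s 0 1 ((λ _ → 0) [ s ≔ 1 ]) (q [ 0 ≔ s ])
  search-start {s} {q} s<V = record
    { q-bound = λ { (s≤s z≤n) → s<V }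
    ; q-visited = λ { (s≤s z≤n) → subst (0 <_) (sym at-s) z<s }
    ; q-inj = λ { (s≤s z≤n) (s≤s z≤n) _ → refl }
    ; visited-q = λ {x} _ 0<δ → 0 , z<s , found x 0<δ
    ; sorted = λ { z≤n (s≤s z≤n) → ℕ.≤-refl }
    ; near = λ { _ (s≤s z≤n) → ℕ.n≤1+n _ }
    ; walk = λ {x} _ eq → walk′ x eq
    ; source = at-s
    ; closed = λ () }
    where
    at-s : ((λ _ → 0) [ s ≔ 1 ]) s ≡ 1
    at-s = update-≡ (λ _ → 0) s
    found : ∀ x → 0 < ((λ _ → 0) [ s ≔ 1 ]) x → s ≡ x
    found x 0<δ with x ℕ.≟ s
    ... | yes eq = sym eq
    ... | no x≢s = case subst (0 <_) (update-≢ (λ _ → 0) x≢s) 0<δ of λ ()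
    walk′ : ∀ x {n} → ((λ _ → 0) [ s ≔ 1 ]) x ≡ suc n → Walk s n x
    walk′ x eq with found x (subst (0 <_) (sym eq) z<s)
    ... | refl with trans (sym at-s) eq
    ...   | refl = here

  module _ {s hd tl δ q} (S : Search s hd tl δ q) (hd<tl : hd < tl) where
    open Search S

    module _ {a} (a<M : a < M) (ta : t a ≡ q hd) (new : δ (h a) ≡ 0) where

      private
        y : ℕ
        y = h a
        d : ℕ
        d = suc (δ (q hd))
        δ′ q′ : ℕ → ℕ
        δ′ = δ [ y ≔ d ]
        q′ = q [ tl ≔ y ]

        old : ∀ {x} → 0 < δ x → δ′ x ≡ δ x
        old {x} 0<δ = update-≢ δ (λ { refl → ℕ.<⇒≢ 0<δ (sym new) })
        q-old : ∀ {j} → j < tl → q′ j ≡ q j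
        q-old j<tl = update-≢ q (ℕ.<⇒≢ j<tl)
        q-new : q′ tl ≡ y
        q-new = update-≡ q tl
        δ-new : δ′ y ≡ d
        δ-new = update-≡ δ y
        δq-old : ∀ {j} → j < tl → δ′ (q′ j) ≡ δ (q j)
        δq-old j<tl = trans (cong δ′ (q-old j<tl)) (old (q-visited j<tl))
        δq-new : δ′ (q′ tl) ≡ d
        δq-new = trans (cong δ′ q-new) δ-new
        visited : ∀ {x} → 0 < δ x → 0 < δ′ x
        visited 0<δ = subst (0 <_) (sym (old 0<δ)) 0<δ

        q-inj′ : ∀ {i j} → i < suc tl → j < suc tl → q′ i ≡ q′ j → i ≡ j
        q-inj′ i< j< eq with <suc i< | <suc j<
        ... | inj₁ i<tl | inj₁ j<tl = q-inj i<tl j<tl (trans (sym (q-old i<tl)) (trans eq (q-old j<tl)))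
        ... | inj₂ refl | inj₂ refl = refl
        ... | inj₁ i<tl | inj₂ refl = contradiction
          (trans (cong δ (trans (sym (q-old i<tl)) (trans eq q-new))) new) (ℕ.<⇒≢ (q-visited i<tl) ∘ sym)
        ... | inj₂ refl | inj₁ j<tl = contradiction
          (trans (cong δ (trans (sym (q-old j<tl)) (trans (sym eq) q-new))) new) (ℕ.<⇒≢ (q-visited j<tl) ∘ sym)

        visited-q′ : ∀ {x} → x < V → 0 < δ′ x → ∃ λ j → j < suc tl × q′ j ≡ x
        visited-q′ {x} x<V 0<δ′ with x ℕ.≟ y
        ... | yes refl = tl , ℕ.≤-refl , q-new
        ... | no x≢y with visited-q x<V (subst (0 <_) (update-≢ δ x≢y) 0<δ′)
        ...   | j , j<tl , eq = j , ℕ.m≤n⇒m≤1+n j<tl , trans (q-old j<tl) eq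

        sorted′ : ∀ {i j} → i ≤ j → j < suc tl → δ′ (q′ i) ≤ δ′ (q′ j)
        sorted′ {i} {j} i≤j j< with <suc j<
        ... | inj₁ j<tl = subst₂ _≤_ (sym (δq-old (ℕ.≤-<-trans i≤j j<tl))) (sym (δq-old j<tl)) (sorted i≤j j<tl)
        ... | inj₂ refl with ℕ.m≤n⇒m<n∨m≡n i≤j
        ...   | inj₁ i<tl = subst₂ _≤_ (sym (δq-old i<tl)) (sym δq-new) (near hd<tl i<tl)
        ...   | inj₂ refl = ℕ.≤-refl

        near′ : ∀ {j} → hd < suc tl → j < suc tl → δ′ (q′ j) ≤ suc (δ′ (q′ hd))
        near′ {j} _ j< with <suc j<
        ... | inj₁ j<tl = subst₂ (λ a b → a ≤ suc b) (sym (δq-old j<tl)) (sym (δq-old hd<tl)) (near hd<tl j<tl)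
        ... | inj₂ refl = ℕ.≤-reflexive (trans δq-new (cong suc (sym (δq-old hd<tl))))

        walk′ : ∀ {x n} → x < V → δ′ x ≡ suc n → Walk s n x
        walk′ {x} {n} x<V eq with x ℕ.≟ y
        ... | no x≢y = walk x<V (trans (sym (update-≢ δ x≢y)) eq)
        ... | yes refl = subst (λ n → Walk s n y) (ℕ.suc-injective (trans (sym δ-new) eq))
          (extend (δ (q hd)) (q-visited hd<tl) refl)
          where
          extend : ∀ m → 0 < m → δ (q hd) ≡ m → Walk s m y
          extend (suc m) _ eq = subst (Walk s m) (sym ta) (walk (q-bound hd<tl) eq) ▹ a<M

      discover : Search s hd (suc tl) (δ [ h a ≔ suc (δ (q hd)) ]) (q [ tl ≔ h a ])
      discover = record
        { q-bound = λ j< → q-bound′ (<suc j<)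
        ; q-visited = λ j< → q-visited′ (<suc j<)
        ; q-inj = q-inj′
        ; visited-q = visited-q′
        ; sorted = sorted′
        ; near = near′
        ; walk = walk′
        ; source = trans (old (subst (0 <_) (sym source) z<s)) source
        ; closed = closed′ }
        where
        q-bound′ : ∀ {j} → j < tl ⊎ j ≡ tl → q′ j < V
        q-bound′ (inj₁ j<tl) = subst (_< V) (sym (q-old j<tl)) (q-bound j<tl)
        q-bound′ (inj₂ refl) = subst (_< V) (sym q-new) (h< a<M)
        q-visited′ : ∀ {j} → j < tl ⊎ j ≡ tl → 0 < δ′ (q′ j)
        q-visited′ (inj₁ j<tl) = subst (0 <_) (sym (δq-old j<tl)) (q-visited j<tl)
        q-visited′ (inj₂ refl) = subst (0 <_) (sym δq-new) z<s
        closed′ : ∀ {j b} → j < hd → j < suc tl → b < M → t b ≡ q′ j →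
                  0 < δ′ (h b) × δ′ (h b) ≤ suc (δ′ (t b))
        closed′ {j} {b} j<hd _ b<M eq with ℕ.<-trans j<hd hd<tl
        ... | j<tl with closed j<hd j<tl b<M (trans eq (q-old j<tl))
        ...   | 0<δ , le = visited 0<δ , subst₂ (λ a b → a ≤ suc b) (sym (old 0<δ))
          (sym (old (subst (λ v → 0 < δ v) (sym (trans eq (q-old j<tl))) (q-visited j<tl)))) le

    search-suc : (∀ {a} → a < M → t a ≡ q hd → 0 < δ (h a) × δ (h a) ≤ suc (δ (q hd))) →
                 Search s (suc hd) tl δ q
    search-suc done = record
      { q-bound = q-bound ; q-visited = q-visited ; q-inj = q-inj ; visited-q = visited-q
      ; sorted = sorted ; walk = walk ; source = source
      ; near = λ hd′<tl j<tl → ℕ.≤-trans (near hd<tl j<tl) (s≤s (sorted (ℕ.n≤1+n hd) hd′<tl))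
      ; closed = λ j< → closed′ (<suc j<) }
      where
      closed′ : ∀ {j a} → j < hd ⊎ j ≡ hd → j < tl → a < M → t a ≡ q j →
                0 < δ (h a) × δ (h a) ≤ suc (δ (t a))
      closed′ (inj₁ j<hd) j<tl a<M eq = closed j<hd j<tl a<M eq
      closed′ {a = a} (inj₂ refl) _ a<M eq with done a<M eq
      ... | 0<δ , le = 0<δ , subst (λ v → δ (h a) ≤ suc (δ v)) (sym eq) le

  search-idle : ∀ {s hd tl δ q} → Search s hd tl δ q → tl ≤ hd → Search s (suc hd) tl δ q
  search-idle S tl≤hd = record
    { q-bound = q-bound ; q-visited = q-visited ; q-inj = q-inj ; visited-q = visited-q
    ; sorted = sorted ; walk = walk ; source = source
    ; near = λ lt → contradiction (ℕ.<-≤-trans (ℕ.<-trans ℕ.≤-refl lt) tl≤hd) (ℕ.<-irrefl refl)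
    ; closed = λ j< j<tl → closed (ℕ.<-≤-trans j<tl tl≤hd) j<tl }
    where open Search S

  module _ {s tl δ q} (S : Search s V tl δ q) where
    open Search S

    -- The queue lists distinct vertices. Hence `V` rounds expand all of it, and `closed` applies to
    -- every visited vertex.
    tail≤V : tl ≤ V
    tail≤V = injective⇒≤ {f = λ j → fromℕ< (q-bound (toℕ<n j))} (λ {i} {j} eq →
      toℕ-injective (q-inj (toℕ<n i) (toℕ<n j)
        (trans (sym (toℕ-fromℕ< (q-bound (toℕ<n i)))) (trans (cong toℕ eq) (toℕ-fromℕ< (q-bound (toℕ<n j)))))))

    edge-step : ∀ {a} → a < M → 0 < δ (t a) → 0 < δ (h a) × δ (h a) ≤ suc (δ (t a))
    edge-step a<M 0<δ with visited-q (t< a<M) 0<δ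
    ... | j , j<tl , eq = closed (ℕ.<-≤-trans j<tl tail≤V) j<tl a<M (sym eq)

    reached : ∀ {n x} → Walk s n x → 0 < δ x × δ x ≤ suc n
    reached here = subst (0 <_) (sym source) z<s , ℕ.≤-reflexive source
    reached (w ▹ a<M) with reached w
    ... | 0<δ , le with edge-step a<M 0<δ
    ...   | 0<δ′ , le′ = 0<δ′ , ℕ.≤-trans le′ (s≤s le)

  IsHops : ℕ → ℕ → ℕ → Set
  IsHops s x d = ∃ λ n → d ≡ suc n × Walk s n x × (∀ {m} → Walk s m x → n ≤ m)

  -- The walk in the invariant attains the label, and `reached` shows that no walk is shorter.
  search-end : ∀ {s tl δ q x n} → Search s V tl δ q → x < V → Walk s n x → IsHops s x (δ x)
  search-end {δ = δ} {x = x} S x<V w = go (δ x) refl (proj₁ (reached S w))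
    where
    go : ∀ d → δ x ≡ d → 0 < d → IsHops _ x d
    go (suc n) eq _ = n , refl , Search.walk S x<V eq ,
      λ w′ → ℕ.≤-pred (subst (_≤ _) eq (proj₂ (reached S w′)))

module Costs where
  open SearchCode

  -- Abstract, so that arithmetic with these constants does not compute.
  abstract
    visitCost : ℕ
    visitCost = 6 + weightC visit

    visitCost≡ : 6 + weightC visit ≡ visitCost
    visitCost≡ = refl

  -- The instructions of one round that are not in the loop over neighbours.
  expandCost : ℕ
  expandCost = 76

module SearchCorrect (ℛ : Reals) (inp : ℕ → ℕ) where
  open Language ℛ
  open Semantics inp
  open Rules ℛ inp
  open Names
  open SearchCode
  open Costs

  -- Without loops the exponent in `time-bound` is 0, so any bound on the sizes will do; one plus
  -- their sum is always available.
  time-flat : ∀ c {s} → T (static c) → depth c ≡ 0 → time (run c s) ≤ time s + weightC c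
  time-flat c {s} p eq = subst (λ w → time (run c s) ≤ time s + w)
    (trans (cong (λ d → weightC c * (suc (∑ 4 (var s)) ^ d)) eq) (ℕ.*-identityʳ _))
    (time-bound (suc (∑ 4 (var s))) (s≤s z≤n) c p (λ {y} → bound y))
    where
    v = var s
    bound : ∀ y → T (y <ᵇ 4) → v y ≤ suc (∑ 4 v)
    bound 0 _ = ℕ.≤-trans (ℕ.≤-trans (ℕ.m≤m+n (v 0) 0) (ℕ.m≤n+m _ (v 3 + (v 2 + v 1)))) (ℕ.≤-trans (ℕ.≤-reflexive (shift (v 0) (v 1) (v 2) (v 3))) (ℕ.n≤1+n _))
      where
      shift : ∀ a b c d → d + (c + b) + (a + 0) ≡ d + (c + (b + (a + 0)))
      shift = solve-∀
    bound 1 _ = ℕ.≤-trans (ℕ.m≤n+m (v 1) (v 3 + v 2 + v 0)) (ℕ.≤-trans (ℕ.≤-reflexive (shift (v 0) (v 1) (v 2) (v 3))) (ℕ.n≤1+n _))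
      where
      shift : ∀ a b c d → d + c + a + b ≡ d + (c + (b + (a + 0)))
      shift = solve-∀
    bound 2 _ = ℕ.≤-trans (ℕ.m≤m+n (v 2) _) (ℕ.≤-trans (ℕ.m≤n+m _ (v 3)) (ℕ.n≤1+n _))
    bound 3 _ = ℕ.≤-trans (ℕ.m≤m+n (v 3) _) (ℕ.n≤1+n _)

  module _ {v e : ℕ} (t h : ℕ → ℕ) (t< : ∀ {a} → a < e + e → t a < v) (h< : ∀ {a} → a < e + e → h a < v) where
    open Tables v e t h hiding (M; N)
    open Tables v e t h using () renaming (M to m; N to n)
    open Hops v e t h t< h<

    record Prepared (s : Store) : Set where
      field
        {adj} : ℕ → ℕ
        sizeV : var s V ≡ v
        rows  : ∀ {u} → u < v → arr s ROW u ≡ u * n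
        recorded : Recorded m adj (arr s NBR) (arr s DEG) (arr s COL)

    record Progress (src : ℕ) (dist₀ : ℕ → ℕ) (hd : ℕ) (s : Store) : Set where
      field
        {δ}    : ℕ → ℕ
        row    : ∀ {x} → x < v → arr s DIST (src ◇ x) ≡ δ x
        others : ∀ {r x} → r ≢ src → x < v → arr s DIST (r ◇ x) ≡ dist₀ (r ◇ x)
        state  : Search src hd (var s TAIL) δ (arr s QUEUE)

    update-row : ∀ {f δ : ℕ → ℕ} r x {y d} → x < v → y < v → f (r ◇ x) ≡ δ x →
                 (f [ r ◇ y ≔ d ]) (r ◇ x) ≡ (δ [ y ≔ d ]) x
    update-row {f} {δ} r x {y} x<v y<v eq with x ℕ.≟ y
    ... | yes refl = trans (update-≡ f (r ◇ x)) (sym (update-≡ δ x))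
    ... | no x≢y   = trans (update-≢ f (x≢y ∘ proj₂ ∘ cell-injective r r (ℕ.<-≤-trans x<v V≤N) (ℕ.<-≤-trans y<v V≤N)))
                       (trans eq (sym (update-≢ δ x≢y)))

    update-other-row : ∀ {f : ℕ → ℕ} {r r′ x y d} → r′ ≢ r → x < v → y < v →
                       (f [ r ◇ y ≔ d ]) (r′ ◇ x) ≡ f (r′ ◇ x)
    update-other-row {f} {r} {r′} r′≢r x<v y<v = update-≢ f
      (r′≢r ∘ proj₁ ∘ cell-injective r′ r (ℕ.<-≤-trans x<v V≤N) (ℕ.<-≤-trans y<v V≤N))

    module Expansion (src hd : ℕ) (src<v : src < v) (dist₀ : ℕ → ℕ) (s : Store) (prep : Prepared s)
      (eqI : var s I ≡ src) (prog : Progress src dist₀ hd s)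
      (hd<tail : hd < var s TAIL) (eqU : var s U ≡ arr s QUEUE hd)
      (eqNEXT : var s NEXT ≡ suc (arr s DIST (src ◇ arr s QUEUE hd))) where

      open Prepared prep
      open Recorded recorded
      u = arr s QUEUE hd

      u<v : u < v
      u<v = Search.q-bound (Progress.state prog) hd<tail

      Done : ℕ → (ℕ → ℕ) → Set
      Done k δ = ∀ {j} → j < k → 0 < δ (arr s NBR (u ◇ j)) × δ (arr s NBR (u ◇ j)) ≤ suc (δ u)

      record Inv (k : ℕ) (s′ : Store) : Set where
        field
          progress : Progress src dist₀ hd s′
          tail≤    : var s TAIL ≤ var s′ TAIL
          queue    : ∀ {j} → j < var s TAIL → arr s′ QUEUE j ≡ arr s QUEUE j
          next     : var s NEXT ≡ suc (Progress.δ progress u)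
          done     : Done k (Progress.δ progress)

      inv-start : ∀ k → Inv 0 (wait k s)
      inv-start k = record
        { progress = record { row = row ; others = others ; state = state }
        ; tail≤ = ℕ.≤-refl ; queue = λ _ → refl
        ; next = trans eqNEXT (cong suc (row u<v)) ; done = λ () }
        where open Progress prog

      step : ∀ {k s′} → k < arr s DEG u → Agree (for K (DEG ⟨ ‵ U ⟩) visit) s s′ → Inv k s′ →
             Inv (suc k) (run visit (assign K k 6 s′))
      step {k} {s′} k<deg ag inv with nbr-sound k<deg
      ... | a , a<m , ta , eq = ifZero-elim (Inv (suc k)) (arr s′ DIST (arr s′ ROW (var s′ I) + arr s′ NBR (arr s′ ROW (var s′ U) + k)))
          (λ z → fresh (trans (cong (arr s′ DIST) (sym at-i)) z)
            (cong (λ i → arr s′ DIST [ i ≔ var s′ NEXT ]) at-i)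
            (cong (λ y → arr s′ QUEUE [ var s′ TAIL ≔ y ]) at-y) refl)
          (λ z → seen (trans (cong (arr s′ DIST) (sym at-i)) z) refl refl refl)
        where
        open Inv inv
        open Progress progress
        y<v = h< a<m

        row-of : ∀ x {r} → var s x ≡ r → r < v → {_ : T (keepsVar x (for K (DEG ⟨ ‵ U ⟩) visit))} →
                 arr s′ ROW (var s′ x) ≡ r * n
        row-of x eq r<v {p} = trans (cong₂ (λ f i → f i) (onArr ag ROW {_}) (trans (onVar ag x {p}) eq)) (rows r<v)

        at-y : arr s′ NBR (arr s′ ROW (var s′ U) + k) ≡ h a
        at-y = trans (cong₂ (λ f i → f (i + k)) (onArr ag NBR {_}) (row-of U eqU u<v)) eq

        at-i : arr s′ ROW (var s′ I) + arr s′ NBR (arr s′ ROW (var s′ U) + k) ≡ src ◇ h a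
        at-i = cong₂ _+_ (row-of I eqI src<v) at-y

        extended : ∀ {δ′ : ℕ → ℕ} → (∀ {x} → 0 < δ x → 0 < δ′ x × δ′ x ≡ δ x) → 0 < δ′ (h a) → δ′ (h a) ≤ suc (δ′ u) →
                   0 < δ u → Done (suc k) δ′
        extended {δ′} old 0<δ le 0<u j< with <suc j<
        ... | inj₁ j<k with done j<k
        ...   | 0<δ₁ , le₁ = proj₁ (old 0<δ₁) , subst₂ (λ a b → a ≤ suc b) (sym (proj₂ (old 0<δ₁))) (sym (proj₂ (old 0<u))) le₁
        extended {δ′} old 0<δ le 0<u j< | inj₂ refl =
          subst (λ x → 0 < δ′ x × δ′ x ≤ suc (δ′ u)) (sym eq) (0<δ , le)

        qhd : arr s′ QUEUE hd ≡ u
        qhd = queue hd<tail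
        hd<tail′ = ℕ.<-≤-trans hd<tail tail≤
        0<δu : 0 < δ u
        0<δu = subst (λ x → 0 < δ x) qhd (Search.q-visited state hd<tail′)

        fresh : ∀ {S} → arr s′ DIST (src ◇ h a) ≡ 0 →
          arr S DIST ≡ arr s′ DIST [ src ◇ h a ≔ var s′ NEXT ] →
          arr S QUEUE ≡ arr s′ QUEUE [ var s′ TAIL ≔ h a ] → var S TAIL ≡ var s′ TAIL + 1 →
          Inv (suc k) S
        fresh {S} eq₀ eqD eqQ eqT = record
          { progress = record
            { δ = δ [ h a ≔ var s′ NEXT ]
            ; row = λ {x} x<v → trans (cong (λ f → f (src ◇ x)) eqD) (update-row {arr s′ DIST} {δ} src x x<v y<v (row x<v))
            ; others = λ {r} {x} r≢ x<v → trans (cong (λ f → f (r ◇ x)) eqD) (trans (update-other-row {arr s′ DIST} r≢ x<v y<v) (others r≢ x<v))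
            ; state = subst₂ (λ t q → Search src hd t (δ [ h a ≔ var s′ NEXT ]) q) (sym eqT) (sym eqQ)
                (subst₂ (λ d t → Search src hd t (δ [ h a ≔ d ]) (arr s′ QUEUE [ var s′ TAIL ≔ h a ]))
                (sym (trans next′ (cong (suc ∘ δ) (sym qhd)))) (ℕ.+-comm 1 _)
                (discover state hd<tail′ a<m (trans ta (sym qhd)) new)) }
          ; tail≤ = ℕ.≤-trans tail≤ (ℕ.≤-trans (ℕ.m≤m+n _ 1) (ℕ.≤-reflexive (sym eqT)))
          ; queue = λ {j} j< → trans (cong (λ f → f j) eqQ)
              (trans (update-≢ (arr s′ QUEUE) (ℕ.<⇒≢ (ℕ.<-≤-trans j< tail≤))) (queue j<))
          ; next = trans next (cong suc (sym (old 0<δu)))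
          ; done = extended (λ 0<δ → subst (0 <_) (sym (old 0<δ)) 0<δ , old 0<δ)
              (subst (0 <_) (sym now) (subst (0 <_) (sym next′) z<s))
              (ℕ.≤-reflexive (trans now (trans next′ (cong suc (sym (old 0<δu)))))) 0<δu }
          where
          next′ : var s′ NEXT ≡ suc (δ u)
          next′ = trans (onVar ag NEXT {_}) next
          new : δ (h a) ≡ 0
          new = trans (sym (row y<v)) eq₀
          old : ∀ {x} → 0 < δ x → (δ [ h a ≔ var s′ NEXT ]) x ≡ δ x
          old 0<δ = update-≢ δ (λ { refl → ℕ.<⇒≢ 0<δ (sym new) })
          now : (δ [ h a ≔ var s′ NEXT ]) (h a) ≡ var s′ NEXT
          now = update-≡ δ (h a)

        seen : ∀ {S d} → arr s′ DIST (src ◇ h a) ≡ suc d → arr S DIST ≡ arr s′ DIST →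
          arr S QUEUE ≡ arr s′ QUEUE → var S TAIL ≡ var s′ TAIL → Inv (suc k) S
        seen eq₁ eqD eqQ eqT = record
          { progress = record
            { δ = δ
            ; row = λ {x} x<v → trans (cong (λ f → f (src ◇ x)) eqD) (row x<v)
            ; others = λ {r} {x} r≢ x<v → trans (cong (λ f → f (r ◇ x)) eqD) (others r≢ x<v)
            ; state = subst₂ (λ t q → Search src hd t δ q) (sym eqT) (sym eqQ) state }
          ; tail≤ = ℕ.≤-trans tail≤ (ℕ.≤-reflexive (sym eqT))
          ; queue = λ {j} j< → trans (cong (λ f → f j) eqQ) (queue j<) ; next = next
          -- A neighbour that was labelled earlier stands in the queue, where `near` bounds its
          -- label.
          ; done = extended (λ 0<δ → 0<δ , refl) 0<y
              (subst (λ x → δ (h a) ≤ suc (δ x)) qhd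
                (subst (λ y → δ y ≤ suc (δ (arr s′ QUEUE hd))) (proj₂ (proj₂ found))
                  (Search.near state hd<tail′ (proj₁ (proj₂ found))))) 0<δu }
          where
          0<y : 0 < δ (h a)
          0<y = subst (0 <_) (trans (sym eq₁) (row y<v)) z<s
          found = Search.visited-q state y<v 0<y

      result : Inv (arr s DEG u) (run (for K (DEG ⟨ ‵ U ⟩) visit) s)
      result = for-induction K (DEG ⟨ ‵ U ⟩) visit Inv (cong (arr s DEG) eqU)
        (inv-start _) step

      duration : time (run (for K (DEG ⟨ ‵ U ⟩) visit) s) ≤ time s + costE (DEG ⟨ ‵ U ⟩) + 2 + arr s DEG u * visitCost
      duration = for-induction K (DEG ⟨ ‵ U ⟩) visit
        (λ k s′ → time s′ ≤ time s + costE (DEG ⟨ ‵ U ⟩) + 2 + k * visitCost) (cong (arr s DEG) eqU)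
        (ℕ.≤-reflexive (shift (time s) (costE (DEG ⟨ ‵ U ⟩)))) tstep
        where
        shift : ∀ a b → a + (b + 2) ≡ a + b + 2 + 0
        shift = solve-∀
        tstep : ∀ {k s′} → k < arr s DEG u → Agree (for K (DEG ⟨ ‵ U ⟩) visit) s s′ →
          time s′ ≤ time s + costE (DEG ⟨ ‵ U ⟩) + 2 + k * visitCost →
          time (run visit (assign K k 6 s′)) ≤ time s + costE (DEG ⟨ ‵ U ⟩) + 2 + suc k * visitCost
        tstep {k} {s′} _ _ ih = begin
          time (run visit (assign K k 6 s′))            ≤⟨ time-flat visit {assign K k 6 s′} tt refl ⟩
          time s′ + 6 + weightC visit                   ≡⟨ trans (ℕ.+-assoc (time s′) 6 (weightC visit)) (cong (time s′ +_) visitCost≡) ⟩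
          time s′ + visitCost                           ≤⟨ ℕ.+-monoˡ-≤ visitCost ih ⟩
          T₀ + k * visitCost + visitCost                ≡⟨ shift′ T₀ (k * visitCost) visitCost ⟩
          T₀ + (visitCost + k * visitCost)              ∎
          where
          open ℕ.≤-Reasoning
          T₀ = time s + costE (DEG ⟨ ‵ U ⟩) + 2
          shift′ : ∀ a b c → a + b + c ≡ a + (c + b)
          shift′ = solve-∀

      closed-now : ∀ {δ a} → Done (arr s DEG u) δ → a < m → t a ≡ u → 0 < δ (h a) × δ (h a) ≤ suc (δ u)
      closed-now {δ} done a<m ta with nbr-complete a<m
      ... | j , j< , eq rewrite ta = subst (λ x → 0 < δ x × δ x ≤ suc (δ u)) eq (done j<)

    module Source (src : ℕ) (src<v : src < v) (dist₀ : ℕ → ℕ) (s : Store) (prep : Prepared s)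
      (eqI : var s I ≡ src) (start : Progress src dist₀ 0 s) where

      open Prepared prep
      open Recorded recorded

      prepared-later : ∀ {s′} → Agree (for J (‵ V) expand) s s′ → Prepared s′
      prepared-later ag = record
        { sizeV = trans (onVar ag V {_}) sizeV
        ; rows = λ u<v → trans (cong (λ f → f _) (onArr ag ROW {_})) (rows u<v)
        ; recorded = subst₂ (λ a b → Recorded m adj a b _) (sym (onArr ag NBR {_})) (sym (onArr ag DEG {_}))
            (subst (λ c → Recorded m adj (arr s NBR) (arr s DEG) c) (sym (onArr ag COL {_})) recorded) }

      deg : ℕ → ℕ
      deg = arr s DEG

      -- `expanded` counts the rounds that were not idle: it equals `k` as long as the queue lasts
      -- and then stays put. Every round is charged a constant, and an expansion also its degree
      -- times `visitCost`.
      record Inv (k : ℕ) (s′ : Store) : Set where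
        field
          progress  : Progress src dist₀ k s′
          expanded  : ℕ
          expanded≤ : expanded ≤ var s′ TAIL
          expanded≡ : k < var s′ TAIL → expanded ≡ k
          elapsed   : time s′ ≤ time s + 4 + (k * expandCost + ∑ expanded (deg ∘ arr s′ QUEUE) * visitCost)

      step : ∀ {k s′} → k < v → Agree (for J (‵ V) expand) s s′ → Inv k s′ →
             Inv (suc k) (run expand (assign J k 6 s′))
      -- The difference vanishes exactly if the queue has an entry `k`. Once the queue is exhausted,
      -- the remaining rounds do nothing.
      step {k} {s′} k<v ag inv = ifZero-elim (Inv (suc k)) (k + 1 ∸ var s′ TAIL) active idle
        where
        open Inv inv
        s₁ = wait 11 (assign J k 6 s′)
        s₂ = run (U ≔ QUEUE ⟨ ‵ J ⟩ ⨾ NEXT ≔ DIST ⟨ ROW ⟨ ‵ I ⟩ ⊕ ‵ U ⟩ ⊕ lit 1) s₁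
        T₀ = time s + 4

        idle : ∀ {d} → k + 1 ∸ var s′ TAIL ≡ suc d → Inv (suc k) (wait 11 (assign J k 6 s′))
        idle {d} eq = record
          { progress = record { row = row ; others = others ; state = search-idle state tail≤k }
          ; expanded = expanded ; expanded≤ = expanded≤
          ; expanded≡ = λ lt → contradiction (ℕ.<-≤-trans (ℕ.<-trans ℕ.≤-refl lt) tail≤k) (ℕ.<-irrefl refl)
          ; elapsed = begin
              time s′ + 6 + 11                 ≤⟨ ℕ.+-monoˡ-≤ 11 (ℕ.+-monoˡ-≤ 6 elapsed) ⟩
              T₀ + (k * 76 + X₀) + 6 + 11      ≡⟨ shift T₀ (k * 76) X₀ ⟩
              T₀ + (17 + k * 76 + X₀)          ≤⟨ ℕ.+-monoʳ-≤ T₀ (ℕ.+-monoˡ-≤ X₀ (ℕ.+-monoˡ-≤ (k * 76) (ℕ.m≤m+n 17 59))) ⟩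
              T₀ + (76 + k * 76 + X₀)          ∎ }
          where
          open Progress progress
          open ℕ.≤-Reasoning
          X₀ = ∑ expanded (deg ∘ arr s′ QUEUE) * visitCost
          shift : ∀ a b c → a + (b + c) + 6 + 11 ≡ a + (17 + b + c)
          shift = solve-∀
          tail≤k : var s′ TAIL ≤ k
          tail≤k = ℕ.≤-pred (subst (suc (var s′ TAIL) ≤_) (ℕ.+-comm k 1)
            (ℕ.m∸n≢0⇒n<m (λ z → case trans (sym eq) z of λ ())))

        active : k + 1 ∸ var s′ TAIL ≡ 0 → Inv (suc k) (run (for K (DEG ⟨ ‵ U ⟩) visit) s₂)
        active eq = record
          { progress = record
            { row = row ; others = others
            ; state = search-suc state (ℕ.<-≤-trans k<tail tail≤)
                (λ {a} a<m ta → subst (λ u → 0 < δ (h a) × δ (h a) ≤ suc (δ u)) (sym (queue k<tail))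
                  (X.closed-now {δ} done a<m (trans ta (queue k<tail)))) }
          ; expanded = suc k
          ; expanded≤ = ℕ.<-≤-trans k<tail tail≤
          ; expanded≡ = λ _ → refl
          ; elapsed = begin
              time (run (for K (DEG ⟨ ‵ U ⟩) visit) s₂)                   ≤⟨ X.duration ⟩
              -- The round itself takes 6, the test 11, the assignments to `U` and `NEXT` 17 and 30,
              -- the look-up of the degree 10, and entering the loop 2; together this is
              -- `expandCost`.
              time s′ + 6 + 11 + 17 + 30 + 10 + 2 + arr s′ DEG u * visitCost
                ≡⟨ cong₂ (λ f g → time s′ + 6 + 11 + 17 + 30 + 10 + 2 + f g * visitCost) (onArr ag DEG {_}) refl ⟩
              time s′ + 6 + 11 + 17 + 30 + 10 + 2 + deg u * visitCost
                ≤⟨ ℕ.+-monoˡ-≤ (deg u * visitCost) (later 2 (later 10 (later 30 (later 17 (later 11 (later 6 elapsed)))))) ⟩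
              T₀ + (k * 76 + ∑ expanded (deg ∘ arr s′ QUEUE) * visitCost) + 6 + 11 + 17 + 30 + 10 + 2 + deg u * visitCost
                ≡⟨ shift T₀ (k * 76) (∑ expanded (deg ∘ arr s′ QUEUE)) (deg u) visitCost ⟩
              T₀ + (76 + k * 76 + (deg u + ∑ expanded (deg ∘ arr s′ QUEUE)) * visitCost)
                ≡⟨ cong total′ {deg u + ∑ expanded (deg ∘ arr s′ QUEUE)} {∑ (suc k) (deg ∘ arr s₃ QUEUE)} sums ⟩
              T₀ + (suc k * expandCost + ∑ (suc k) (deg ∘ arr s₃ QUEUE) * visitCost) ∎ }
          where
          open ℕ.≤-Reasoning
          later : ∀ c {a b} → a ≤ b → a + c ≤ b + c
          later c = ℕ.+-monoˡ-≤ c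
          total′ : ℕ → ℕ
          total′ w = T₀ + (76 + k * 76 + w * visitCost)
          shift : ∀ a b c d f → a + (b + c * f) + 6 + 11 + 17 + 30 + 10 + 2 + d * f ≡ a + (76 + b + (d + c) * f)
          shift = solve-∀
          s₃ = run (for K (DEG ⟨ ‵ U ⟩) visit) s₂
          u = arr s′ QUEUE k
          k<tail : k < var s′ TAIL
          k<tail = subst (_≤ var s′ TAIL) (ℕ.+-comm k 1) (ℕ.m∸n≡0⇒m≤n eq)
          prep′ = prepared-later ag
          src-row : arr s′ ROW (var s′ I) ≡ src * n
          src-row = trans (cong (arr s′ ROW) (trans (onVar ag I {_}) eqI)) (Prepared.rows prep′ src<v)
          prep₂ : Prepared s₂
          prep₂ = record { sizeV = Prepared.sizeV prep′ ; rows = Prepared.rows prep′ ; recorded = Prepared.recorded prep′ }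
          progress₂ : Progress src dist₀ k s₂
          progress₂ = record { row = Progress.row progress ; others = Progress.others progress ; state = Progress.state progress }
          module X = Expansion src k src<v dist₀ s₂ prep₂ (trans (onVar ag I {_}) eqI) progress₂
            k<tail refl
            (trans (ℕ.+-comm _ 1) (cong (λ i → suc (arr s′ DIST (i + u))) src-row))
          open X.Inv X.result hiding (progress)
          open Progress (X.Inv.progress X.result)
          sums : deg u + ∑ expanded (deg ∘ arr s′ QUEUE) ≡ ∑ (suc k) (deg ∘ arr s₃ QUEUE)
          sums = cong₂ _+_ (cong deg (sym (queue k<tail)))
            (trans (cong (λ k → ∑ k (deg ∘ arr s′ QUEUE)) (expanded≡ k<tail))
              (∑-cong k (λ j<k → cong deg (sym (queue (ℕ.<-trans j<k k<tail))))))

      finish : Inv v (run (for J (‵ V) expand) s)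
      finish = for-induction J (‵ V) expand Inv sizeV
        (record
          { progress = record { row = row ; others = others ; state = state }
          ; expanded = 0 ; expanded≤ = z≤n ; expanded≡ = λ _ → refl
          ; elapsed = ℕ.≤-reflexive (sym (ℕ.+-identityʳ _)) }) step
        where open Progress start

      -- The expanded vertices are distinct entries of the queue, and all degrees together amount to
      -- `m`: one search is linear in `v` and `m`.
      total : ∀ {s′} → Inv v s′ → time s′ ≤ time s + 4 + (v * expandCost + m * visitCost)
      total {s′} inv = ℕ.≤-trans elapsed (ℕ.+-monoʳ-≤ (time s + 4) (ℕ.+-monoʳ-≤ (v * expandCost)
        (ℕ.*-monoˡ-≤ visitCost (ℕ.≤-trans (∑-injective expanded {arr s′ QUEUE} {deg}
          (λ j< → q-bound (ℕ.<-≤-trans j< expanded≤))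
          (λ i< j< → q-inj (ℕ.<-≤-trans i< expanded≤) (ℕ.<-≤-trans j< expanded≤)))
          (ℕ.≤-reflexive deg-sum)))))
        where
        open Inv inv
        open Search (Progress.state progress)

    -- `pending` is kept because a search presupposes that its row of the distance table is still
    -- zero.
    record Found (k : ℕ) (s : Store) : Set where
      field
        hops    : ∀ {r x l} → r < k → r < v → x < v → Walk r l x → IsHops r x (arr s DIST (r ◇ x))
        pending : ∀ {r x} → k ≤ r → r < v → x < v → arr s DIST (r ◇ x) ≡ 0

    -- Setting up a search takes 56 steps, namely 6 for the round, 27, 16 and 3 for the assignments
    -- and 4 for entering the loop; the rest is slack.
    searchCost : ℕ
    searchCost = 100

    module Searches (s : Store) (prep : Prepared s) (eqDIST : arr s DIST ≡ λ _ → 0) where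
      open Prepared prep

      record Inv (k : ℕ) (s′ : Store) : Set where
        field
          found   : Found k s′
          elapsed : time s′ ≤ time s + 4 + k * (searchCost + (v * expandCost + m * visitCost))

      step : ∀ {k s′} → k < v → Agree searches s s′ → Inv k s′ → Inv (suc k) (run search (assign I k 6 s′))
      step {k} {s′} k<v ag inv = record
        { found = record { hops = hops′ ; pending = pending′ }
        ; elapsed = begin
            time s₂                                                  ≤⟨ X.total X.finish ⟩
            time s₁ + 4 + W                                          ≡⟨ shift (time s′) W ⟩
            time s′ + (56 + W)                                       ≤⟨ ℕ.+-mono-≤ elapsed (ℕ.+-monoˡ-≤ W (ℕ.m≤m+n 56 44)) ⟩
            time s + 4 + k * (searchCost + W) + (searchCost + W)     ≡⟨ shift′ (time s + 4) (k * (searchCost + W)) (searchCost + W) ⟩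
            time s + 4 + (searchCost + W + k * (searchCost + W))     ∎ }
        where
        open Inv inv
        open Found found
        open ℕ.≤-Reasoning
        W = v * expandCost + m * visitCost
        shift : ∀ a w → a + 6 + 27 + 16 + 3 + 4 + w ≡ a + (56 + w)
        shift = solve-∀
        shift′ : ∀ a b c → a + b + c ≡ a + (c + b)
        shift′ = solve-∀
        s₁ = run (DIST ⟨ ROW ⟨ ‵ I ⟩ ⊕ ‵ I ⟩≔ lit 1 ⨾ QUEUE ⟨ lit 0 ⟩≔ ‵ I ⨾ TAIL ≔ lit 1) (assign I k 6 s′)
        s₂ = run (for J (‵ V) expand) s₁

        rows′ : ∀ {u} → u < v → arr s₁ ROW u ≡ u * n
        rows′ u<v = trans (cong (λ f → f _) (onArr ag ROW {_})) (rows u<v)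

        cleared : ∀ {r x} → r < v → x < v → arr s₁ DIST (r ◇ x) ≡ (arr s′ DIST [ k ◇ k ≔ 1 ]) (r ◇ x)
        cleared {r} {x} _ _ = cong (λ i → (arr s′ DIST [ i + k ≔ 1 ]) (r ◇ x)) (rows′ k<v)

        prep₁ : Prepared s₁
        prep₁ = record { sizeV = trans (onVar ag V {_}) sizeV ; rows = rows′
          ; recorded = subst₂ (λ a b → Recorded m (Prepared.adj prep) a b _) (sym (onArr ag NBR {_})) (sym (onArr ag DEG {_}))
              (subst (λ c → Recorded m (Prepared.adj prep) (arr s NBR) (arr s DEG) c) (sym (onArr ag COL {_})) recorded) }

        begun : Progress k (arr s′ DIST) 0 s₁
        begun = record
          { δ = (λ _ → 0) [ k ≔ 1 ]
          ; row = λ {x} x<v → trans (cleared k<v x<v)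
              (update-row {arr s′ DIST} {λ _ → 0} k x x<v k<v (pending ℕ.≤-refl k<v x<v))
          ; others = λ {r} {x} r≢k x<v → trans (cong (λ i → (arr s′ DIST [ i + k ≔ 1 ]) (r ◇ x)) (rows′ k<v))
              (update-other-row {arr s′ DIST} r≢k x<v k<v)
          ; state = search-start k<v }

        module X = Source k k<v (arr s′ DIST) s₁ prep₁ refl begun

        open Progress (X.Inv.progress X.finish)

        hops′ : ∀ {r x l} → r < suc k → r < v → x < v → Walk r l x → IsHops r x (arr s₂ DIST (r ◇ x))
        hops′ {r} {x} r<1+k r<v x<v w with <suc r<1+k
        ... | inj₁ r<k  = subst (IsHops r x) (sym (others (ℕ.<⇒≢ r<k) x<v)) (hops r<k r<v x<v w)
        ... | inj₂ refl = subst (IsHops r x) (sym (row x<v)) (search-end state x<v w)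

        pending′ : ∀ {r x} → suc k ≤ r → r < v → x < v → arr s₂ DIST (r ◇ x) ≡ 0
        pending′ k<r r<v x<v = trans (others (ℕ.<⇒≢ k<r ∘ sym) x<v) (pending (ℕ.<⇒≤ k<r) r<v x<v)

      result : Inv v (run searches s)
      result = for-induction I (‵ V) search Inv sizeV
        (record { found = record { hops = λ () ; pending = λ {r} {x} _ _ _ → cong (λ f → f (r ◇ x)) eqDIST }
                ; elapsed = ℕ.≤-reflexive (sym (ℕ.+-identityʳ _)) }) step

-- Edge classes

module ClassesCode where
  open Names

  -- Zero exactly when the two numbers are equal.
  infix 6 _≶_
  _≶_ : Exp → Exp → Exp
  e ≶ f = (e ⊖ f) ⊕ (f ⊖ e)

  dist : Exp → Exp → Exp
  dist e f = DIST ⟨ ROW ⟨ e ⟩ ⊕ f ⟩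

  arcAt : Exp → Exp → Exp
  arcAt e f = ADJ ⟨ ROW ⟨ e ⟩ ⊕ f ⟩

  separation : Exp → Exp → Exp → Exp → Exp
  separation u v x y = (dist u x ⊕ dist v y) ≶ (dist u y ⊕ dist v x)

  -- Every pass is made for an arc I = (u, x).  Stamping with I + 1 makes it
  -- unnecessary to clear GOOD and FLAG between passes.  GOOD marks the
  -- neighbours y of u such that ux and uy lie on a square with equal weights
  -- on opposite sides, and FLAG the colours that have to be merged with that
  -- of I.
  mark flag relabel classify classes : Cmd
  mark =
    ifz ((lit 1 ⊖ (HD ⟨ ‵ J ⟩ ≶ ‵ U)) ⊕ (lit 1 ⊖ arcAt (‵ U) (TL ⟨ ‵ J ⟩)) ⊕ (lit 1 ⊖ arcAt (‵ X) (HD ⟨ ‵ J ⟩)))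
      (wheneqℝ (EID ⟨ ‵ I ⟩) (EID ⟨ ‵ J ⟩)
        (wheneqℝ (EID ⟨ arcAt (‵ U) (TL ⟨ ‵ J ⟩) ⊖ lit 1 ⟩) (EID ⟨ arcAt (‵ X) (HD ⟨ ‵ J ⟩) ⊖ lit 1 ⟩)
          (GOOD ⟨ TL ⟨ ‵ J ⟩ ⟩≔ ‵ I ⊕ lit 1)))
      skip
  flag =
    ifz (separation (‵ U) (‵ X) (TL ⟨ ‵ J ⟩) (HD ⟨ ‵ J ⟩)
         ⊕ ((lit 1 ⊖ (TL ⟨ ‵ J ⟩ ≶ ‵ U)) ⊖ (lit 1 ⊖ (GOOD ⟨ HD ⟨ ‵ J ⟩ ⟩ ≶ ‵ I ⊕ lit 1))))
      skip
      (FLAG ⟨ COL ⟨ ‵ J ⟩ ⟩≔ ‵ I ⊕ lit 1)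
  relabel =
    ifz (FLAG ⟨ COL ⟨ ‵ J ⟩ ⟩ ≶ ‵ I ⊕ lit 1) (COL ⟨ ‵ J ⟩≔ ‵ ACC) skip
  classify =
    U ≔ TL ⟨ ‵ I ⟩ ⨾ X ≔ HD ⟨ ‵ I ⟩ ⨾ ACC ≔ COL ⟨ ‵ I ⟩ ⨾
    for J (‵ M) mark ⨾ for J (‵ M) flag ⨾ for J (‵ M) relabel
  classes = for I (‵ M) classify

gap : ℕ → ℕ → ℕ
gap m n = (m ∸ n) + (n ∸ m)

gap-zero : ∀ {m n} → gap m n ≡ 0 → m ≡ n
gap-zero {m} {n} eq = ℕ.≤-antisym (ℕ.m∸n≡0⇒m≤n (ℕ.m+n≡0⇒m≡0 _ eq)) (ℕ.m∸n≡0⇒m≤n (ℕ.m+n≡0⇒n≡0 (m ∸ n) eq))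

gap-refl : ∀ m → gap m m ≡ 0
gap-refl m = cong₂ _+_ (ℕ.n∸n≡0 m) (ℕ.n∸n≡0 m)

gap-pos : ∀ {m n} → m ≢ n → 1 ∸ gap m n ≡ 0
gap-pos {m} {n} m≢n with gap m n in eq
... | zero  = contradiction (gap-zero eq) m≢n
... | suc k = ℕ.0∸n≡0 k

monus-pos : ∀ {n} → 1 ∸ n ≡ 0 → 0 < n
monus-pos {suc n} _ = z<s

pos-monus : ∀ {n} → 0 < n → 1 ∸ n ≡ 0
pos-monus {suc n} _ = ℕ.0∸n≡0 n

monus-gap : ∀ {m n} → 1 ∸ gap m n ≡ 0 → m ≢ n
monus-gap {m} eq refl = case trans (sym (cong (1 ∸_) (gap-refl m))) eq of λ ()

-- The first two fields identify the cells that carry the stamp `T` of the current pass. The third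
-- one lets the next pass, with a larger stamp, begin without clearing.
record Stamped (T : ℕ) (P : ℕ → Set) (g : ℕ → ℕ) (k : ℕ) (f : ℕ → ℕ) : Set where
  field
    stamped-sound    : ∀ {x} → f x ≡ T → ∃ λ b → b < k × P b × g b ≡ x
    stamped-complete : ∀ {b} → b < k → P b → f (g b) ≡ T
    stamped-bound    : ∀ x → f x ≤ T

module _ {T : ℕ} {P : ℕ → Set} {g : ℕ → ℕ} where
  open Stamped

  stamped-start : ∀ {f} → (∀ x → f x < T) → Stamped T P g 0 f
  stamped-start f< = record
    { stamped-sound    = λ {x} eq → contradiction eq (ℕ.<⇒≢ (f< x))
    ; stamped-complete = λ ()
    ; stamped-bound    = λ x → ℕ.<⇒≤ (f< x) }

  stamp : ∀ {k f} → P k → Stamped T P g k f → Stamped T P g (suc k) (f [ g k ≔ T ])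
  stamp {k} {f} p S = record
    { stamped-sound = sound ; stamped-complete = λ b< → complete (<suc b<) ; stamped-bound = bound }
    where
    sound : ∀ {x} → (f [ g k ≔ T ]) x ≡ T → ∃ λ b → b < suc k × P b × g b ≡ x
    sound {x} eq with x ℕ.≟ g k
    ... | yes refl = k , ℕ.≤-refl , p , refl
    ... | no x≢ with stamped-sound S (trans (sym (update-≢ f x≢)) eq)
    ...   | b , b<k , q = b , ℕ.m≤n⇒m≤1+n b<k , q
    complete : ∀ {b} → b < k ⊎ b ≡ k → P b → (f [ g k ≔ T ]) (g b) ≡ T
    complete (inj₂ refl) _ = update-≡ f (g k)
    complete {b} (inj₁ b<k) q with g b ℕ.≟ g k
    ... | yes eq = trans (cong (f [ g k ≔ T ]) eq) (update-≡ f (g k))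
    ... | no ne  = trans (update-≢ f ne) (stamped-complete S b<k q)
    bound : ∀ x → (f [ g k ≔ T ]) x ≤ T
    bound x with x ℕ.≟ g k
    ... | yes refl = ℕ.≤-reflexive (update-≡ f (g k))
    ... | no x≢    = subst (_≤ T) (sym (update-≢ f x≢)) (stamped-bound S x)

  unstamped : ∀ {k f} → ¬ P k → Stamped T P g k f → Stamped T P g (suc k) f
  unstamped {k} {f} ¬p S = record
    { stamped-sound = λ eq → let b , b<k , q = stamped-sound S eq in b , ℕ.m≤n⇒m≤1+n b<k , q
    ; stamped-complete = λ b< q → complete (<suc b<) q
    ; stamped-bound = stamped-bound S }
    where
    complete : ∀ {b} → b < k ⊎ b ≡ k → P b → f (g b) ≡ T
    complete (inj₁ b<k)  q = stamped-complete S b<k q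
    complete (inj₂ refl) q = contradiction q ¬p

-- Colour classes of arcs and their merging.

module Colouring (ℛ : Reals) (M : ℕ) (t h eid : ℕ → ℕ) (adj dist : ℕ → ℕ → ℕ) (w : ℕ → Reals.Carrier ℛ) where
  open Reals ℛ using (_≈_)

  Separates : ℕ → ℕ → ℕ → Set
  Separates u v b = dist u (t b) + dist v (h b) ≢ dist u (h b) + dist v (t b)

  Opposite : ℕ → ℕ → Set
  Opposite a b = h b ≢ t a × 0 < adj (t a) (t b) × 0 < adj (h a) (h b) × w (eid a) ≈ w (eid b) ×
    w (eid (adj (t a) (t b) ∸ 1)) ≈ w (eid (adj (h a) (h b) ∸ 1))

  Square : ℕ → ℕ → Set
  Square a x = ∃ λ b → b < M × Opposite a b × t b ≡ x

  -- The second alternative is (□). A square is attached to the arc `a` and the other neighbour of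
  -- its tail, so that one sweep can find all squares at `a`.
  Related : ℕ → ℕ → Set
  Related a b = Separates (t a) (h a) b ⊎ (t b ≡ t a × ¬ Square a (h b))

  -- `closed` makes the classes large enough for the first `k` arcs. `forced` makes them no larger
  -- than the generated equivalence, whose classes are detected by Boolean invariants; primality
  -- uses it in this very form. By `col-idem` the name of a class is a member of it.
  record Coloured (k : ℕ) (col : ℕ → ℕ) : Set where
    field
      closed   : ∀ {a b} → a < k → b < M → Related a b → col a ≡ col b
      forced   : ∀ (J : ℕ → Bool) → (∀ {a b} → a < M → b < M → Related a b → J a ≡ J b) →
                 ∀ {a b} → a < M → b < M → col a ≡ col b → J a ≡ J b
      col-idem : ∀ {a} → a < M → col (col a) ≡ col a
      col<     : ∀ {a} → a < M → col a < M

  coloured-start : ∀ {col} → (∀ {a} → a < M → col a ≡ a) → Coloured 0 col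
  coloured-start {col} eq = record
    { closed = λ ()
    ; forced = λ J _ a<M b<M same → cong J (trans (sym (eq a<M)) (trans same (eq b<M)))
    ; col-idem = λ a<M → cong col (eq a<M)
    ; col< = λ a<M → subst (_< M) (sym (eq a<M)) a<M }

  -- How the relabelling pass for arc a acts on the colour c of an arc.
  Relabels : ℕ → (ℕ → ℕ) → ℕ → ℕ → Set
  Relabels a col c c′ = let Flagged = ∃ λ b → b < M × Related a b × col b ≡ c in
    (Flagged × c′ ≡ col a) ⊎ (¬ Flagged × c′ ≡ c)

  -- Whether an arc is recoloured depends on its colour alone, so classes are merged but never
  -- split. The class of `a` has the colour `col a` afterwards, flagged or not.
  coloured-suc : ∀ {a col col′} → a < M → Coloured a col →
    (∀ {b} → b < M → Relabels a col (col b) (col′ b)) → Coloured (suc a) col′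
  coloured-suc {a} {col} {col′} a<M C relabels = record
    { closed = λ x< → closed′ (<suc x<)
    ; forced = forced′
    ; col-idem = idem′
    ; col< = col<′ }
    where
    open Coloured C
    same : ∀ {b c} → b < M → c < M → col b ≡ col c → col′ b ≡ col′ c
    same {b} {c} b<M c<M eq with relabels b<M | relabels c<M
    ... | inj₁ (_ , e) | inj₁ (_ , f) = trans e (sym f)
    ... | inj₂ (_ , e) | inj₂ (_ , f) = trans e (trans eq (sym f))
    ... | inj₁ (F , _) | inj₂ (¬F , _) = contradiction (subst (λ c → ∃ λ b → b < M × Related a b × col b ≡ c) eq F) ¬F
    ... | inj₂ (¬F , _) | inj₁ (F , _) = contradiction (subst (λ c → ∃ λ b → b < M × Related a b × col b ≡ c) (sym eq) F) ¬F
    fixed : ∀ {b} → b < M → col b ≡ col a → col′ b ≡ col a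
    fixed b<M eq with relabels b<M
    ... | inj₁ (_ , e) = e
    ... | inj₂ (_ , e) = trans e eq
    closed′ : ∀ {x b} → x < a ⊎ x ≡ a → b < M → Related x b → col′ x ≡ col′ b
    closed′ (inj₁ x<a)  b<M r = same (ℕ.<-trans x<a a<M) b<M (closed x<a b<M r)
    closed′ {b = b} (inj₂ refl) b<M r with relabels b<M
    ... | inj₁ (_ , e)  = trans (fixed a<M refl) (sym e)
    ... | inj₂ (¬F , _) = contradiction (b , b<M , r , refl) ¬F
    forced′ : ∀ (J : ℕ → Bool) → (∀ {a b} → a < M → b < M → Related a b → J a ≡ J b) →
              ∀ {b c} → b < M → c < M → col′ b ≡ col′ c → J b ≡ J c
    forced′ J respects {b} {c} b<M c<M eq = go (relabels b<M) (relabels c<M)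
      where
      like-a : ∀ {b} → b < M → (∃ λ d → d < M × Related a d × col d ≡ col b) → J b ≡ J a
      like-a b<M (d , d<M , r , e) = trans (forced J respects b<M d<M (sym e)) (sym (respects a<M d<M r))
      go : Relabels a col (col b) (col′ b) → Relabels a col (col c) (col′ c) → J b ≡ J c
      go (inj₁ (F , _)) (inj₁ (G , _)) = trans (like-a b<M F) (sym (like-a c<M G))
      go (inj₁ (F , e)) (inj₂ (_ , f)) = trans (like-a b<M F)
        (forced J respects a<M c<M (trans (sym e) (trans eq f)))
      go (inj₂ (_ , e)) (inj₁ (G , f)) = trans
        (forced J respects b<M a<M (trans (sym e) (trans eq f))) (sym (like-a c<M G))
      go (inj₂ (_ , e)) (inj₂ (_ , f)) = forced J respects b<M c<M (trans (sym e) (trans eq f))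
    idem′ : ∀ {b} → b < M → col′ (col′ b) ≡ col′ b
    idem′ {b} b<M with relabels b<M
    ... | inj₁ (_ , e) = trans (cong col′ e) (trans (fixed (col< a<M) (col-idem a<M)) (sym e))
    ... | inj₂ (_ , e) = trans (cong col′ e) (same (col< b<M) b<M (col-idem b<M))
    col<′ : ∀ {b} → b < M → col′ b < M
    col<′ b<M with relabels b<M
    ... | inj₁ (_ , e) = subst (_< M) (sym e) (col< a<M)
    ... | inj₂ (_ , e) = subst (_< M) (sym e) (col< b<M)

module ClassesCorrect (ℛ : Reals) (inp : ℕ → ℕ) where
  open Reals ℛ using (Carrier)
  open Language ℛ
  open Semantics inp
  open Rules ℛ inp
  open Names
  open ClassesCode

  module _ {v e : ℕ} (t h eid A D : ℕ → ℕ) (w : ℕ → Carrier)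
    (t< : ∀ {a} → a < e + e → t a < v) (h< : ∀ {a} → a < e + e → h a < v) where
    open Tables v e t h using (_◇_) renaming (M to m; N to n)

    record Context (s : Store) : Set where
      field
        sizeM : var s M ≡ m
        tails : arr s TL ≡ t
        heads : arr s HD ≡ h
        eids  : arr s EID ≡ eid
        adjs  : arr s ADJ ≡ A
        dists : arr s DIST ≡ D
        rows  : ∀ {u} → u < v → arr s ROW u ≡ u * n
        reals : real s ≡ w

    keepsContext : Cmd → Bool
    keepsContext c = keepsVar M c ∧ (keepsArr TL c ∧ (keepsArr HD c ∧ (keepsArr EID c ∧
      (keepsArr ADJ c ∧ (keepsArr DIST c ∧ (keepsArr ROW c ∧ keepsReal c))))))

    context-run : ∀ {c s s′} → T (keepsContext c) → Agree c s s′ → Context s → Context s′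
    context-run {c} p ag C with ∧-T {keepsVar M c} p
    ... | p₁ , q with ∧-T {keepsArr TL c} q
    ... | p₂ , q with ∧-T {keepsArr HD c} q
    ... | p₃ , q with ∧-T {keepsArr EID c} q
    ... | p₄ , q with ∧-T {keepsArr ADJ c} q
    ... | p₅ , q with ∧-T {keepsArr DIST c} q
    ... | p₆ , q with ∧-T {keepsArr ROW c} q
    ... | p₇ , p₈ = record
      { sizeM = trans (onVar ag M {p₁}) sizeM
      ; tails = trans (onArr ag TL {p₂}) tails
      ; heads = trans (onArr ag HD {p₃}) heads
      ; eids  = trans (onArr ag EID {p₄}) eids
      ; adjs  = trans (onArr ag ADJ {p₅}) adjs
      ; dists = trans (onArr ag DIST {p₆}) dists
      ; rows  = λ u<v → trans (cong (λ f → f _) (onArr ag ROW {p₇})) (rows u<v)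
      ; reals = trans (onReal ag {p₈}) reals }
      where open Context C

    open Colouring ℛ m t h eid (λ u x → A (u ◇ x)) (λ u x → D (u ◇ x)) w

    record At (a : ℕ) (s : Store) : Set where
      field
        context : Context s
        atI : var s I ≡ a
        atU : var s U ≡ t a
        atX : var s X ≡ h a

    module _ {a : ℕ} (a<m : a < m) where

      eval-dist : ∀ {s} → Context s → ∀ e f {u x} → eval e s ≡ u → eval f s ≡ x → u < v →
                  eval (dist e f) s ≡ D (u ◇ x)
      eval-dist {s} C e f eqe eqf u<v = cong₂ (λ f i → f i) dists
        (cong₂ _+_ (trans (cong (arr s ROW) eqe) (rows u<v)) eqf)
        where open Context C

      eval-arc : ∀ {s} → Context s → ∀ e f {u x} → eval e s ≡ u → eval f s ≡ x → u < v →
                 eval (arcAt e f) s ≡ A (u ◇ x)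
      eval-arc {s} C e f eqe eqf u<v = cong₂ (λ f i → f i) adjs
        (cong₂ _+_ (trans (cong (arr s ROW) eqe) (rows u<v)) eqf)
        where open Context C

      module AtArc {s : Store} (now : At a s) {b : ℕ} (b<m : b < m) where
        open At now
        open Context context

        sⱼ : Store
        sⱼ = assign J b 6 s

        contextⱼ : Context sⱼ
        contextⱼ = record { sizeM = sizeM ; tails = tails ; heads = heads ; eids = eids
                          ; adjs = adjs ; dists = dists ; rows = rows ; reals = reals }

        tl : arr s TL b ≡ t b
        tl = cong (λ f → f b) tails

        hd : arr s HD b ≡ h b
        hd = cong (λ f → f b) heads

        adj₁ : eval (arcAt (‵ U) (TL ⟨ ‵ J ⟩)) sⱼ ≡ A (t a ◇ t b)
        adj₁ = eval-arc contextⱼ (‵ U) (TL ⟨ ‵ J ⟩) atU tl (t< a<m)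

        adj₂ : eval (arcAt (‵ X) (HD ⟨ ‵ J ⟩)) sⱼ ≡ A (h a ◇ h b)
        adj₂ = eval-arc contextⱼ (‵ X) (HD ⟨ ‵ J ⟩) atX hd (h< a<m)

        separation-correct : eval (separation (‵ U) (‵ X) (TL ⟨ ‵ J ⟩) (HD ⟨ ‵ J ⟩)) sⱼ ≡
          gap (D (t a ◇ t b) + D (h a ◇ h b)) (D (t a ◇ h b) + D (h a ◇ t b))
        separation-correct = cong₂ gap
          (cong₂ _+_ (eval-dist contextⱼ (‵ U) (TL ⟨ ‵ J ⟩) atU tl (t< a<m))
                     (eval-dist contextⱼ (‵ X) (HD ⟨ ‵ J ⟩) atX hd (h< a<m)))
          (cong₂ _+_ (eval-dist contextⱼ (‵ U) (HD ⟨ ‵ J ⟩) atU hd (t< a<m))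
                     (eval-dist contextⱼ (‵ X) (TL ⟨ ‵ J ⟩) atX tl (h< a<m)))

      Marked : ℕ → Store → Set
      Marked k s = Stamped (suc a) (Opposite a) t k (arr s GOOD)

      mark-step : ∀ {s b} → b < m → At a s → Marked b s → Marked (suc b) (run mark (assign J b 6 s))
      mark-step {s} {b} b<m now S = ifZero-elim (Marked (suc b)) (eval cond sⱼ)
        (λ z → let z₁ , z₃ = zeros z in
          if-elim (Marked (suc b)) (sameℝ (real s (arr s EID (var s I))) (real s (arr s EID b)))
          (λ same₁ → if-elim (Marked (suc b)) (sameℝ (real s (eval (EID ⟨ arcAt (‵ U) (TL ⟨ ‵ J ⟩) ⊖ lit 1 ⟩) sⱼ)) (real s (eval (EID ⟨ arcAt (‵ X) (HD ⟨ ‵ J ⟩) ⊖ lit 1 ⟩) sⱼ)))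
            (λ same₂ → subst (Stamped (suc a) (Opposite a) t (suc b))
              (cong₂ (λ x y → arr s GOOD [ x ≔ y ]) (sym tl) (trans (cong suc (sym atI)) (ℕ.+-comm 1 _)))
              (stamp (monus-gap (trans (cong (1 ∸_) (cong₂ gap (sym hd) (sym atU))) (proj₁ z₁)) ,
                monus-pos (trans (cong (1 ∸_) (sym adj₁)) (proj₂ z₁)) ,
                monus-pos (trans (cong (1 ∸_) (sym adj₂)) z₃) ,
                subst₂ (Reals._≈_ ℛ) weight-I weight-J (sameℝ-sound same₁) ,
                subst₂ (Reals._≈_ ℛ) weight₁ weight₂ (sameℝ-sound same₂)) S))
            (λ differ → unstamped (λ (_ , _ , _ , _ , same) → case trans (sym differ) (sameℝ-complete (subst₂ (Reals._≈_ ℛ) (sym weight₁) (sym weight₂) same)) of λ ()) S))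
          (λ differ → unstamped (λ (_ , _ , _ , same , _) → case trans (sym differ) (sameℝ-complete (subst₂ (Reals._≈_ ℛ) (sym weight-I) (sym weight-J) same)) of λ ()) S))
        (λ nz → unstamped (λ (ne , 0<₁ , 0<₂ , _) → case trans (sym nz) (cong₂ _+_ (cong₂ _+_
            (trans (cong (1 ∸_) (cong₂ gap hd atU)) (gap-pos ne))
            (trans (cong (1 ∸_) adj₁) (pos-monus 0<₁))) (trans (cong (1 ∸_) adj₂) (pos-monus 0<₂))) of λ ()) S)
        where
        open AtArc now b<m
        open At now
        open Context context
        cond = (lit 1 ⊖ (HD ⟨ ‵ J ⟩ ≶ ‵ U)) ⊕ (lit 1 ⊖ arcAt (‵ U) (TL ⟨ ‵ J ⟩)) ⊕ (lit 1 ⊖ arcAt (‵ X) (HD ⟨ ‵ J ⟩))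
        -- Each of the three summands is 1 if one of the combinatorial conditions in `Opposite`
        -- fails, and 0 otherwise.
        c₁ = 1 ∸ gap (arr s HD b) (var s U)
        c₂ = 1 ∸ eval (arcAt (‵ U) (TL ⟨ ‵ J ⟩)) sⱼ
        c₃ = 1 ∸ eval (arcAt (‵ X) (HD ⟨ ‵ J ⟩)) sⱼ
        zeros : c₁ + c₂ + c₃ ≡ 0 → (c₁ ≡ 0 × c₂ ≡ 0) × c₃ ≡ 0
        zeros z = (ℕ.m+n≡0⇒m≡0 c₁ (ℕ.m+n≡0⇒m≡0 (c₁ + c₂) z) , ℕ.m+n≡0⇒n≡0 c₁ (ℕ.m+n≡0⇒m≡0 (c₁ + c₂) z)) ,
                  ℕ.m+n≡0⇒n≡0 (c₁ + c₂) z
        weight-I : real s (arr s EID (var s I)) ≡ w (eid a)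
        weight-I = cong₂ (λ f i → f i) reals (cong₂ (λ f i → f i) eids atI)
        weight-J : real s (arr s EID b) ≡ w (eid b)
        weight-J = cong₂ (λ f i → f i) reals (cong (λ f → f b) eids)
        weight₁ : real s (eval (EID ⟨ arcAt (‵ U) (TL ⟨ ‵ J ⟩) ⊖ lit 1 ⟩) sⱼ) ≡ w (eid (A (t a ◇ t b) ∸ 1))
        weight₁ = cong₂ (λ f i → f i) reals (cong₂ (λ f i → f i) eids (cong (_∸ 1) adj₁))
        weight₂ : real s (eval (EID ⟨ arcAt (‵ X) (HD ⟨ ‵ J ⟩) ⊖ lit 1 ⟩) sⱼ) ≡ w (eid (A (h a ◇ h b) ∸ 1))
        weight₂ = cong₂ (λ f i → f i) reals (cong₂ (λ f i → f i) eids (cong (_∸ 1) adj₂))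

      Flagged : (ℕ → ℕ) → ℕ → Store → Set
      Flagged col k s = Stamped (suc a) (Related a) col k (arr s FLAG)

      flag-step : ∀ {s b col} → b < m → At a s → arr s COL ≡ col → Marked m s →
                  Flagged col b s → Flagged col (suc b) (run flag (assign J b 6 s))
      flag-step {s} {b} {col} b<m now eqCOL S F = ifZero-elim (Flagged col (suc b)) (eval cond sⱼ)
        (λ z → unstamped (unrelated z) F)
        (λ nz → subst (Stamped (suc a) (Related a) col (suc b))
          (cong₂ (λ x y → arr s FLAG [ x ≔ y ]) (cong (λ f → f b) (sym eqCOL)) (trans (cong suc (sym atI)) (ℕ.+-comm 1 _)))
          (stamp (related nz) F))
        where
        open AtArc now b<m
        open At now
        open Context context
        open Stamped
        cond = separation (‵ U) (‵ X) (TL ⟨ ‵ J ⟩) (HD ⟨ ‵ J ⟩)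
          ⊕ ((lit 1 ⊖ (TL ⟨ ‵ J ⟩ ≶ ‵ U)) ⊖ (lit 1 ⊖ (GOOD ⟨ HD ⟨ ‵ J ⟩ ⟩ ≶ ‵ I ⊕ lit 1)))
        Q = gap (D (t a ◇ t b) + D (h a ◇ h b)) (D (t a ◇ h b) + D (h a ◇ t b))
        -- `P` and `G` are truth values, for a common tail and for a good head, so `P ∸ G` is 1
        -- exactly if (□) demands the same colour.
        P = 1 ∸ gap (t b) (t a)
        G = 1 ∸ gap (arr s GOOD (h b)) (suc a)
        value : eval cond sⱼ ≡ Q + (P ∸ G)
        value = cong₂ _+_ separation-correct (cong₂ _∸_ (cong (1 ∸_) (cong₂ gap tl atU))
          (cong (1 ∸_) (cong₂ gap (cong (arr s GOOD) hd) (trans (ℕ.+-comm _ 1) (cong suc atI)))))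
        square : Square a (h b) → arr s GOOD (h b) ≡ suc a
        square (c , c<m , o , eq) = trans (cong (arr s GOOD) (sym eq)) (stamped-complete S c<m o)
        unrelated : eval cond sⱼ ≡ 0 → ¬ Related a b
        unrelated z (inj₁ sep) = sep (gap-zero (ℕ.m+n≡0⇒m≡0 Q (trans (sym value) z)))
        unrelated z (inj₂ (eq , ¬sq)) = ¬sq (let c , c<m , o , eq′ = stamped-sound S good in c , c<m , o , eq′)
          where
          P≤G : P ≤ G
          P≤G = ℕ.m∸n≡0⇒m≤n (ℕ.m+n≡0⇒n≡0 Q (trans (sym value) z))
          P≡1 : P ≡ 1
          P≡1 = cong (1 ∸_) (trans (cong (λ x → gap x (t a)) eq) (gap-refl (t a)))
          good : arr s GOOD (h b) ≡ suc a
          good with gap (arr s GOOD (h b)) (suc a) in gap-eq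
          ... | zero  = gap-zero gap-eq
          ... | suc k = contradiction (ℕ.≤-trans (ℕ.≤-trans (ℕ.≤-reflexive (sym P≡1)) P≤G)
            (ℕ.≤-reflexive (trans (cong (1 ∸_) gap-eq) (ℕ.0∸n≡0 k)))) λ ()
        related : ∀ {d} → eval cond sⱼ ≡ suc d → Related a b
        related {d} nz with D (t a ◇ t b) + D (h a ◇ h b) ℕ.≟ D (t a ◇ h b) + D (h a ◇ t b)
        ... | no sep = inj₁ sep
        ... | yes eq = inj₂ (same , λ sq → ℕ.<⇒≱ G<P (ℕ.≤-trans (ℕ.m∸n≤m 1 (gap (t b) (t a)))
            (ℕ.≤-reflexive (sym (trans (cong (λ x → 1 ∸ gap x (suc a)) (square sq)) (cong (1 ∸_) (gap-refl (suc a))))))))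
          where
          rest : P ∸ G ≡ suc d
          rest = trans (sym (cong (_+ (P ∸ G)) (trans (cong (λ x → gap x (D (t a ◇ h b) + D (h a ◇ t b))) eq) (gap-refl (D (t a ◇ h b) + D (h a ◇ t b)))))) (trans (sym value) nz)
          G<P : G < P
          G<P = ℕ.m∸n≢0⇒n<m (λ z → case trans (sym rest) z of λ ())
          same : t b ≡ t a
          same with gap (t b) (t a) in gap-eq
          ... | zero  = gap-zero gap-eq
          ... | suc k = contradiction (ℕ.<-≤-trans G<P (ℕ.≤-reflexive (trans (cong (1 ∸_) gap-eq) (ℕ.0∸n≡0 k)))) λ ()

      Relabelled : (ℕ → ℕ) → ℕ → Store → Set
      Relabelled col k s =
        (∀ {b} → b < k → Relabels a col (col b) (arr s COL b)) ×
        (∀ {b} → k ≤ b → arr s COL b ≡ col b)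

      relabel-step : ∀ {s b col} → b < m → At a s → var s ACC ≡ col a → Flagged col m s →
        Relabelled col b s → Relabelled col (suc b) (run relabel (assign J b 6 s))
      relabel-step {s} {b} {col} b<m now eqACC F (done , todo) =
        ifZero-elim (Relabelled col (suc b)) (eval cond sⱼ)
          (λ z → (λ c< → hit z (<suc c<)) ,
                 (λ b<c → trans (update-≢ (arr s COL) (ℕ.<⇒≢ b<c ∘ sym)) (todo (ℕ.<⇒≤ b<c))))
          (λ nz → (λ c< → miss nz (<suc c<)) , (λ b<c → todo (ℕ.<⇒≤ b<c)))
        where
        open AtArc now b<m
        open At now
        open Stamped
        cond = FLAG ⟨ COL ⟨ ‵ J ⟩ ⟩ ≶ ‵ I ⊕ lit 1
        value : eval cond sⱼ ≡ gap (arr s FLAG (col b)) (suc a)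
        value = cong₂ gap (cong (arr s FLAG) (todo ℕ.≤-refl)) (trans (ℕ.+-comm _ 1) (cong suc atI))
        hit : eval cond sⱼ ≡ 0 → ∀ {c} → c < b ⊎ c ≡ b →
              Relabels a col (col c) ((arr s COL [ b ≔ var s ACC ]) c)
        hit z {c} (inj₁ c<b) = subst (Relabels a col (col c)) (sym (update-≢ (arr s COL) (ℕ.<⇒≢ c<b))) (done c<b)
        hit z (inj₂ refl) = inj₁ (stamped-sound F (gap-zero (trans (sym value) z)) , trans (update-≡ (arr s COL) b) eqACC)
        miss : ∀ {d} → eval cond sⱼ ≡ suc d → ∀ {c} → c < b ⊎ c ≡ b → Relabels a col (col c) (arr s COL c)
        miss nz (inj₁ c<b) = done c<b
        miss nz (inj₂ refl) = inj₂ ((λ (c , c<m , r , eq) → case trans (sym nz) (trans value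
          (trans (cong (λ x → gap x (suc a)) (trans (cong (arr s FLAG) (sym eq)) (stamped-complete F c<m r))) (gap-refl (suc a)))) of λ ()) ,
          todo ℕ.≤-refl)

    record Inv (k : ℕ) (s : Store) : Set where
      field
        context  : Context s
        coloured : Coloured k (arr s COL)
        good≤    : ∀ x → arr s GOOD x ≤ k
        flag≤    : ∀ x → arr s FLAG x ≤ k

    at-run : ∀ {a c s s′} → T (keepsContext c) → T (keepsVar I c ∧ (keepsVar U c ∧ keepsVar X c)) →
             Agree c s s′ → At a s → At a s′
    at-run {c = c} p q ag now with ∧-T {keepsVar I c} q
    ... | q₁ , q with ∧-T {keepsVar U c} q
    ... | q₂ , q₃ = record
      { context = context-run p ag context
      ; atI = trans (onVar ag I {q₁}) atI
      ; atU = trans (onVar ag U {q₂}) atU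
      ; atX = trans (onVar ag X {q₃}) atX }
      where open At now

    classify-step : ∀ {a s} → a < m → Inv a s → Inv (suc a) (run classify (assign I a 6 s))
    classify-step {a} {s} a<m inv = record
      { context = At.context at₄
      ; coloured = coloured-suc a<m coloured (λ b<m → proj₁ relabelled b<m)
      ; good≤ = λ x → subst (λ f → f x ≤ suc a) (sym (trans (onArr ag₄ GOOD {_}) (onArr ag₃ GOOD {_})))
          (Stamped.stamped-bound marked x)
      ; flag≤ = λ x → subst (λ f → f x ≤ suc a) (sym (onArr ag₄ FLAG {_})) (Stamped.stamped-bound flagged x) }
      where
      open Inv inv
      open Context context
      s₁ = run (U ≔ TL ⟨ ‵ I ⟩ ⨾ X ≔ HD ⟨ ‵ I ⟩ ⨾ ACC ≔ COL ⟨ ‵ I ⟩) (assign I a 6 s)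
      s₂ = run (for J (‵ M) mark) s₁
      s₃ = run (for J (‵ M) flag) s₂
      s₄ = run (for J (‵ M) relabel) s₃
      ag₂ = agree (for J (‵ M) mark) s₁
      ag₃ = agree (for J (‵ M) flag) s₂
      ag₄ = agree (for J (‵ M) relabel) s₃
      at₁ : At a s₁
      at₁ = record
        { context = record { sizeM = sizeM ; tails = tails ; heads = heads ; eids = eids
                           ; adjs = adjs ; dists = dists ; rows = rows ; reals = reals }
        ; atI = refl ; atU = cong (λ f → f a) tails ; atX = cong (λ f → f a) heads }
      at₂ = at-run {s = s₁} {s₂} tt tt ag₂ at₁
      at₃ = at-run {s = s₂} {s₃} tt tt ag₃ at₂
      at₄ = at-run {s = s₃} {s₄} tt tt ag₄ at₃
      marked : Marked a<m m s₂
      marked = for-induction J (‵ M) mark (Marked a<m) sizeM (stamped-start (λ x → s≤s (good≤ x)))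
        (λ b<m ag → mark-step a<m b<m (at-run tt tt ag at₁))
      col₃ : ∀ {s′} → Agree (for J (‵ M) flag) s₂ s′ → arr s′ COL ≡ arr s COL
      col₃ ag = trans (onArr ag COL {_}) (onArr ag₂ COL {_})
      flagged : Flagged a<m (arr s COL) m s₃
      flagged = for-induction J (‵ M) flag (Flagged a<m (arr s COL)) (Context.sizeM (At.context at₂))
        (stamped-start (λ x → s≤s (subst (λ f → f x ≤ a) (sym (onArr ag₂ FLAG {_})) (flag≤ x))))
        (λ b<m ag → flag-step a<m b<m (at-run tt tt ag at₂) (col₃ ag)
          (subst (Stamped (suc a) (Opposite a) t m) (sym (onArr ag GOOD {_})) marked))
      relabelled : Relabelled a<m (arr s COL) m s₄
      relabelled = for-induction J (‵ M) relabel (Relabelled a<m (arr s COL)) (Context.sizeM (At.context at₃))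
        ((λ ()) , λ _ → cong (λ f → f _) (col₃ ag₃))
        (λ b<m ag → relabel-step a<m b<m (at-run tt tt ag at₃)
          (trans (onVar ag ACC {_}) (trans (onVar ag₃ ACC {_}) (onVar ag₂ ACC {_})))
          (subst (Stamped (suc a) (Related a) (arr s COL) m) (sym (onArr ag FLAG {_})) flagged))

    classes-correct : ∀ s → Context s → (∀ {a} → a < m → arr s COL a ≡ a) →
      arr s GOOD ≡ (λ _ → 0) → arr s FLAG ≡ (λ _ → 0) → Inv m (run classes s)
    classes-correct s C eqCOL eqGOOD eqFLAG = for-induction I (‵ M) classify {s} Inv (Context.sizeM C)
      (record
        { context = record { sizeM = sizeM ; tails = tails ; heads = heads ; eids = eids
                           ; adjs = adjs ; dists = dists ; rows = rows ; reals = reals }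
        ; coloured = coloured-start eqCOL
        ; good≤ = λ x → subst (λ f → f x ≤ 0) (sym eqGOOD) z≤n
        ; flag≤ = λ x → subst (λ f → f x ≤ 0) (sym eqFLAG) z≤n })
      (λ a<m ag → classify-step a<m)
      where open Context C

-- Layers and output

module LayersCode where
  open Names
  open ClassesCode using (_≶_; separation)

  -- With truncated subtraction, `x + (e ∸ x)` is the maximum of `x` and `e`.
  raise : ℕ → Exp → Cmd
  raise a e = a ⟨ ‵ J ⟩≔ a ⟨ ‵ J ⟩ ⊕ (e ⊖ a ⟨ ‵ J ⟩)

  measure layers : Cmd
  measure = ifz (separation (lit 0) (‵ J) (TL ⟨ ‵ K ⟩) (HD ⟨ ‵ K ⟩)) skip
    (raise MX (COL ⟨ ‵ K ⟩ ⊕ lit 1) ⨾ raise MN (‵ M ⊖ COL ⟨ ‵ K ⟩))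
  layers = for J (‵ V) (for K (‵ M) measure)

  -- The vertex x is in the layer of colour I iff every arc that separates it
  -- from vertex 0 has colour I.  As the colours c of these arcs are
  -- represented by the maxima MX of c + 1 and MN of M - c, which start at 0,
  -- this is the case iff MX ≤ I + 1 and MN ≤ M - I.
  outsideE : Exp → Exp
  outsideE x = (MX ⟨ x ⟩ ⊖ (‵ I ⊕ lit 1)) ⊕ (MN ⟨ x ⟩ ⊖ (‵ M ⊖ ‵ I))

  push : Exp → Cmd
  push x = OUT ⟨ ‵ OUTPOS ⟩≔ x ⨾ OUTPOS ≔ ‵ OUTPOS ⊕ lit 1

  edgeOutsideE : Exp
  edgeOutsideE = outsideE (TL ⟨ ‵ J ⟩) ⊕ outsideE (HD ⟨ ‵ J ⟩)

  rankVertex countEdge emitEdge emitFactor countFactor output : Cmd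
  rankVertex = ifz (outsideE (‵ J)) (IDX ⟨ ‵ J ⟩≔ ‵ X ⨾ X ≔ ‵ X ⊕ lit 1) skip
  countEdge = ifz edgeOutsideE (Y ≔ ‵ Y ⊕ lit 1) skip
  emitEdge = ifz edgeOutsideE
    (push (IDX ⟨ TL ⟨ ‵ J ⟩ ⟩) ⨾ push (IDX ⟨ HD ⟨ ‵ J ⟩ ⟩) ⨾
     -- The weights of the factors are written behind the `E` input weights, since later factors
     -- still have to read those.
     copyℝ (‵ E ⊕ ‵ REALPOS) (‵ J) ⨾ REALPOS ≔ ‵ REALPOS ⊕ lit 1)
    skip
  emitFactor = ifz (COL ⟨ ‵ I ⟩ ≶ ‵ I)
    (X ≔ lit 0 ⨾ for J (‵ V) rankVertex ⨾ Y ≔ lit 0 ⨾ for J (‵ E) countEdge ⨾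
     push (‵ X) ⨾ push (‵ Y) ⨾ for J (‵ E) emitEdge)
    skip
  countFactor = ifz (COL ⟨ ‵ I ⟩ ≶ ‵ I) (CNT ≔ ‵ CNT ⊕ lit 1) skip
  output = ifz (‵ E)
    -- Without edges there are no colours. The single factor is then the graph itself, with `V`
    -- vertices and no edges.
    (push (lit 1) ⨾ push (‵ V) ⨾ push (lit 0))
    (for I (‵ M) countFactor ⨾ push (‵ CNT) ⨾ for I (‵ M) emitFactor)

-- A maximum described by its upper bounds. This also covers the empty case, where it is 0, the
-- initial content of the arrays.
record Supremum (P : ℕ → Set) (g : ℕ → ℕ) (k x : ℕ) : Set where
  field
    upper : ∀ {B b} → x ≤ B → b < k → P b → g b ≤ B
    least : ∀ {B} → (∀ {b} → b < k → P b → g b ≤ B) → x ≤ B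

supremum-start : ∀ {P g} → Supremum P g 0 0
supremum-start = record { upper = λ _ () ; least = λ _ → z≤n }

supremum-yes : ∀ {P g k x} → P k → Supremum P g k x → Supremum P g (suc k) (x + (g k ∸ x))
supremum-yes {P} {g} {k} {x} p S = record
  { upper = λ x≤ b< q → upper′ x≤ (<suc b<) q
  ; least = λ bound → lub (least (λ b<k → bound (ℕ.m≤n⇒m≤1+n b<k))) (bound ℕ.≤-refl p) }
  where
  open Supremum S
  lub : ∀ {y B} → x ≤ B → y ≤ B → x + (y ∸ x) ≤ B
  lub {y} {B} x≤ y≤ with ℕ.≤-total x y
  ... | inj₁ x≤y = subst (_≤ B) (sym (ℕ.m+[n∸m]≡n x≤y)) y≤
  ... | inj₂ y≤x = subst (_≤ B) (sym (trans (cong (x +_) (ℕ.m≤n⇒m∸n≡0 y≤x)) (ℕ.+-identityʳ x))) x≤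
  upper′ : ∀ {B b} → x + (g k ∸ x) ≤ B → b < k ⊎ b ≡ k → P b → g b ≤ B
  upper′ x≤ (inj₁ b<k) q  = upper (ℕ.≤-trans (ℕ.m≤m+n x _) x≤) b<k q
  upper′ x≤ (inj₂ refl) _ = ℕ.≤-trans (ℕ.m≤n+m∸n (g k) x) x≤

supremum-no : ∀ {P g k x} → ¬ P k → Supremum P g k x → Supremum P g (suc k) x
supremum-no {P} {g} {k} {x} ¬p S = record
  { upper = λ x≤ b< q → upper′ x≤ (<suc b<) q
  ; least = λ bound → least (λ b<k → bound (ℕ.m≤n⇒m≤1+n b<k)) }
  where
  open Supremum S
  upper′ : ∀ {B b} → x ≤ B → b < k ⊎ b ≡ k → P b → g b ≤ B
  upper′ x≤ (inj₁ b<k) q  = upper x≤ b<k q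
  upper′ x≤ (inj₂ refl) q = contradiction q ¬p

-- Extends on the right, in the order in which a loop writes its output.
gather : ∀ {A : Set} → (ℕ → List A) → ℕ → List A
gather g zero    = []
gather g (suc k) = gather g k ++ g k

select : (ℕ → ℕ) → ℕ → List ℕ
select p = gather (λ k → ifZero p k then k ∷ [] else [])

module _ {A : Set} {_∼_ : A → A → Set} where

  stored-cong : ∀ {f g : ℕ → A} {a} xs → (∀ {j} → a ≤ j → j < a + length xs → f j ≡ g j) →
                StoredAt _∼_ f a xs → StoredAt _∼_ g a xs
  stored-cong []       eq _       = tt
  stored-cong {a = a} (x ∷ xs) eq (p , q) =
    subst (_∼ x) (eq ℕ.≤-refl (ℕ.m<m+n a z<s)) p ,
    stored-cong xs (λ {j} a<j j< → eq (ℕ.<⇒≤ a<j) (subst (j <_) (sym (ℕ.+-suc a (length xs))) j<)) q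

  stored-++ : ∀ {f : ℕ → A} {a} xs {ys} → StoredAt _∼_ f a xs → StoredAt _∼_ f (a + length xs) ys →
              StoredAt _∼_ f a (xs ++ ys)
  stored-++ {f} {a} [] {ys}       _       q = subst (λ a → StoredAt _∼_ f a ys) (ℕ.+-identityʳ a) q
  stored-++ {f} {a} (x ∷ xs) {ys} (p , r) q =
    p , stored-++ xs r (subst (λ a → StoredAt _∼_ f a ys) (ℕ.+-suc a (length xs)) q)

stored-snoc : ∀ {A : Set} {f : ℕ → A} {a k} xs {x} → k ≡ a + length xs →
  StoredAt _≡_ f a xs → StoredAt _≡_ (f [ k ≔ x ]) a (xs ++ x ∷ [])
stored-snoc {f = f} {a} xs {x} refl S = stored-++ xs
  (stored-cong xs (λ _ j< → sym (update-≢ f (ℕ.<⇒≢ j<))) S) (update-≡ f (a + length xs) , tt)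

length-snoc : ∀ {A : Set} (xs : List A) {x k} → k ≡ length xs → k + 1 ≡ length (xs ++ x ∷ [])
length-snoc xs refl = sym (length-++ xs)

module LayersCorrect (ℛ : Reals) (inp : ℕ → ℕ) where
  open Reals ℛ using (Carrier)
  open Language ℛ
  open Semantics inp
  open Rules ℛ inp
  open Names
  open ClassesCode using (separation; _≶_)
  open LayersCode

  module Layers {v e : ℕ} (t h D col : ℕ → ℕ)
    (t< : ∀ {a} → a < e + e → t a < v) (h< : ∀ {a} → a < e + e → h a < v) where
    open Tables v e t h using (_◇_) renaming (M to m; N to n)

    Sep : ℕ → ℕ → Set
    Sep x b = D (0 ◇ t b) + D (x ◇ h b) ≢ D (0 ◇ h b) + D (x ◇ t b)

    record Measured (k x : ℕ) (mx mn : ℕ → ℕ) : Set where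
      field
        mx-sup : Supremum (Sep x) (λ b → col b + 1) k (mx x)
        mn-sup : Supremum (Sep x) (λ b → m ∸ col b) k (mn x)

    outside : (mx mn : ℕ → ℕ) → ℕ → ℕ → ℕ
    outside mx mn i x = (mx x ∸ (i + 1)) + (mn x ∸ (m ∸ i))

    module _ {mx mn : ℕ → ℕ} {x : ℕ} (R : Measured m x mx mn) (col< : ∀ {a} → a < m → col a < m) {i : ℕ} where
      open Measured R

      outside-sound : outside mx mn i x ≡ 0 → ∀ {b} → b < m → Sep x b → col b ≡ i
      outside-sound z {b} b<m sep = ℕ.≤-antisym
        (ℕ.+-cancelʳ-≤ 1 _ _ (Supremum.upper mx-sup (ℕ.m∸n≡0⇒m≤n (ℕ.m+n≡0⇒m≡0 _ z)) b<m sep))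
        (ℕ.≮⇒≥ (λ lt → ℕ.<⇒≱ (larger lt)
          (Supremum.upper mn-sup (ℕ.m∸n≡0⇒m≤n (ℕ.m+n≡0⇒n≡0 (mx x ∸ (i + 1)) z)) b<m sep)))
        where
        -- Strict in spite of truncation: if `m ≤ i`, the left side is 0, and the right side is
        -- positive by `col b < m`.
        larger : col b < i → m ∸ i < m ∸ col b
        larger lt with ℕ.≤-total i m
        ... | inj₁ i≤m = ℕ.∸-monoʳ-< lt i≤m
        ... | inj₂ m≤i = subst (_< m ∸ col b) (sym (ℕ.m≤n⇒m∸n≡0 m≤i)) (ℕ.m<n⇒0<n∸m (col< b<m))

      outside-complete : (∀ {b} → b < m → Sep x b → col b ≡ i) → outside mx mn i x ≡ 0
      outside-complete all = cong₂ _+_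
        (ℕ.m≤n⇒m∸n≡0 (Supremum.least mx-sup (λ b<m sep → ℕ.≤-reflexive (cong (_+ 1) (all b<m sep)))))
        (ℕ.m≤n⇒m∸n≡0 (Supremum.least mn-sup (λ b<m sep → ℕ.≤-reflexive (cong (m ∸_) (all b<m sep)))))

    record Setting (s : Store) : Set where
      field
        sizeM : var s M ≡ m
        tails : arr s TL ≡ t
        heads : arr s HD ≡ h
        dists : arr s DIST ≡ D
        cols  : arr s COL ≡ col
        rows  : ∀ {u} → u < v → arr s ROW u ≡ u * n

    Others : ℕ → (ℕ → ℕ) → (ℕ → ℕ) → Set
    Others x f g = ∀ {y} → y ≢ x → g y ≡ f y

    module _ {x : ℕ} (x<v : x < v) (s : Store) (cur : Setting s) (atJ : var s J ≡ x)
      (zeroX : arr s MX x ≡ 0) (zeroN : arr s MN x ≡ 0) where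

      0<v : 0 < v
      0<v = ℕ.≤-<-trans z≤n x<v

      Inv : ℕ → Store → Set
      Inv k s′ = Measured k x (arr s′ MX) (arr s′ MN) × Others x (arr s MX) (arr s′ MX) × Others x (arr s MN) (arr s′ MN)

      measure-step : ∀ {k s′} → k < m → Agree (for K (‵ M) measure) s s′ → Inv k s′ →
                     Inv (suc k) (run measure (assign K k 6 s′))
      measure-step {k} {s′} k<m ag (R , oX , oN) =
        ifZero-elim (Inv (suc k)) (eval (separation (lit 0) (‵ J) (TL ⟨ ‵ K ⟩) (HD ⟨ ‵ K ⟩)) sₖ)
          (λ z → record { mx-sup = supremum-no (unsep z) mx-sup ; mn-sup = supremum-no (unsep z) mn-sup } , oX , oN)
          (λ nz → record
            { mx-sup = subst (Supremum (Sep x) (λ b → col b + 1) (suc k)) (sym newX) (supremum-yes (sep nz) mx-sup)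
            ; mn-sup = subst (Supremum (Sep x) (λ b → m ∸ col b) (suc k)) (sym newN) (supremum-yes (sep nz) mn-sup) } ,
            (λ y≢ → trans (update-≢ (arr s′ MX) (λ e → y≢ (trans e J≡))) (oX y≢)) ,
            (λ y≢ → trans (update-≢ (arr s′ MN) (λ e → y≢ (trans e J≡))) (oN y≢)))
        where
        open Measured R
        open Setting cur
        sₖ = assign K k 6 s′
        J≡ : var s′ J ≡ x
        J≡ = trans (onVar ag J {_}) atJ
        tl : arr s′ TL k ≡ t k
        tl = cong (λ f → f k) (trans (onArr ag TL {_}) tails)
        hd : arr s′ HD k ≡ h k
        hd = cong (λ f → f k) (trans (onArr ag HD {_}) heads)
        col≡ : arr s′ COL k ≡ col k
        col≡ = cong (λ f → f k) (trans (onArr ag COL {_}) cols)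
        M≡ : var s′ M ≡ m
        M≡ = trans (onVar ag M {_}) sizeM
        look : ∀ {u u′ y y′} → u′ ≡ u → y′ ≡ y → u < v → arr s′ DIST (arr s′ ROW u′ + y′) ≡ D (u ◇ y)
        look refl refl u<v = cong₂ (λ f i → f i) (trans (onArr ag DIST {_}) dists)
          (cong (_+ _) (trans (cong (λ f → f _) (onArr ag ROW {_})) (rows u<v)))
        value : eval (separation (lit 0) (‵ J) (TL ⟨ ‵ K ⟩) (HD ⟨ ‵ K ⟩)) sₖ ≡
          gap (D (0 ◇ t k) + D (x ◇ h k)) (D (0 ◇ h k) + D (x ◇ t k))
        value = cong₂ gap (cong₂ _+_ (look refl tl 0<v) (look J≡ hd x<v))
                          (cong₂ _+_ (look refl hd 0<v) (look J≡ tl x<v))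
        unsep : eval (separation (lit 0) (‵ J) (TL ⟨ ‵ K ⟩) (HD ⟨ ‵ K ⟩)) sₖ ≡ 0 → ¬ Sep x k
        unsep z sep = sep (gap-zero (trans (sym value) z))
        sep : ∀ {d} → eval (separation (lit 0) (‵ J) (TL ⟨ ‵ K ⟩) (HD ⟨ ‵ K ⟩)) sₖ ≡ suc d → Sep x k
        sep nz eq = case trans (sym nz) (trans value (trans (cong (λ y → gap y (D (0 ◇ h k) + D (x ◇ t k))) eq)
          (gap-refl (D (0 ◇ h k) + D (x ◇ t k))))) of λ ()
        raised : ∀ (f : ℕ → ℕ) {y z} j → j ≡ x → y ≡ z → (f [ j ≔ f j + (y ∸ f j) ]) x ≡ f x + (z ∸ f x)
        raised f j refl refl = update-≡ f j
        newX : (arr s′ MX [ var s′ J ≔ arr s′ MX (var s′ J) + (arr s′ COL k + 1 ∸ arr s′ MX (var s′ J)) ]) x ≡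
               arr s′ MX x + (col k + 1 ∸ arr s′ MX x)
        newX = raised (arr s′ MX) (var s′ J) J≡ (cong (_+ 1) col≡)
        newN : (arr s′ MN [ var s′ J ≔ arr s′ MN (var s′ J) + (var s′ M ∸ arr s′ COL k ∸ arr s′ MN (var s′ J)) ]) x ≡
               arr s′ MN x + (m ∸ col k ∸ arr s′ MN x)
        newN = raised (arr s′ MN) (var s′ J) J≡ (cong₂ _∸_ M≡ col≡)

      measure-correct : Inv m (run (for K (‵ M) measure) s)
      measure-correct = for-induction K (‵ M) measure {s} Inv (Setting.sizeM cur)
        (record { mx-sup = subst (Supremum _ _ 0) (sym zeroX) supremum-start
                ; mn-sup = subst (Supremum _ _ 0) (sym zeroN) supremum-start } , (λ _ → refl) , (λ _ → refl))
        measure-step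

    layers-correct : ∀ s → Setting s → var s V ≡ v → arr s MX ≡ (λ _ → 0) → arr s MN ≡ (λ _ → 0) →
      ∀ {x} → x < v → Measured m x (arr (run layers s) MX) (arr (run layers s) MN)
    layers-correct s cur eqV zeroX zeroN = proj₁ (for-induction J (‵ V) (for K (‵ M) measure) {s} Inv₂ eqV
      ((λ ()) , λ {x} _ → cong (λ f → f x) zeroX , cong (λ f → f x) zeroN) step)
      where
      Inv₂ : ℕ → Store → Set
      Inv₂ k s′ = (∀ {x} → x < k → Measured m x (arr s′ MX) (arr s′ MN)) ×
                  (∀ {x} → k ≤ x → arr s′ MX x ≡ 0 × arr s′ MN x ≡ 0)
      transfer : ∀ {x f f′ g g′} → f′ x ≡ f x → g′ x ≡ g x → Measured m x f g → Measured m x f′ g′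
      transfer p q R = record { mx-sup = subst (Supremum _ _ m) (sym p) mx-sup ; mn-sup = subst (Supremum _ _ m) (sym q) mn-sup }
        where open Measured R
      step : ∀ {k s′} → k < v → Agree layers s s′ → Inv₂ k s′ → Inv₂ (suc k) (run (for K (‵ M) measure) (assign J k 6 s′))
      step {k} {s′} k<v ag (done , todo)
        with measure-correct k<v (assign J k 6 s′)
               (record { sizeM = trans (onVar ag M {_}) sizeM ; tails = trans (onArr ag TL {_}) tails
                       ; heads = trans (onArr ag HD {_}) heads ; dists = trans (onArr ag DIST {_}) dists
                       ; cols = trans (onArr ag COL {_}) cols
                       ; rows = λ u<v → trans (cong (λ f → f _) (onArr ag ROW {_})) (rows u<v) })
               refl (proj₁ (todo ℕ.≤-refl)) (proj₂ (todo ℕ.≤-refl))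
        where open Setting cur
      ... | R , oX , oN = (λ x< → now (<suc x<)) ,
        λ k<x → trans (oX (ℕ.<⇒≢ k<x ∘ sym)) (proj₁ (todo (ℕ.<⇒≤ k<x))) ,
                trans (oN (ℕ.<⇒≢ k<x ∘ sym)) (proj₂ (todo (ℕ.<⇒≤ k<x)))
        where
        now : ∀ {x} → x < k ⊎ x ≡ k → Measured m x _ _
        now (inj₂ refl) = R
        now (inj₁ x<k)  = transfer (oX (ℕ.<⇒≢ x<k)) (oN (ℕ.<⇒≢ x<k)) (done x<k)

module Output (ℛ : Reals) (inp : ℕ → ℕ) where
  open Reals ℛ using (Carrier)
  open Language ℛ
  open Semantics inp
  open Rules ℛ inp
  open Names
  open ClassesCode using (_≶_)
  open LayersCode

  module _ (v e : ℕ) (t h col mx mn : ℕ → ℕ) (w : ℕ → Carrier)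
    where

    m : ℕ
    m = e + e

    outside : ℕ → ℕ → ℕ
    outside i x = (mx x ∸ (i + 1)) + (mn x ∸ (m ∸ i))

    edgeOutside : ℕ → ℕ → ℕ
    edgeOutside i f = outside i (t f) + outside i (h f)

    -- The number of layer vertices below `x`. It is the new number of `x` if `x` lies in the layer,
    -- and the order of the layer if `x` is `v`.
    rank : ℕ → ℕ → ℕ
    rank i x = length (select (outside i) x)

    edgeEntry : ℕ → ℕ → List ℕ
    edgeEntry i f = ifZero edgeOutside i f then rank i (t f) ∷ rank i (h f) ∷ [] else []

    weightEntry : ℕ → ℕ → List Carrier
    weightEntry i f = ifZero edgeOutside i f then w f ∷ [] else []

    factorEntry : ℕ → List ℕ
    factorEntry i = ifZero gap (col i) i
      then rank i v ∷ length (select (edgeOutside i) e) ∷ gather (edgeEntry i) e else []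

    factorWeights : ℕ → List Carrier
    factorWeights i = ifZero gap (col i) i then gather (weightEntry i) e else []

    colourCount : ℕ
    colourCount = length (select (λ i → gap (col i) i) m)

    record Setting (s : Store) : Set where
      field
        sizeV : var s V ≡ v
        sizeE : var s E ≡ e
        sizeM : var s M ≡ m
        tails : arr s TL ≡ t
        heads : arr s HD ≡ h
        cols  : arr s COL ≡ col
        mxs   : arr s MX ≡ mx
        mns   : arr s MN ≡ mn

    keepsSetting : Cmd → Bool
    keepsSetting c = keepsVar V c ∧ (keepsVar E c ∧ (keepsVar M c ∧ (keepsArr TL c ∧ (keepsArr HD c ∧
      (keepsArr COL c ∧ (keepsArr MX c ∧ keepsArr MN c))))))

    setting-run : ∀ {c s s′} → T (keepsSetting c) → Agree c s s′ → Setting s → Setting s′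
    setting-run {c} p ag C with ∧-T {keepsVar V c} p
    ... | p₁ , q with ∧-T {keepsVar E c} q
    ... | p₂ , q with ∧-T {keepsVar M c} q
    ... | p₃ , q with ∧-T {keepsArr TL c} q
    ... | p₄ , q with ∧-T {keepsArr HD c} q
    ... | p₅ , q with ∧-T {keepsArr COL c} q
    ... | p₆ , q with ∧-T {keepsArr MX c} q
    ... | p₇ , p₈ = record
      { sizeV = trans (onVar ag V {p₁}) sizeV
      ; sizeE = trans (onVar ag E {p₂}) sizeE
      ; sizeM = trans (onVar ag M {p₃}) sizeM
      ; tails = trans (onArr ag TL {p₄}) tails
      ; heads = trans (onArr ag HD {p₅}) heads
      ; cols  = trans (onArr ag COL {p₆}) cols
      ; mxs   = trans (onArr ag MX {p₇}) mxs
      ; mns   = trans (onArr ag MN {p₈}) mns }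
      where open Setting C

    record Written (xs : List ℕ) (ys : List Carrier) (s : Store) : Set where
      field
        out     : StoredAt _≡_ (arr s OUT) 0 xs
        pos     : var s OUTPOS ≡ length xs
        outℝ    : StoredAt _≡_ (real s) e ys
        posℝ    : var s REALPOS ≡ length ys
        weights : ∀ {j} → j < e → real s j ≡ w j

    written-run : ∀ {c s s′ xs ys} → T (keepsArr OUT c ∧ (keepsVar OUTPOS c ∧ (keepsVar REALPOS c ∧ keepsReal c))) →
                  Agree c s s′ → Written xs ys s → Written xs ys s′
    written-run {c} {xs = xs} {ys} p ag W with ∧-T {keepsArr OUT c} p
    ... | p₁ , q with ∧-T {keepsVar OUTPOS c} q
    ... | p₂ , q with ∧-T {keepsVar REALPOS c} q
    ... | p₃ , p₄ = record
      { out     = subst (λ f → StoredAt _≡_ f 0 xs) (sym (onArr ag OUT {p₁})) out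
      ; pos     = trans (onVar ag OUTPOS {p₂}) pos
      ; outℝ    = subst (λ f → StoredAt _≡_ f e ys) (sym (onReal ag {p₄})) outℝ
      ; posℝ    = trans (onVar ag REALPOS {p₃}) posℝ
      ; weights = λ {j} j<e → trans (cong (λ f → f j) (onReal ag {p₄})) (weights j<e) }
      where open Written W

    push-written : ∀ f {s x xs ys} → eval f s ≡ x → Written xs ys s → Written (xs ++ x ∷ []) ys (run (push f) s)
    push-written f {s} {xs = xs} refl W = record
      { out = stored-snoc xs pos out ; pos = length-snoc xs pos ; outℝ = outℝ ; posℝ = posℝ ; weights = weights }
      where open Written W

    written-wait : ∀ {s xs ys} t → Written xs ys s → Written xs ys (wait t s)
    written-wait t W = record { out = out ; pos = pos ; outℝ = outℝ ; posℝ = posℝ ; weights = weights }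
      where open Written W

    written-assign : ∀ {s xs ys} x k t → T (not (OUTPOS ≡ᵇ x) ∧ not (REALPOS ≡ᵇ x)) → Written xs ys s →
                     Written xs ys (assign x k t s)
    written-assign {s} x k t p W = record
      { out = out ; outℝ = outℝ ; weights = weights
      ; pos = trans (keep OUTPOS (proj₁ (∧-T {not (OUTPOS ≡ᵇ x)} p))) pos
      ; posℝ = trans (keep REALPOS (proj₂ (∧-T {not (OUTPOS ≡ᵇ x)} p))) posℝ }
      where
      open Written W
      keep : ∀ y → T (not (y ≡ᵇ x)) → (var s [ x ≔ k ]) y ≡ var s y
      keep y p rewrite T-not p = refl

    module _ {i : ℕ} {s : Store} (now : Setting s) (atI : var s I ≡ i) where
      open Setting now

      outside-eval : ∀ x {y} → eval x s ≡ y → eval (outsideE x) s ≡ outside i y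
      outside-eval x refl = cong₂ _+_
        (cong₂ _∸_ (cong (λ f → f (eval x s)) mxs) (cong (_+ 1) atI))
        (cong₂ _∸_ (cong (λ f → f (eval x s)) mns) (cong₂ _∸_ sizeM atI))

      edgeOutside-eval : ∀ {f} → var s J ≡ f → eval edgeOutsideE s ≡ edgeOutside i f
      edgeOutside-eval refl = cong₂ _+_
        (outside-eval (TL ⟨ ‵ J ⟩) (cong (λ g → g (var s J)) tails))
        (outside-eval (HD ⟨ ‵ J ⟩) (cong (λ g → g (var s J)) heads))

    setting-assign : ∀ {s} x k t → T (3 <ᵇ x) → Setting s → Setting (assign x k t s)
    setting-assign {s} x k t p S = record
      { sizeV = trans (update-≢ (var s) (small≢large {V} {x} tt p)) sizeV
      ; sizeE = trans (update-≢ (var s) (small≢large {E} {x} tt p)) sizeE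
      ; sizeM = trans (update-≢ (var s) (small≢large {M} {x} tt p)) sizeM
      ; tails = tails ; heads = heads ; cols = cols ; mxs = mxs ; mns = mns }
      where open Setting S

    gather-suc : ∀ {A : Set} (g : ℕ → List A) k {xs} → xs ≡ g k → gather g k ++ xs ≡ gather g (suc k)
    gather-suc g k refl = refl

    select-suc : ∀ p k {b} → p k ≡ b → length (select p k) + length (ifZero b then k ∷ [] else []) ≡ length (select p (suc k))
    select-suc p k refl = sym (length-++ (select p k))

    module _ {i : ℕ} where

      record Ranked (k : ℕ) (s : Store) : Set where
        field
          next  : var s X ≡ rank i k
          ranks : ∀ {x} → x < k → outside i x ≡ 0 → arr s IDX x ≡ rank i x

      rank-step : ∀ {k s} → Setting s → var s I ≡ i → Ranked k s → Ranked (suc k) (run rankVertex (assign J k 6 s))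
      rank-step {k} {s} now atI R = ifZero-elim (Ranked (suc k)) (eval (outsideE (‵ J)) (assign J k 6 s))
        (λ z → record
          { next = trans (cong (_+ 1) next) (select-suc (outside i) k (trans (sym value) z))
          ; ranks = λ x< z → old (<suc x<) z })
        (λ nz → record
          { next = trans (trans next (sym (ℕ.+-identityʳ _))) (select-suc (outside i) k (trans (sym value) nz))
          ; ranks = λ x< z → same nz (<suc x<) z })
        where
        open Ranked R
        value : eval (outsideE (‵ J)) (assign J k 6 s) ≡ outside i k
        value = outside-eval (setting-assign J k 6 tt now) atI (‵ J) refl
        old : ∀ {x} → x < k ⊎ x ≡ k → outside i x ≡ 0 → (arr s IDX [ k ≔ var s X ]) x ≡ rank i x
        old (inj₁ x<k)  z = trans (update-≢ (arr s IDX) (ℕ.<⇒≢ x<k)) (ranks x<k z)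
        old (inj₂ refl) z = trans (update-≡ (arr s IDX) k) next
        same : ∀ {d x} → eval (outsideE (‵ J)) (assign J k 6 s) ≡ suc d → x < k ⊎ x ≡ k → outside i x ≡ 0 → arr s IDX x ≡ rank i x
        same nz (inj₁ x<k)  z = ranks x<k z
        same nz (inj₂ refl) z = case trans (sym nz) (trans value z) of λ ()

      ranked-run : ∀ {c s s′ k} → T (keepsVar X c ∧ keepsArr IDX c) → Agree c s s′ → Ranked k s → Ranked k s′
      ranked-run {c} p ag R with ∧-T {keepsVar X c} p
      ... | p₁ , p₂ = record { next = trans (onVar ag X {p₁}) next
                             ; ranks = λ {x} x< z → trans (cong (λ f → f x) (onArr ag IDX {p₂})) (ranks x< z) }
        where open Ranked R

      Counted : ℕ → Store → Set
      Counted k s = var s Y ≡ length (select (edgeOutside i) k)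

      count-step : ∀ {k s} → Setting s → var s I ≡ i → Counted k s → Counted (suc k) (run countEdge (assign J k 6 s))
      count-step {k} {s} now atI eq = ifZero-elim (Counted (suc k)) (eval edgeOutsideE (assign J k 6 s))
        (λ z → trans (cong (_+ 1) eq) (select-suc (edgeOutside i) k (trans (sym value) z)))
        (λ nz → trans (trans eq (sym (ℕ.+-identityʳ _))) (select-suc (edgeOutside i) k (trans (sym value) nz)))
        where
        value : eval edgeOutsideE (assign J k 6 s) ≡ edgeOutside i k
        value = edgeOutside-eval (setting-assign J k 6 tt now) atI refl

      module _ (t< : ∀ {a} → a < e → t a < v) (h< : ∀ {a} → a < e → h a < v) where

        Emitted : List ℕ → List Carrier → ℕ → Store → Set
        Emitted xs ys k s = Written (xs ++ gather (edgeEntry i) k) (ys ++ gather (weightEntry i) k) s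

        emit-step : ∀ {k s xs ys} → k < e → Setting s → var s I ≡ i → Ranked v s → Emitted xs ys k s →
                    Emitted xs ys (suc k) (run emitEdge (assign J k 6 s))
        emit-step {k} {s} {xs} {ys} k<e now atI R W = ifZero-elim (Emitted xs ys (suc k)) (eval edgeOutsideE (assign J k 6 s)) inside skipped
          where
          open Ranked R
          open Setting now
          value : eval edgeOutsideE (assign J k 6 s) ≡ edgeOutside i k
          value = edgeOutside-eval (setting-assign J k 6 tt now) atI refl
          entry : ∀ {n} → edgeOutside i k ≡ n → edgeEntry i k ≡ (ifZero n then rank i (t k) ∷ rank i (h k) ∷ [] else [])
          entry refl = refl
          entryℝ : ∀ {n} → edgeOutside i k ≡ n → weightEntry i k ≡ (ifZero n then w k ∷ [] else [])
          entryℝ refl = refl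
          skipped : ∀ {d} → eval edgeOutsideE (assign J k 6 s) ≡ suc d → Emitted xs ys (suc k) (wait (costE edgeOutsideE + 4) (assign J k 6 s))
          skipped {d} nz = subst₂ (λ xs ys → Written xs ys (wait (costE edgeOutsideE + 4) (assign J k 6 s)))
            (trans (sym (++-identityʳ _)) (trans (++-assoc xs _ []) (cong (xs ++_) (gather-suc (edgeEntry i) k (sym (entry {suc d} at-k))))))
            (trans (sym (++-identityʳ _)) (trans (++-assoc ys _ []) (cong (ys ++_) (gather-suc (weightEntry i) k (sym (entryℝ {suc d} at-k))))))
            (written-wait _ (written-assign J k 6 tt W))
            where
            at-k = trans (sym value) nz
          inside : eval edgeOutsideE (assign J k 6 s) ≡ 0 → Emitted xs ys (suc k)
            (run (push (IDX ⟨ TL ⟨ ‵ J ⟩ ⟩) ⨾ push (IDX ⟨ HD ⟨ ‵ J ⟩ ⟩) ⨾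
                  copyℝ (‵ E ⊕ ‵ REALPOS) (‵ J) ⨾ REALPOS ≔ ‵ REALPOS ⊕ lit 1) (wait (costE edgeOutsideE + 4) (assign J k 6 s)))
          inside z = subst₂ (λ xs ys → Written xs ys s₄)
              (trans (++-assoc (xs ++ gather (edgeEntry i) k) _ _) (trans (++-assoc xs _ _) (cong (xs ++_) (gather-suc (edgeEntry i) k (sym (entry {0} at-k))))))
              (trans (++-assoc ys _ _) (cong (ys ++_) (gather-suc (weightEntry i) k (sym (entryℝ {0} at-k)))))
              (record
                { out = out ; pos = pos
                ; outℝ = subst₂ (λ n c → StoredAt _≡_ (real s₂ [ n ≔ c ]) e (ys′ ++ w k ∷ []))
                    (cong₂ _+_ (sym sizeE) (sym posℝ)) (sym (weights k<e)) (stored-snoc ys′ refl outℝ)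
                ; posℝ = length-snoc ys′ posℝ
                ; weights = λ {j} j<e → trans (update-≢ (real s₂) (λ eq → ℕ.<⇒≢ (ℕ.<-≤-trans j<e (ℕ.m≤m+n e _)) (trans eq (cong (_+ var s REALPOS) sizeE)))) (weights j<e) })
            where
            at-k = trans (sym value) z
            ys′ = ys ++ gather (weightEntry i) k
            s₀ = wait (costE edgeOutsideE + 4) (assign J k 6 s)
            s₁ = run (push (IDX ⟨ TL ⟨ ‵ J ⟩ ⟩)) s₀
            s₂ = run (push (IDX ⟨ HD ⟨ ‵ J ⟩ ⟩)) s₁
            s₄ = run (copyℝ (‵ E ⊕ ‵ REALPOS) (‵ J) ⨾ REALPOS ≔ ‵ REALPOS ⊕ lit 1) s₂
            idx : ∀ {x y} → y ≡ x → x < v → outside i x ≡ 0 → arr s IDX y ≡ rank i x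
            idx refl = ranks
            W₂ = push-written (IDX ⟨ HD ⟨ ‵ J ⟩ ⟩) {s₁}
              (idx (cong (λ f → f k) heads) (h< k<e) (ℕ.m+n≡0⇒n≡0 (outside i (t k)) at-k))
              (push-written (IDX ⟨ TL ⟨ ‵ J ⟩ ⟩) {s₀}
                (idx (cong (λ f → f k) tails) (t< k<e) (ℕ.m+n≡0⇒m≡0 _ at-k))
                (written-wait _ (written-assign J k 6 tt W)))
            open Written W₂

    module _ (t< : ∀ {a} → a < e → t a < v) (h< : ∀ {a} → a < e → h a < v) where

      record Produced (k : ℕ) (s : Store) : Set where
        field
          setting : Setting s
          written : Written (length (select (λ i → gap (col i) i) m) ∷ gather factorEntry k) (gather factorWeights k) s

      factor-step : ∀ {k s} → Produced k s → Produced (suc k) (run emitFactor (assign I k 6 s))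
      factor-step {i} {s} P = ifZero-elim (Produced (suc i)) (gap (arr s COL i) i) emit omit
        where
        open Produced P
        open Setting setting
        value : gap (arr s COL i) i ≡ gap (col i) i
        value = cong (λ f → gap (f i) i) cols
        sᵢ = wait (costE (COL ⟨ ‵ I ⟩ ≶ ‵ I) + 4) (assign I i 6 s)
        xs = length (select (λ i → gap (col i) i) m) ∷ gather factorEntry i
        ys = gather factorWeights i
        setᵢ : Setting sᵢ
        setᵢ = record { Setting (setting-assign I i 6 tt setting) }
        writtenᵢ : Written xs ys sᵢ
        writtenᵢ = written-wait _ (written-assign I i 6 tt written)
        entry : ∀ {n} → gap (col i) i ≡ n → factorEntry i ≡ (ifZero n
          then rank i v ∷ length (select (edgeOutside i) e) ∷ gather (edgeEntry i) e else [])
        entry refl = refl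
        entryℝ : ∀ {n} → gap (col i) i ≡ n → factorWeights i ≡ (ifZero n then gather (weightEntry i) e else [])
        entryℝ refl = refl
        omit : ∀ {d} → gap (arr s COL i) i ≡ suc d → Produced (suc i) sᵢ
        omit {d} nz = record
          { setting = setᵢ
          ; written = subst₂ (λ xs ys → Written xs ys sᵢ)
              (trans (sym (++-identityʳ xs)) (cong (_ ∷_) (gather-suc factorEntry i (sym (entry {suc d} at-i)))))
              (trans (sym (++-identityʳ ys)) (gather-suc factorWeights i (sym (entryℝ {suc d} at-i))))
              writtenᵢ }
          where at-i = trans (sym value) nz
        emit : gap (arr s COL i) i ≡ 0 → Produced (suc i)
          (run (X ≔ lit 0 ⨾ for J (‵ V) rankVertex ⨾ Y ≔ lit 0 ⨾ for J (‵ E) countEdge ⨾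
                push (‵ X) ⨾ push (‵ Y) ⨾ for J (‵ E) emitEdge) sᵢ)
        emit z = record
          { setting = set₅
          ; written = subst₂ (λ xs ys → Written xs ys s₅)
              (trans (++-assoc (xs ++ _ ∷ []) _ _) (trans (++-assoc xs _ _) (cong (_ ∷_) (gather-suc factorEntry i (sym (entry {0} at-i))))))
              (gather-suc factorWeights i (sym (entryℝ {0} at-i)))
              emitted }
          where
          at-i = trans (sym value) z
          s₁ = run (X ≔ lit 0) sᵢ
          s₂ = run (for J (‵ V) rankVertex) s₁
          s₂′ = run (Y ≔ lit 0) s₂
          s₃ = run (for J (‵ E) countEdge) s₂′
          s₄ = run (push (‵ X) ⨾ push (‵ Y)) s₃
          s₅ = run (for J (‵ E) emitEdge) s₄
          set₁ : Setting s₁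
          set₁ = setting-assign X 0 3 tt setᵢ
          ag₂ = agree (for J (‵ V) rankVertex) s₁
          ag₃ = agree (for J (‵ E) countEdge) s₂′
          ag₄ = agree (push (‵ X) ⨾ push (‵ Y)) s₃
          ag₅ = agree (for J (‵ E) emitEdge) s₄
          set₂ : Setting s₂′
          set₂ = setting-assign Y 0 3 tt (setting-run {for J (‵ V) rankVertex} tt ag₂ set₁)
          set₃ : Setting s₃
          set₃ = setting-run {for J (‵ E) countEdge} tt ag₃ set₂
          set₄ : Setting s₄
          set₄ = setting-run {push (‵ X) ⨾ push (‵ Y)} tt ag₄ set₃
          set₅ : Setting s₅
          set₅ = setting-run {for J (‵ E) emitEdge} tt ag₅ set₄
          I₂ : var s₂′ I ≡ i
          I₂ = onVar ag₂ I {_}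
          I₃ : var s₃ I ≡ i
          I₃ = trans (onVar ag₃ I {_}) I₂
          I₄ : var s₄ I ≡ i
          I₄ = trans (onVar ag₄ I {_}) I₃
          ranked : Ranked {i} v s₂
          ranked = for-induction J (‵ V) rankVertex {s₁} Ranked (Setting.sizeV set₁)
            (record { next = refl ; ranks = λ () })
            (λ _ ag → rank-step (setting-run {for J (‵ V) rankVertex} tt ag set₁) (onVar ag I {_}))
          counted : Counted {i} e s₃
          counted = for-induction J (‵ E) countEdge {s₂′} (Counted {i}) (Setting.sizeE set₂) refl
            (λ _ ag → count-step {i} (setting-run {for J (‵ E) countEdge} tt ag set₂) (trans (onVar ag I {_}) I₂))
          ranked₄ : Ranked {i} v s₄
          ranked₄ = ranked-run {c = push (‵ X) ⨾ push (‵ Y)} tt ag₄ (ranked-run {c = for J (‵ E) countEdge} tt ag₃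
            (record { next = next ; ranks = ranks }))
            where open Ranked ranked
          written₃ : Written xs ys s₃
          written₃ = written-run {for J (‵ E) countEdge} tt ag₃ (written-assign Y 0 3 tt
            (written-run {for J (‵ V) rankVertex} tt ag₂ (written-assign X 0 3 tt writtenᵢ)))
          written₄ : Written ((xs ++ rank i v ∷ []) ++ length (select (edgeOutside i) e) ∷ []) ys s₄
          written₄ = push-written (‵ Y) {run (push (‵ X)) s₃} counted
            (push-written (‵ X) {s₃} (trans (onVar ag₃ X {_}) (Ranked.next ranked)) written₃)
          xs₄ = (xs ++ rank i v ∷ []) ++ length (select (edgeOutside i) e) ∷ []
          emitted : Written (xs₄ ++ gather (edgeEntry i) e) (ys ++ gather (weightEntry i) e) s₅
          emitted = for-induction J (‵ E) emitEdge {s₄} (Emitted {i} t< h< xs₄ ys) (Setting.sizeE set₄)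
            (subst₂ (λ xs ys → Written xs ys (wait 4 s₄)) (sym (++-identityʳ xs₄)) (sym (++-identityʳ ys)) (written-wait 4 written₄))
            (λ k<e ag → emit-step {i} t< h< k<e (setting-run {for J (‵ E) emitEdge} tt ag set₄) (trans (onVar ag I {_}) I₄)
              (ranked-run {c = for J (‵ E) emitEdge} tt ag ranked₄))

      record Tallied (k : ℕ) (s : Store) : Set where
        field
          tally : var s CNT ≡ length (select (λ i → gap (col i) i) k)

      output-general : ∀ s → Setting s → var s CNT ≡ 0 → Written [] [] s →
        Written (colourCount ∷ gather factorEntry m) (gather factorWeights m)
                (run (for I (‵ M) countFactor ⨾ push (‵ CNT) ⨾ for I (‵ M) emitFactor) s)
      output-general s now zeroCNT W = Produced.written
          (for-induction I (‵ M) emitFactor {s₂} Produced (Setting.sizeM set₂)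
            (record { setting = record { Setting set₂ } ; written = written-wait 4 written₂ })
            (λ _ _ → factor-step))
        where
        s₁ = run (for I (‵ M) countFactor) s
        s₂ = run (push (‵ CNT)) s₁
        ag₁ = agree (for I (‵ M) countFactor) s
        set₂ : Setting s₂
        set₂ = setting-run {push (‵ CNT)} tt (agree (push (‵ CNT)) s₁) (setting-run {for I (‵ M) countFactor} tt ag₁ now)
        tallied : Tallied m s₁
        tallied = for-induction I (‵ M) countFactor {s} Tallied (Setting.sizeM now) (record { tally = zeroCNT }) step
          where
          step : ∀ {k s′} → k < m → Agree (for I (‵ M) countFactor) s s′ → Tallied k s′ → Tallied (suc k) (run countFactor (assign I k 6 s′))
          step {k} {s′} _ ag T = ifZero-elim (Tallied (suc k)) (gap (arr s′ COL k) k)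
            (λ z → record { tally = trans (cong (_+ 1) tally) (select-suc (λ i → gap (col i) i) k (trans (sym value) z)) })
            (λ nz → record { tally = trans (trans tally (sym (ℕ.+-identityʳ _))) (select-suc (λ i → gap (col i) i) k (trans (sym value) nz)) })
            where
            open Tallied T
            value : gap (arr s′ COL k) k ≡ gap (col k) k
            value = cong (λ f → gap (f k) k) (trans (onArr ag COL {_}) (Setting.cols now))
        written₂ : Written (colourCount ∷ []) [] s₂
        written₂ = push-written (‵ CNT) {s₁} (Tallied.tally tallied) (written-run {for I (‵ M) countFactor} tt ag₁ W)

-- Walks and products

module _ (p : ℕ → ℕ) where

  count : ℕ → ℕ
  count k = length (select p k)

  count-in : ∀ {k} → p k ≡ 0 → count (suc k) ≡ suc (count k)
  count-in {k} eq rewrite eq = trans (length-++ (select p k)) (ℕ.+-comm _ 1)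

  count-out : ∀ {k d} → p k ≡ suc d → count (suc k) ≡ count k
  count-out {k} eq rewrite eq = cong length (++-identityʳ (select p k))

  count-mono-suc : ∀ k → count k ≤ count (suc k)
  count-mono-suc k with p k in eq
  ... | zero  = ℕ.≤-trans (ℕ.n≤1+n _) (ℕ.≤-reflexive (sym (trans (length-++ (select p k)) (ℕ.+-comm _ 1))))
  ... | suc d = ℕ.≤-reflexive (cong length (sym (++-identityʳ (select p k))))

  count-mono : ∀ {j k} → j ≤ k → count j ≤ count k
  count-mono {j} {zero}  z≤n = ℕ.≤-refl
  count-mono {j} {suc k} j≤ with ℕ.m≤n⇒m<n∨m≡n j≤
  ... | inj₁ (s≤s j≤k) = ℕ.≤-trans (count-mono j≤k) (count-mono-suc k)
  ... | inj₂ refl      = ℕ.≤-refl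

  count-< : ∀ {j k} → p j ≡ 0 → j < k → count j < count k
  count-< {j} eq j<k = ℕ.≤-trans (ℕ.≤-reflexive (sym (count-in {j} eq))) (count-mono j<k)

  count-injective : ∀ {j k} → p j ≡ 0 → p k ≡ 0 → count j ≡ count k → j ≡ k
  count-injective {j} {k} pj pk eq with ℕ.<-cmp j k
  ... | tri< j<k _ _ = contradiction eq (ℕ.<⇒≢ (count-< pj j<k))
  ... | tri≈ _ j≡k _ = j≡k
  ... | tri> _ _ k<j = contradiction (sym eq) (ℕ.<⇒≢ (count-< pk k<j))

  -- With `count-injective` this makes `count` a bijection from the members below `n` onto the
  -- numbers below `count n`, the numbering of the vertices of a layer.
  nth : ∀ n {j} → j < count n → ∃ λ x → x < n × p x ≡ 0 × count x ≡ j
  nth (suc n) {j} j< with p n in eq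
  ... | suc d = let x , x<n , q = nth n (subst (λ l → j < l) (cong length (++-identityʳ (select p n))) j<)
                in x , ℕ.m≤n⇒m≤1+n x<n , q
  ... | zero with <suc (subst (j <_) (trans (length-++ (select p n)) (ℕ.+-comm _ 1)) j<)
  ...   | inj₂ j≡ = n , ℕ.≤-refl , eq , sym j≡
  ...   | inj₁ j<′ = let x , x<n , q = nth n j<′ in x , ℕ.m≤n⇒m≤1+n x<n , q

module Networks (ℛ : Reals) where
  open Reals ℛ using (Carrier; _≈_)
  open OverReals ℛ

  module Erasure (N : Network) (_≟_ : (u v : Network.Vertex N) → Dec (u ≡ v)) where
    open Network N
    open DecMembership _≟_ using (_∈?_)

    suffix : ∀ {u v w} (p : Star Adj v w) → Unique (vertices N p) → u ∈ vertices N p → Path N u w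
    suffix ε       q       (here refl) = ε , q
    suffix (e ◅ p) q       (here refl) = e ◅ p , q
    suffix (e ◅ p) (_ ∷ q) (there u∈)  = suffix p q u∈

    -- The field `connected` asks for a path without repeated vertices, whereas the connectedness of
    -- a layer is obtained from walks. Whenever the first vertex recurs, everything before its
    -- recurrence is cut off.
    erase : ∀ {u v} → Star Adj u v → Path N u v
    erase ε = ε , [] ∷ []
    erase {u} (e ◅ p) with erase p
    ... | p′ , q with u ∈? vertices N p′
    ...   | yes u∈ = suffix p′ q u∈
    ...   | no u∉  = e ◅ p′ , ¬Any⇒All¬ _ u∉ ∷ q

  Tuple : List WeightedGraph → Set
  Tuple = All (λ G → Fin (order G))

  component : ∀ {Gs} → Tuple Gs → (i : Fin (length Gs)) → Fin (order (List.lookup Gs i))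
  component u i = All.lookup u (∈-lookup i)

  build : ∀ {Gs} → ((i : Fin (length Gs)) → Fin (order (List.lookup Gs i))) → Tuple Gs
  build {[]}    f = []
  build {G ∷ Gs} f = f zero ∷ build (f ∘ suc)

  component-build : ∀ {Gs} f i → component {Gs} (build f) i ≡ f i
  component-build {G ∷ Gs} f zero    = refl
  component-build {G ∷ Gs} f (suc i) = component-build {Gs} (f ∘ suc) i

  tuple-ext : ∀ {Gs} {u v : Tuple Gs} → (∀ i → component u i ≡ component v i) → u ≡ v
  tuple-ext {u = []}    {[]}    eq = refl
  tuple-ext {u = x ∷ u} {y ∷ v} eq = cong₂ _∷_ (eq zero) (tuple-ext (eq ∘ suc))

  -- Repeats, up to definitional equality, the relation that is local to `∏` and has no name outside
  -- it.
  DifferOnlyAt : ∀ {Gs} → Tuple Gs → Tuple Gs → Fin (length Gs) → Set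
  DifferOnlyAt {Gs} u v ℓ =
    WeightedGraph.Adj (List.lookup Gs ℓ) (component u ℓ) (component v ℓ) ×
    (∀ i → i ≢ ℓ → component u i ≡ component v i)

  differ-unique : ∀ {Gs} {u v : Tuple Gs} {ℓ ℓ′} → DifferOnlyAt u v ℓ →
                  WeightedGraph.Adj (List.lookup Gs ℓ′) (component u ℓ′) (component v ℓ′) → ℓ ≡ ℓ′
  differ-unique {Gs} {u} {v} {ℓ} {ℓ′} (_ , same) e with ℓ′ Fin.≟ ℓ
  ... | yes eq = sym eq
  ... | no ne  = contradiction (subst (λ x → WeightedGraph.Adj (List.lookup Gs ℓ′) x (component v ℓ′)) (same ℓ′ ne) e)
                   (WeightedGraph.irrefl (List.lookup Gs ℓ′))

  product-edge : ∀ {Gs} {u v : Tuple Gs} {ℓ} → DifferOnlyAt u v ℓ → Network.Adj (∏ Gs) u v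
  product-edge {Gs} {u} {v} {ℓ} D = ℓ , D , λ D′ → differ-unique {Gs} {u} {v} D (proj₁ D′)

  replace : ∀ {Gs} → Tuple Gs → (j : Fin (length Gs)) → Fin (order (List.lookup Gs j)) → Tuple Gs
  replace {G ∷ Gs} (_ ∷ u) zero    x = x ∷ u
  replace {G ∷ Gs} (y ∷ u) (suc j) x = y ∷ replace u j x

  replace-at : ∀ {Gs} (u : Tuple Gs) j x → component (replace u j x) j ≡ x
  replace-at {G ∷ Gs} (_ ∷ u) zero    x = refl
  replace-at {G ∷ Gs} (_ ∷ u) (suc j) x = replace-at u j x

  replace-other : ∀ {Gs} (u : Tuple Gs) j x {i} → i ≢ j → component (replace u j x) i ≡ component u i
  replace-other {G ∷ Gs} (y ∷ u) zero    x {zero}  ne = contradiction refl ne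
  replace-other {G ∷ Gs} (y ∷ u) zero    x {suc i} ne = refl
  replace-other {G ∷ Gs} (y ∷ u) (suc j) x {zero}  ne = refl
  replace-other {G ∷ Gs} (y ∷ u) (suc j) x {suc i} ne = replace-other u j x (ne ∘ cong suc)

-- Colourings and their layers

module GraphWalks (ℛ : Reals) (G : OverReals.WeightedGraph ℛ) where
  open Reals ℛ using (Carrier; _≈_)
  open OverReals ℛ
  open WeightedGraph G public using (Adj; weight; irrefl; symmetric; weight-sym)
  open WeightedGraph G using (connected)

  Vertex : Set
  Vertex = Fin (order G)

  ≈-refl : ∀ {x} → x ≈ x
  ≈-refl = IsDecTotalOrder.Eq.refl (Reals.isDecTotalOrder ℛ)

  ≈-sym : ∀ {x y} → x ≈ y → y ≈ x
  ≈-sym = IsDecTotalOrder.Eq.sym (Reals.isDecTotalOrder ℛ)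

  ≈-trans : ∀ {x y z} → x ≈ y → y ≈ z → x ≈ z
  ≈-trans = IsDecTotalOrder.Eq.trans (Reals.isDecTotalOrder ℛ)

  weight-irr : ∀ {u v} (e f : Adj u v) → weight e ≈ weight f
  weight-irr e f = subst (λ g → weight e ≈ weight g) (T-irrelevant e f) ≈-refl

  infixl 5 _▹_
  data Walk (u : Vertex) : ℕ → Vertex → Set where
    here : Walk u 0 u
    _▹_  : ∀ {n v w} → Walk u n v → Adj v w → Walk u (suc n) w

  _▸_ : ∀ {u v w n} → Adj u v → Walk v n w → Walk u (suc n) w
  e ▸ here    = here ▹ e
  e ▸ (p ▹ f) = (e ▸ p) ▹ f

  backward : ∀ {u v n} → Walk u n v → Walk v n u
  backward here    = here
  backward (p ▹ e) = symmetric e ▸ backward p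

  walk : ∀ {u v} → Star Adj u v → ∃ λ n → Walk u n v
  walk ε       = 0 , here
  walk (e ◅ p) = let n , q = walk p in suc n , e ▸ q

  some-walk : ∀ u v → ∃ λ n → Walk u n v
  some-walk u v = walk (proj₁ (connected u v))

  record IsHopDistance (d : Vertex → Vertex → ℕ) : Set where
    field
      shortest : ∀ u v → Walk u (d u v) v
      minimal  : ∀ {u v n} → Walk u n v → d u v ≤ n

    d-self : ∀ u → d u u ≡ 0
    d-self u = ℕ.n≤0⇒n≡0 (minimal here)

    d-sym : ∀ u v → d u v ≡ d v u
    d-sym u v = ℕ.≤-antisym (minimal (backward (shortest v u))) (minimal (backward (shortest u v)))

    d-zero : ∀ {u v} → d u v ≡ 0 → u ≡ v
    d-zero {u} {v} eq with d u v | shortest u v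
    d-zero refl | .0 | here = refl

    d-pos : ∀ {u v} → u ≢ v → 0 < d u v
    d-pos {u} {v} u≢v with d u v in eq
    ... | zero  = contradiction (d-zero eq) u≢v
    ... | suc k = z<s

    d-adj : ∀ {u v} → Adj u v → d u v ≡ 1
    d-adj {u} {v} e = ℕ.≤-antisym (minimal (here ▹ e)) (d-pos (λ { refl → irrefl e }))

    d-one : ∀ {u v} → d u v ≡ 1 → Adj u v
    d-one {u} {v} eq with d u v | shortest u v
    d-one refl | .1 | here ▹ e = e

    descent : ∀ {u v} → u ≢ v → ∃ λ v′ → Adj v′ v × d u v ≡ suc (d u v′)
    descent {u} {v} u≢v = go (d u v) refl (shortest u v)
      where
      go : ∀ n → d u v ≡ n → Walk u n v → ∃ λ v′ → Adj v′ v × d u v ≡ suc (d u v′)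
      go zero    eq p = contradiction (d-zero eq) u≢v
      go (suc n) eq (_▹_ {v = v′} p e) = v′ , e , ℕ.≤-antisym
        (minimal (shortest u v′ ▹ e)) (subst (suc (d u v′) ≤_) (sym eq) (s≤s (minimal p)))

module Colours (ℛ : Reals) (G : OverReals.WeightedGraph ℛ) where
  open Reals ℛ using (Carrier; _≈_)
  open OverReals ℛ
  open GraphWalks ℛ G

  Separates : (Vertex → Vertex → ℕ) → (u v x y : Vertex) → Set
  Separates d u v x y = d u x + d v y ≢ d u y + d v x

  Opposite : ∀ {u v w} → Adj u v → Adj u w → Vertex → Set
  Opposite {u} {v} {w} e f x = x ≢ u ×
    (Σ[ g ∈ Adj w x ] weight e ≈ weight g) × (Σ[ g ∈ Adj v x ] weight f ≈ weight g)

  module _ {d : Vertex → Vertex → ℕ} (isHop : IsHopDistance d) (κ : Vertex → Vertex → ℕ)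
    (same : ∀ {u v x y} → Adj u v → Adj x y → Separates d u v x y → κ u v ≡ κ x y)
    (square : ∀ {u v w} (e : Adj u v) (f : Adj u w) → κ u v ≢ κ u w → ∃ (Opposite e f)) where
    open IsHopDistance isHop

    -- An edge is in relation Θ with its reversal, as 1 + 1 differs from 0 + 0.
    κ-sym : ∀ {u v} → Adj u v → κ u v ≡ κ v u
    κ-sym {u} {v} e = same e (symmetric e) λ eq → case trans (sym (cong₂ _+_ (d-adj e) (d-adj (symmetric e))))
      (trans eq (cong₂ _+_ (d-self u) (d-self v))) of λ ()

    -- For the product decomposition this relation will turn out to be the
    -- equality of the coordinates of colour i.
    infix 4 _∼[_]_
    _∼[_]_ : Vertex → ℕ → Vertex → Set
    u ∼[ i ] v = ∀ {x y} → Adj x y → κ x y ≡ i → d u x + d v y ≡ d u y + d v x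

    ∼-refl : ∀ {i u} → u ∼[ i ] u
    ∼-refl {u = u} {x} {y} _ _ = ℕ.+-comm (d u x) (d u y)

    ∼-sym : ∀ {i u v} → u ∼[ i ] v → v ∼[ i ] u
    ∼-sym {u = u} {v} p {x} {y} e eq = begin
      d v x + d u y ≡⟨ ℕ.+-comm (d v x) (d u y) ⟩
      d u y + d v x ≡⟨ p e eq ⟨
      d u x + d v y ≡⟨ ℕ.+-comm (d u x) (d v y) ⟩
      d v y + d u x ∎
      where open ≡-Reasoning

    -- The relation says that the differences `d u x - d u y` and `d v x - d v y` agree on all edges
    -- `xy` of colour `i`. This is an equality of functions, written without subtraction.
    ∼-trans : ∀ {i u v w} → u ∼[ i ] v → v ∼[ i ] w → u ∼[ i ] w
    ∼-trans {u = u} {v} {w} p q {x} {y} e eq = ℕ.+-cancelʳ-≡ (d v x + d v y) _ _ (begin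
      d u x + d w y + (d v x + d v y)   ≡⟨ shift (d u x) (d w y) (d v x) (d v y) ⟩
      d u x + d v y + (d v x + d w y)   ≡⟨ cong₂ _+_ (p e eq) (q e eq) ⟩
      d u y + d v x + (d v y + d w x)   ≡⟨ shift′ (d u y) (d v x) (d v y) (d w x) ⟩
      d u y + d w x + (d v x + d v y)   ∎)
      where
      open ≡-Reasoning
      shift : ∀ a b c e → a + b + (c + e) ≡ a + e + (c + b)
      shift = solve-∀
      shift′ : ∀ a b c e → a + b + (c + e) ≡ a + e + (b + c)
      shift′ = solve-∀

    edge-∼ : ∀ {i u v} → Adj u v → κ u v ≢ i → u ∼[ i ] v
    edge-∼ {i} {u} {v} e κ≢i {x} {y} f eq with d u x + d v y ℕ.≟ d u y + d v x
    ... | yes p = p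
    ... | no ¬p = contradiction (trans (same e f ¬p) eq) κ≢i

    -- If `u` and `v` differ, the last edge `v′v` of a shortest walk from `u` to `v` separates them:
    -- it increases the distance from `u` and decreases that from `v`.
    ∼-injective : ∀ {u v} → (∀ i → u ∼[ i ] v) → u ≡ v
    ∼-injective {u} {v} all with u Fin.≟ v
    ... | yes u≡v = u≡v
    ... | no u≢v with descent u≢v
    ...   | v′ , e , eq = contradiction (trans (all (κ v′ v) e refl) (cong₂ _+_ eq (d-adj (symmetric e))))
      (λ eq → ℕ.<⇒≢ (absurd (d u v′)) (trans (cong (d u v′ +_) (sym (d-self v))) eq))
      where
      absurd : ∀ a → a + 0 < suc a + 1
      absurd a = ℕ.≤-trans (s≤s (ℕ.≤-reflexive (ℕ.+-identityʳ a))) (ℕ.m≤m+n (suc a) 1)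

    -- The diagonals `ux` and `vw` have total length at least 3, but two opposite sides only 2, so
    -- opposite sides are in relation Θ. Here `v` and `w` are not adjacent, because two sides of a
    -- triangle would be in relation Θ and have the same colour.
    square-colours : ∀ {u v w x} → Adj u v → Adj u w → Adj v x → Adj w x → x ≢ u → κ u v ≢ κ u w →
                     κ w x ≡ κ u v × κ v x ≡ κ u w
    square-colours {u} {v} {w} {x} e f g k x≢u κ≢ =
      sym (same e k (λ eq → ℕ.<⇒≢ large (trans (sym (cong₂ _+_ (d-adj f) (d-adj g))) eq))) ,
      sym (same f g (λ eq → ℕ.<⇒≢ large (trans (sym (cong₂ _+_ (d-adj e) (d-adj k))) (trans eq (cong (d u x +_) (d-sym w v))))))
      where
      v≢w : v ≢ w
      v≢w refl = κ≢ refl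
      triangle : ¬ Adj v w
      triangle vw = κ≢ (same e f (λ eq → case trans (sym (cong₂ _+_ (d-self u) (d-adj vw)))
        (trans eq (cong₂ _+_ (d-adj f) (trans (d-sym v u) (d-adj e)))) of λ ()))
      far : 1 < d v w
      far = ℕ.≤∧≢⇒< (d-pos v≢w) (triangle ∘ d-one ∘ sym)
      large : 2 < d u x + d v w
      large = ℕ.+-mono-≤ (d-pos (x≢u ∘ sym)) far

    -- Walks are kept, and not just the relation `∼[ i ]` between their ends, because `transport`
    -- carries edges along them.
    data Avoiding (i : ℕ) (u : Vertex) : Vertex → Set where
      here : Avoiding i u u
      step : ∀ {v w} → Avoiding i u v → Adj v w → κ v w ≢ i → Avoiding i u w

    avoiding-∼ : ∀ {i u v} → Avoiding i u v → u ∼[ i ] v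
    avoiding-∼ here             = ∼-refl
    avoiding-∼ {i} (step p e κ≢i) = ∼-trans {i} (avoiding-∼ p) (edge-∼ e κ≢i)

    step-first : ∀ {i u v w} → Adj u v → κ u v ≢ i → Avoiding i v w → Avoiding i u w
    step-first e κ≢i here           = step here e κ≢i
    step-first e κ≢i (step p f κ≢i′) = step (step-first e κ≢i p) f κ≢i′

    avoiding-sym : ∀ {i u v} → Avoiding i u v → Avoiding i v u
    avoiding-sym here           = here
    avoiding-sym (step p e κ≢i) = step-first (symmetric e) (κ≢i ∘ trans (κ-sym e)) (avoiding-sym p)

    -- Carries an edge of colour i at the end of a walk that avoids i back to
    -- the beginning of the walk, one square at a time.
    transport : ∀ {i u v v′} → Avoiding i u v → (e : Adj v v′) → κ v v′ ≡ i →
      ∃ λ u′ → (Σ[ f ∈ Adj u u′ ] weight e ≈ weight f) × κ u u′ ≡ i × Avoiding i u′ v′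
    transport {v′ = v′} here e eq = v′ , (e , ≈-refl) , eq , here
    transport {i} {v′ = v′} (step {w} {v} p g κ≢i) e eq
      with square e (symmetric g) (λ eq′ → κ≢i (trans (κ-sym g) (trans (sym eq′) eq)))
    ... | y , y≢v , (k , e≈k) , (l , _)
      with square-colours e (symmetric g) l k y≢v (λ eq′ → κ≢i (trans (κ-sym g) (trans (sym eq′) eq)))
    ...   | κwy , κv′y with transport p k (trans κwy eq)
    ...     | u′ , (f , k≈f) , eq′ , q = u′ , (f , ≈-trans e≈k k≈f) , eq′ ,
      step q (symmetric l) (λ eq″ → κ≢i (trans (κ-sym g) (trans (sym κv′y) (trans (κ-sym l) eq″))))

    -- All that the product decomposition and primality use of a factor: a projection whose fibres
    -- are the classes of `∼[ i ]`, along which edges of colour `i` descend and lift, with a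
    -- section. The root and the numbering stay hidden.
    record IsLayer (i : ℕ) (H : WeightedGraph) : Set where
      field
        π        : Vertex → Fin (order H)
        π-∼      : ∀ {u v} → π u ≡ π v → u ∼[ i ] v
        ∼-π      : ∀ {u v} → u ∼[ i ] v → π u ≡ π v
        down     : ∀ {u v} (e : Adj u v) → κ u v ≡ i →
                   Σ[ f ∈ WeightedGraph.Adj H (π u) (π v) ] weight e ≈ WeightedGraph.weight H f
        lift     : ∀ u {y} (f : WeightedGraph.Adj H (π u) y) →
                   ∃ λ v → (Σ[ e ∈ Adj u v ] weight e ≈ WeightedGraph.weight H f) × κ u v ≡ i × π v ≡ y
        embed    : Fin (order H) → Vertex
        π-embed  : ∀ x → π (embed x) ≡ x
        embed-adj : ∀ {x y} → WeightedGraph.Adj H x y → Adj (embed x) (embed y) × κ (embed x) (embed y) ≡ i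

      -- Lifts a walk of the factor edge by edge. The lift uses colour `i` only, so coordinate `i`
      -- becomes `y` and all others are preserved.
      move : ∀ u y → ∃ λ v → π v ≡ y × (∀ {j} → j ≢ i → Avoiding j u v)
      move u y = go u refl (proj₁ (WeightedGraph.connected H (π u) y))
        where
        go : ∀ u {x y} → π u ≡ x → Star (WeightedGraph.Adj H) x y → ∃ λ v → π v ≡ y × (∀ {j} → j ≢ i → Avoiding j u v)
        go u refl ε = u , refl , λ _ → here
        go u refl (f ◅ p) with lift u f
        ... | v , (e , _) , κ≡i , refl with go v refl p
        ...   | w , eq , avoid = w , eq , λ j≢i → step-first e (λ κ≡j → j≢i (trans (sym κ≡j) κ≡i)) (avoid j≢i)

    module _ (r : Vertex) where

      InLayer : ℕ → Vertex → Set
      InLayer i v = ∀ {j} → j ≢ i → r ∼[ j ] v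

      layer-unique : ∀ {i u v} → InLayer i u → InLayer i v → u ∼[ i ] v → u ≡ v
      layer-unique {i} {u} {v} p q sim = ∼-injective sim′
        where
        sim′ : ∀ j → u ∼[ j ] v
        sim′ j with j ℕ.≟ i
        ... | yes refl = sim
        ... | no j≢i   = ∼-trans {j} (∼-sym {j} (p j≢i)) (q j≢i)

      layer-step : ∀ {i u v} → InLayer i u → Adj u v → κ u v ≡ i → InLayer i v
      layer-step p e eq {j} j≢i = ∼-trans {j} (p j≢i) (edge-∼ e (λ eq′ → j≢i (trans (sym eq′) eq)))

      -- Follows a walk from `r`: an edge of another colour leaves the projection `x` unchanged, and
      -- an edge of colour `i` is transported back to `x`, where it leads to the next vertex of the
      -- layer.
      project : ∀ i v → ∃ λ x → InLayer i x × Avoiding i x v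
      project i v = go (proj₂ (some-walk r v))
        where
        go : ∀ {n v} → Walk r n v → ∃ λ x → InLayer i x × Avoiding i x v
        go here = r , (λ {j} _ → ∼-refl {j}) , here
        go (_▹_ {v = v} {w} p e) with go p | κ v w ℕ.≟ i
        ... | x , inL , q | no κ≢i  = x , inL , step q e κ≢i
        ... | x , inL , q | yes κ≡i with transport q e κ≡i
        ...   | x′ , (f , _) , eq , q′ = x′ , layer-step inL f eq , q′

      -- If the edge had another colour, `u` and `v` would agree in that coordinate through `r`; but
      -- an edge separates its own ends.
      layer-edge : ∀ {i u v} → InLayer i u → InLayer i v → Adj u v → κ u v ≡ i
      layer-edge {i} {u} {v} p q e with κ u v ℕ.≟ i
      ... | yes eq = eq
      ... | no ne  = contradiction
        (trans (sym (cong₂ _+_ (d-self u) (d-self v))) (trans (∼-trans {κ u v} (∼-sym {κ u v} (p ne)) (q ne) e refl)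
          (cong₂ _+_ (d-adj e) (d-adj (symmetric e))))) λ ()

      -- `p` stands for the membership test computed by the program. Numbering the members by
      -- `count p` matches the ranks in the output.
      module LayerGraph (i : ℕ) (p : ℕ → ℕ)
        (sound : ∀ v → p (toℕ v) ≡ 0 → InLayer i v) (complete : ∀ v → InLayer i v → p (toℕ v) ≡ 0) where

        size : ℕ
        size = count p (order G)

        index : ∀ v → p (toℕ v) ≡ 0 → Fin size
        index v eq = fromℕ< (count-< p {toℕ v} {order G} eq (toℕ<n v))

        toℕ-index : ∀ v eq → toℕ (index v eq) ≡ count p (toℕ v)
        toℕ-index v eq = toℕ-fromℕ< (count-< p {toℕ v} {order G} eq (toℕ<n v))

        private
          member : (x : Fin size) → ∃ λ y → y < order G × p y ≡ 0 × count p y ≡ toℕ x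
          member x = nth p (order G) (toℕ<n x)

        inject : Fin size → Vertex
        inject x = fromℕ< (proj₁ (proj₂ (member x)))

        toℕ-inject : ∀ x → toℕ (inject x) ≡ proj₁ (member x)
        toℕ-inject x = toℕ-fromℕ< (proj₁ (proj₂ (member x)))

        inject-in : ∀ x → p (toℕ (inject x)) ≡ 0
        inject-in x = trans (cong p (toℕ-inject x)) (proj₁ (proj₂ (proj₂ (member x))))

        index-inject : ∀ x eq → index (inject x) eq ≡ x
        index-inject x eq = toℕ-injective (trans (toℕ-index (inject x) eq)
          (trans (cong (count p) (toℕ-inject x)) (proj₂ (proj₂ (proj₂ (member x))))))

        inject-index : ∀ v eq → inject (index v eq) ≡ v
        inject-index v eq = toℕ-injective (count-injective p (inject-in (index v eq)) eq
          (trans (cong (count p) (toℕ-inject _)) (trans (proj₂ (proj₂ (proj₂ (member (index v eq))))) (toℕ-index v eq))))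

        index-cong : ∀ {u v} → u ≡ v → ∀ p q → index u p ≡ index v q
        index-cong {u} refl p q = toℕ-injective (trans (toℕ-index u p) (sym (toℕ-index u q)))

        in-layer : ∀ x → InLayer i (inject x)
        in-layer x = sound (inject x) (inject-in x)

        Adjᵢ : Fin size → Fin size → Set
        Adjᵢ x y = Adj (inject x) (inject y)

        lower : ∀ {u v} p q → Adj u v → Adjᵢ (index u p) (index v q)
        lower {u} {v} p q e = subst₂ Adj (sym (inject-index u p)) (sym (inject-index v q)) e

        root-in : p (toℕ r) ≡ 0
        root-in = complete r (λ {j} _ → ∼-refl {j})

        -- The layer is connected because it contains the predecessor `v′` of `v` on a shortest walk
        -- from `r`: the edge `v′v` separates `r` from `v`, so within the layer its colour can only
        -- be `i`.
        reach : ∀ k v (eq : p (toℕ v) ≡ 0) → d r v ≡ k → Star Adjᵢ (index v eq) (index r root-in)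
        reach zero v eq dz = subst (λ x → Star Adjᵢ x (index r root-in)) (index-cong (d-zero dz) root-in eq) ε
        reach (suc k) v eq dk with r Fin.≟ v
        ... | yes refl = case trans (sym (d-self r)) dk of λ ()
        ... | no r≢v with descent r≢v
        ...   | v′ , e , eq′ = lower eq in′ (symmetric e) ◅ reach k v′ in′ (ℕ.suc-injective (trans (sym eq′) dk))
          where
          colour : κ v′ v ≡ i
          colour with κ v′ v ℕ.≟ i
          ... | yes eqᵢ = eqᵢ
          ... | no ne   = contradiction (trans (cong (d r v′ +_) (sym (d-self v))) (sound v eq ne e refl))
            (λ z → ℕ.<⇒≢ (small (d r v′)) (trans z (cong₂ _+_ eq′ (trans (d-sym v v′) (d-adj e)))))
            where
            small : ∀ a → a + 0 < suc a + 1
            small a = ℕ.≤-trans (s≤s (ℕ.≤-reflexive (ℕ.+-identityʳ a))) (ℕ.m≤m+n (suc a) 1)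
          in′ : p (toℕ v′) ≡ 0
          in′ = complete v′ (layer-step (sound v eq) (symmetric e) (trans (sym (κ-sym e)) colour))

        layerNetwork : Network
        layerNetwork = record { Vertex = Fin size ; Adj = Adjᵢ ; weight = weight }

        star : ∀ x y → Star Adjᵢ x y
        star x y = to-root x ◅◅ reverse {T = Adjᵢ} symmetric (to-root y)
          where
          to-root : ∀ x → Star Adjᵢ x (index r root-in)
          to-root x = subst (λ x → Star Adjᵢ x (index r root-in)) (index-inject x (inject-in x))
            (reach _ (inject x) (inject-in x) refl)

        graph : WeightedGraph
        graph = record
          { order = size
          ; adjacent = λ x y → WeightedGraph.adjacent G (inject x) (inject y)
          ; weight = weight
          ; nonEmpty = nonEmpty′ (index r root-in)
          ; irrefl = irrefl
          ; symmetric = symmetric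
          ; weight-sym = weight-sym
          ; positive = WeightedGraph.positive G
          ; connected = λ x y → Erasure.erase layerNetwork Fin._≟_ (star x y) }
          where
          open Networks ℛ
          nonEmpty′ : ∀ {n} → Fin n → NonZero n
          nonEmpty′ {suc n} _ = _

        proj : Vertex → Vertex
        proj v = proj₁ (project i v)

        proj-in : ∀ v → InLayer i (proj v)
        proj-in v = proj₁ (proj₂ (project i v))

        proj-avoid : ∀ v → Avoiding i (proj v) v
        proj-avoid v = proj₂ (proj₂ (project i v))

        proj-∼ : ∀ v → proj v ∼[ i ] v
        proj-∼ v = avoiding-∼ (proj-avoid v)

        proj-zero : ∀ v → p (toℕ (proj v)) ≡ 0
        proj-zero v = complete (proj v) (proj-in v)

        π : Vertex → Fin size
        π v = index (proj v) (proj-zero v)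

        inject-π : ∀ v → inject (π v) ≡ proj v
        inject-π v = inject-index (proj v) (proj-zero v)

        proj-unique : ∀ {u v} → InLayer i u → u ∼[ i ] v → proj v ≡ u
        proj-unique {u} {v} inL sim = layer-unique (proj-in v) inL (∼-trans {i} (proj-∼ v) (∼-sym {i} sim))

        isLayer : IsLayer i graph
        isLayer = record
          { π = π
          ; π-∼ = λ {u} {v} eq → ∼-trans {i} (∼-sym {i} (proj-∼ u))
              (subst (λ x → x ∼[ i ] v) (trans (sym (inject-π v)) (trans (cong inject (sym eq)) (inject-π u))) (proj-∼ v))
          ; ∼-π = λ {u} {v} sim → index-cong (sym (proj-unique (proj-in u) (∼-trans {i} (proj-∼ u) sim))) (proj-zero u) (proj-zero v)
          ; down = down
          ; lift = lift
          ; embed = inject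
          ; π-embed = λ x → trans (index-cong (proj-unique (in-layer x) (∼-refl {i})) (proj-zero (inject x)) (inject-in x)) (index-inject x (inject-in x))
          ; embed-adj = λ {x} {y} e → e , layer-edge (in-layer x) (in-layer y) e }
          where
          retype : ∀ {u u′ v v′} → u ≡ u′ → v ≡ v′ → (e : Adj u v) → Σ[ f ∈ Adj u′ v′ ] weight e ≈ weight f
          retype refl refl e = e , ≈-refl
          down : ∀ {u v} (e : Adj u v) → κ u v ≡ i → Σ[ f ∈ Adjᵢ (π u) (π v) ] weight e ≈ weight f
          down {u} {v} e eq with transport (proj-avoid u) e eq
          ... | x′ , (f , e≈f) , eq′ , q with retype (sym (inject-π u))
                  (trans (sym (proj-unique (layer-step (proj-in u) f eq′) (avoiding-∼ q))) (sym (inject-π v))) f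
          ...   | g , f≈g = g , ≈-trans e≈f f≈g
          lift : ∀ u {y} (f : Adjᵢ (π u) y) → ∃ λ v → (Σ[ e ∈ Adj u v ] weight e ≈ weight f) × κ u v ≡ i × π v ≡ y
          lift u {y} f with retype (inject-π u) refl f
          -- The converse of `down`: with the walk reversed, the edge moves from the layer out to
          -- `u`.
          ... | f′ , f≈f′ with transport (avoiding-sym (proj-avoid u)) f′ (layer-edge (proj-in u) (in-layer y) f′)
          ...   | v , (e , f′≈e) , eq , q = v , (e , ≈-sym (≈-trans f≈f′ f′≈e)) , eq ,
            trans (index-cong (proj-unique (in-layer y) (∼-sym {i} (avoiding-∼ q))) (proj-zero v) (inject-in y)) (index-inject y (inject-in y))

-- The layers as coordinates.

module Products (ℛ : Reals) (G : OverReals.WeightedGraph ℛ) where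
  open Reals ℛ using (Carrier; _≈_)
  open OverReals ℛ
  open Networks ℛ
  open GraphWalks ℛ G
  open Colours ℛ G

  retype : ∀ (H : WeightedGraph) {x x′ y y′} → x ≡ x′ → y ≡ y′ → (e : WeightedGraph.Adj H x y) →
           Σ[ f ∈ WeightedGraph.Adj H x′ y′ ] WeightedGraph.weight H e ≈ WeightedGraph.weight H f
  retype H refl refl e = e , ≈-refl

  weight-unique : ∀ (H : WeightedGraph) {x y} (e f : WeightedGraph.Adj H x y) →
                  WeightedGraph.weight H e ≈ WeightedGraph.weight H f
  weight-unique H e f = subst (λ g → WeightedGraph.weight H e ≈ WeightedGraph.weight H g) (T-irrelevant e f) ≈-refl

  module _ {d : Vertex → Vertex → ℕ} (isHop : IsHopDistance d) (κ : Vertex → Vertex → ℕ)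
    (same : ∀ {u v x y} → Adj u v → Adj x y → Separates d u v x y → κ u v ≡ κ x y)
    (square : ∀ {u v w} (e : Adj u v) (f : Adj u w) → κ u v ≢ κ u w → ∃ (Opposite e f))
    {Gs : List WeightedGraph} (colour : Fin (length Gs) → ℕ) (r : Vertex)
    (colour-injective : ∀ {k l} → colour k ≡ colour l → k ≡ l)
    (covering : ∀ {u v} → Adj u v → ∃ λ k → κ u v ≡ colour k)
    (layer : ∀ k → IsLayer isHop κ same square (colour k) (List.lookup Gs k)) where

    private module L k = IsLayer (layer k)

    to : Vertex → Tuple Gs
    to v = build {Gs} (λ k → L.π k v)

    component-to : ∀ v k → component {Gs} (to v) k ≡ L.π k v
    component-to v k = component-build {Gs} (λ k → L.π k v) k

    -- `∼-injective` asks for agreement in every colour. A colour carried by some edge is among the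
    -- listed ones by `covering`, and for a colour without edges agreement is vacuous.
    π-injective : ∀ {u v} → (∀ k → L.π k u ≡ L.π k v) → u ≡ v
    π-injective eq = ∼-injective isHop κ same square (λ i e κ≡i → let k , κ≡k = covering e in L.π-∼ k (eq k) e κ≡k)

    -- Reaches a given tuple by correcting one coordinate at a time.
    fill : (x : Tuple Gs) → ∀ n → n ≤ length Gs → ∃ λ v → ∀ k → toℕ k < n → L.π k v ≡ component {Gs} x k
    fill x zero    _   = r , λ _ ()
    fill x (suc n) n<m with fill x n (ℕ.<⇒≤ n<m)
    ... | u , done with L.move (fromℕ< n<m) u (component {Gs} x (fromℕ< n<m))
    ...   | v , eq , avoid = v , now
      where
      now : ∀ k → toℕ k < suc n → L.π k v ≡ component {Gs} x k
      now k k< with k Fin.≟ fromℕ< n<m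
      ... | yes refl = eq
      ... | no k≢    = trans (sym (L.∼-π k (avoiding-∼ isHop κ same square (avoid (k≢ ∘ colour-injective)))))
        (done k (ℕ.≤∧≢⇒< (ℕ.≤-pred k<) (λ k≡n → k≢ (toℕ-injective (trans k≡n (sym (toℕ-fromℕ< n<m)))))))

    from : Tuple Gs → Vertex
    from x = proj₁ (fill x (length Gs) ℕ.≤-refl)

    to-from : ∀ x → to (from x) ≡ x
    to-from x = tuple-ext {Gs} (λ k → trans (component-to (from x) k) (proj₂ (fill x (length Gs) ℕ.≤-refl) k (toℕ<n k)))

    from-to : ∀ v → from (to v) ≡ v
    from-to v = π-injective (λ k → trans (sym (component-to (from (to v)) k))
      (trans (cong (λ x → component {Gs} x k) (to-from (to v))) (component-to v k)))

    π-edge : ∀ {u v k} → Adj u v → κ u v ≡ colour k → ∀ l → l ≢ k → L.π l u ≡ L.π l v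
    π-edge e κ≡k l l≢k = L.∼-π l (edge-∼ isHop κ same square e (λ κ≡l → l≢k (colour-injective (trans (sym κ≡l) κ≡k))))

    edge-at : ∀ {u v} (e : Adj u v) k → κ u v ≡ colour k →
      Σ[ D ∈ DifferOnlyAt (to u) (to v) k ] weight e ≈ WeightedGraph.weight (List.lookup Gs k) (proj₁ D)
    edge-at {u} {v} e k κ≡k with L.down k e κ≡k
    ... | f , e≈f with retype (List.lookup Gs k) (sym (component-to u k)) (sym (component-to v k)) f
    ...   | g , f≈g = (g , λ l l≢k → trans (component-to u l) (trans (π-edge e κ≡k l l≢k) (sym (component-to v l)))) ,
      ≈-trans e≈f f≈g

    isomorphic : network G ≅ ∏ Gs
    isomorphic = record
      { bijection = mk↔ₛ′ to from to-from from-to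
      ; adjacency = λ u v → mk⇔ forth back
      ; weights = same-weight }
      where
      forth : ∀ {u v} → Adj u v → Network.Adj (∏ Gs) (to u) (to v)
      forth {u} {v} e with covering e
      ... | k , κ≡k = product-edge {Gs} {to u} {to v} (proj₁ (edge-at e k κ≡k))
      back : ∀ {u v} → Network.Adj (∏ Gs) (to u) (to v) → Adj u v
      back {u} {v} (ℓ , (f , others) , _) with retype (List.lookup Gs ℓ) (component-to u ℓ) refl f
      ... | g , _ with L.lift ℓ u g
      ...   | v′ , (e , _) , κ≡ℓ , eq = subst (Adj u) (π-injective agrees) e
        where
        agrees : ∀ k → L.π k v′ ≡ L.π k v
        agrees k with k Fin.≟ ℓ
        ... | yes refl = trans eq (component-to v k)
        ... | no k≢ℓ   = trans (sym (π-edge e κ≡ℓ k k≢ℓ)) (trans (sym (component-to u k)) (trans (others k k≢ℓ) (component-to v k)))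
      same-weight : ∀ {u v} (e : Adj u v) (f : Network.Adj (∏ Gs) (to u) (to v)) → weight e ≈ Network.weight (∏ Gs) {to u} {to v} f
      same-weight {u} {v} e (ℓ , D , _) with covering e
      ... | k , κ≡k with edge-at e k κ≡k
      ...   | D′ , e≈ with differ-unique {Gs} {to u} {to v} D′ (proj₁ D)
      ...     | refl = ≈-trans e≈ (weight-unique (List.lookup Gs k) (proj₁ D′) (proj₁ D))

-- Every splitting into two factors respects (Θ) and (□).

module Mixtures (ℛ : Reals) where
  open Reals ℛ using (Carrier; _≈_)
  open OverReals ℛ
  open Networks ℛ

  -- A factorization into two factors: J picks the edges of one of them, and
  -- mix u v has the coordinate of v there and that of u in the other factor.
  record Mixing (G : WeightedGraph) (J : Fin (order G) → Fin (order G) → Bool)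
                (mix : Fin (order G) → Fin (order G) → Fin (order G)) : Set where
    open WeightedGraph G using (Adj; weight)
    field
      mix-self : ∀ u → mix u u ≡ u
      J-sym    : ∀ {u v} → Adj u v → J u v ≡ J v u
      across   : ∀ {u v} → Adj u v → J u v ≡ true → ∀ x → mix u x ≡ mix v x
      across′  : ∀ {u v} → Adj u v → J u v ≡ false → ∀ x → mix x u ≡ mix x v
      along    : ∀ {u v} (e : Adj u v) → J u v ≡ true → ∀ x →
                 (Σ[ f ∈ Adj (mix x u) (mix x v) ] weight e ≈ weight f) × J (mix x u) (mix x v) ≡ true
      along′   : ∀ {u v} (e : Adj u v) → J u v ≡ false → ∀ x →
                 (Σ[ f ∈ Adj (mix u x) (mix v x) ] weight e ≈ weight f) × J (mix u x) (mix v x) ≡ false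

  module Forced {G : WeightedGraph} {J mix} (M : Mixing G J mix)
    {d : Fin (order G) → Fin (order G) → ℕ} (isHop : GraphWalks.IsHopDistance ℛ G d) where
    open Mixing M
    open GraphWalks ℛ G
    open Colours ℛ G
    open IsHopDistance isHop

    _++ʷ_ : ∀ {u v w m n} → Walk u m v → Walk v n w → Walk u (m + n) w
    _++ʷ_ {u} {w = w} {m} p here = subst (λ n → Walk u n w) (sym (ℕ.+-identityʳ m)) p
    _++ʷ_ {u} {w = w} {m} p (_▹_ {n} q e) = subst (λ n → Walk u n w) (sym (ℕ.+-suc m n)) ((p ++ʷ q) ▹ e)

    -- Additivity of distance over the two factors, in terms of walks: `k` steps change the
    -- coordinate outside `J` and `l` steps the one in `J`. Fixing one coordinate turns the steps of
    -- the other kind into standstills.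
    split : ∀ {u n x} → Walk u n x → ∃₂ λ k l → k + l ≡ n ×
      (∀ b → Walk (mix u b) k (mix x b)) × (∀ a → Walk (mix a u) l (mix a x))
    split here = 0 , 0 , refl , (λ _ → here) , (λ _ → here)
    split {u} (_▹_ {v = v} {w} p e) with split p
    ... | k , l , refl , P , Q with J v w in eq
    ...   | true  = k , suc l , ℕ.+-suc k l , (λ b → subst (Walk (mix u b) k) (across e eq b) (P b)) ,
                    (λ a → Q a ▹ proj₁ (proj₁ (along e eq a)))
    ...   | false = suc k , l , refl , (λ b → P b ▹ proj₁ (proj₁ (along′ e eq b))) ,
                    (λ a → subst (Walk (mix a u) l) (across′ e eq a) (Q a))

    -- Shortest walks from `u` to `x` and from `v` to `y` are sorted by factors, and their `J` parts
    -- are exchanged. This yields walks from `v` to `x` and from `u` to `y` of the same total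
    -- length.
    exchange : ∀ {u v x y} → Adj u v → J u v ≡ true → Adj x y → J x y ≡ false →
               d v x + d u y ≤ d u x + d v y
    exchange {u} {v} {x} {y} e eq f eq′ with split (shortest u x) | split (shortest v y)
    ... | k , l , kl , P , Q | k′ , l′ , kl′ , P′ , Q′ = begin
      d v x + d u y         ≤⟨ ℕ.+-mono-≤
          (minimal (subst₂ (λ a b → Walk a (k + l′) b) (trans (across e eq v) (mix-self v)) (trans (sym (across′ f eq′ x)) (mix-self x)) (P v ++ʷ Q′ x)))
          (minimal (subst₂ (λ a b → Walk a (k′ + l) b) (trans (sym (across e eq u)) (mix-self u)) (trans (across′ f eq′ y) (mix-self y)) (P′ u ++ʷ Q y))) ⟩
      k + l′ + (k′ + l)     ≡⟨ shift k l′ k′ l ⟩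
      k + l + (k′ + l′)     ≡⟨ cong₂ _+_ kl kl′ ⟩
      d u x + d v y         ∎
      where
      open ℕ.≤-Reasoning
      shift : ∀ a b c e → a + b + (c + e) ≡ a + e + (c + b)
      shift = solve-∀

    -- The second inequality is `exchange` for the reversed edge `yx`.
    unseparated : ∀ {u v x y} → Adj u v → J u v ≡ true → Adj x y → J x y ≡ false →
                  d u x + d v y ≡ d u y + d v x
    unseparated {u} {v} {x} {y} e eq f eq′ = ℕ.≤-antisym
      (subst (_≤ d u y + d v x) (ℕ.+-comm (d v y) (d u x)) (exchange e eq (symmetric f) (trans (sym (J-sym f)) eq′)))
      (subst (_≤ d u x + d v y) (ℕ.+-comm (d v x) (d u y)) (exchange e eq f eq′))

    separated-same : ∀ {u v x y} → Adj u v → Adj x y → Separates d u v x y → J u v ≡ J x y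
    separated-same {u} {v} {x} {y} e f sep with J u v in p | J x y in q
    ... | true  | true  = refl
    ... | false | false = refl
    ... | true  | false = contradiction (unseparated e p f q) sep
    ... | false | true  = contradiction
      (trans (cong₂ _+_ (d-sym u x) (d-sym v y)) (trans (unseparated f q e p)
        (trans (cong₂ _+_ (d-sym x v) (d-sym y u)) (ℕ.+-comm (d v x) (d u y))))) sep

    -- The fourth corner `mix w v` combines the `J` coordinate of `v` with the other coordinate of
    -- `w`.
    opposite : ∀ {u v w} (e : Adj u v) (f : Adj u w) → J u v ≡ true → J u w ≡ false → Opposite e f (mix w v)
    opposite {u} {v} {w} e f p q = apart ,
      (let g , e≈g = proj₁ (along e p w) in
        subst (λ a → Σ[ g ∈ Adj a (mix w v) ] weight e ≈ weight g) (trans (sym (across′ (symmetric f) (trans (sym (J-sym f)) q) w)) (mix-self w)) (g , e≈g)) ,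
      subst (λ a → Σ[ g ∈ Adj a (mix w v) ] weight f ≈ weight g) at-v (proj₁ (along′ f q v))
      where
      at-v : mix u v ≡ v
      at-v = trans (across e p v) (mix-self v)
      apart : mix w v ≢ u
      apart eq = case trans (sym p) (trans (J-sym e) (subst₂ (λ a b → J a b ≡ false) at-v eq (proj₂ (along′ f q v)))) of λ ()

    cornered-same : ∀ {u v w} (e : Adj u v) (f : Adj u w) → (∀ {x} → ¬ Opposite e f x) → J u v ≡ J u w
    cornered-same {u} {v} {w} e f none with J u v in p | J u w in q
    ... | true  | true  = refl
    ... | false | false = refl
    ... | true  | false = contradiction (opposite e f p q) none
    ... | false | true  with opposite f e q p
    ...   | x≢u , a , b = contradiction (x≢u , b , a) none

-- Primality

module Factorizations (ℛ : Reals) where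
  open Reals ℛ using (Carrier; _≈_)
  open OverReals ℛ
  open Networks ℛ
  open Mixtures ℛ

  module FromProduct (H : WeightedGraph) {Gs : List WeightedGraph} (φ : network H ≅ ∏ Gs) where
    open Products ℛ H using (retype; weight-unique)
    open GraphWalks ℛ H
    open _≅_ φ
    open Inverse bijection using (to; from; strictlyInverseˡ; strictlyInverseʳ)

    coord : Vertex → (k : Fin (length Gs)) → Fin (order (List.lookup Gs k))
    coord v k = component {Gs} (to v) k

    coord-injective : ∀ {u v} → (∀ k → coord u k ≡ coord v k) → u ≡ v
    coord-injective {u} {v} eq = trans (sym (strictlyInverseʳ u))
      (trans (cong from (tuple-ext {Gs} eq)) (strictlyInverseʳ v))

    Changes : (u v : Vertex) → Fin (length Gs) → Set
    Changes u v = DifferOnlyAt {Gs} (to u) (to v)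

    changes : ∀ {u v} (e : Adj u v) → ∃ λ k → Σ[ D ∈ Changes u v k ] weight e ≈ WeightedGraph.weight (List.lookup Gs k) (proj₁ D)
    changes {u} {v} e with Equivalence.to (adjacency u v) e in eq
    ... | f@(k , D , _) = k , D , weights e f

    changed-edge : ∀ {u v k} (D : Changes u v k) → Σ[ e ∈ Adj u v ] weight e ≈ WeightedGraph.weight (List.lookup Gs k) (proj₁ D)
    changed-edge {u} {v} D = let f = product-edge {Gs} {to u} {to v} D
                                 e = Equivalence.from (adjacency u v) f in e , weights e f

    module _ (j : Fin (length Gs)) where

      J : Vertex → Vertex → Bool
      J u v = not (does (coord u j Fin.≟ coord v j))

      J-true : ∀ {u v} → coord u j ≢ coord v j → J u v ≡ true
      J-true {u} {v} ne = cong not (dec-false (coord u j Fin.≟ coord v j) ne)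

      J-false : ∀ {u v} → coord u j ≡ coord v j → J u v ≡ false
      J-false {u} {v} eq = cong not (dec-true (coord u j Fin.≟ coord v j) eq)

      J-at : ∀ {u v k} → Changes u v k → J u v ≡ true → k ≡ j
      J-at {u} {v} {k} (_ , others) p with j Fin.≟ k
      ... | yes eq = sym eq
      ... | no ne  = case trans (sym p) (J-false {u} {v} (others j ne)) of λ ()

      J-not-at : ∀ {u v k} → Changes u v k → J u v ≡ false → j ≢ k
      J-not-at {u} {v} {k} (e , _) p refl = case trans (sym p)
        (J-true {u} {v} (λ eq → WeightedGraph.irrefl (List.lookup Gs k)
          (subst (λ x → WeightedGraph.Adj (List.lookup Gs k) x (coord v k)) eq e))) of λ ()

      mix : Vertex → Vertex → Vertex
      mix u v = from (replace {Gs} (to u) j (coord v j))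

      to-mix : ∀ u v → to (mix u v) ≡ replace {Gs} (to u) j (coord v j)
      to-mix u v = strictlyInverseˡ _

      mix-at : ∀ u v → coord (mix u v) j ≡ coord v j
      mix-at u v = trans (cong (λ x → component {Gs} x j) (to-mix u v)) (replace-at {Gs} (to u) j (coord v j))

      mix-other : ∀ u v {k} → k ≢ j → coord (mix u v) k ≡ coord u k
      mix-other u v {k} ne = trans (cong (λ x → component {Gs} x k) (to-mix u v)) (replace-other {Gs} (to u) j (coord v j) ne)

      mix-ext : ∀ {u v w} → coord v j ≡ coord w j → (∀ k → k ≢ j → coord u k ≡ coord w k) → mix u v ≡ w
      mix-ext {u} {v} {w} at other = coord-injective agree
        where
        agree : ∀ k → coord (mix u v) k ≡ coord w k
        agree k with k Fin.≟ j
        ... | yes refl = trans (mix-at u v) at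
        ... | no ne    = trans (mix-other u v ne) (other k ne)

      shifted : ∀ {u v u′ v′ k} (D : Changes u v k) (e : Adj u v) → weight e ≈ WeightedGraph.weight (List.lookup Gs k) (proj₁ D) →
        coord u k ≡ coord u′ k → coord v k ≡ coord v′ k → (∀ i → i ≢ k → coord u′ i ≡ coord v′ i) →
        Σ[ f ∈ Adj u′ v′ ] weight e ≈ weight f
      shifted {k = k} D e e≈ p q others with retype (List.lookup Gs k) p q (proj₁ D)
      ... | g , D≈g with changed-edge (g , others)
      ...   | f , f≈g = f , ≈-trans e≈ (≈-trans D≈g (≈-sym f≈g))

      mixing : Mixing H J mix
      mixing = record
        { mix-self = λ u → mix-ext refl (λ _ _ → refl)
        ; J-sym = λ {u} {v} _ → J-sym u v
        ; across = across ; across′ = across′ ; along = along ; along′ = along′ }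
        where
        J-sym : ∀ u v → J u v ≡ J v u
        J-sym u v with coord u j Fin.≟ coord v j
        ... | yes eq = sym (J-false {v} {u} (sym eq))
        ... | no ne  = sym (J-true {v} {u} (ne ∘ sym))
        across : ∀ {u v} → Adj u v → J u v ≡ true → ∀ x → mix u x ≡ mix v x
        across {u} {v} e p x with changes e
        ... | k , D , _ with J-at {u} {v} D p
        ...   | refl = mix-ext (sym (mix-at v x)) (λ i ne → trans (proj₂ D i ne) (sym (mix-other v x ne)))
        across′ : ∀ {u v} → Adj u v → J u v ≡ false → ∀ x → mix x u ≡ mix x v
        across′ {u} {v} e p x with changes e
        ... | k , D , _ = mix-ext (trans (proj₂ D j (J-not-at {u} {v} D p)) (sym (mix-at x v))) (λ i ne → sym (mix-other x v ne))
        along : ∀ {u v} (e : Adj u v) → J u v ≡ true → ∀ x →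
                (Σ[ f ∈ Adj (mix x u) (mix x v) ] weight e ≈ weight f) × J (mix x u) (mix x v) ≡ true
        along {u} {v} e p x with changes e
        ... | k , D , e≈ with J-at {u} {v} D p
        ...   | refl = shifted D e e≈ (sym (mix-at x u)) (sym (mix-at x v)) (λ i ne → trans (mix-other x u ne) (sym (mix-other x v ne))) ,
          trans (cong₂ (λ a b → not (does (a Fin.≟ b))) (mix-at x u) (mix-at x v)) p
        along′ : ∀ {u v} (e : Adj u v) → J u v ≡ false → ∀ x →
                 (Σ[ f ∈ Adj (mix u x) (mix v x) ] weight e ≈ weight f) × J (mix u x) (mix v x) ≡ false
        along′ {u} {v} e p x with changes e
        ... | k , D , e≈ = shifted D e e≈ (sym (mix-other u x k≢j)) (sym (mix-other v x k≢j)) others ,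
          J-false {mix u x} {mix v x} (trans (mix-at u x) (sym (mix-at v x)))
          where
          k≢j : k ≢ j
          k≢j = J-not-at {u} {v} D p ∘ sym
          others : ∀ i → i ≢ k → coord (mix u x) i ≡ coord (mix v x) i
          others i ne with i Fin.≟ j
          ... | yes refl = trans (mix-at u x) (sym (mix-at v x))
          ... | no i≢j   = trans (mix-other u x i≢j) (trans (proj₂ D i ne) (sym (mix-other v x i≢j)))

      -- No edge changes any coordinate other than `j`, so by connectedness the others are constant
      -- and factor `j` is all of `H`.
      whole : Vertex → (∀ {u v} → Adj u v → J u v ≡ true) → network (List.lookup Gs j) ≅ network H
      whole x₀ all = record
        { bijection = mk↔ₛ′ up (λ x → coord x j) (λ x → up-coord x) at-up
        ; adjacency = λ y z → mk⇔ forth back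
        ; weights = λ e f → same-weight e f }
        where
        connect : ∀ {u v k} → k ≢ j → Star Adj u v → coord u k ≡ coord v k
        connect ne ε = refl
        connect {u} {k = k} ne (_◅_ {j = v} e p) with changes e
        ... | k′ , D , _ with J-at {u} {v} D (all e)
        ...   | refl = trans (proj₂ D k ne) (connect ne p)
        up : Fin (order (List.lookup Gs j)) → Vertex
        up y = from (replace {Gs} (to x₀) j y)
        to-up : ∀ y → to (up y) ≡ replace {Gs} (to x₀) j y
        to-up y = strictlyInverseˡ _
        at-up : ∀ y → coord (up y) j ≡ y
        at-up y = trans (cong (λ x → component {Gs} x j) (to-up y)) (replace-at {Gs} (to x₀) j y)
        other-up : ∀ y {k} → k ≢ j → coord (up y) k ≡ coord x₀ k
        other-up y {k} ne = trans (cong (λ x → component {Gs} x k) (to-up y)) (replace-other {Gs} (to x₀) j y ne)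
        up-coord : ∀ x → up (coord x j) ≡ x
        up-coord x = coord-injective agree
          where
          agree : ∀ k → coord (up (coord x j)) k ≡ coord x k
          agree k with k Fin.≟ j
          ... | yes refl = at-up _
          ... | no ne    = trans (other-up _ ne) (connect ne (proj₁ (WeightedGraph.connected H x₀ x)))
        raised : ∀ {y z} (e : WeightedGraph.Adj (List.lookup Gs j) y z) →
          Σ[ f ∈ Adj (up y) (up z) ] WeightedGraph.weight (List.lookup Gs j) e ≈ weight f
        raised {y} {z} e with retype (List.lookup Gs j) (sym (at-up y)) (sym (at-up z)) e
        ... | g , e≈g with changed-edge (g , λ i ne → trans (other-up y ne) (sym (other-up z ne)))
        ...   | f , f≈g = f , ≈-trans e≈g (≈-sym f≈g)
        forth : ∀ {y z} → WeightedGraph.Adj (List.lookup Gs j) y z → Adj (up y) (up z)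
        forth e = proj₁ (raised e)
        back : ∀ {y z} → Adj (up y) (up z) → WeightedGraph.Adj (List.lookup Gs j) y z
        back {y} {z} e with changes e
        ... | k , D , _ with J-at {up y} {up z} D (all e)
        ...   | refl = proj₁ (retype (List.lookup Gs j) (at-up y) (at-up z) (proj₁ D))
        same-weight : ∀ {y z} (e : WeightedGraph.Adj (List.lookup Gs j) y z) (f : Adj (up y) (up z)) →
                      WeightedGraph.weight (List.lookup Gs j) e ≈ weight f
        same-weight e f = ≈-trans (proj₂ (raised e)) (weight-irr _ f)

  any-lookup : ∀ {P : WeightedGraph → Set} {Gs} k → P (List.lookup Gs k) → Any P Gs
  any-lookup {Gs = Gs} k p = lose (∈-lookup k) p

  -- The premise of `whole` is vacuous without edges, so that already the first factor is isomorphic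
  -- to `H`.
  prime-edgeless : ∀ {H} → (∀ {u v} → ¬ WeightedGraph.Adj H u v) → Fin (order H) → Prime H
  prime-edgeless {H} none x₀ Gs F = go Gs (IsFactorization.nonEmpty F) (IsFactorization.isomorphism F)
    where
    go : ∀ Gs → Gs ≢ [] → network H ≅ ∏ Gs → Any (λ K → network K ≅ network H) Gs
    go []       ne φ = contradiction refl ne
    go (K ∷ Gs) ne φ = any-lookup {Gs = K ∷ Gs} zero (FromProduct.whole H φ zero x₀ (λ e → contradiction e none))

  module _ {G : WeightedGraph} where
    open GraphWalks ℛ G
    open Colours ℛ G

    module LayerPrime {d : Vertex → Vertex → ℕ} (isHop : IsHopDistance d) (κ : Vertex → Vertex → ℕ)
      (same : ∀ {u v x y} → Adj u v → Adj x y → Separates d u v x y → κ u v ≡ κ x y)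
      (square : ∀ {u v w} (e : Adj u v) (f : Adj u w) → κ u v ≢ κ u w → ∃ (Opposite e f))
      (forced : (J : Vertex → Vertex → Bool) →
        (∀ {u v x y} → Adj u v → Adj x y → Separates d u v x y → J u v ≡ J x y) →
        (∀ {u v w} (e : Adj u v) (f : Adj u w) → (∀ {x} → ¬ Opposite e f x) → J u v ≡ J u w) →
        ∀ {u v x y} → Adj u v → Adj x y → κ u v ≡ κ x y → J u v ≡ J x y)
      {i : ℕ} {H : WeightedGraph} (layer : IsLayer isHop κ same square i H) where
      open IsLayer layer

      private
        H-Adj = WeightedGraph.Adj H
        infix 4 _∼⟨_⟩_
        _∼⟨_⟩_ : Vertex → ℕ → Vertex → Set
        u ∼⟨ j ⟩ v = _∼[_]_ isHop κ same square u j v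

        ∼r : ∀ {j u} → u ∼⟨ j ⟩ u
        ∼r {j} = ∼-refl isHop κ same square {j}
        ∼s : ∀ {j u v} → u ∼⟨ j ⟩ v → v ∼⟨ j ⟩ u
        ∼s {j} = ∼-sym isHop κ same square {j}
        _∙_ : ∀ {j u v w} → u ∼⟨ j ⟩ v → v ∼⟨ j ⟩ w → u ∼⟨ j ⟩ w
        _∙_ {j} = ∼-trans isHop κ same square {j}
        edge∼ : ∀ {j u v} → Adj u v → κ u v ≢ j → u ∼⟨ j ⟩ v
        edge∼ {j} = edge-∼ isHop κ same square {j}
        avoid∼ : ∀ {j u v} → Avoiding isHop κ same square j u v → u ∼⟨ j ⟩ v
        avoid∼ {j} = avoiding-∼ isHop κ same square {j}

      vertex-ext : ∀ {u v} → π u ≡ π v → (∀ {j} → j ≢ i → u ∼⟨ j ⟩ v) → u ≡ v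
      vertex-ext {u} {v} eq sim = ∼-injective isHop κ same square all
        where
        all : ∀ j → u ∼⟨ j ⟩ v
        all j with j ℕ.≟ i
        ... | yes refl = π-∼ eq
        ... | no j≢i   = sim j≢i

      -- A splitting of one factor induces a splitting of `G`: all the other coordinates of `G` are
      -- put on the side that is not selected by `J′`.
      module Lifted {J′ mix′} (M : Mixing H J′ mix′) where
        open Mixing M renaming (across to acr; across′ to acr′; along to alo; along′ to alo′; mix-self to mix-self′; J-sym to J-sym′)

        J : Vertex → Vertex → Bool
        J u v = does (κ u v ℕ.≟ i) ∧ J′ (π u) (π v)

        mix : Vertex → Vertex → Vertex
        mix u v = proj₁ (move u (mix′ (π u) (π v)))

        π-mix : ∀ u v → π (mix u v) ≡ mix′ (π u) (π v)
        π-mix u v = proj₁ (proj₂ (move u (mix′ (π u) (π v))))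

        avoid-mix : ∀ u v {j} → j ≢ i → Avoiding isHop κ same square j u (mix u v)
        avoid-mix u v = proj₂ (proj₂ (move u (mix′ (π u) (π v))))

        mix∼ : ∀ u v {j} → j ≢ i → u ∼⟨ j ⟩ mix u v
        mix∼ u v {j} j≢i = avoid∼ {j} (avoid-mix u v j≢i)

        J-in : ∀ {u v} → κ u v ≡ i → J u v ≡ J′ (π u) (π v)
        J-in {u} {v} eq = cong (_∧ J′ (π u) (π v)) (dec-true (κ u v ℕ.≟ i) eq)

        J-out : ∀ {u v} → κ u v ≢ i → J u v ≡ false
        J-out {u} {v} ne = cong (_∧ J′ (π u) (π v)) (dec-false (κ u v ℕ.≟ i) ne)

        J-colour : ∀ {u v} → J u v ≡ true → κ u v ≡ i
        J-colour {u} {v} p with κ u v ℕ.≟ i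
        ... | yes eq = eq
        ... | no ne  = case trans (sym p) (J-out ne) of λ ()

        side : ∀ {u v j} → Adj u v → κ u v ≡ i → j ≢ i → u ∼⟨ j ⟩ v
        side {j = j} e κ≡i j≢i = edge∼ {j} e (λ κ≡j → j≢i (trans (sym κ≡j) κ≡i))

        J-sym : ∀ {u v} → Adj u v → J u v ≡ J v u
        J-sym {u} {v} e with κ u v ℕ.≟ i
        ... | no ne  = trans (J-out ne) (sym (J-out (ne ∘ trans (κ-sym isHop κ same square e))))
        ... | yes eq = trans (J-in eq) (trans (J-sym′ (proj₁ (down e eq))) (sym (J-in (trans (sym (κ-sym isHop κ same square e)) eq))))

        across : ∀ {u v} → Adj u v → J u v ≡ true → ∀ x → mix u x ≡ mix v x
        across {u} {v} e p x = vertex-ext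
          (trans (π-mix u x) (trans (acr (proj₁ (down e κ≡i)) (trans (sym (J-in κ≡i)) p) (π x)) (sym (π-mix v x))))
          (λ {j} j≢i → _∙_ {j} (∼s {j} (mix∼ u x j≢i)) (_∙_ {j} (side e κ≡i j≢i) (mix∼ v x j≢i)))
          where κ≡i = J-colour p

        across′ : ∀ {u v} → Adj u v → J u v ≡ false → ∀ x → mix x u ≡ mix x v
        across′ {u} {v} e p x = vertex-ext (trans (π-mix x u) (trans agree (sym (π-mix x v))))
          (λ {j} j≢i → _∙_ {j} (∼s {j} (mix∼ x u j≢i)) (mix∼ x v j≢i))
          where
          agree : mix′ (π x) (π u) ≡ mix′ (π x) (π v)
          agree with κ u v ℕ.≟ i
          ... | yes eq = acr′ (proj₁ (down e eq)) (trans (sym (J-in eq)) p) (π x)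
          ... | no ne  = cong (mix′ (π x)) (∼-π (edge∼ {i} e ne))

        along : ∀ {u v} (e : Adj u v) → J u v ≡ true → ∀ x →
                (Σ[ f ∈ Adj (mix x u) (mix x v) ] weight e ≈ weight f) × J (mix x u) (mix x v) ≡ true
        along {u} {v} e p x with down e (J-colour p)
        ... | g , e≈g with alo g (trans (sym (J-in (J-colour p))) p) (π x)
        ...   | (g′ , g≈g′) , q with Products.retype ℛ G H (sym (π-mix x u)) refl g′
        ...     | g″ , g′≈g″ with lift (mix x u) g″
        ...       | w , (f , f≈g″) , κ≡i , eq
          with vertex-ext {w} {mix x v} (trans eq (sym (π-mix x v)))
                 (λ {j} j≢i → _∙_ {j} (∼s {j} (side f κ≡i j≢i)) (_∙_ {j} (∼s {j} (mix∼ x u j≢i)) (mix∼ x v j≢i)))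
        ...         | refl = (f , ≈-trans e≈g (≈-trans g≈g′ (≈-trans g′≈g″ (≈-sym f≈g″)))) ,
          trans (J-in κ≡i) (trans (cong₂ J′ (π-mix x u) (π-mix x v)) q)

        along′ : ∀ {u v} (e : Adj u v) → J u v ≡ false → ∀ x →
                 (Σ[ f ∈ Adj (mix u x) (mix v x) ] weight e ≈ weight f) × J (mix u x) (mix v x) ≡ false
        along′ {u} {v} e p x with κ u v ℕ.≟ i
        -- An edge of another colour is carried from `u` to `mix u x` along a walk of colour `i`,
        -- which avoids the colour of the edge.
        ... | no ne with transport isHop κ same square
                (avoiding-sym isHop κ same square (avoid-mix u x ne)) e refl
        ...   | w , (f , e≈f) , eq , avoid with vertex-ext {w} {mix v x} at-π sim
          where
          at-π : π w ≡ π (mix v x)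
          at-π = trans (sym (∼-π (edge∼ {i} f (ne ∘ trans (sym eq))))) (trans (π-mix u x)
            (trans (cong (λ y → mix′ y (π x)) (∼-π (edge∼ {i} e ne))) (sym (π-mix v x))))
          sim : ∀ {j} → j ≢ i → w ∼⟨ j ⟩ mix v x
          sim {j} j≢i with j ℕ.≟ κ u v
          ... | yes refl = _∙_ {j} (avoid∼ {j} avoid) (mix∼ v x j≢i)
          ... | no j≢c   = _∙_ {j} (∼s {j} (edge∼ {j} f (λ eq′ → j≢c (trans (sym eq′) eq))))
            (_∙_ {j} (∼s {j} (mix∼ u x j≢i)) (_∙_ {j} (edge∼ {j} e (j≢c ∘ sym)) (mix∼ v x j≢i)))
        ...     | refl = (f , e≈f) , J-out (ne ∘ trans (sym eq))
        along′ {u} {v} e p x | yes κ≡i with down e κ≡i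
        ...   | g , e≈g with alo′ g (trans (sym (J-in κ≡i)) p) (π x)
        ...     | (g′ , g≈g′) , q with Products.retype ℛ G H (sym (π-mix u x)) refl g′
        ...       | g″ , g′≈g″ with lift (mix u x) g″
        ...         | w , (f , f≈g″) , κ≡i′ , eq
          with vertex-ext {w} {mix v x} (trans eq (sym (π-mix v x)))
                 (λ {j} j≢i → _∙_ {j} (∼s {j} (side f κ≡i′ j≢i)) (_∙_ {j} (∼s {j} (mix∼ u x j≢i))
                   (_∙_ {j} (side e κ≡i j≢i) (mix∼ v x j≢i))))
        ...           | refl = (f , ≈-trans e≈g (≈-trans g≈g′ (≈-trans g′≈g″ (≈-sym f≈g″)))) ,
          trans (J-in κ≡i′) (trans (cong₂ J′ (π-mix u x) (π-mix v x)) q)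

        mixing : Mixing G J mix
        mixing = record
          { mix-self = λ u → vertex-ext (trans (π-mix u u) (mix-self′ (π u))) (λ {j} j≢i → ∼s {j} (mix∼ u u j≢i))
          ; J-sym = J-sym ; across = across ; across′ = across′ ; along = along ; along′ = along′ }

        -- The lifted labelling respects (Θ) and (□), hence is constant on colour `i` by `forced`;
        -- and all edges of `H` come from edges of colour `i`.
        constant : ∀ {a b x y} → H-Adj a b → H-Adj x y → J′ a b ≡ J′ x y
        constant {a} {b} {x} {y} e f with embed-adj e | embed-adj f
        ... | e′ , p | f′ , q = trans (sym (read p)) (trans
          (forced J (Forced.separated-same mixing isHop) (Forced.cornered-same mixing isHop) e′ f′ (trans p (sym q)))
          (read q))
          where
          read : ∀ {a b} → κ (embed a) (embed b) ≡ i → J (embed a) (embed b) ≡ J′ a b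
          read {a} {b} eq = trans (J-in eq) (cong₂ J′ (π-embed a) (π-embed b))

      -- Given a factorization of `H`, the coordinate changed by one edge is changed by all of them,
      -- so the corresponding factor is all of `H`.
      prime : ∀ {a b} → H-Adj a b → Prime H
      prime {a} {b} e Gs F with FromProduct.changes H (IsFactorization.isomorphism F) e
      ... | j , D , _ = any-lookup j (FP.whole j a (λ f → trans (sym (Lifted.constant (FP.mixing j) e f)) (FP.J-true j changed)))
        where
        module FP = FromProduct H (IsFactorization.isomorphism F)
        changed : FP.coord a j ≢ FP.coord b j
        changed eq = WeightedGraph.irrefl (List.lookup Gs j)
          (subst (λ x → WeightedGraph.Adj (List.lookup Gs j) x (FP.coord b j)) eq (proj₁ D))

-- The machine program

module Sealed (ℛ : Reals) (inp : ℕ → ℕ) where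
  open Language ℛ
  open Semantics inp

  abstract
    -- Comparing unfolded runs is expensive, hence this opaque copy.
    result : Cmd → Store → Store
    result c s = run c s

    result≡ : ∀ c s → run c s ≡ result c s
    result≡ c s = refl

    result-⨾ : ∀ c d s → result (c ⨾ d) s ≡ result d (result c s)
    result-⨾ c d s = refl

  seal : ∀ {c s} (P : Store → Set) → P (run c s) → P (result c s)
  seal {c} {s} P = subst P (result≡ c s)

module Machine (ℛ : Reals) (main : Cmd) (OUT OUTPOS E : ℕ) (E≢0 : E ≢ 0) where
  open Reals ℛ using (Carrier; _≈_; 0#)
  open OverReals ℛ
  open StructuredCode ℛ
  open Language ℛ
  open State

  -- The numbers of the input occupy `2 + 2|E|` cells, with `|E|` in cell 1. Their end becomes the
  -- base address of the arrays.
  prologue : Code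
  prologue = op (set (tp 1) 1) ⨟ op (load (tp 1) (tp 1)) ⨟ op (set (tp 0) 2) ⨟
    op (add (tp 0) (tp 0) (tp 1)) ⨟ op (add (tp 0) (tp 0) (tp 1))

  copyCell : Code
  copyCell = op (load (tp 6) (tp 3)) ⨟ op (store (tp 1) (tp 6)) ⨟
    op (add (tp 3) (tp 3) (tp 4)) ⨟ op (add (tp 1) (tp 1) (tp 5))

  -- Temporary 3 runs through the cells of the output array, which are
  -- 2 ^ suc OUT apart, and temporary 1 through the addresses 0, 1, 2, …
  epilogue : Code
  epilogue = compileE 2 (‵ OUTPOS) ⨟ (compileE 3 (lit 0) ⨟ address OUT 3) ⨟
    (op (set (tp 1) 0) ⨟ op (set (tp 4) (2 ^ suc OUT)) ⨟ op (set (tp 5) 1)) ⨟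
    while< (tp 1) (tp 2) copyCell ⨟
    op (set (vr 0) 0) ⨟ op (set (tp 0) 0) ⨟ op (add (tp 0) (tp 0) (vr E))

  code : Code
  code = prologue ⨟ compile 1 main ⨟ epilogue

  abstract
    program : Program
    program = assemble code 0

    program≡ : program ≡ assemble code 0
    program≡ = refl

  offset-suc : ∀ a k → offset a (suc k) ≡ offset a k + 2 ^ suc a
  offset-suc zero    k = shift k
    where
    shift : ∀ k → suc (suc k + suc k) ≡ suc (k + k) + 2
    shift = solve-∀
  offset-suc (suc a) k = trans (cong₂ _+_ (offset-suc a k) (offset-suc a k)) (shift (offset a k) (2 ^ suc a))
    where
    shift : ∀ x y → x + y + (x + y) ≡ x + x + (y + (y + 0))
    shift = solve-∀

  module Copying (out : ℕ → ℕ) (ℓ B e : ℕ) (real₀ : ℕ → Carrier) where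

    record Copied (k : ℕ) (σ : State) : Set where
      field
        counter : reg σ (tp 1) ≡ k
        limit   : reg σ (tp 2) ≡ ℓ
        pointer : reg σ (tp 3) ≡ offset OUT k + B
        stride  : reg σ (tp 4) ≡ 2 ^ suc OUT
        one     : reg σ (tp 5) ≡ 1
        sizeE   : reg σ (vr E) ≡ e
        done    : ∀ {j} → j < k → mem σ j ≡ out j
        todo    : ∀ {j} → k ≤ j → mem σ (offset OUT j + B) ≡ out j
        reals   : ∀ j → memℝ σ j ≡ real₀ j

    copy-step : ∀ {k σ} → Copied k σ → ∃ λ τ → ⟪ copyCell ⟫ σ ⇒[ 4 ] τ × Copied (suc k) τ
    copy-step {k} {σ} C = σ₄ , op ⨟ op ⨟ op ⨟ op , record
      { counter = trans (update-≡ (reg σ₃) (tp 1)) (trans (cong₂ _+_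
          (trans (keep₃ 1 (λ ()) (λ ())) counter) (trans (keep₃ 5 (λ ()) (λ ())) one)) (ℕ.+-comm k 1))
      ; limit = trans (keep₄ 2 (λ ()) (λ ()) (λ ())) limit
      ; pointer = trans (update-≢ (reg σ₃) (tp-≢ 3 1 λ ())) (trans (update-≡ (reg σ₂) (tp 3)) (trans (cong₂ _+_
          (trans (update-≢ (reg σ) (tp-≢ 3 6 λ ())) pointer) (trans (update-≢ (reg σ) (tp-≢ 4 6 λ ())) stride))
          (trans (swap (offset OUT k) B (2 ^ suc OUT)) (cong (_+ B) (sym (offset-suc OUT k))))))
      ; stride = trans (keep₄ 4 (λ ()) (λ ()) (λ ())) stride
      ; one = trans (keep₄ 5 (λ ()) (λ ()) (λ ())) one
      ; sizeE = trans (update-≢ (reg σ₃) (vr≢tp E 1)) (trans (update-≢ (reg σ₂) (vr≢tp E 3)) (trans (update-≢ (reg σ) (vr≢tp E 6)) sizeE))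
      ; done = λ j< → done′ (<suc j<)
      ; todo = λ {j} k<j → trans (update-≢ (mem σ) (λ eq → ℕ.<⇒≢
          (ℕ.<-≤-trans (ℕ.<-trans (ℕ.≤-<-trans (ℕ.≤-reflexive cell) k<j) (<offset OUT j)) (ℕ.m≤m+n _ B)) (sym eq))) (todo (ℕ.<⇒≤ k<j))
      ; reals = reals }
      where
      open Copied C
      σ₁ = execute (load (tp 6) (tp 3)) σ
      σ₂ = execute (store (tp 1) (tp 6)) σ₁
      σ₃ = execute (add (tp 3) (tp 3) (tp 4)) σ₂
      σ₄ = execute (add (tp 1) (tp 1) (tp 5)) σ₃
      swap : ∀ a b c → a + b + c ≡ a + c + b
      swap = solve-∀
      tp-≢ : ∀ i j → i ≢ j → tp i ≢ tp j
      tp-≢ i j i≢j eq with ℕ.<-cmp i j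
      ... | tri< i<j _ _ = tp≢ i<j eq
      ... | tri≈ _ i≡j _ = i≢j i≡j
      ... | tri> _ _ j<i = tp≢ j<i (sym eq)
      keep₃ : ∀ i → i ≢ 3 → i ≢ 6 → reg σ₃ (tp i) ≡ reg σ (tp i)
      keep₃ i p q = trans (update-≢ (reg σ₂) (tp-≢ i 3 p)) (update-≢ (reg σ) (tp-≢ i 6 q))
      keep₄ : ∀ i → i ≢ 1 → i ≢ 3 → i ≢ 6 → reg σ₄ (tp i) ≡ reg σ (tp i)
      keep₄ i r p q = trans (update-≢ (reg σ₃) (tp-≢ i 1 r)) (keep₃ i p q)
      cell : reg σ₁ (tp 1) ≡ k
      cell = trans (update-≢ (reg σ) (tp-≢ 1 6 λ ())) counter
      value : reg σ₁ (tp 6) ≡ out k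
      value = trans (update-≡ (reg σ) (tp 6)) (trans (cong (mem σ) pointer) (todo ℕ.≤-refl))
      done′ : ∀ {j} → j < k ⊎ j ≡ k → (mem σ [ reg σ₁ (tp 1) ≔ reg σ₁ (tp 6) ]) j ≡ out j
      done′ (inj₁ j<k)  = trans (update-≢ (mem σ) (λ eq → ℕ.<⇒≢ j<k (trans eq cell))) (done j<k)
      done′ {j} (inj₂ refl) = trans (cong (λ i → (mem σ [ i ≔ reg σ₁ (tp 6) ]) j) cell) (trans (update-≡ (mem σ) j) value)

    copy-all : ∀ n {k σ} → n + k ≡ ℓ → Copied k σ →
      ∃₂ λ t τ → ⟪ while< (tp 1) (tp 2) copyCell ⟫ σ ⇒[ t ] τ × Copied ℓ τ × t ≤ 1 + n * 6
    copy-all zero    {k} {σ} refl C = 1 , σ , exit (ℕ.≤-reflexive (trans (Copied.limit C) (sym (Copied.counter C)))) , C , ℕ.≤-refl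
    copy-all (suc n) {k} {σ} eq C with copy-step C
    ... | τ , x , C′ with copy-all n (trans (ℕ.+-suc n k) eq) C′
    ...   | t , υ , y , C″ , t≤ = suc (4 + suc t) , υ ,
      again (λ le → ℕ.<⇒≱ (ℕ.≤-trans (s≤s (ℕ.m≤n+m k n)) (ℕ.≤-reflexive eq)) (subst₂ _≤_ (Copied.limit C) (Copied.counter C) le)) x y ,
      C″ , ℕ.≤-trans (ℕ.+-monoʳ-≤ 6 t≤) (ℕ.≤-reflexive (shift (n * 6)))
      where
      shift : ∀ a → 6 + (1 + a) ≡ 1 + (6 + a)
      shift = solve-∀

  module Run (ks : List ℕ) (xs : List Carrier) where
    inp : ℕ → ℕ
    inp a = fromMaybe 0 (ks !? a)

    real₀ : ℕ → Carrier
    real₀ a = fromMaybe 0# (xs !? a)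

    open Semantics inp

    B : ℕ
    B = 2 + inp 1 + inp 1

    module _ (inp-end : ∀ {k} → B ≤ k → inp k ≡ 0) where
      open Simulation inp B inp-end

      σ₀ : State
      σ₀ = start ks xs

      prologue-correct : ∃ λ σ → ⟪ prologue ⟫ σ₀ ⇒[ 5 ] σ × Represents (initial real₀) σ
      prologue-correct = σ₅ , op ⨟ op ⨟ op ⨟ op ⨟ op , record
        { vars = λ x → trans (update-≢ (reg σ₄) (vr≢tp x 0)) (trans (update-≢ (reg σ₃) (vr≢tp x 0))
            (trans (update-≢ (reg σ₂) (vr≢tp x 0)) (trans (update-≢ (reg σ₁) (vr≢tp x 1)) (update-≢ (reg σ₀) (vr≢tp x 1)))))
        ; base = trans (update-≡ (reg σ₄) (tp 0)) (cong₂ _+_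
            (trans (update-≡ (reg σ₃) (tp 0)) (cong₂ _+_ (update-≡ (reg σ₂) (tp 0)) one₂))
            (trans (update-≢ (reg σ₃) (tp≢ z<s ∘ sym)) one₂))
        -- The arrays start as zero because the memory is zero behind the input.
        ; arrays = λ a k → inp-end (ℕ.m≤n+m B (offset a k))
        ; inputs = λ _ → refl
        ; reals = λ _ → refl }
        where
        σ₁ = execute (set (tp 1) 1) σ₀
        σ₂ = execute (load (tp 1) (tp 1)) σ₁
        σ₃ = execute (set (tp 0) 2) σ₂
        σ₄ = execute (add (tp 0) (tp 0) (tp 1)) σ₃
        σ₅ = execute (add (tp 0) (tp 0) (tp 1)) σ₄
        one₂ : reg σ₃ (tp 1) ≡ inp 1
        one₂ = trans (update-≢ (reg σ₂) (tp≢ z<s ∘ sym)) (trans (update-≡ (reg σ₁) (tp 1)) (cong inp (update-≡ (reg σ₀) (tp 1))))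

      record Outcome (s : Store) (τ : State) : Set where
        field
          address-ℕ : reg τ 0 ≡ 0
          address-ℝ : reg τ 1 ≡ var s E
          numbers   : ∀ {j} → j < var s OUTPOS → mem τ j ≡ arr s OUT j
          reals     : ∀ j → memℝ τ j ≡ real s j

      epilogue-correct : ∀ {s σ} → Represents s σ →
        ∃₂ λ t τ → ⟪ epilogue ⟫ σ ⇒[ t ] τ × Outcome s τ × t ≤ 31 + OUT + var s OUTPOS * 6
      epilogue-correct {s} {σ} R with compileE-correct 1 (‵ OUTPOS) R
      ... | computes {σ₁} x m R₁ k₁ with compileE-correct 2 (lit 0) R₁
      ... | computes {σ₂} y m₂ R₂ k₂ with address-correct 2 OUT R₂ m₂
      ... | computes {σ₃} z m₃ R₃ k₃ = finish (Copying.copy-all (arr s OUT) (var s OUTPOS) B (var s E) (real s) (var s OUTPOS) (ℕ.+-identityʳ _) copied)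
        where
        σ₄ = execute (set (tp 1) 0) σ₃
        σ₅ = execute (set (tp 4) (2 ^ suc OUT)) σ₄
        σ₆ = execute (set (tp 5) 1) σ₅
        open Copying (arr s OUT) (var s OUTPOS) B (var s E) (real s) using (Copied)
        copied : Copied 0 σ₆
        copied = record
          { counter = trans (update-≢ (reg σ₅) (tp≢ (s≤s z<s))) (trans (update-≢ (reg σ₄) (tp≢ (s≤s z<s))) (update-≡ (reg σ₃) (tp 1)))
          ; limit = trans (update-≢ (reg σ₅) (tp≢ (s≤s (s≤s z<s)))) (trans (update-≢ (reg σ₄) (tp≢ (s≤s (s≤s z<s))))
              (trans (update-≢ (reg σ₃) (tp≢ (s≤s z<s) ∘ sym)) (trans (KeepsTemps.keep k₃ ℕ.≤-refl) (trans (KeepsTemps.keep k₂ ℕ.≤-refl) m))))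
          ; pointer = trans (update-≢ (reg σ₅) (tp≢ (s≤s (s≤s (s≤s z<s))))) (trans (update-≢ (reg σ₄) (tp≢ (s≤s (s≤s (s≤s z<s)))))
              (trans (update-≢ (reg σ₃) (tp≢ (s≤s z<s) ∘ sym)) m₃))
          ; stride = trans (update-≢ (reg σ₅) (tp≢ (s≤s (s≤s (s≤s (s≤s z<s)))))) (update-≡ (reg σ₄) (tp 4))
          ; one = update-≡ (reg σ₅) (tp 5)
          ; sizeE = trans (update-≢ (reg σ₅) (vr≢tp E 5)) (trans (update-≢ (reg σ₄) (vr≢tp E 4))
              (trans (update-≢ (reg σ₃) (vr≢tp E 1)) (Represents.vars R₃ E)))
          ; done = λ ()
          ; todo = λ {j} _ → Represents.arrays R₃ OUT j
          ; reals = Represents.reals R₃ }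
        finish : (∃₂ λ t τ → ⟪ while< (tp 1) (tp 2) copyCell ⟫ σ₆ ⇒[ t ] τ × Copied (var s OUTPOS) τ × t ≤ 1 + var s OUTPOS * 6) →
          ∃₂ λ t τ → ⟪ epilogue ⟫ σ ⇒[ t ] τ × Outcome s τ × t ≤ 31 + OUT + var s OUTPOS * 6
        finish (t , τ , w , C , t≤) = _ , τ₃ , x ⨟ (y ⨟ z) ⨟ (op ⨟ op ⨟ op) ⨟ w ⨟ op ⨟ op ⨟ op , record
          -- Registers 0 and 1 are `vr 0` and `tp 0`. By `E≢0` the number of edges is not in the
          -- register that has just been cleared.
          { address-ℕ = subst (λ i → reg τ₃ i ≡ 0) vr-0 (trans (update-≢ (reg τ₂) (vr≢tp 0 0))
              (trans (update-≢ (reg τ₁) (vr≢tp 0 0)) (update-≡ (reg τ) (vr 0))))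
          ; address-ℝ = subst (λ i → reg τ₃ i ≡ var s E) tp-0 (trans (update-≡ (reg τ₂) (tp 0)) (cong₂ _+_ (update-≡ (reg τ₁) (tp 0))
              (trans (update-≢ (reg τ₁) (vr≢tp E 0)) (trans (update-≢ (reg τ) (E≢0 ∘ vr-injective)) sizeE))))
          ; numbers = done ; reals = reals } ,
          ℕ.≤-trans (ℕ.≤-reflexive (shift OUT t)) (ℕ.≤-trans (ℕ.+-monoʳ-≤ (13 + OUT) t≤) (ℕ.≤-trans (ℕ.≤-reflexive (shift′ OUT (var s OUTPOS * 6))) (ℕ.+-monoˡ-≤ (var s OUTPOS * 6) (ℕ.+-monoˡ-≤ OUT (ℕ.m≤m+n 14 17)))))
          where
          open Copied C
          τ₁ = execute (set (vr 0) 0) τ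
          τ₂ = execute (set (tp 0) 0) τ₁
          τ₃ = execute (add (tp 0) (tp 0) (vr E)) τ₂
          shift : ∀ o t → 2 + (1 + (4 + o) + (3 + (t + 3))) ≡ 13 + o + t
          shift = solve-∀
          shift′ : ∀ o x → 13 + o + (1 + x) ≡ 14 + o + x
          shift′ = solve-∀

      output-correct : ∀ s → run main (initial real₀) ≡ s →
        ∃₂ λ t τ → program ⊢ start ks xs ⇓[ t ] τ × t ≤ 36 + OUT + time s + var s OUTPOS * 6 × Outcome s τ
      output-correct s refl = assembled (proj₂ prologue-correct) (compile-correct 0 main (proj₂ (proj₂ prologue-correct)))
        where
        shift : ∀ o a b → 5 + (a + (31 + o + b)) ≡ 36 + o + a + b
        shift = solve-∀
        halted : ∀ {t τ} → ⟪ code ⟫ σ₀ ⇒[ t ] τ → program ⊢ σ₀ ⇓[ t ] at (size code) τ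
        halted = correct-program program {code} {σ₀} program≡
        relocate : ∀ k {τ} → Outcome s τ → Outcome s (at k τ)
        relocate k O = record { address-ℕ = address-ℕ ; address-ℝ = address-ℝ ; numbers = numbers ; reals = reals }
          where open Outcome O
        bound : ∀ {a b} → a ≤ time s → b ≤ 31 + OUT + var s OUTPOS * 6 → 5 + (a + b) ≤ 36 + OUT + time s + var s OUTPOS * 6
        bound le le₂ = ℕ.≤-trans (ℕ.+-monoʳ-≤ 5 (ℕ.+-mono-≤ le le₂)) (ℕ.≤-reflexive (shift OUT (time s) (var s OUTPOS * 6)))
        composed : ∀ {σ σ′ τ t t₂} → ⟪ prologue ⟫ σ₀ ⇒[ 5 ] σ → ⟪ compile 1 main ⟫ σ ⇒[ t ] σ′ → ⟪ epilogue ⟫ σ′ ⇒[ t₂ ] τ →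
                   ⟪ code ⟫ σ₀ ⇒[ 5 + (t + t₂) ] τ
        composed x y z = x ⨟ y ⨟ z
        assembled : ∀ {σ} → ⟪ prologue ⟫ σ₀ ⇒[ 5 ] σ × Represents (initial real₀) σ → Executes 0 (compile 1 main) 0 s (time s) σ →
          ∃₂ λ t τ → program ⊢ start ks xs ⇓[ t ] τ × t ≤ 36 + OUT + time s + var s OUTPOS * 6 × Outcome s τ
        assembled {σ} (x , _) (executes {t₁} {σ₁} y R _ le) = continue (epilogue-correct R)
          where
          continue : (∃₂ λ t τ → ⟪ epilogue ⟫ σ₁ ⇒[ t ] τ × Outcome s τ × t ≤ 31 + OUT + var s OUTPOS * 6) →
            ∃₂ λ t τ → program ⊢ start ks xs ⇓[ t ] τ × t ≤ 36 + OUT + time s + var s OUTPOS * 6 × Outcome s τ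
          continue (t₂ , τ , z , O , le₂) =
            5 + (t₁ + t₂) , at (size code) τ , halted (composed x y z) , bound le le₂ , relocate (size code) O

      open Sealed ℛ inp using (result; result≡)

      program-correct : ∃₂ λ t τ → let s = result main (initial real₀) in
        program ⊢ start ks xs ⇓[ t ] τ × t ≤ 36 + OUT + time s + var s OUTPOS * 6 × Outcome s τ
      program-correct = output-correct _ (result≡ main (initial real₀))

module Main where
  open ArcTables
  open SearchCode
  open ClassesCode
  open LayersCode
  open Costs

  prepare finish main : Cmd
  prepare = readArcs ⨾ makeRows ⨾ recordArcs
  finish = classes ⨾ layers ⨾ output
  main = readSizes ⨾ prepare ⨾ searches ⨾ finish

  abstract
    -- Reading the sizes takes 22 steps and entering the outer loop of the searches 4. The next
    -- summand is the cost of the searches relative to `n ^ 2`, and the two weights come from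
    -- `time-bound`.
    totalWeight : ℕ
    totalWeight = 22 + weightC prepare + 4 + (100 + (expandCost + visitCost)) + weightC finish

    totalWeight≡ : 22 + weightC prepare + 4 + (100 + (expandCost + visitCost)) + weightC finish ≡ totalWeight
    totalWeight≡ = refl

length-gather : ∀ {A : Set} {g : ℕ → List A} {b} n → (∀ k → length (g k) ≤ b) → length (gather g n) ≤ n * b
length-gather         zero    g≤ = z≤n
length-gather {g = g} {b} (suc n) g≤ = begin
  length (gather g n ++ g n)        ≡⟨ length-++ (gather g n) ⟩
  length (gather g n) + length (g n) ≤⟨ ℕ.+-mono-≤ (length-gather n g≤) (g≤ n) ⟩
  n * b + b                         ≡⟨ ℕ.+-comm (n * b) b ⟩
  b + n * b                         ∎
  where open ℕ.≤-Reasoning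

-- The arrays are arbitrary functions subject to these facts, so that the graph-theoretic argument
-- no longer refers to a run of the program.
record Computed (ℛ : Reals) (inp : ℕ → ℕ) (w : ℕ → Reals.Carrier ℛ) (v e : ℕ) : Set where
  m : ℕ
  m = e + e
  field
    {t h eid adj D col mx mn} : ℕ → ℕ
    arcs : ∀ {i} → i < e → (t i ≡ inp (2 + i + i) × t (e + i) ≡ inp (3 + i + i)) ×
      (h i ≡ inp (3 + i + i) × h (e + i) ≡ inp (2 + i + i)) × (eid i ≡ i × eid (e + i) ≡ i)
    t< : ∀ {a} → a < m → t a < v
    h< : ∀ {a} → a < m → h a < v
    adj-sound : ∀ {u x a} → x < v → adj (Tables._◇_ v e t h u x) ≡ suc a → a < m × t a ≡ u × h a ≡ x
    adj-complete : ∀ {a} → a < m → ∃ λ b → adj (Tables._◇_ v e t h (t a) (h a)) ≡ suc b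
    hops : ∀ {r x l} → r < v → x < v → Hops.Walk v e t h t< h< r l x →
      Hops.IsHops v e t h t< h< r x (D (Tables._◇_ v e t h r x))
    coloured : Colouring.Coloured ℛ m t h eid (λ u x → adj (Tables._◇_ v e t h u x))
      (λ u x → D (Tables._◇_ v e t h u x)) w m col
    measured : ∀ {x} → x < v → LayersCorrect.Layers.Measured ℛ inp {v} {e} t h D col t< h< m x mx mn

record Facts (ℛ : Reals) (inp : ℕ → ℕ) (w : ℕ → Reals.Carrier ℛ) (v e : ℕ) (s : Language.Store ℛ) : Set where
  open Language ℛ
  field
    computed : Computed ℛ inp w v e
  open Computed computed using (m; t; h; col; mx; mn)
  Written : List ℕ → List (Reals.Carrier ℛ) → Set
  Written xs ys = Output.Written ℛ inp v e t h col mx mn w xs ys s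
  numbers : List ℕ
  numbers = Output.colourCount ℛ inp v e t h col mx mn w ∷ gather (Output.factorEntry ℛ inp v e t h col mx mn w) m
  weights : List (Reals.Carrier ℛ)
  weights = gather (Output.factorWeights ℛ inp v e t h col mx mn w) m
  n : ℕ
  n = v + m
  field
    size           : var s Names.E ≡ e
    edgeless       : e ≡ 0 → Written (1 ∷ v ∷ 0 ∷ []) []
    general        : 0 < e → Written numbers weights
    numbers-length : length numbers ≤ 1 + n * (n + n)
    time≤          : time s ≤ Main.totalWeight * n ^ 2

halves : ∀ {e a} → a < e + e → a < e ⊎ ∃ λ i → i < e × a ≡ e + i
halves {e} {a} a<m with ℕ.<-≤-connex a e
... | inj₁ a<e = inj₁ a<e
... | inj₂ e≤a = inj₂ (a ∸ e , ℕ.+-cancelˡ-< e _ _ (subst (_< e + e) (sym (ℕ.m+[n∸m]≡n e≤a)) a<m) , sym (ℕ.m+[n∸m]≡n e≤a))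

module Pipeline (ℛ : Reals) (inp : ℕ → ℕ) (w : ℕ → Reals.Carrier ℛ) (v e : ℕ)
  (eqV : inp 0 ≡ v) (eqE : inp 1 ≡ e) (0<v : 0 < v)
  (end₁ : ∀ {i} → i < e → inp (2 + i + i) < v) (end₂ : ∀ {i} → i < e → inp (3 + i + i) < v) where
  open Reals ℛ using (Carrier)
  open Language ℛ
  open Semantics inp
  open Rules ℛ inp
  open Names
  open ArcTables
  open SearchCode
  open ClassesCode
  open LayersCode
  open Main
  open Sealed ℛ inp

  s₁ s₂ s₃ s₄ s₅ s₆ s₇ s₈ : Store
  s₁ = result readSizes (initial w)
  s₂ = result readArcs s₁
  s₃ = result makeRows s₂
  s₄ = result recordArcs s₃
  s₅ = result searches s₄
  s₆ = result classes s₅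
  s₇ = result layers s₆
  s₈ = result output s₇

  t h eid : ℕ → ℕ
  t = arr s₂ TL
  h = arr s₂ HD
  eid = arr s₂ EID

  m n : ℕ
  m = e + e
  n = v + m

  V₁ : var s₁ V ≡ v
  V₁ = seal {readSizes} {initial w} (λ s → var s V ≡ v) eqV
  E₁ : var s₁ E ≡ e
  E₁ = seal {readSizes} {initial w} (λ s → var s E ≡ e) eqE
  M₁ : var s₁ M ≡ m
  M₁ = seal {readSizes} {initial w} (λ s → var s M ≡ m) (cong₂ _+_ eqE eqE)
  N₁ : var s₁ N ≡ n
  N₁ = seal {readSizes} {initial w} (λ s → var s N ≡ n) (cong₂ _+_ eqV (cong₂ _+_ eqE eqE))
  zero-var : ∀ x → var (run readSizes (initial w)) x ≡ 0 → var s₁ x ≡ 0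
  zero-var x = seal {readSizes} {initial w} (λ s → var s x ≡ 0)
  zero-arr : ∀ a → arr s₁ a ≡ (λ _ → 0)
  zero-arr a = seal {readSizes} {initial w} (λ s → arr s a ≡ (λ _ → 0)) refl
  real₁ : real s₁ ≡ w
  real₁ = seal {readSizes} {initial w} (λ s → real s ≡ w) refl

  ag₂ : Agree readArcs s₁ s₂
  ag₂ = seal (Agree readArcs s₁) (agree readArcs s₁)
  ag₃ : Agree makeRows s₂ s₃
  ag₃ = seal (Agree makeRows s₂) (agree makeRows s₂)
  ag₄ : Agree recordArcs s₃ s₄
  ag₄ = seal (Agree recordArcs s₃) (agree recordArcs s₃)
  ag₅ : Agree searches s₄ s₅
  ag₅ = seal (Agree searches s₄) (agree searches s₄)
  ag₆ : Agree classes s₅ s₆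
  ag₆ = seal (Agree classes s₅) (agree classes s₅)
  ag₇ : Agree layers s₆ s₇
  ag₇ = seal (Agree layers s₆) (agree layers s₆)

  arcs : ∀ {i} → i < e → (t i ≡ inp (2 + i + i) × t (e + i) ≡ inp (3 + i + i)) ×
    (h i ≡ inp (3 + i + i) × h (e + i) ≡ inp (2 + i + i)) × (eid i ≡ i × eid (e + i) ≡ i)
  arcs {i} i<e = seal {readArcs} {s₁} (λ s →
    (arr s TL i ≡ inp (2 + i + i) × arr s TL (e + i) ≡ inp (3 + i + i)) ×
    (arr s HD i ≡ inp (3 + i + i) × arr s HD (e + i) ≡ inp (2 + i + i)) ×
    (arr s EID i ≡ i × arr s EID (e + i) ≡ i)) (ArcTablesCorrect.readArcs-correct ℛ inp s₁ E₁ i<e)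

  t< : ∀ {a} → a < m → t a < v
  t< a<m with halves a<m
  ... | inj₁ a<e              = subst (_< v) (sym (proj₁ (proj₁ (arcs a<e)))) (end₁ a<e)
  ... | inj₂ (i , i<e , refl) = subst (_< v) (sym (proj₂ (proj₁ (arcs i<e)))) (end₂ i<e)

  h< : ∀ {a} → a < m → h a < v
  h< a<m with halves a<m
  ... | inj₁ a<e              = subst (_< v) (sym (proj₁ (proj₁ (proj₂ (arcs a<e))))) (end₂ a<e)
  ... | inj₂ (i , i<e , refl) = subst (_< v) (sym (proj₂ (proj₁ (proj₂ (arcs i<e))))) (end₁ i<e)

  module Tab = Tables v e t h
  module Hop = Hops v e t h t< h<
  open Tab using (_◇_)

  adj D col mx mn : ℕ → ℕ
  adj = arr s₄ ADJ
  D = arr s₅ DIST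
  col = arr s₆ COL
  mx = arr s₇ MX
  mn = arr s₇ MN

  rows₃ : ∀ {u} → u < v → arr s₃ ROW u ≡ u * n
  rows₃ {u} u<v = seal {makeRows} {s₂} (λ s → arr s ROW u ≡ u * n) (ArcTablesCorrect.makeRows-correct ℛ inp s₂
    (trans (onVar ag₂ V {_}) V₁) (trans (onVar ag₂ N {_}) N₁) (trans (onVar ag₂ ACC {_}) (zero-var ACC refl)) u<v)

  M₃ : var s₃ M ≡ m
  M₃ = trans (onVar ag₃ M {_}) (trans (onVar ag₂ M {_}) M₁)

  V₄ : var s₄ V ≡ v
  V₄ = trans (onVar ag₄ V {_}) (trans (onVar ag₃ V {_}) (trans (onVar ag₂ V {_}) V₁))

  E₄ : var s₄ E ≡ e
  E₄ = trans (onVar ag₄ E {_}) (trans (onVar ag₃ E {_}) (trans (onVar ag₂ E {_}) E₁))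

  M₄ : var s₄ M ≡ m
  M₄ = trans (onVar ag₄ M {_}) M₃

  N₄ : var s₄ N ≡ n
  N₄ = trans (onVar ag₄ N {_}) (trans (onVar ag₃ N {_}) (trans (onVar ag₂ N {_}) N₁))

  rows₄ : ∀ {u} → u < v → arr s₄ ROW u ≡ u * n
  rows₄ u<v = trans (cong (λ f → f _) (onArr ag₄ ROW {_})) (rows₃ u<v)

  tails₄ : arr s₄ TL ≡ t
  tails₄ = trans (onArr ag₄ TL {_}) (onArr ag₃ TL {_})

  heads₄ : arr s₄ HD ≡ h
  heads₄ = trans (onArr ag₄ HD {_}) (onArr ag₃ HD {_})

  eids₄ : arr s₄ EID ≡ eid
  eids₄ = trans (onArr ag₄ EID {_}) (onArr ag₃ EID {_})

  fresh₄ : ∀ a {p : T (keepsArr a readArcs)} {q : T (keepsArr a makeRows)} {r : T (keepsArr a recordArcs)} →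
           arr s₄ a ≡ (λ _ → 0)
  fresh₄ a {p} {q} {r} = trans (onArr ag₄ a {r}) (trans (onArr ag₃ a {q}) (trans (onArr ag₂ a {p}) (zero-arr a)))

  recorded : Tab.Recorded m adj (arr s₄ NBR) (arr s₄ DEG) (arr s₄ COL)
  recorded = seal {recordArcs} {s₃} (λ s → Tab.Recorded m (arr s ADJ) (arr s NBR) (arr s DEG) (arr s COL))
    (ArcTablesCorrect.recordArcs-correct ℛ inp t h t< h< s₃ M₃ (onArr ag₃ TL {_}) (onArr ag₃ HD {_}) rows₃
      (trans (onArr ag₃ ADJ {_}) (trans (onArr ag₂ ADJ {_}) (zero-arr ADJ)))
      (trans (onArr ag₃ DEG {_}) (trans (onArr ag₂ DEG {_}) (zero-arr DEG))))

  open Costs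

  prepared₄ : SearchCorrect.Prepared ℛ inp {v} {e} t h t< h< s₄
  prepared₄ = record { sizeV = V₄ ; rows = rows₄ ; recorded = recorded }

  module Search = SearchCorrect.Searches ℛ inp {v} {e} t h t< h< s₄ prepared₄ (fresh₄ DIST)

  hops : ∀ {r x l} → r < v → x < v → Hop.Walk r l x → Hop.IsHops r x (D (r ◇ x))
  hops {r} {x} r<v x<v walk = seal {searches} {s₄} (λ s → Hop.IsHops r x (arr s DIST (r ◇ x)))
    (SearchCorrect.Found.hops (Search.Inv.found Search.result) r<v r<v x<v walk)

  elapsed₅ : time s₅ ≤ time s₄ + 4 + v * (100 + (v * expandCost + m * visitCost))
  elapsed₅ = seal {searches} {s₄} (λ s → time s ≤ time s₄ + 4 + v * (100 + (v * expandCost + m * visitCost)))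
    (Search.Inv.elapsed Search.result)

  real₅ : real s₅ ≡ w
  real₅ = trans (onReal ag₅ {_}) (trans (onReal ag₄ {_}) (trans (onReal ag₃ {_}) (trans (onReal ag₂ {_}) real₁)))

  classified : ClassesCorrect.Inv ℛ inp {v} {e} t h eid adj D w t< h< m s₆
  classified = seal {classes} {s₅} (ClassesCorrect.Inv ℛ inp {v} {e} t h eid adj D w t< h< m) (ClassesCorrect.classes-correct ℛ inp t h eid adj D w t< h< s₅
    (record
      { sizeM = trans (onVar ag₅ M {_}) M₄
      ; tails = trans (onArr ag₅ TL {_}) tails₄
      ; heads = trans (onArr ag₅ HD {_}) heads₄
      ; eids = trans (onArr ag₅ EID {_}) eids₄
      ; adjs = onArr ag₅ ADJ {_}
      ; dists = refl
      ; rows = λ u<v → trans (cong (λ f → f _) (onArr ag₅ ROW {_})) (rows₄ u<v)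
      ; reals = real₅ })
    (λ a<m → trans (cong (λ f → f _) (onArr ag₅ COL {_})) (Tab.Recorded.col-id recorded a<m))
    (trans (onArr ag₅ GOOD {_}) (fresh₄ GOOD)) (trans (onArr ag₅ FLAG {_}) (fresh₄ FLAG)))

  module Col = Colouring ℛ m t h eid (λ u x → adj (u ◇ x)) (λ u x → D (u ◇ x)) w

  coloured : Col.Coloured m col
  coloured = ClassesCorrect.Inv.coloured classified

  context₆ : ClassesCorrect.Context ℛ inp {v} {e} t h eid adj D w t< h< s₆
  context₆ = ClassesCorrect.Inv.context classified

  module Lay = LayersCorrect.Layers ℛ inp {v} {e} t h D col t< h<

  measured : ∀ {x} → x < v → Lay.Measured m x mx mn
  measured {x} x<v = seal {layers} {s₆} (λ s → Lay.Measured m x (arr s MX) (arr s MN)) (Lay.layers-correct s₆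
    (record { sizeM = sizeM ; tails = tails ; heads = heads ; dists = dists ; cols = refl ; rows = rows })
    (trans (onVar ag₆ V {_}) (trans (onVar ag₅ V {_}) V₄))
    (trans (onArr ag₆ MX {_}) (trans (onArr ag₅ MX {_}) (fresh₄ MX)))
    (trans (onArr ag₆ MN {_}) (trans (onArr ag₅ MN {_}) (fresh₄ MN))) x<v)
    where open ClassesCorrect.Context context₆

  computed : Computed ℛ inp w v e
  computed = record
    { t = t ; h = h ; eid = eid ; adj = adj ; D = D ; col = col ; mx = mx ; mn = mn
    ; arcs = arcs ; t< = t< ; h< = h<
    ; adj-sound = Tab.Recorded.adj-sound recorded ; adj-complete = Tab.Recorded.adj-complete recorded
    ; hops = hops ; coloured = coloured ; measured = measured }

  module Out = Output ℛ inp

  V₇ : var s₇ V ≡ v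
  V₇ = trans (onVar ag₇ V {_}) (trans (onVar ag₆ V {_}) (trans (onVar ag₅ V {_}) V₄))

  E₇ : var s₇ E ≡ e
  E₇ = trans (onVar ag₇ E {_}) (trans (onVar ag₆ E {_}) (trans (onVar ag₅ E {_}) E₄))

  setting₇ : Out.Setting v e t h col mx mn w s₇
  setting₇ = record
    { sizeV = V₇ ; sizeE = E₇
    ; sizeM = trans (onVar ag₇ M {_}) sizeM
    ; tails = trans (onArr ag₇ TL {_}) tails
    ; heads = trans (onArr ag₇ HD {_}) heads
    ; cols = onArr ag₇ COL {_} ; mxs = refl ; mns = refl }
    where open ClassesCorrect.Context context₆

  fresh-var : ∀ x {p : T (keepsVar x readArcs)} {q : T (keepsVar x makeRows)} {r : T (keepsVar x recordArcs)}
    {p′ : T (keepsVar x searches)} {q′ : T (keepsVar x classes)} {r′ : T (keepsVar x layers)} → var s₇ x ≡ var s₁ x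
  fresh-var x {p} {q} {r} {p′} {q′} {r′} = trans (onVar ag₇ x {r′}) (trans (onVar ag₆ x {q′}) (trans (onVar ag₅ x {p′})
    (trans (onVar ag₄ x {r}) (trans (onVar ag₃ x {q}) (onVar ag₂ x {p})))))

  written₇ : Out.Written v e t h col mx mn w [] [] s₇
  written₇ = record
    { out = tt ; pos = trans (fresh-var OUTPOS {_} {_} {_} {_} {_} {_}) (zero-var OUTPOS refl) ; outℝ = tt
    ; posℝ = trans (fresh-var REALPOS {_} {_} {_} {_} {_} {_}) (zero-var REALPOS refl)
    ; weights = λ {j} _ → cong (λ f → f j) (trans (onReal ag₇ {_}) (trans (onReal ag₆ {_}) real₅)) }

  numbers : List ℕ
  numbers = Out.colourCount v e t h col mx mn w ∷ gather (Out.factorEntry v e t h col mx mn w) m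

  weights : List Carrier
  weights = gather (Out.factorWeights v e t h col mx mn w) m

  low : ∀ {a} → a < e → a < m
  low a<e = ℕ.<-≤-trans a<e (ℕ.m≤m+n e e)

  output-general : 0 < e → Out.Written v e t h col mx mn w numbers weights s₈
  output-general 0<e = seal {output} {s₇} (Out.Written v e t h col mx mn w numbers weights) (ifZero-elim (Out.Written v e t h col mx mn w numbers weights) (var s₇ E)
    (λ z → contradiction (trans (sym z) E₇) (ℕ.<⇒≢ 0<e))
    (λ _ → Out.output-general v e t h col mx mn w (λ a<e → t< (low a<e)) (λ a<e → h< (low a<e)) (wait 6 s₇)
      (record { sizeV = sizeV ; sizeE = sizeE ; sizeM = sizeM ; tails = tails ; heads = heads ; cols = cols ; mxs = mxs ; mns = mns })
      (trans (fresh-var CNT {_} {_} {_} {_} {_} {_}) (zero-var CNT refl)) (Out.written-wait v e t h col mx mn w 6 written₇)))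
    where open Out.Setting setting₇

  output-edgeless : e ≡ 0 → Out.Written v e t h col mx mn w (1 ∷ v ∷ 0 ∷ []) [] s₈
  output-edgeless e≡0 = seal {output} {s₇} (Out.Written v e t h col mx mn w (1 ∷ v ∷ 0 ∷ []) []) (ifZero-elim (Out.Written v e t h col mx mn w (1 ∷ v ∷ 0 ∷ []) []) (var s₇ E)
    (λ _ → push₁ (lit 0) {run (push (‵ V)) (run (push (lit 1)) (wait 6 s₇))} refl
      (push₁ (‵ V) {run (push (lit 1)) (wait 6 s₇)} V₇ (push₁ (lit 1) {wait 6 s₇} refl (Out.written-wait v e t h col mx mn w 6 written₇))))
    (λ nz → case trans (sym nz) (trans E₇ e≡0) of λ ()))
    where
    push₁ = Out.push-written v e t h col mx mn w

  s₈-size : var s₈ E ≡ e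
  s₈-size = trans (onVar (seal (Agree output s₇) (agree output s₇)) E {_}) E₇

  1≤n : 1 ≤ n
  1≤n = ℕ.≤-trans 0<v (ℕ.m≤m+n v m)

  sizes≤ : ∀ s → var s V ≡ v → var s E ≡ e → var s M ≡ m → var s N ≡ n → ∀ y → T (y <ᵇ 4) → var s y ≤ n
  sizes≤ s p q r o 0 _ = subst (_≤ n) (sym p) (ℕ.m≤m+n v m)
  sizes≤ s p q r o 1 _ = subst (_≤ n) (sym q) (ℕ.≤-trans (ℕ.m≤m+n e e) (ℕ.m≤n+m m v))
  sizes≤ s p q r o 2 _ = subst (_≤ n) (sym r) (ℕ.m≤n+m m v)
  sizes≤ s p q r o 3 _ = ℕ.≤-reflexive o

  prepared : result prepare s₁ ≡ s₄
  prepared = trans (result-⨾ readArcs (makeRows ⨾ recordArcs) s₁) (result-⨾ makeRows recordArcs s₂)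

  finished : result finish s₅ ≡ s₈
  finished = trans (result-⨾ classes (layers ⨾ output) s₅) (result-⨾ layers output s₆)

  run-time : ∀ c k {s s′} → run c s ≡ s′ → T (static c) → depth c ≡ k → (∀ y → T (y <ᵇ 4) → var s y ≤ n) →
             time s′ ≤ time s + weightC c * n ^ k
  run-time c k {s} refl p refl bound = time-bound n 1≤n c {s} p (λ {y} → bound y)

  prepare-time : time s₄ ≤ 22 + weightC prepare * n ^ 1
  prepare-time = subst (λ a → time s₄ ≤ a + weightC prepare * n ^ 1)
    (seal {readSizes} {initial w} (λ s → time s ≡ 22) refl)
    (run-time prepare 1 (trans (result≡ prepare s₁) prepared) tt refl (sizes≤ s₁ V₁ E₁ M₁ N₁))

  finish-time : time s₈ ≤ time s₅ + weightC finish * n ^ 2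
  finish-time = run-time finish 2 (trans (result≡ finish s₅) finished) tt refl (sizes≤ s₅ (trans (onVar ag₅ V {_}) V₄)
    (trans (onVar ag₅ E {_}) E₄) (trans (onVar ag₅ M {_}) M₄) (trans (onVar ag₅ N {_}) N₄))

  -- As `v` and `m` are at most `n`, and `1 ≤ n`, every summand is absorbed into a multiple of
  -- `n ^ 2`. The coefficients are variables so that the actual weights are not computed.
  sum-times : ∀ a P A B F {t₄ t₅ t₈} → t₄ ≤ a + P * n ^ 1 → t₅ ≤ t₄ + 4 + v * (100 + (v * A + m * B)) →
    t₈ ≤ t₅ + F * n ^ 2 → t₈ ≤ (a + P + 4 + (100 + (A + B)) + F) * n ^ 2
  sum-times a P A B F {t₄} {t₅} {t₈} le₄ le₅ le₈ = begin
    t₈                                              ≤⟨ le₈ ⟩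
    t₅ + F * n ^ 2                                  ≤⟨ ℕ.+-monoˡ-≤ (F * n ^ 2) le₅ ⟩
    t₄ + 4 + v * (100 + (v * A + m * B)) + F * n ^ 2
      ≤⟨ ℕ.+-monoˡ-≤ (F * n ^ 2) (ℕ.+-mono-≤ (ℕ.+-monoˡ-≤ 4 le₄) (ℕ.*-mono-≤ v≤n inner)) ⟩
    a + P * n ^ 1 + 4 + n * ((100 + (A + B)) * n) + F * n ^ 2
      ≤⟨ ℕ.+-monoˡ-≤ (F * n ^ 2) (ℕ.+-mono-≤ (ℕ.+-mono-≤ (ℕ.+-mono-≤ (scale a) (ℕ.*-monoʳ-≤ P pow)) (scale 4)) (ℕ.≤-reflexive (square (100 + (A + B)) n))) ⟩
    a * n ^ 2 + P * n ^ 2 + 4 * n ^ 2 + (100 + (A + B)) * n ^ 2 + F * n ^ 2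
      ≡⟨ collect a P 4 (100 + (A + B)) F (n ^ 2) ⟩
    (a + P + 4 + (100 + (A + B)) + F) * n ^ 2       ∎
    where
    open ℕ.≤-Reasoning
    instance
      n≢0 : NonZero n
      n≢0 = >-nonZero 1≤n
    v≤n : v ≤ n
    v≤n = ℕ.m≤m+n v m
    scale : ∀ k → k ≤ k * n ^ 2
    scale k = ℕ.m≤m*n k (n ^ 2) {{ℕ.m^n≢0 n 2}}
    pow : n ^ 1 ≤ n ^ 2
    pow = ℕ.^-monoʳ-≤ n {1} {2} (s≤s z≤n)
    inner : 100 + (v * A + m * B) ≤ (100 + (A + B)) * n
    inner = ℕ.≤-trans (ℕ.+-mono-≤ (ℕ.m≤m*n 100 n) (ℕ.+-mono-≤ (ℕ.*-monoˡ-≤ A v≤n) (ℕ.*-monoˡ-≤ B (ℕ.m≤n+m m v))))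
      (ℕ.≤-reflexive (factor n A B))
      where
      factor : ∀ n x y → 100 * n + (n * x + n * y) ≡ (100 + (x + y)) * n
      factor = solve-∀
    square : ∀ k n → n * (k * n) ≡ k * n ^ 2
    square k n = trans (swap k n) (cong (λ x → k * (n * x)) (sym (ℕ.*-identityʳ n)))
      where
      swap : ∀ k n → n * (k * n) ≡ k * (n * n)
      swap = solve-∀
    collect : ∀ a b c d f x → a * x + b * x + c * x + d * x + f * x ≡ (a + b + c + d + f) * x
    collect = solve-∀

  total-time : time s₈ ≤ totalWeight * n ^ 2
  total-time = subst (λ W → time s₈ ≤ W * n ^ 2) totalWeight≡
    (sum-times 22 (weightC prepare) expandCost visitCost (weightC finish) prepare-time elapsed₅ finish-time)

  -- Bounds the time of the final copying: each of the `m` possible colours contributes at most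
  -- `2 + 2e` numbers, and each of the two halves `1 + e` is at most `n` because `v` is positive.
  numbers-length : length numbers ≤ 1 + n * (n + n)
  numbers-length = s≤s (ℕ.≤-trans (length-gather m entry≤) (ℕ.*-mono-≤ (ℕ.m≤n+m m v) size≤))
    where
    size≤ : 2 + e * 2 ≤ n + n
    size≤ = ℕ.≤-trans (ℕ.≤-reflexive (shift e)) (ℕ.+-mono-≤ half≤ half≤)
      where
      half≤ : 1 + e ≤ n
      half≤ = ℕ.+-mono-≤ 0<v (ℕ.m≤m+n e e)
      shift : ∀ e → 2 + e * 2 ≡ 1 + e + (1 + e)
      shift = solve-∀
    edge≤ : ∀ i f → length (Out.edgeEntry v e t h col mx mn w i f) ≤ 2
    edge≤ i f = ifZero-elim (λ xs → length xs ≤ 2) (Out.edgeOutside v e t h col mx mn w i f) (λ _ → ℕ.≤-refl) (λ _ → z≤n)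
    entry≤ : ∀ i → length (Out.factorEntry v e t h col mx mn w i) ≤ 2 + e * 2
    entry≤ i = ifZero-elim (λ xs → length xs ≤ 2 + e * 2) (gap (col i) i) (λ _ → s≤s (s≤s (length-gather e (edge≤ i)))) (λ _ → z≤n)

  completed : result main (initial w) ≡ s₈
  completed = begin
    result main (initial w)                        ≡⟨ result-⨾ readSizes (prepare ⨾ searches ⨾ finish) (initial w) ⟩
    result (prepare ⨾ searches ⨾ finish) s₁        ≡⟨ result-⨾ prepare (searches ⨾ finish) s₁ ⟩
    result (searches ⨾ finish) (result prepare s₁) ≡⟨ cong (result (searches ⨾ finish)) prepared ⟩
    result (searches ⨾ finish) s₄                  ≡⟨ result-⨾ searches finish s₄ ⟩
    result finish s₅                               ≡⟨ finished ⟩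
    s₈                                             ∎
    where open ≡-Reasoning

  facts : Facts ℛ inp w v e (result main (initial w))
  facts = subst (Facts ℛ inp w v e) (sym completed) (record
    { computed = computed ; size = s₈-size ; edgeless = output-edgeless ; general = output-general
    ; numbers-length = numbers-length ; time≤ = total-time })

-- Edge lists of layers

gather-cons : ∀ {A : Set} (g : ℕ → List A) n → gather g (suc n) ≡ g 0 ++ gather (g ∘ suc) n
gather-cons g zero    = sym (++-identityʳ (g 0))
gather-cons g (suc n) = trans (cong (_++ g (suc n)) (gather-cons g n)) (++-assoc (g 0) (gather (g ∘ suc) n) (g (suc n)))

gather-concatMap : ∀ {A B : Set} {g : ℕ → List B} {f : A → List B} xs → (∀ k → g (toℕ k) ≡ f (List.lookup xs k)) →
                   gather g (length xs) ≡ concatMap f xs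
gather-concatMap             []       eq = refl
gather-concatMap {g = g} {f} (x ∷ xs) eq = trans (gather-cons g (length xs))
  (cong₂ _++_ (eq zero) (gather-concatMap {g = g ∘ suc} {f} xs (eq ∘ suc)))

length-gather-concatMap : ∀ {A B C : Set} {g : ℕ → List B} {f : A → List C} xs →
  (∀ k → length (g (toℕ k)) ≡ length (f (List.lookup xs k))) → length (gather g (length xs)) ≡ length (concatMap f xs)
length-gather-concatMap             []       eq = refl
length-gather-concatMap {g = g} {f} (x ∷ xs) eq = begin
  length (gather g (suc (length xs)))                     ≡⟨ cong length (gather-cons g (length xs)) ⟩
  length (g 0 ++ gather (g ∘ suc) (length xs))            ≡⟨ length-++ (g 0) ⟩
  length (g 0) + length (gather (g ∘ suc) (length xs))    ≡⟨ cong₂ _+_ (eq zero) (length-gather-concatMap {g = g ∘ suc} {f} xs (eq ∘ suc)) ⟩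
  length (f x) + length (concatMap f xs)                  ≡⟨ length-++ (f x) ⟨
  length (f x ++ concatMap f xs)                          ∎
  where open ≡-Reasoning

gather-select : ∀ {A : Set} (p : ℕ → ℕ) (f : ℕ → List A) m →
                gather (λ i → ifZero p i then f i else []) m ≡ concatMap f (select p m)
gather-select p f zero    = refl
gather-select p f (suc m) = trans (cong₂ _++_ (gather-select p f m) (entry (p m)))
  (sym (concatMap-++ f (select p m) (ifZero p m then m ∷ [] else [])))
  where
  entry : ∀ n → (ifZero n then f m else []) ≡ concatMap f (ifZero n then m ∷ [] else [])
  entry zero    = sym (++-identityʳ (f m))
  entry (suc n) = refl

concatMap-concatMap : ∀ {A B C : Set} (f : B → List C) (g : A → List B) xs →
                      concatMap f (concatMap g xs) ≡ concatMap (concatMap f ∘ g) xs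
concatMap-concatMap f g []       = refl
concatMap-concatMap f g (x ∷ xs) = trans (concatMap-++ f (g x) (concatMap g xs))
  (cong (concatMap f (g x) ++_) (concatMap-concatMap f g xs))

module _ (p : ℕ → ℕ) where

  ∈-select⁻ : ∀ k {i} → i ∈ select p k → i < k × p i ≡ 0
  ∈-select⁻ (suc k) {i} i∈ with ∈-++⁻ (select p k) i∈
  ... | inj₁ i∈′ = let i<k , z = ∈-select⁻ k i∈′ in ℕ.m≤n⇒m≤1+n i<k , z
  ... | inj₂ i∈′ with p k in eq
  ∈-select⁻ (suc k) i∈ | inj₂ (here refl) | zero = ℕ.≤-refl , eq

  ∈-select⁺ : ∀ k {i} → i < k → p i ≡ 0 → i ∈ select p k
  ∈-select⁺ (suc k) {i} i< z with <suc i<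
  ... | inj₁ i<k  = ∈-++⁺ˡ (∈-select⁺ k i<k z)
  ... | inj₂ refl = ∈-++⁺ʳ (select p k) (subst (λ n → k ∈ (ifZero n then k ∷ [] else [])) (sym z) (here refl))

  select-unique : ∀ k → Unique (select p k)
  select-unique zero    = []
  select-unique (suc k) = Unique.++⁺ (select-unique k) (single (p k)) disjoint
    where
    single : ∀ n → Unique (ifZero n then k ∷ [] else [])
    single zero    = [] ∷ []
    single (suc n) = []
    last : ∀ n {i} → i ∈ (ifZero n then k ∷ [] else []) → i ≡ k
    last zero (here refl) = refl
    disjoint : ∀ {i} → i ∈ select p k × i ∈ (ifZero p k then k ∷ [] else []) → ⊥
    disjoint (i∈ , i∈′) = ℕ.<⇒≢ (proj₁ (∈-select⁻ k i∈)) (last (p k) i∈′)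

module Labelled (ℛ : Reals) where
  open OverReals ℛ

  module _ (mk : ℕ → ∃ EdgeList) where

    factors : List ℕ → List WeightedGraph
    factors cs = map proj₁ (map mk cs)

    -- The coordinates of a product are positions in a list, whereas `κ` takes colours as values;
    -- `label` translates the former into the latter.
    label : ∀ cs → Fin (length (factors cs)) → ℕ
    label (c ∷ cs) zero    = c
    label (c ∷ cs) (suc k) = label cs k

    label-∈ : ∀ cs k → label cs k ∈ cs
    label-∈ (c ∷ cs) zero    = here refl
    label-∈ (c ∷ cs) (suc k) = there (label-∈ cs k)

    label-injective : ∀ {cs} → Unique cs → ∀ {k l} → label cs k ≡ label cs l → k ≡ l
    label-injective (c∉ ∷ u) {zero}  {zero}  eq = refl
    label-injective {c ∷ cs} (c∉ ∷ u) {zero}  {suc l} eq = contradiction eq (All.lookup c∉ (label-∈ cs l))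
    label-injective {c ∷ cs} (c∉ ∷ u) {suc k} {zero}  eq = contradiction (sym eq) (All.lookup c∉ (label-∈ cs k))
    label-injective (c∉ ∷ u) {suc k} {suc l} eq = cong suc (label-injective u eq)

    label-covers : ∀ {cs c} → c ∈ cs → ∃ λ k → c ≡ label cs k
    label-covers (here refl) = zero , refl
    label-covers (there c∈)  = let k , eq = label-covers c∈ in suc k , eq

    lookup-factor : ∀ {P : ℕ → WeightedGraph → Set} → (∀ c → P c (proj₁ (mk c))) →
                    ∀ cs k → P (label cs k) (List.lookup (factors cs) k)
    lookup-factor all (c ∷ cs) zero    = all c
    lookup-factor {P} all (c ∷ cs) (suc k) = lookup-factor {P} all cs k

    all-factors : ∀ {P : WeightedGraph → Set} cs → (∀ {c} → c ∈ cs → P (proj₁ (mk c))) → All P (factors cs)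
    all-factors []       all = []
    all-factors (c ∷ cs) all = all (here refl) ∷ all-factors cs (all ∘ there)

module LayerEdges (ℛ : Reals) (G : OverReals.WeightedGraph ℛ) (L : OverReals.EdgeList ℛ G) where
  open Reals ℛ using (Carrier)
  open OverReals ℛ
  open GraphWalks ℛ G
  open Colours ℛ G
  open EdgeList L

  module _ {d : Vertex → Vertex → ℕ} (isHop : IsHopDistance d) (κ : Vertex → Vertex → ℕ)
    (same : ∀ {u v x y} → Adj u v → Adj x y → Separates d u v x y → κ u v ≡ κ x y)
    (square : ∀ {u v w} (e : Adj u v) (f : Adj u w) → κ u v ≢ κ u w → ∃ (Opposite e f)) (r : Vertex)
    (i : ℕ) (p : ℕ → ℕ)
    (sound : ∀ v → p (toℕ v) ≡ 0 → InLayer isHop κ same square r i v)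
    (complete-p : ∀ v → InLayer isHop κ same square r i v → p (toℕ v) ≡ 0) where

    open LayerGraph isHop κ same square r i p sound complete-p

    -- The sum of the two tests is a separate argument with its equation, because the `ifZero` in
    -- the output of the program branches on the same number.
    keepIf : ∀ n u v → p (toℕ u) + p (toℕ v) ≡ n → Adj u v → List (Edge graph)
    keepIf zero    u v z e = (index u zu , index v zv , lower zu zv e) ∷ []
      where
      zu = ℕ.m+n≡0⇒m≡0 (p (toℕ u)) z
      zv = ℕ.m+n≡0⇒n≡0 (p (toℕ u)) z
    keepIf (suc n) u v z e = []

    keep : Edge G → List (Edge graph)
    keep (u , v , e) = keepIf (p (toℕ u) + p (toℕ v)) u v refl e

    SameEdgeᵢ : Edge graph → Edge graph → Set
    SameEdgeᵢ = SameEdge {graph}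

    index-injective : ∀ {u v} zu zv → index u zu ≡ index v zv → u ≡ v
    index-injective {u} {v} zu zv eq = trans (sym (inject-index u zu)) (trans (cong inject eq) (inject-index v zv))

    keepIf-lift : ∀ {P : Edge graph → Set} n u v z e →
      (∀ zu zv → P (index u zu , index v zv , lower zu zv e)) → All P (keepIf n u v z e)
    keepIf-lift zero    u v z e all = all _ _ ∷ []
    keepIf-lift (suc n) u v z e all = []

    kept-distinct : ∀ {xs} → AllPairs (λ e f → ¬ SameEdge {G} e f) xs → AllPairs (λ e f → ¬ SameEdgeᵢ e f) (concatMap keep xs)
    kept-distinct [] = []
    kept-distinct {(u , v , e) ∷ xs} (x∉ ∷ rest) =
      AllPairs.++⁺ (single (p (toℕ u) + p (toℕ v)) refl) (kept-distinct rest)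
        (keepIf-lift _ u v refl e (λ zu zv → cross zu zv x∉))
      where
      single : ∀ n z → AllPairs (λ e f → ¬ SameEdgeᵢ e f) (keepIf n u v z e)
      single zero    z = [] ∷ []
      single (suc n) z = []
      cross : ∀ zu zv {ys} → All (λ f → ¬ SameEdge {G} (u , v , e) f) ys →
              All (λ f → ¬ SameEdgeᵢ (index u zu , index v zv , lower zu zv e) f) (concatMap keep ys)
      cross zu zv [] = []
      cross zu zv {(x , y , f) ∷ ys} (ne ∷ nes) = All.++⁺
        (keepIf-lift _ x y refl f (λ zx zy → λ
          { (inj₁ (a , b)) → ne (inj₁ (index-injective zu zx a , index-injective zv zy b))
          ; (inj₂ (a , b)) → ne (inj₂ (index-injective zu zy a , index-injective zv zx b)) }))
        (cross zu zv nes)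

    kept-complete : ∀ e → Any (SameEdgeᵢ e) (concatMap keep edges)
    kept-complete (x , y , e) = concatMap⁺ keep (Any.map found (complete (inject x , inject y , e)))
      where
      found : ∀ {f} → SameEdge {G} (inject x , inject y , e) f → Any (SameEdgeᵢ (x , y , e)) (keep f)
      found {u , v , f} se = go (p (toℕ u) + p (toℕ v)) refl se
        where
        go : ∀ n z → SameEdge {G} (inject x , inject y , e) (u , v , f) → Any (SameEdgeᵢ (x , y , e)) (keepIf n u v z f)
        go zero z (inj₁ (refl , refl)) = here (inj₁ (sym (index-inject x (inject-in x)) , sym (index-inject y (inject-in y))))
        go zero z (inj₂ (refl , refl)) = here (inj₂ (sym (index-inject x (inject-in x)) , sym (index-inject y (inject-in y))))
        go (suc n) z (inj₁ (refl , refl)) = case trans (sym z) (cong₂ _+_ (inject-in x) (inject-in y)) of λ ()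
        go (suc n) z (inj₂ (refl , refl)) = case trans (sym z) (cong₂ _+_ (inject-in y) (inject-in x)) of λ ()

    layerEdges : EdgeList graph
    layerEdges = record { edges = concatMap keep edges ; distinct = kept-distinct distinct ; complete = kept-complete }

    module _ (t h : ℕ → ℕ) (w : ℕ → Carrier)
      (tails : ∀ k → t (toℕ k) ≡ toℕ (proj₁ (List.lookup edges k)))
      (heads : ∀ k → h (toℕ k) ≡ toℕ (proj₁ (proj₂ (List.lookup edges k))))
      (weights : ∀ k → w (toℕ k) ≡ weight (proj₂ (proj₂ (List.lookup edges k)))) where

      q : ℕ → ℕ
      q f = p (t f) + p (h f)

      private
        q-edge : ∀ k {u v e} → List.lookup edges k ≡ (u , v , e) → q (toℕ k) ≡ p (toℕ u) + p (toℕ v)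
        q-edge k refl = cong₂ (λ a b → p a + p b) (tails k) (heads k)

      kept-length : length (select q (length edges)) ≡ length (concatMap keep edges)
      kept-length = length-gather-concatMap edges entry
        where
        entry : ∀ k → length (ifZero q (toℕ k) then toℕ k ∷ [] else []) ≡ length (keep (List.lookup edges k))
        entry k = go (p (toℕ u) + p (toℕ v)) refl
          where
          u = proj₁ (List.lookup edges k)
          v = proj₁ (proj₂ (List.lookup edges k))
          e = proj₂ (proj₂ (List.lookup edges k))
          go : ∀ n z → length (ifZero q (toℕ k) then toℕ k ∷ [] else []) ≡ length (keepIf n u v z e)
          go n z rewrite trans (q-edge k refl) z = go′ n z
            where
            go′ : ∀ n z → length (ifZero n then toℕ k ∷ [] else []) ≡ length (keepIf n u v z e)
            go′ zero    z = refl
            go′ (suc n) z = refl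

      -- `f` is given by its defining equation because the pattern-matching function inside
      -- `encodeℕ` has no name; for it the equation is `refl`.
      kept-numbers : (f : Edge graph → List ℕ) → (∀ u v e → f (u , v , e) ≡ toℕ u ∷ toℕ v ∷ []) →
        gather (λ k → ifZero q k then count p (t k) ∷ count p (h k) ∷ [] else []) (length edges) ≡
        concatMap f (concatMap keep edges)
      kept-numbers f f≡ = trans (gather-concatMap edges entry) (sym (concatMap-concatMap f keep edges))
        where
        entry : ∀ k → (ifZero q (toℕ k) then count p (t (toℕ k)) ∷ count p (h (toℕ k)) ∷ [] else []) ≡
                      concatMap f (keep (List.lookup edges k))
        entry k = trans (cong (λ n → ifZero n then count p (t (toℕ k)) ∷ count p (h (toℕ k)) ∷ [] else []) (q-edge k refl))
                        (go (p (toℕ u) + p (toℕ v)) refl)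
          where
          u = proj₁ (List.lookup edges k)
          v = proj₁ (proj₂ (List.lookup edges k))
          e = proj₂ (proj₂ (List.lookup edges k))
          go : ∀ n z → (ifZero n then count p (t (toℕ k)) ∷ count p (h (toℕ k)) ∷ [] else []) ≡ concatMap f (keepIf n u v z e)
          go zero    z = trans (cong₂ (λ a b → a ∷ b ∷ [])
              (trans (cong (count p) (tails k)) (sym (toℕ-index u (ℕ.m+n≡0⇒m≡0 (p (toℕ u)) z))))
              (trans (cong (count p) (heads k)) (sym (toℕ-index v (ℕ.m+n≡0⇒n≡0 (p (toℕ u)) z)))))
            (trans (sym (f≡ _ _ _)) (sym (++-identityʳ _)))
          go (suc n) z = refl

      kept-weights : (f : Edge graph → Carrier) → (∀ u v e → f (u , v , e) ≡ weight e) →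
        gather (λ k → ifZero q k then w k ∷ [] else []) (length edges) ≡ map f (concatMap keep edges)
      kept-weights f f≡ = trans (gather-concatMap edges entry) (sym (map-concatMap f keep edges))
        where
        weight-subst : ∀ {u u′ v v′} (a : u ≡ u′) (b : v ≡ v′) (e : Adj u v) → weight (subst₂ Adj a b e) ≡ weight e
        weight-subst refl refl e = refl
        entry : ∀ k → (ifZero q (toℕ k) then w (toℕ k) ∷ [] else []) ≡ map f (keep (List.lookup edges k))
        entry k = trans (cong (λ n → ifZero n then w (toℕ k) ∷ [] else []) (q-edge k refl))
                        (go (p (toℕ u) + p (toℕ v)) refl)
          where
          u = proj₁ (List.lookup edges k)
          v = proj₁ (proj₂ (List.lookup edges k))
          e = proj₂ (proj₂ (List.lookup edges k))
          go : ∀ n z → (ifZero n then w (toℕ k) ∷ [] else []) ≡ map f (keepIf n u v z e)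
          go zero    z = cong (_∷ []) (trans (weights k) (trans (sym (weight-subst _ _ e)) (sym (f≡ _ _ _))))
          go (suc n) z = refl

lookup-pairs : ∀ {A : Set} (f : A → List ℕ) (a b : A → ℕ) → (∀ x → f x ≡ a x ∷ b x ∷ []) → ∀ xs k →
  fromMaybe 0 (concatMap f xs !? (toℕ k + toℕ k)) ≡ a (List.lookup xs k) ×
  fromMaybe 0 (concatMap f xs !? suc (toℕ k + toℕ k)) ≡ b (List.lookup xs k)
lookup-pairs f a b eq (x ∷ xs) zero rewrite eq x = refl , refl
lookup-pairs f a b eq (x ∷ xs) (suc k) rewrite eq x | ℕ.+-suc (toℕ k) (toℕ k) = lookup-pairs f a b eq xs k

length-pairs : ∀ {A : Set} (f : A → List ℕ) (a b : A → ℕ) → (∀ x → f x ≡ a x ∷ b x ∷ []) → ∀ xs →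
  length (concatMap f xs) ≡ length xs + length xs
length-pairs f a b eq []       = refl
length-pairs f a b eq (x ∷ xs) rewrite eq x =
  cong suc (trans (cong suc (length-pairs f a b eq xs)) (sym (ℕ.+-suc (length xs) (length xs))))

beyond-end : ∀ {A : Set} (xs : List A) {k z} → length xs ≤ k → fromMaybe z (xs !? k) ≡ z
beyond-end []       {zero}  _        = refl
beyond-end []       {suc k} _        = refl
beyond-end (x ∷ xs) {suc k} (s≤s le) = beyond-end xs le

module Input (ℛ : Reals) (G : OverReals.WeightedGraph ℛ) (L : OverReals.EdgeList ℛ G) where
  open Reals ℛ using (Carrier; _≈_)
  open OverReals ℛ
  open GraphWalks ℛ G
  open Colours ℛ G
  open EdgeList L using (edges; complete)

  v e : ℕ
  v = order G
  e = length edges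

  inp : ℕ → ℕ
  inp a = fromMaybe 0 (encodeℕ L !? a)

  endpoint₁ endpoint₂ : Fin e → Vertex
  endpoint₁ k = proj₁ (List.lookup edges k)
  endpoint₂ k = proj₁ (proj₂ (List.lookup edges k))

  edge : ∀ k → Adj (endpoint₁ k) (endpoint₂ k)
  edge k = proj₂ (proj₂ (List.lookup edges k))

  inp-edge : ∀ k → inp (2 + toℕ k + toℕ k) ≡ toℕ (endpoint₁ k) × inp (3 + toℕ k + toℕ k) ≡ toℕ (endpoint₂ k)
  inp-edge k = lookup-pairs _ (λ x → toℕ (proj₁ x)) (λ x → toℕ (proj₁ (proj₂ x))) (λ _ → refl) edges k

  inp-end : ∀ {k} → 2 + inp 1 + inp 1 ≤ k → inp k ≡ 0
  inp-end le = beyond-end (encodeℕ L) (ℕ.≤-trans (ℕ.≤-reflexive (cong (2 +_)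
    (length-pairs _ (λ x → toℕ (proj₁ x)) (λ x → toℕ (proj₁ (proj₂ x))) (λ _ → refl) edges))) le)

  0<v : 0 < v
  0<v = >-nonZero⁻¹ v {{WeightedGraph.nonEmpty G}}

  end₁ : ∀ {i} → i < e → inp (2 + i + i) < v
  end₁ {i} i<e = subst (λ i → inp (2 + i + i) < v) (toℕ-fromℕ< i<e)
    (subst (_< v) (sym (proj₁ (inp-edge (fromℕ< i<e)))) (toℕ<n _))

  end₂ : ∀ {i} → i < e → inp (3 + i + i) < v
  end₂ {i} i<e = subst (λ i → inp (3 + i + i) < v) (toℕ-fromℕ< i<e)
    (subst (_< v) (sym (proj₂ (inp-edge (fromℕ< i<e)))) (toℕ<n _))

-- The computed arrays as a colouring of the graph.

module Instance (ℛ : Reals) (G : OverReals.WeightedGraph ℛ) (L : OverReals.EdgeList ℛ G) (w : ℕ → Reals.Carrier ℛ)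
  (w-edge : ∀ k → w (toℕ k) ≡ OverReals.WeightedGraph.weight G (proj₂ (proj₂ (List.lookup (OverReals.EdgeList.edges L) k))))
  (computed : Computed ℛ (Input.inp ℛ G L) w (Input.v ℛ G L) (Input.e ℛ G L))
  where
  open Reals ℛ using (Carrier; _≈_)
  open OverReals ℛ
  open GraphWalks ℛ G
  open Colours ℛ G
  open EdgeList L using (edges; complete)
  open Input ℛ G L
  open Computed computed public
  module Tab = Tables v e t h
  module Hop = Hops v e t h t< h<
  module Col = Colouring ℛ m t h eid (λ u x → adj (Tab._◇_ u x)) (λ u x → D (Tab._◇_ u x)) w
  module Lay = LayersCorrect.Layers ℛ inp {v} {e} t h D col t< h<
  open Tab using (_◇_)

  tail-edge : ∀ k → t (toℕ k) ≡ toℕ (endpoint₁ k)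
  tail-edge k = trans (proj₁ (proj₁ (arcs (toℕ<n k)))) (proj₁ (inp-edge k))

  head-edge : ∀ k → h (toℕ k) ≡ toℕ (endpoint₂ k)
  head-edge k = trans (proj₁ (proj₁ (proj₂ (arcs (toℕ<n k))))) (proj₂ (inp-edge k))

  tail-reverse : ∀ k → t (e + toℕ k) ≡ toℕ (endpoint₂ k)
  tail-reverse k = trans (proj₂ (proj₁ (arcs (toℕ<n k)))) (proj₂ (inp-edge k))

  head-reverse : ∀ k → h (e + toℕ k) ≡ toℕ (endpoint₁ k)
  head-reverse k = trans (proj₂ (proj₁ (proj₂ (arcs (toℕ<n k))))) (proj₁ (inp-edge k))

  record Arc (a : ℕ) (x y : Vertex) : Set where
    constructor arc
    field
      a<m : a < m
      ta  : t a ≡ toℕ x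
      ha  : h a ≡ toℕ y

  arc-ends : ∀ {a} → a < m → ∃₂ λ x y → Arc a x y × Σ[ f ∈ Adj x y ] weight f ≈ w (eid a)
  arc-ends {a} a<m with halves a<m
  ... | inj₁ a<e = endpoint₁ k , endpoint₂ k ,
      arc a<m (trans (cong t (sym eq)) (tail-edge k)) (trans (cong h (sym eq)) (head-edge k)) ,
      edge k , subst (weight (edge k) ≈_) (trans (sym (w-edge k)) (cong w (trans eq (sym (proj₁ (proj₂ (proj₂ (arcs a<e)))))))) ≈-refl
    where
    k = fromℕ< a<e
    eq : toℕ k ≡ a
    eq = toℕ-fromℕ< a<e
  ... | inj₂ (i , i<e , refl) = endpoint₂ k , endpoint₁ k ,
      arc a<m (trans (cong (λ i → t (e + i)) (sym eq)) (tail-reverse k)) (trans (cong (λ i → h (e + i)) (sym eq)) (head-reverse k)) ,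
      symmetric (edge k) , ≈-trans (weight-sym (symmetric (edge k)) (edge k))
        (subst (weight (edge k) ≈_) (trans (sym (w-edge k)) (cong w (trans eq (sym (proj₂ (proj₂ (proj₂ (arcs i<e)))))))) ≈-refl)
    where
    k = fromℕ< i<e
    eq : toℕ k ≡ i
    eq = toℕ-fromℕ< i<e

  arc-unique : ∀ {a x y x′ y′} → Arc a x y → Arc a x′ y′ → x ≡ x′ × y ≡ y′
  arc-unique (arc _ p q) (arc _ p′ q′) = toℕ-injective (trans (sym p) p′) , toℕ-injective (trans (sym q) q′)

  arc-adj : ∀ {a x y} → Arc a x y → Adj x y
  arc-adj A with arc-ends (Arc.a<m A)
  ... | x′ , y′ , A′ , f , _ with arc-unique A A′
  ...   | refl , refl = f

  arc-weight : ∀ {a x y} → Arc a x y → (f : Adj x y) → weight f ≈ w (eid a)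
  arc-weight A f with arc-ends (Arc.a<m A)
  ... | x′ , y′ , A′ , g , eq with arc-unique A A′
  ...   | refl , refl = ≈-trans (weight-irr f g) eq

  arc-of : ∀ {x y} → Adj x y → ∃ λ a → Arc a x y
  arc-of {x} {y} f = go (lookup-index found)
    where
    found = complete (x , y , f)
    k = Any.index found
    go : SameEdge {G} (x , y , f) (List.lookup edges k) → ∃ λ a → Arc a x y
    go (inj₁ (p , q)) = toℕ k , arc (ℕ.<-≤-trans (toℕ<n k) (ℕ.m≤m+n e e))
      (trans (tail-edge k) (cong toℕ (sym p))) (trans (head-edge k) (cong toℕ (sym q)))
    go (inj₂ (p , q)) = e + toℕ k , arc (ℕ.+-monoʳ-< e (toℕ<n k))
      (trans (tail-reverse k) (cong toℕ (sym p))) (trans (head-reverse k) (cong toℕ (sym q)))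

  walk-down : ∀ {x y k} → Walk x k y → Hop.Walk (toℕ x) k (toℕ y)
  walk-down here = Hop.here
  walk-down {x} (_▹_ {n} p f) with arc-of f
  ... | a , arc a<m ta ha = subst (Hop.Walk (toℕ x) (suc n)) ha (subst (Hop.Walk (toℕ x) n) (sym ta) (walk-down p) Hop.▹ a<m)

  walk-up : ∀ {x y′ k} → Hop.Walk (toℕ x) k y′ → ∃ λ y → toℕ y ≡ y′ × Walk x k y
  walk-up {x} Hop.here = x , refl , here
  walk-up {x} (Hop._▹_ {n} p a<m) with walk-up p | arc-ends a<m
  ... | y , eq , q | u , z , arc _ ta ha , f , _ =
    z , sym ha , subst (Walk x n) (toℕ-injective (trans eq ta)) q ▹ f

  d : Vertex → Vertex → ℕ
  d x y = D (toℕ x ◇ toℕ y) ∸ 1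

  hops-at : ∀ x y → Hop.IsHops (toℕ x) (toℕ y) (D (toℕ x ◇ toℕ y))
  hops-at x y = hops (toℕ<n x) (toℕ<n y) (walk-down (proj₂ (some-walk x y)))

  D-suc : ∀ x y → D (toℕ x ◇ toℕ y) ≡ suc (d x y)
  D-suc x y = let l , eq , _ = hops-at x y in trans eq (cong (λ n → suc (n ∸ 1)) (sym eq))

  isHop : IsHopDistance d
  isHop = record
    { shortest = λ x y → let l , eq , walk , _ = hops-at x y
                             y′ , eq′ , p = walk-up walk
                         in subst₂ (Walk x) (sym (cong (_∸ 1) eq)) (toℕ-injective eq′) p
    ; minimal = λ {x} {y} p → let l , eq , _ , min = hops-at x y
                              in subst (_≤ _) (sym (cong (_∸ 1) eq)) (min (walk-down p)) }
  open IsHopDistance isHop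

  κ : Vertex → Vertex → ℕ
  κ x y = col (adj (toℕ x ◇ toℕ y) ∸ 1)

  open Col.Coloured coloured

  -- `D` exceeds `d` by one, so both sides of a comparison in (Θ) are shifted by 2 and the
  -- comparison is unaffected.
  sums : ∀ x y x′ y′ → D (toℕ x ◇ toℕ y) + D (toℕ x′ ◇ toℕ y′) ≡ 2 + (d x y + d x′ y′)
  sums x y x′ y′ = trans (cong₂ _+_ (D-suc x y) (D-suc x′ y′)) (cong suc (ℕ.+-suc _ _))

  separates-down : ∀ {b x y x′ y′} → Arc b x′ y′ → Separates d x y x′ y′ → Col.Separates (toℕ x) (toℕ y) b
  separates-down {x = x} {y} {x′} {y′} (arc _ tb hb) sep eq rewrite tb | hb = sep
    (ℕ.suc-injective (ℕ.suc-injective (trans (sym (sums x x′ y y′)) (trans eq (sums x y′ y x′)))))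

  separates-up : ∀ {b x y x′ y′} → Arc b x′ y′ → Col.Separates (toℕ x) (toℕ y) b → Separates d x y x′ y′
  separates-up {x = x} {y} {x′} {y′} (arc _ tb hb) sep eq rewrite tb | hb = sep
    (trans (sums x x′ y y′) (trans (cong (2 +_) eq) (sym (sums x y′ y x′))))

  related : ∀ {a b x y x′ y′} → Arc a x y → Arc b x′ y′ → Separates d x y x′ y′ → Col.Related a b
  related {x = x} {y} (arc _ ta ha) B sep =
    inj₁ (subst₂ (λ p q → Col.Separates p q _) (sym ta) (sym ha) (separates-down {x = x} {y} B sep))

  self-separates : ∀ {x y} → Adj x y → Separates d x y x y
  self-separates {x} {y} f eq = case trans (sym (cong₂ _+_ (d-self x) (d-self y))) (trans eq (cong₂ _+_ (d-adj f) (d-adj (symmetric f)))) of λ ()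

  found-arc : ∀ {a x y} → Arc a x y → ∃ λ b → adj (toℕ x ◇ toℕ y) ≡ suc b × Arc b x y
  found-arc {x = x} {y} (arc a<m ta ha) with adj-complete a<m
  ... | b , eq rewrite ta | ha with adj-sound (toℕ<n y) eq
  ...   | b<m , tb , hb = b , eq , arc b<m tb hb

  -- The arc recorded in `adj` may differ from `a`, but it has the same ends. An edge is in relation
  -- Θ with itself, so the two have the same colour.
  arc-colour : ∀ {a x y} → Arc a x y → col a ≡ κ x y
  arc-colour A with found-arc A
  ... | b , eq , B = trans (closed (Arc.a<m A) (Arc.a<m B) (related A B (self-separates (arc-adj A)))) (cong (λ n → col (n ∸ 1)) (sym eq))

  same : ∀ {x y x′ y′} → Adj x y → Adj x′ y′ → Separates d x y x′ y′ → κ x y ≡ κ x′ y′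
  same f g sep with arc-of f | arc-of g
  ... | a , A | b , B = trans (sym (arc-colour A)) (trans (closed (Arc.a<m A) (Arc.a<m B) (related A B sep)) (arc-colour B))

  square? : ∀ a x → Dec (Col.Square a x)
  square? a x = ℕ.anyUpTo? (λ b → (¬? (h b ℕ.≟ t a) ×-dec (0 ℕ.<? adj (t a ◇ t b)) ×-dec (0 ℕ.<? adj (h a ◇ h b)) ×-dec
    (Reals._≟_ ℛ (w (eid a)) (w (eid b))) ×-dec (Reals._≟_ ℛ (w (eid (adj (t a ◇ t b) ∸ 1))) (w (eid (adj (h a ◇ h b) ∸ 1))))) ×-dec (t b ℕ.≟ x)) m

  adjacent-arc : ∀ {x y} → 0 < adj (toℕ x ◇ toℕ y) → Arc (adj (toℕ x ◇ toℕ y) ∸ 1) x y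
  adjacent-arc {x} {y} pos with adj (toℕ x ◇ toℕ y) in eq
  ... | suc b = let b<m , tb , hb = adj-sound (toℕ<n y) eq in arc b<m tb hb

  square-up : ∀ {a x y z} → Arc a x y → (f : Adj x y) (g : Adj x z) → Col.Square a (toℕ z) → ∃ (Opposite f g)
  square-up {a} {x} {y} {z} A@(arc _ ta ha) f g (b , b<m , (ne , pos₁ , pos₂ , w₁ , w₂) , tb) with arc-ends b<m
  ... | z′ , u , B@(arc _ tb′ hb) , k , _ with toℕ-injective (trans (sym tb′) tb)
  ...   | refl = u , (λ { refl → ne (trans hb (sym ta)) }) ,
    (k , ≈-trans (arc-weight A f) (≈-trans w₁ (≈-sym (arc-weight B k)))) ,
    (arc-adj C₂ , ≈-trans (arc-weight C₁ g) (≈-trans (subst₂ (λ i j → w (eid (i ∸ 1)) ≈ w (eid (j ∸ 1))) at₁ at₂ w₂) (≈-sym (arc-weight C₂ _))))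
    where
    at₁ = cong₂ (λ i j → adj (i ◇ j)) ta tb
    at₂ = cong₂ (λ i j → adj (i ◇ j)) ha hb
    C₁ = adjacent-arc (subst (0 <_) at₁ pos₁)
    C₂ = adjacent-arc (subst (0 <_) at₂ pos₂)

  square-down : ∀ {a x y z u} → Arc a x y → (f : Adj x y) (g : Adj x z) → Opposite f g u → Col.Square a (toℕ z)
  square-down {a} {x} {y} {z} {u} A@(arc _ ta ha) f g (u≢x , (k , f≈k) , (l , g≈l)) with arc-of k | arc-of g | arc-of l
  ... | b , B@(arc b<m tb hb) | c , C | c′ , C′ with found-arc C | found-arc C′
  ...   | c₁ , eq₁ , C₁ | c₂ , eq₂ , C₂ = b , b<m ,
    ( (λ eq → u≢x (toℕ-injective (trans (sym hb) (trans eq ta))))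
    , subst (0 <_) (sym at₁) z<s
    , subst (0 <_) (sym at₂) z<s
    , ≈-trans (≈-sym (arc-weight A f)) (≈-trans f≈k (arc-weight B k))
    , subst₂ (λ i j → w (eid (i ∸ 1)) ≈ w (eid (j ∸ 1))) (sym at₁) (sym at₂)
        (≈-trans (≈-sym (arc-weight C₁ g)) (≈-trans g≈l (arc-weight C₂ l)))) , tb
    where
    at₁ : adj (t a ◇ t b) ≡ suc c₁
    at₁ = trans (cong₂ (λ i j → adj (i ◇ j)) ta tb) eq₁
    at₂ : adj (h a ◇ h b) ≡ suc c₂
    at₂ = trans (cong₂ (λ i j → adj (i ◇ j)) ha hb) eq₂

  -- `closed` gives equal colours in the absence of a square. As squares can be decided, unequal
  -- colours yield one.
  square : ∀ {x y z} (f : Adj x y) (g : Adj x z) → κ x y ≢ κ x z → ∃ (Opposite f g)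
  square {x} {y} {z} f g κ≢ with arc-of f | arc-of g
  ... | a , A | b , B with square? a (toℕ z)
  ...   | yes sq = square-up A f g sq
  ...   | no ¬sq = contradiction (trans (sym (arc-colour A)) (trans (closed (Arc.a<m A) (Arc.a<m B)
    (inj₂ (trans (Arc.ta B) (sym (Arc.ta A)) , ¬sq ∘ subst (Col.Square a) (Arc.ha B)))) (arc-colour B))) κ≢

  all-forced : (J : Vertex → Vertex → Bool) →
    (∀ {x y x′ y′} → Adj x y → Adj x′ y′ → Separates d x y x′ y′ → J x y ≡ J x′ y′) →
    (∀ {x y z} (f : Adj x y) (g : Adj x z) → (∀ {u} → ¬ Opposite f g u) → J x y ≡ J x z) →
    ∀ {x y x′ y′} → Adj x y → Adj x′ y′ → κ x y ≡ κ x′ y′ → J x y ≡ J x′ y′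
  all-forced J sep corner {x} {y} {x′} {y′} f g κ≡ with arc-of f | arc-of g
  ... | a , A | b , B = trans (sym (at A)) (trans
    (forced Jᵃ respects (Arc.a<m A) (Arc.a<m B) (trans (arc-colour A) (trans κ≡ (sym (arc-colour B))))) (at B))
    where
    value : ∀ {a} → Dec (a < m) → Bool
    value (yes a<m) = let x , y , _ = arc-ends a<m in J x y
    -- An arbitrary default: only arc numbers below `m` are ever compared.
    value (no _)    = false
    Jᵃ : ℕ → Bool
    Jᵃ a = value (a ℕ.<? m)
    at : ∀ {a x y} → Arc a x y → Jᵃ a ≡ J x y
    at {a} {x} {y} A = go (a ℕ.<? m)
      where
      go : (p : Dec (a < m)) → value p ≡ J x y
      go (no a≮m)  = contradiction (Arc.a<m A) a≮m
      go (yes a<m) with arc-ends a<m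
      ... | x′ , y′ , A′ , _ with arc-unique A A′
      ...   | refl , refl = refl
    respects : ∀ {a b} → a < m → b < m → Col.Related a b → Jᵃ a ≡ Jᵃ b
    respects {a} {b} a<m b<m rel with arc-ends a<m | arc-ends b<m
    ... | x , y , A , f , _ | x′ , y′ , B , g , _ = trans (at A) (trans (go rel) (sym (at B)))
      where
      go : Col.Related a b → J x y ≡ J x′ y′
      go (inj₁ s) = sep f g (separates-up {b} {x} {y} B (subst₂ (λ p q → Col.Separates p q b) (Arc.ta A) (Arc.ha A) s))
      go (inj₂ (eq , ¬sq)) with toℕ-injective (trans (sym (Arc.ta B)) (trans eq (Arc.ta A)))
      ... | refl = corner f g (λ o → ¬sq (subst (Col.Square a) (sym (Arc.ha B)) (square-down A f g o)))

  r : Vertex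
  r = fromℕ< 0<v

  toℕ-r : toℕ r ≡ 0
  toℕ-r = toℕ-fromℕ< 0<v

  outside : ℕ → ℕ → ℕ
  outside = Output.outside ℛ inp v e t h col mx mn w

  root-separates : ∀ {b} {x : Vertex} → Lay.Sep (toℕ x) b → Col.Separates (toℕ r) (toℕ x) b
  root-separates {b} {x} sep eq = sep (subst (λ z → D (z ◇ t b) + D (toℕ x ◇ h b) ≡ D (z ◇ h b) + D (toℕ x ◇ t b)) toℕ-r eq)

  root-separates⁻ : ∀ {b} {x : Vertex} → Col.Separates (toℕ r) (toℕ x) b → Lay.Sep (toℕ x) b
  root-separates⁻ {b} {x} sep eq = sep (subst (λ z → D (z ◇ t b) + D (toℕ x ◇ h b) ≡ D (z ◇ h b) + D (toℕ x ◇ t b)) (sym toℕ-r) eq)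

  outside-sound : ∀ i x → outside i (toℕ x) ≡ 0 → InLayer isHop κ same square r i x
  outside-sound i x z {j} j≢i {x′} {y′} f κ≡j with d r x′ + d x y′ ℕ.≟ d r y′ + d x x′
  ... | yes eq = eq
  ... | no sep with arc-of f
  ...   | b , B = contradiction (trans (sym κ≡j) (trans (sym (arc-colour B))
    (Lay.outside-sound (measured (toℕ<n x)) col< z (Arc.a<m B) (root-separates⁻ {b} {x} (separates-down {b} {r} {x} B sep))))) j≢i

  outside-complete : ∀ i x → InLayer isHop κ same square r i x → outside i (toℕ x) ≡ 0
  outside-complete i x inL = Lay.outside-complete (measured (toℕ<n x)) col< all
    where
    all : ∀ {b} → b < m → Lay.Sep (toℕ x) b → col b ≡ i
    all {b} b<m sep with col b ℕ.≟ i
    ... | yes eq = eq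
    ... | no ne with arc-ends b<m
    ...   | x′ , y′ , B , f , _ = contradiction (inL ne f (sym (arc-colour B))) (separates-up {b} {r} {x} B (root-separates {b} {x} sep))

  -- Every vertex other than r is charged to its last edge on a shortest walk from r.
  v≤1+e : v ≤ suc e
  v≤1+e = injective⇒≤ {f = charge} (λ {x} {y} → charge-injective x y)
    where
    last-edge : ∀ {x} → r ≢ x → Fin e
    last-edge r≢x = let x′ , f , _ = descent r≢x in Any.index (complete (x′ , _ , f))
    charge : Vertex → Fin (suc e)
    charge x with r Fin.≟ x
    ... | yes _  = zero
    ... | no r≢x = suc (last-edge r≢x)
    charge-injective : ∀ x y → charge x ≡ charge y → x ≡ y
    charge-injective x y eq with r Fin.≟ x | r Fin.≟ y
    ... | yes refl | yes refl = refl
    ... | yes _    | no _     = case eq of λ ()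
    ... | no _     | yes _    = case eq of λ ()
    ... | no r≢x   | no r≢y with descent r≢x | descent r≢y
    ...   | x′ , f , dx | y′ , g , dy = meet {List.lookup edges (Any.index (complete (x′ , x , f)))} (lookup-index (complete (x′ , x , f)))
            (subst (λ k → SameEdge {G} (y′ , y , g) (List.lookup edges k)) (sym (Fin.suc-injective eq)) (lookup-index (complete (y′ , y , g))))
      where
      -- If two vertices were charged to one edge from opposite ends, each would be farther from `r`
      -- than the other.
      apart : x′ ≡ y → x ≢ y′
      apart p q = ℕ.<⇒≢ (ℕ.≤-trans (ℕ.n<1+n (d r x)) (ℕ.n≤1+n _))
        (trans dx (trans (cong (λ z → suc (d r z)) p) (trans (cong suc dy) (cong (λ z → suc (suc (d r z))) (sym q)))))
      meet : ∀ {k} → SameEdge {G} (x′ , x , f) k → SameEdge {G} (y′ , y , g) k → x ≡ y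
      meet (inj₁ (_ , p)) (inj₁ (_ , q)) = trans p (sym q)
      meet (inj₂ (_ , p)) (inj₂ (_ , q)) = trans p (sym q)
      meet (inj₁ (p , q)) (inj₂ (p′ , q′)) = contradiction (trans q (sym p′)) (apart (trans p (sym q′)))
      meet (inj₂ (p , q)) (inj₁ (p′ , q′)) = contradiction (trans q (sym p′)) (apart (trans p (sym q′)))

lookup-map-++ : ∀ {A B : Set} (f : A → B) xs ys {z} k → fromMaybe z ((map f xs ++ ys) !? toℕ k) ≡ f (List.lookup xs k)
lookup-map-++ f (x ∷ xs) ys zero    = refl
lookup-map-++ f (x ∷ xs) ys (suc k) = lookup-map-++ f xs ys k

module Layers (ℛ : Reals) (G : OverReals.WeightedGraph ℛ) (L : OverReals.EdgeList ℛ G) (w : ℕ → Reals.Carrier ℛ)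
  (w-edge : ∀ k → w (toℕ k) ≡ OverReals.WeightedGraph.weight G (proj₂ (proj₂ (List.lookup (OverReals.EdgeList.edges L) k))))
  (computed : Computed ℛ (Input.inp ℛ G L) w (Input.v ℛ G L) (Input.e ℛ G L))
  (0<e : 0 < Input.e ℛ G L)
  where
  open Reals ℛ using (Carrier; _≈_)
  open OverReals ℛ
  open GraphWalks ℛ G
  open Colours ℛ G
  open Input ℛ G L
  open Instance ℛ G L w w-edge computed
  open Col.Coloured coloured

  graphOf : ℕ → WeightedGraph
  graphOf i = LayerGraph.graph isHop κ same square r i (outside i) (outside-sound i) (outside-complete i)

  edgesOf : (i : ℕ) → EdgeList (graphOf i)
  edgesOf i = LayerEdges.layerEdges ℛ G L isHop κ same square r i (outside i) (outside-sound i) (outside-complete i)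

  layerOf : ∀ i → IsLayer isHop κ same square i (graphOf i)
  layerOf i = LayerGraph.isLayer isHop κ same square r i (outside i) (outside-sound i) (outside-complete i)

  factorOf : ℕ → ∃ EdgeList
  factorOf i = graphOf i , edgesOf i

  colours : List ℕ
  colours = select (λ i → gap (col i) i) m

  open Labelled ℛ using (factors; label; label-injective; label-covers; lookup-factor; all-factors)

  Hs : List (∃ EdgeList)
  Hs = map factorOf colours

  colour-∈ : ∀ {x y} → Adj x y → κ x y ∈ colours
  colour-∈ {x} {y} f with arc-of f
  ... | a , A = subst (_∈ colours) (arc-colour A)
    (∈-select⁺ (λ i → gap (col i) i) m (col< (Arc.a<m A)) (trans (cong (λ c → gap c (col a)) (col-idem (Arc.a<m A))) (gap-refl (col a))))

  arc₀ : ∃₂ λ x y → Adj x y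
  arc₀ with arc-ends (ℕ.<-≤-trans 0<e (ℕ.m≤m+n _ _))
  ... | x , y , _ , f , _ = x , y , f

  -- A colour is the number of an arc of this colour, and that arc descends to the layer. So no
  -- factor is `K₁`, and `prime` has an edge to start from.
  layer-nonempty : ∀ {c} → c ∈ colours → ∃₂ (WeightedGraph.Adj (graphOf c))
  layer-nonempty {c} c∈ with ∈-select⁻ (λ i → gap (col i) i) m c∈
  ... | c<m , z with arc-ends c<m
  ...   | x , y , A , f , _ = _ , _ , proj₁ (IsLayer.down (layerOf c) f (trans (sym (arc-colour A)) (gap-zero z)))

  prime-layer : ∀ {c} → c ∈ colours → Prime (graphOf c)
  prime-layer {c} c∈ = Factorizations.LayerPrime.prime ℛ isHop κ same square all-forced (layerOf c)
    (proj₂ (proj₂ (layer-nonempty c∈)))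

  factorization : IsFactorization G (map proj₁ Hs)
  factorization = record
    { nonEmpty = nonEmpty colours (colour-∈ (proj₂ (proj₂ arc₀)))
    ; isomorphism = Products.isomorphic ℛ G isHop κ same square (label factorOf colours) r
        (label-injective factorOf (select-unique (λ i → gap (col i) i) m))
        (λ f → label-covers factorOf (colour-∈ f))
        (lookup-factor factorOf {IsLayer isHop κ same square} layerOf colours)
    ; noK₁ = all-factors factorOf colours (λ c∈ φ → contradiction
        (Equivalence.to (_≅_.adjacency φ _ _) (proj₂ (proj₂ (layer-nonempty c∈)))) λ ()) }
    where
    nonEmpty : ∀ cs {c} → c ∈ cs → map proj₁ (map factorOf cs) ≢ []
    nonEmpty (c ∷ cs) _ ()

  primes : All Prime (map proj₁ Hs)
  primes = all-factors factorOf colours prime-layer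

  edgeEntries : (i : ℕ) → List ℕ
  edgeEntries i = gather (Output.edgeEntry ℛ inp v e t h col mx mn w i) e

  -- The ranks of the program and the indices in the layer graph are both given by
  -- `count (outside i)`, so only the lists of edges have to be compared.
  encoding : ∀ i → Output.rank ℛ inp v e t h col mx mn w i v ∷ length (select (Output.edgeOutside ℛ inp v e t h col mx mn w i) e) ∷ edgeEntries i ≡
    encodeℕ (edgesOf i)
  encoding i = cong₂ (λ (n : ℕ) (es : List ℕ) → count (outside i) v ∷ n ∷ es)
    (LayerEdges.kept-length ℛ G L isHop κ same square r i (outside i) (outside-sound i) (outside-complete i) t h w tail-edge head-edge w-edge)
    (LayerEdges.kept-numbers ℛ G L isHop κ same square r i (outside i) (outside-sound i) (outside-complete i) t h w tail-edge head-edge w-edge _ (λ _ _ _ → refl))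

  encodingℝ : ∀ i → gather (Output.weightEntry ℛ inp v e t h col mx mn w i) e ≡ encodeℝ (edgesOf i)
  encodingℝ i = LayerEdges.kept-weights ℛ G L isHop κ same square r i (outside i) (outside-sound i) (outside-complete i) t h w tail-edge head-edge w-edge _ (λ _ _ _ → refl)

  numbers≡ : Output.colourCount ℛ inp v e t h col mx mn w ∷ gather (Output.factorEntry ℛ inp v e t h col mx mn w) m ≡
             length Hs ∷ concatMap (encodeℕ ∘ proj₂) Hs
  numbers≡ = cong₂ (λ (n : ℕ) (ns : List ℕ) → n ∷ ns) (sym (length-map factorOf colours))
    (trans (gather-select (λ i → gap (col i) i) _ m) (trans (concatMap-cong encoding colours) (sym (concatMap-map (encodeℕ ∘ proj₂) factorOf colours))))

  weights≡ : gather (Output.factorWeights ℛ inp v e t h col mx mn w) m ≡ concatMap (encodeℝ ∘ proj₂) Hs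
  weights≡ = trans (gather-select (λ i → gap (col i) i) _ m) (trans (concatMap-cong encodingℝ colours) (sym (concatMap-map (encodeℝ ∘ proj₂) factorOf colours)))

-- Correctness

module Edgeless (ℛ : Reals) (G : OverReals.WeightedGraph ℛ) (L : OverReals.EdgeList ℛ G)
  (none : OverReals.EdgeList.edges L ≡ []) where
  open OverReals ℛ
  open WeightedGraph G using (Adj)

  no-edge : ∀ {u v} → ¬ Adj u v
  no-edge {u} {v} e = case subst (Any (SameEdge {G} (u , v , e))) none (EdgeList.complete L (u , v , e)) of λ ()

  factorization : IsFactorization G (G ∷ [])
  factorization = record
    { nonEmpty = λ ()
    ; isomorphism = record
      { bijection = mk↔ₛ′ (λ v → v ∷ []) (λ { (v ∷ []) → v }) (λ { (v ∷ []) → refl }) (λ _ → refl)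
      ; adjacency = λ u v → mk⇔ (λ e → contradiction e no-edge) (λ { (zero , (e , _) , _) → e })
      ; weights = λ e → contradiction e no-edge }
    ; noK₁ = id ∷ [] }

module Correctness (ℛ : Reals) where
  open Reals ℛ using (Carrier; _≈_; 0#)
  open OverReals ℛ
  open Names
  open Main
  open Sealed ℛ using (result)
  open Language ℛ using (initial)

  open Machine ℛ main OUT OUTPOS E (λ ()) using (program; module Run)

  -- Prologue and epilogue take at most `36 + OUT = 51` steps, apart from 6 for each number copied.
  -- At most `1 + 2n²` numbers add 6 to the constant part and 12 to the coefficient of `n²`; the
  -- factor 12 comes from `square-bound`.
  constant : ℕ
  constant = (57 + totalWeight + 12) * 12

  -- From `v ≤ e + 1` the left side is at most `(3e + 1)²`, whose linear term `6e` is at most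
  -- `3e² + 3`.
  square-bound : ∀ v e → v ≤ suc e → (v + (e + e)) ^ 2 ≤ 12 * (e ^ 2 + 1)
  square-bound v e v≤ = begin
    (v + (e + e)) ^ 2            ≤⟨ ℕ.^-monoˡ-≤ 2 (ℕ.+-monoˡ-≤ (e + e) v≤) ⟩
    (suc e + (e + e)) ^ 2        ≡⟨ expand e ⟩
    9 * (e * e) + 6 * e + 1      ≤⟨ ℕ.+-monoˡ-≤ 1 (ℕ.+-monoʳ-≤ (9 * (e * e)) (six e)) ⟩
    9 * (e * e) + (3 * (e * e) + 3) + 1 ≤⟨ ℕ.m≤m+n _ 8 ⟩
    9 * (e * e) + (3 * (e * e) + 3) + 1 + 8 ≡⟨ collect e ⟩
    12 * (e ^ 2 + 1)             ∎
    where
    open ℕ.≤-Reasoning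
    expand : ∀ e → (suc e + (e + e)) * ((suc e + (e + e)) * 1) ≡ 9 * (e * e) + 6 * e + 1
    expand = solve-∀
    collect : ∀ e → 9 * (e * e) + (3 * (e * e) + 3) + 1 + 8 ≡ 12 * (e * (e * 1) + 1)
    collect = solve-∀
    six : ∀ e → 6 * e ≤ 3 * (e * e) + 3
    six zero = z≤n
    six (suc zero) = ℕ.≤-refl
    six (suc (suc e)) = ℕ.≤-trans (ℕ.*-monoˡ-≤ (suc (suc e)) (ℕ.*-monoʳ-≤ 3 {2} {suc (suc e)} (s≤s (s≤s z≤n))))
      (ℕ.≤-trans (ℕ.≤-reflexive (ℕ.*-assoc 3 (suc (suc e)) (suc (suc e)))) (ℕ.m≤m+n _ 3))

  -- The reals `ys` behind the edge weights are arbitrary, so that one argument covers both input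
  -- formats: the table of distances, or nothing.
  module _ {G : WeightedGraph} (L : EdgeList G) (ys : List Carrier) where
    open Input ℛ G L using (inp; inp-end; 0<v; end₁; end₂) renaming (v to n₀; e to e₀)
    open WeightedGraph G using (weight)
    open Language ℛ using (Store; var; arr; real; time)

    xs : List Carrier
    xs = encodeℝ L ++ ys

    w : ℕ → Carrier
    w a = fromMaybe 0# (xs !? a)

    w-edge : ∀ k → w (toℕ k) ≡ weight (proj₂ (proj₂ (List.lookup (EdgeList.edges L) k)))
    w-edge k = lookup-map-++ _ (EdgeList.edges L) ys k

    module _ (s : Store) (F : Facts ℛ inp w n₀ e₀ s) where
      open Facts F

      stored-≈ : ∀ {f : ℕ → Carrier} {a} rs → StoredAt _≡_ f a rs → StoredAt _≈_ f a rs
      stored-≈ []       _       = tt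
      stored-≈ (r ∷ rs) (p , q) = IsDecTotalOrder.Eq.reflexive (Reals.isDecTotalOrder ℛ) p , stored-≈ rs q

      outputs : ∀ {τ ns rs} (Hs : List (∃ EdgeList)) → IsFactorization G (map proj₁ Hs) → All Prime (map proj₁ Hs) →
        ns ≡ length Hs ∷ concatMap (encodeℕ ∘ proj₂) Hs → rs ≡ concatMap (encodeℝ ∘ proj₂) Hs →
        Written ns rs → Run.Outcome (encodeℕ L) xs inp-end s τ → OutputsPrimeFactorization G τ
      outputs {τ} {ns} {rs} Hs isF P refl refl W O = Hs , isF , P ,
        subst (λ a → StoredAt _≡_ (State.mem τ) a ns) (sym address-ℕ)
          (stored-cong ns (λ _ j< → sym (numbers′ (subst (_ <_) (sym pos) j<))) out) ,
        stored-≈ rs (subst (λ a → StoredAt _≡_ (State.memℝ τ) a rs) (sym (trans address-ℝ size))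
          (stored-cong rs (λ _ _ → sym (reals _)) outℝ))
        where
        open Output.Written W
        open Run.Outcome O renaming (numbers to numbers′)

      bounded : ∀ {t ns rs} → Written ns rs → length ns ≤ 1 + n * (n + n) →
        t ≤ 36 + OUT + time s + var s OUTPOS * 6 → t ≤ constant * (e₀ ^ 2 + 1)
      bounded {t} {ns} W short t≤ = begin
        t                                              ≤⟨ t≤ ⟩
        36 + OUT + time s + var s OUTPOS * 6           ≤⟨ ℕ.+-mono-≤ (ℕ.+-monoʳ-≤ 51 time≤) (ℕ.*-monoˡ-≤ 6 (ℕ.≤-trans (ℕ.≤-reflexive (Output.Written.pos W)) short)) ⟩
        51 + Ω * N² + (1 + n * (n + n)) * 6            ≡⟨ arrange Ω n ⟩
        57 * 1 + (Ω * N² + 12 * N²)                    ≤⟨ ℕ.+-monoˡ-≤ (Ω * N² + 12 * N²) (ℕ.*-monoʳ-≤ 57 (ℕ.^-monoˡ-≤ 2 1≤n)) ⟩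
        57 * N² + (Ω * N² + 12 * N²)                   ≡⟨ collect Ω N² ⟩
        (57 + Ω + 12) * N²                             ≤⟨ ℕ.*-monoʳ-≤ (57 + Ω + 12) (square-bound n₀ e₀ (Instance.v≤1+e ℛ G L w w-edge computed)) ⟩
        (57 + Ω + 12) * (12 * (e₀ ^ 2 + 1))            ≡⟨ ℕ.*-assoc (57 + Ω + 12) 12 (e₀ ^ 2 + 1) ⟨
        constant * (e₀ ^ 2 + 1)                        ∎
        where
        open ℕ.≤-Reasoning
        Ω N² : ℕ
        Ω = totalWeight
        N² = n ^ 2
        1≤n : 1 ≤ n
        1≤n = ℕ.≤-trans 0<v (ℕ.m≤m+n n₀ _)
        arrange : ∀ T n → 51 + T * (n * (n * 1)) + (1 + n * (n + n)) * 6 ≡ 57 * 1 + (T * (n * (n * 1)) + 12 * (n * (n * 1)))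
        arrange = solve-∀
        collect : ∀ T x → 57 * x + (T * x + 12 * x) ≡ (57 + T + 12) * x
        collect = solve-∀

      Correct : Program → Set
      Correct p = ∃₂ λ t τ → p ⊢ start (encodeℕ L) xs ⇓[ t ] τ × t ≤ 36 + OUT + time s + var s OUTPOS * 6 ×
        Run.Outcome (encodeℕ L) xs inp-end s τ

      conclude : ∀ p → Correct p → ComputesPrimeFactorization p (start (encodeℕ L) xs) G (constant * (e₀ ^ 2 + 1))
      conclude p (t , τ , runs , t≤ , O) = go (EdgeList.edges L) refl
        where
        go : ∀ es → EdgeList.edges L ≡ es →
             ComputesPrimeFactorization p (start (encodeℕ L) xs) G (constant * (e₀ ^ 2 + 1))
        go [] none = t , τ , runs , bounded W short t≤ ,
          outputs ((G , L) ∷ []) factorization (Factorizations.prime-edgeless ℛ {G} no-edge (fromℕ< 0<v) ∷ [])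
            (cong (λ es → 1 ∷ n₀ ∷ length es ∷ concatMap _ es ++ []) (sym none)) (cong (λ es → map _ es ++ []) (sym none)) W O
          where
          open Edgeless ℛ G L none
          W = edgeless (cong length none)
          1≤n : 1 ≤ n
          1≤n = ℕ.≤-trans 0<v (ℕ.m≤m+n n₀ _)
          short : 3 ≤ 1 + n * (n + n)
          short = s≤s (ℕ.*-mono-≤ 1≤n (ℕ.+-mono-≤ 1≤n 1≤n))
        go (x ∷ es) some = t , τ , runs , bounded W numbers-length t≤ ,
          outputs Lay.Hs Lay.factorization Lay.primes Lay.numbers≡ Lay.weights≡ W O
          where
          0<e : 0 < e₀
          0<e = subst (λ es → 0 < length es) (sym some) z<s
          module Lay = Layers ℛ G L w w-edge computed 0<e
          W = general 0<e

    computes : ComputesPrimeFactorization program (start (encodeℕ L) xs) G (constant * (e₀ ^ 2 + 1))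
    computes = conclude (result inp main (initial w)) (Pipeline.facts ℛ inp w n₀ e₀ refl refl 0<v end₁ end₂) program
      (Run.program-correct (encodeℕ L) xs inp-end)

  without-distances : ∀ {G} (L : EdgeList G) →
    ComputesPrimeFactorization program (inputGraph L) G (constant * (∣E∣ L ^ 2 + 1))
  without-distances L = subst (λ xs → ComputesPrimeFactorization program (start (encodeℕ L) xs) _ (constant * (∣E∣ L ^ 2 + 1)))
    (++-identityʳ (encodeℝ L)) (computes L [])

  longer : ∀ {p σ G s t} → s ≤ t → ComputesPrimeFactorization p σ G s → ComputesPrimeFactorization p σ G t
  longer s≤t (k , τ , runs , k≤s , out) = k , τ , runs , ℕ.≤-trans k≤s s≤t , out

theorem1p4 : (ℛ : Reals) →
    let open Reals ℛ using (Carrier)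
        open OverReals ℛ
    in
    (∃₂ λ (p : Program) (C : ℕ) →
       (G : WeightedGraph) (L : EdgeList G) → Minimal (network G) →
       (d : Fin (order G) → Fin (order G) → Carrier) →
       (∀ u v → IsDistance (network G) u v (d u v)) →
       ComputesPrimeFactorization p (inputGraphAndDistances L d) G
         (C * (∣E∣ L ^ 2 + 1)))
    ×
    (∃₂ λ (p : Program) (C : ℕ) →
       (G : WeightedGraph) (L : EdgeList G) → Minimal (network G) →
       ComputesPrimeFactorization p (inputGraph L) G
         (C * (order G ^ 2 * ⌊log₂ ⌊log₂ order G ⌋ ⌋ + ∣E∣ L ^ 2 + 1)))
theorem1p4 ℛ =
    (program , constant , λ G L _ d _ → computes L (OverReals.table ℛ d)) ,
    -- The time is already bounded in terms of `|E|²`, which is a summand of the bound claimed here.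
    (program , constant , λ G L _ → longer
      (ℕ.*-monoʳ-≤ constant (ℕ.+-monoˡ-≤ 1 (ℕ.m≤n+m (OverReals.∣E∣ L ^ 2) (OverReals.order G ^ 2 * ⌊log₂ ⌊log₂ OverReals.order G ⌋ ⌋))))
      (without-distances L))
  where
  open Correctness ℛ
  open Machine ℛ Main.main Names.OUT Names.OUTPOS Names.E (λ ()) using (program)
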